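{- There is a randomized algorithm for the multi-criteria matroid basis problem with the following property. Given any $\epsilon>0$, a matroid on elements $\{1,\ldots,n\}$, cost functions $d_j:\{1,\ldots,n\}\to\mathbb{Z}_+$ and budgets $B_j$ for $j=1,\ldots,k$, such that there exists a basis $I'$ of the matroid with $d_j(I')\le B_j$ for all $j\in\{1,\ldots,k\}$, the algorithm finds in $n^{O(k^{1.5}/\epsilon)}$ time a basis $I$ of the matroid with $d_j(I)\le(1+\epsilon)B_j$ for all $j\in\{1,\ldots,k\}$.
   Context: For a set $I$ of elements, $d_j(I):=\sum_{e\in I}d_j(e)$. The multi-criteria matroid basis problem: given a matroid on $\{1,\ldots,n\}$ (accessed by a polynomial time independent set oracle) with $k$ cost functions $d_j$ and budgets $B_j$, find (if possible) a basis $I$ with $d_j(I)\le B_j$ for each $j$.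
   Formalization: The time bound proved is (2+n+k)^{O(1)}·n^{O(k^{1.5}/ε)}: literally n^{O(k^{1.5}/ε)} fails for n=1, k=0 or very large ε, where it is less than the time to read the input or write a basis; for n≥2, k≥1, ε≤1 the two agree. ε is rational. -}

module Defs where

import Algebra.Properties.CommutativeMonoid.Sum
open import Data.Bool.Base using (Bool; true; false; if_then_else_)
open import Data.Fin.Base using (Fin; toℕ)
open import Data.Fin.Properties using (all?)
open import Data.Fin.Subset using (Subset; _∈_; _∉_; _⊆_; _⊂_; _∪_; ⁅_⁆; ∣_∣)
  renaming (⊥ to ∅)
open import Data.Fin.Subset.Properties using (anySubset?; _⊂?_)
open import Data.Integer.Base as ℤ using (+_)
open import Data.List.Base using (List; []; _∷_; _++_; concat; drop; head; tabulate)
open import Data.Maybe.Base using (Maybe; just; nothing; fromMaybe)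
open import Data.Nat.Base using (ℕ; zero; suc; _+_; _*_; _∸_; _^_; _≤_; _<_; _≡ᵇ_; _<ᵇ_)
open import Data.Nat.Properties using (+-0-commutativeMonoid)
open import Data.Product.Base using (_×_; ∃-syntax)
open import Data.Rational as ℚ using (ℚ; 0ℚ; 1ℚ; ½; ↥_; ↧ₙ_)
open import Data.Vec.Base as Vec using (Vec; []; _∷_; lookup)
open import Level using (Level)
open import Relation.Binary.PropositionalEquality using (_≡_)
open import Relation.Nullary using (¬_; Dec; does; _×-dec_; ¬?)
open import Relation.Unary using (Pred; Decidable)

open Algebra.Properties.CommutativeMonoid.Sum +-0-commutativeMonoid using (sum)

private variable
  ℓ : Level
  n k : ℕ

fromℕ : ℕ → ℚ
fromℕ m = + m ℚ./ 1

record Matroid (n : ℕ) : Set₁ where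
  field
    Independent  : Subset n → Set
    independent? : Decidable Independent
    ∅-independent : Independent ∅
    hereditary   : ∀ {I J} → I ⊆ J → Independent J → Independent I
    exchange     : ∀ {I J} → Independent I → Independent J → ∣ I ∣ < ∣ J ∣ →
                   ∃[ e ] e ∈ J × e ∉ I × Independent (I ∪ ⁅ e ⁆)

  IsBasis : Subset n → Set
  IsBasis I = Independent I × ¬ (∃[ J ] Independent J × I ⊂ J)

  isBasis? : Decidable IsBasis
  isBasis? I = independent? I ×-dec ¬? (anySubset? λ J → independent? J ×-dec I ⊂? J)

cost : (Fin n → ℕ) → Subset n → ℕ
cost d I = sum λ e → if lookup I e then d e else 0

record Instance (n k : ℕ) : Set₁ where
  field
    matroid : Matroid n
    d       : Fin k → Fin n → ℕ
    B       : Fin k → ℕ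

  open Matroid matroid public

  Feasible : Set
  Feasible = ∃[ I ] IsBasis I × (∀ j → cost (d j) I ≤ B j)

  IsApproxSolution : ℚ → Subset n → Set
  IsApproxSolution ε I =
    IsBasis I × (∀ j → fromℕ (cost (d j) I) ℚ.≤ (1ℚ ℚ.+ ε) ℚ.* fromℕ (B j))

  isApproxSolution? : ∀ ε → Decidable (IsApproxSolution ε)
  isApproxSolution? ε I = isBasis? I ×-dec all? λ j → _ ℚ.≤? _

-- Algorithms are programs of a random access machine with natural-number
-- registers and memory cells, extended by a fair coin and an independence
-- oracle.  Every instruction takes one unit of time.  Multiplication is
-- deliberately not an instruction: with only + and ∸ the largest number grows
-- by at most one bit per step, so unit-cost time is polynomially related to
-- Turing machine time (in the number of steps and the bit-length of the input).

data Instr : Set where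
  const : (r c : ℕ)   → Instr   -- R[r] := c
  add   : (r s t : ℕ) → Instr   -- R[r] := R[s] + R[t]
  sub   : (r s t : ℕ) → Instr   -- R[r] := R[s] ∸ R[t]
  load  : (r s : ℕ)   → Instr   -- R[r] := M[R[s]]
  store : (r s : ℕ)   → Instr   -- M[R[r]] := R[s]
  jzero : (r l : ℕ)   → Instr   -- if R[r] = 0 then continue at line l
  flip  : (r : ℕ)     → Instr   -- R[r] := fair random bit
  query : (r s : ℕ)   → Instr   -- R[r] := 1 if the set stored from M[R[s]] on
                                --         is independent, and 0 otherwise

Program : Set
Program = List Instr

Store : Set
Store = ℕ → ℕ

_[_≔_] : Store → ℕ → ℕ → Store
(f [ a ≔ v ]) b = if b ≡ᵇ a then v else f b

record Config : Set where
  constructor config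
  field
    pc  : ℕ
    reg : Store
    mem : Store

bit : Bool → ℕ
bit b = if b then 1 else 0

-- A set is stored as n consecutive cells, nonzero exactly at its elements.
readSet : ∀ n → Store → ℕ → Subset n
readSet n M a = Vec.tabulate λ e → 0 <ᵇ M (a + toℕ e)

module _ {n : ℕ} (oracle : Subset n → Bool) where

  execute : Bool → Instr → Config → Config
  execute b (const r c) (config p R M) = config (suc p) (R [ r ≔ c ]) M
  execute b (add r s t) (config p R M) = config (suc p) (R [ r ≔ R s + R t ]) M
  execute b (sub r s t) (config p R M) = config (suc p) (R [ r ≔ R s ∸ R t ]) M
  execute b (load r s)  (config p R M) = config (suc p) (R [ r ≔ M (R s) ]) M
  execute b (store r s) (config p R M) = config (suc p) R (M [ R r ≔ R s ])
  execute b (jzero r l) (config p R M) = config (if R r ≡ᵇ 0 then l else suc p) R M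
  execute b (flip r)    (config p R M) = config (suc p) (R [ r ≔ bit b ]) M
  execute b (query r s) (config p R M) =
    config (suc p) (R [ r ≔ bit (oracle (readSet n M (R s))) ]) M

fetch : Program → Config → Maybe Instr
fetch P c = head (drop (Config.pc c) P)

-- The machine halts when the program counter leaves the program.
Halted : Program → Config → Set
Halted P c = fetch P c ≡ nothing

step : (Subset n → Bool) → Program → Config → Bool → Config
step oracle P c b with fetch P c
... | nothing = c
... | just i  = execute oracle b i c

-- The i-th coin belongs to the i-th step, which ignores it unless it is a flip.
run : (Subset n → Bool) → Program → Config → ∀ {t} → Vec Bool t → Config
run oracle P c ω = Vec.foldl′ (step oracle P) c ω

-- Memory initially holds n, k, the numerator and denominator of ε, the
-- budgets, and the costs row by row; all else is 0.  The matroid is accessible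
-- only through the oracle.
encode : ℚ → Instance n k → List ℕ
encode {n} {k} ε X =
  n ∷ k ∷ ℤ.∣ ↥ ε ∣ ∷ ↧ₙ ε ∷ tabulate B ++ concat (tabulate λ j → tabulate (d j))
  where open Instance X

initial : List ℕ → Config
initial xs = config 0 (λ _ → 0) (λ a → fromMaybe 0 (head (drop a xs)))

runOn : Program → ℚ → Instance n k → ∀ {t} → Vec Bool t → Config
runOn P ε X = run (λ I → does (Instance.independent? X I)) P (initial (encode ε X))

-- On halting, the output is the set stored from cell 0 on.
output : ∀ n → Config → Subset n
output n c = readSet n (Config.mem c) 0

-- Probability of an event under t independent fair coin tosses.
Pr : ∀ t {A : Pred (Vec Bool t) ℓ} → Decidable A → ℚ
Pr zero    A? = if does (A? []) then 1ℚ else 0ℚ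
Pr (suc t) A? = ½ ℚ.* (Pr t (λ ω → A? (true ∷ ω)) ℚ.+ Pr t (λ ω → A? (false ∷ ω)))

-- t is n^{O(k^{1.5}/ε)} with implied constant C.  The irrational exponent
-- condition E ≤ C·k^{1.5}/ε is squared.  The factor polynomial in n + k pays
-- for reading the input; for ε ≤ 1, k ≥ 1, n ≥ 2 it is itself n^{O(k^{1.5}/ε)},
-- but for n ≤ 1, k = 0 or large ε the term n^E alone may be smaller than the input.
TimeBound : (C n k : ℕ) → ℚ → ℕ → Set
TimeBound C n k ε t = ∃[ E ]
    (fromℕ E ℚ.* ε) ℚ.* (fromℕ E ℚ.* ε) ℚ.≤ fromℕ (C ^ 2 * k ^ 3)
  × t ≤ (2 + n + k) ^ C * n ^ E

{-# OPTIONS --safe #-}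
-- Round the costs so that each budget becomes N.  At most h = O(k/ε) elements of a
-- feasible basis have ℓ₁-cost above Θ; guess them (n^{O(k/ε)} choices) and allow only
-- light elements besides.  Starting from a fractional basis, iterative relaxation
-- rounds one element at a time: tight sets form a lattice whose classes each contain
-- at least two fractional elements, so a vertex has a 0-1 coordinate as soon as every
-- row whose remaining load is at most 2Θ above the budget has been dropped, and a
-- dropped row costs only O(Θ), which N = (h + 1)(n + 1) and Θ = O(k n) make at most ε N.
-- Instead of solving linear programs, the existence of a fractional solution is tested
-- by a quadratic-potential multiplicative-weights iteration over greedy bases, at the
-- price of one extra unit of budget for each of the at most n tests that succeed.
-- No coins are used, so the success probability is 1; rounding the costs before
-- use keeps the running time independent of their size.
module Submission where

-- Fractional points live only in the proof: they are integer vectors with a common denominator,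
-- their tight sets range over all `2 ^ n` subsets, and rounding merely shows that some element can
-- be fixed. The machine cannot multiply or divide, so it tries both decisions for each free element
-- and commits to whatever a yes-or-no test accepts. The test need not be exact: it accepts whenever
-- budget b is achievable, and acceptance certifies b + 1, because the bases it has computed average
-- to a point of that budget.
--
-- The constants are forced. Rounding up adds at most n to the cost of a feasible basis, successful
-- tests add at most n more, a dropped row adds 2Θ, and 2n ≤ Θ; so 3Θ must fit into εN. With W = n +
-- 1, Θ = 2kW and N = (h + 1)W this reads 6k ≤ ε(h + 1), and the same Θ makes more than h heavy
-- elements unaffordable. When 6k/ε is n or more, h is n and the guess names the whole basis. Up to
-- a polynomial factor the number of guesses is n to an exponent of at most 12k/ε, within the bound
-- asked for.

module Development where
  open import Algebra.Bundles using (CommutativeSemiring)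
  open import Data.Bool.Base using (Bool; true; false; if_then_else_; _∧_; _∨_; not; T)
  open import Data.Empty using (⊥; ⊥-elim)
  open import Data.Integer.Base as ℤ using (ℤ; 0ℤ; 1ℤ) renaming (+_ to pos)
  import Data.Integer.Properties as ℤP
  open import Data.Nat.Base using (ℕ; zero; suc; _+_; _*_; _∸_; _^_; _≤_; _<_; _≡ᵇ_; _<ᵇ_; z≤n; s≤s; _⊔_)
  open import Data.Nat.Properties
  import Data.Integer.Tactic.RingSolver as ℤS
  import Data.Nat.Tactic.RingSolver as ℕS
  open import Data.Product.Base using (_×_; _,_; proj₁; proj₂; ∃-syntax; Σ-syntax)
  open import Data.Sum.Base using (_⊎_; inj₁; inj₂)
  open import Function.Base using (_∘_; id; _$_; case_of_)
  open import Level using (0ℓ)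
  open import Relation.Binary.PropositionalEquality using (_≡_; _≢_; refl; sym; trans; cong; cong₂; subst; subst₂)
  open import Relation.Nullary using (¬_; Dec; yes; no; does)
  open import Defs using (bit)
  import Relation.Binary.PropositionalEquality
  open import Relation.Binary.Definitions using (tri<; tri≈; tri>)
  import Data.Nat.Base as ℕB
  open import Data.Fin.Subset using (Subset)
  open import Data.List.Base using (List; []; _∷_; _++_; drop; head; length)
  open import Data.List.Properties using (++-assoc; length-++; drop-drop; ++-identityʳ; drop-all)
  open import Data.Maybe.Base using (just; fromMaybe)
  open import Data.Vec.Base using (Vec; []; _∷_)
  open import Defs using (Instr; const; add; sub; load; store; jzero; query; Program; Store; _[_≔_]; Config; config; readSet; execute; fetch; Halted; step)
  open import Data.Nat.DivMod using (_%_; [m+kn]%n≡m%n; m<n⇒m%n≡m)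
  open import Data.Vec.Base using (tabulate)
  open import Data.Fin.Base using (Fin; toℕ)
  open import Data.Vec.Properties using (tabulate-cong)
  open import Data.Fin.Properties using (toℕ<n)
  import Defs
  open import Data.Fin.Base using (zero; suc)
  import Data.Fin.Subset as Sub
  import Data.Fin.Subset.Properties as SubP
  import Data.List.Base as List
  open import Data.List.Properties using (length-tabulate)
  import Data.Vec.Base as Vec
  import Data.Vec.Properties as VecP
  open import Algebra.Properties.CommutativeMonoid.Sum +-0-commutativeMonoid using (sum-cong-≗) renaming (sum to sumᶠ)
  open import Relation.Nullary.Decidable using (dec-true)
  import Data.Rational as ℚ
  import Data.Rational.Properties as ℚP
  import Data.Rational.Unnormalised as ℚᵘ
  import Data.Rational.Unnormalised.Properties as ℚᵘP
  import Data.Fin.Base as Fin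
  import Data.Fin.Properties as FinP

  -- Finite sums and bounded search

  module BigSum (S : CommutativeSemiring 0ℓ 0ℓ) where
    private module S = CommutativeSemiring S
    open S using (Carrier; _≈_; 0#) renaming (_+_ to _⊕_; _*_ to _⊗_; refl to ≈-refl; sym to ≈-sym; trans to ≈-trans)
    open import Relation.Binary.Reasoning.Setoid S.setoid

    ∑ : ℕ → (ℕ → Carrier) → Carrier
    ∑ zero    f = 0#
    ∑ (suc m) f = ∑ m f ⊕ f m

    ∑-cong : ∀ m {f g} → (∀ i → i < m → f i ≈ g i) → ∑ m f ≈ ∑ m g
    ∑-cong zero    eq = ≈-refl
    ∑-cong (suc m) eq = S.+-cong (∑-cong m λ i i<m → eq i (m<n⇒m<1+n i<m)) (eq m ≤-refl)

    ∑-zero : ∀ m {f} → (∀ i → i < m → f i ≈ 0#) → ∑ m f ≈ 0#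
    ∑-zero zero    eq = ≈-refl
    ∑-zero (suc m) eq =
      ≈-trans (S.+-cong (∑-zero m λ i i<m → eq i (m<n⇒m<1+n i<m)) (eq m ≤-refl)) (S.+-identityˡ 0#)

    ∑-+ : ∀ m f g → ∑ m (λ i → f i ⊕ g i) ≈ ∑ m f ⊕ ∑ m g
    ∑-+ zero    f g = ≈-sym (S.+-identityˡ 0#)
    ∑-+ (suc m) f g = begin
      ∑ m (λ i → f i ⊕ g i) ⊕ (f m ⊕ g m) ≈⟨ S.+-congʳ (∑-+ m f g) ⟩
      (∑ m f ⊕ ∑ m g) ⊕ (f m ⊕ g m)       ≈⟨ S.+-assoc _ _ _ ⟩
      ∑ m f ⊕ (∑ m g ⊕ (f m ⊕ g m))       ≈⟨ S.+-congˡ (≈-sym (S.+-assoc _ _ _)) ⟩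
      ∑ m f ⊕ ((∑ m g ⊕ f m) ⊕ g m)       ≈⟨ S.+-congˡ (S.+-congʳ (S.+-comm _ _)) ⟩
      ∑ m f ⊕ ((f m ⊕ ∑ m g) ⊕ g m)       ≈⟨ S.+-congˡ (S.+-assoc _ _ _) ⟩
      ∑ m f ⊕ (f m ⊕ (∑ m g ⊕ g m))       ≈⟨ ≈-sym (S.+-assoc _ _ _) ⟩
      (∑ m f ⊕ f m) ⊕ (∑ m g ⊕ g m)       ∎

    ∑-* : ∀ m c f → ∑ m (λ i → c ⊗ f i) ≈ c ⊗ ∑ m f
    ∑-* zero    c f = ≈-sym (S.zeroʳ c)
    ∑-* (suc m) c f = ≈-trans (S.+-congʳ (∑-* m c f)) (≈-sym (S.distribˡ c _ _))

    ∑-swap : ∀ m l (f : ℕ → ℕ → Carrier) → ∑ m (λ i → ∑ l (f i)) ≈ ∑ l (λ j → ∑ m (λ i → f i j))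
    ∑-swap zero    l f = ≈-sym (∑-zero l λ _ _ → ≈-refl)
    ∑-swap (suc m) l f = ≈-trans (S.+-congʳ (∑-swap m l f)) (≈-sym (∑-+ l _ _))

    ∑-single : ∀ m j {f} → j < m → (∀ i → i < m → i ≢ j → f i ≈ 0#) → ∑ m f ≈ f j
    ∑-single (suc m) j {f} j<m eq with m ≟ j
    ... | yes refl = ≈-trans (S.+-congʳ (∑-zero m λ i i<m → eq i (m<n⇒m<1+n i<m) (<⇒≢ i<m))) (S.+-identityˡ _)
    ... | no  m≢j  = ≈-trans
      (S.+-cong (∑-single m j (≤∧≢⇒< (≤-pred j<m) (m≢j ∘ sym)) λ i i<m → eq i (m<n⇒m<1+n i<m)) (eq m ≤-refl m≢j))
      (S.+-identityʳ _)

  open BigSum +-*-commutativeSemiring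

  module ∑ᶻ = BigSum ℤP.+-*-commutativeSemiring
  open ∑ᶻ using () renaming (∑ to ∑ᶻ)

  ∑-mono : ∀ m {f g} → (∀ i → i < m → f i ≤ g i) → ∑ m f ≤ ∑ m g
  ∑-mono zero    le = z≤n
  ∑-mono (suc m) le = +-mono-≤ (∑-mono m λ i i<m → le i (m<n⇒m<1+n i<m)) (le m ≤-refl)

  ∑-const : ∀ m c → ∑ m (λ _ → c) ≡ m * c
  ∑-const zero    c = refl
  ∑-const (suc m) c = trans (cong (_+ c) (∑-const m c)) (+-comm (m * c) c)

  ∑-bound : ∀ m {f c} → (∀ i → i < m → f i ≤ c) → ∑ m f ≤ m * c
  ∑-bound m {f} {c} le = ≤-trans (∑-mono m le) (≤-reflexive (∑-const m c))

  ∑-term : ∀ m {f} j → j < m → f j ≤ ∑ m f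
  ∑-term (suc m) {f} j j<m with m ≟ j
  ... | yes refl = m≤n+m (f m) (∑ m f)
  ... | no  m≢j  = m≤n⇒m≤n+o (f m) (∑-term m j (≤∧≢⇒< (≤-pred j<m) (m≢j ∘ sym)))

  ∑-mono-< : ∀ m {f g} j → j < m → (∀ i → i < m → f i ≤ g i) → f j < g j → ∑ m f < ∑ m g
  ∑-mono-< (suc m) {f} {g} j j<m le lt with m ≟ j
  ... | yes refl = +-mono-≤-< (∑-mono m λ i i<m → le i (m<n⇒m<1+n i<m)) lt
  ... | no  m≢j  = +-mono-<-≤
    (∑-mono-< m j (≤∧≢⇒< (≤-pred j<m) (m≢j ∘ sym)) (λ i i<m → le i (m<n⇒m<1+n i<m)) lt) (le m ≤-refl)

  ∑ᶻ-mono : ∀ m {f g} → (∀ i → i < m → f i ℤ.≤ g i) → ∑ᶻ m f ℤ.≤ ∑ᶻ m g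
  ∑ᶻ-mono zero    le = ℤP.≤-refl
  ∑ᶻ-mono (suc m) le = ℤP.+-mono-≤ (∑ᶻ-mono m λ i i<m → le i (m<n⇒m<1+n i<m)) (le m ≤-refl)

  pos-∑ : ∀ m f → pos (∑ m f) ≡ ∑ᶻ m (λ i → pos (f i))
  pos-∑ zero    f = refl
  pos-∑ (suc m) f = cong (ℤ._+ pos (f m)) (pos-∑ m f)

  bit-if : ∀ b → (if b then 1 else 0) ≤ 1
  bit-if true  = ≤-refl
  bit-if false = z≤n

  search : ∀ m (p : ℕ → Bool) → (∃[ i ] i < m × p i ≡ true) ⊎ (∀ i → i < m → p i ≡ false)
  search zero    p = inj₂ λ _ ()
  search (suc m) p with p m in eq | search m p
  ... | true  | _                     = inj₁ (m , ≤-refl , eq)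
  ... | false | inj₁ (i , i<m , pi)   = inj₁ (i , m<n⇒m<1+n i<m , pi)
  ... | false | inj₂ none             = inj₂ λ i i<1+m → case m ≟ i of λ where
    (yes refl) → eq
    (no m≢i)   → none i (≤∧≢⇒< (≤-pred i<1+m) (m≢i ∘ sym))

  true≢false : ∀ {b} → b ≡ true → b ≡ false → ⊥
  true≢false refl ()

  bool-ext : ∀ {a b} → (a ≡ true → b ≡ true) → (b ≡ true → a ≡ true) → a ≡ b
  bool-ext {true}  {true}  f g = refl
  bool-ext {true}  {false} f g = sym (f refl)
  bool-ext {false} {true}  f g = g refl
  bool-ext {false} {false} f g = refl

  ¬true⇒false : ∀ {b} → (b ≡ true → ⊥) → b ≡ false
  ¬true⇒false {true}  h = ⊥-elim (h refl)
  ¬true⇒false {false} h = refl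

  ≡ᵇ-refl : ∀ m → (m ≡ᵇ m) ≡ true
  ≡ᵇ-refl zero    = refl
  ≡ᵇ-refl (suc m) = ≡ᵇ-refl m

  ≡ᵇ-true : ∀ m l → (m ≡ᵇ l) ≡ true → m ≡ l
  ≡ᵇ-true zero    zero    eq = refl
  ≡ᵇ-true (suc m) (suc l) eq = cong suc (≡ᵇ-true m l eq)

  ≡ᵇ-false : ∀ {m l} → m ≢ l → (m ≡ᵇ l) ≡ false
  ≡ᵇ-false m≢l = ¬true⇒false λ eq → m≢l (≡ᵇ-true _ _ eq)

  T⇒true : ∀ {b} → T b → b ≡ true
  T⇒true {true} _ = refl

  true⇒T : ∀ {b} → b ≡ true → T b
  true⇒T refl = _

  not-true : ∀ {b} → not b ≡ true → b ≡ false
  not-true {false} _ = refl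

  ≡ᵇ-intro : ∀ {m l} → m ≡ l → (m ≡ᵇ l) ≡ true
  ≡ᵇ-intro {m} refl = ≡ᵇ-refl m

  -- Matroids on initial segments of ℕ, by their greedy bases

  FSet : Set
  FSet = ℕ → Bool

  _∪_ _∩_ : FSet → FSet → FSet
  (S ∪ T) e = S e ∨ T e
  (S ∩ T) e = S e ∧ T e

  _⊕_ : FSet → ℕ → FSet
  (S ⊕ e) x = (x ≡ᵇ e) ∨ S x

  ∨-true : ∀ {a b} → a ∨ b ≡ true → a ≡ true ⊎ b ≡ true
  ∨-true {true}  _ = inj₁ refl
  ∨-true {false} h = inj₂ h

  ∨-introˡ : ∀ {a b} → a ≡ true → a ∨ b ≡ true
  ∨-introˡ refl = refl

  ∨-introʳ : ∀ {a b} → b ≡ true → a ∨ b ≡ true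
  ∨-introʳ {true}  _ = refl
  ∨-introʳ {false} h = h

  ∧-true : ∀ {a b} → a ∧ b ≡ true → a ≡ true × b ≡ true
  ∧-true {true} h = refl , h

  ∧-intro : ∀ {a b} → a ≡ true → b ≡ true → a ∧ b ≡ true
  ∧-intro refl h = h

  bit-mono : ∀ {a b} → (a ≡ true → b ≡ true) → bit a ≤ bit b
  bit-mono {false}         h = z≤n
  bit-mono {true}  {true}  h = ≤-refl
  bit-mono {true}  {false} h with () ← h refl

  -- Sets are Boolean functions on all of ℕ. Since `ind-mono` compares them only below n, `ind` does
  -- not depend on their values from n on.
  record FMatroid (n : ℕ) : Set where
    field
      ind      : FSet → Bool
      ind-mono : ∀ {S T} → (∀ e → e < n → S e ≡ true → T e ≡ true) → ind T ≡ true → ind S ≡ true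
      ind-∅    : ind (λ _ → false) ≡ true
      ind-exch : ∀ {S T} → ind S ≡ true → ind T ≡ true → ∑ n (bit ∘ S) < ∑ n (bit ∘ T) →
        ∃[ e ] e < n × T e ≡ true × S e ≡ false × ind (S ⊕ e) ≡ true

  module Matroids {n : ℕ} (M : FMatroid n) where
    open FMatroid M

    infix 4 _⊆_
    _⊆_ : FSet → FSet → Set
    S ⊆ T = ∀ e → e < n → S e ≡ true → T e ≡ true

    ∣_∣ : FSet → ℕ
    ∣ S ∣ = ∑ n (bit ∘ S)

    ∣∣-mono : ∀ {S T} → S ⊆ T → ∣ S ∣ ≤ ∣ T ∣
    ∣∣-mono h = ∑-mono n λ e e<n → bit-mono (h e e<n)

    dep-mono : ∀ {S T} → S ⊆ T → ind S ≡ false → ind T ≡ false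
    dep-mono h d = ¬true⇒false λ t → true≢false (ind-mono h t) d

    ⊆-⊕ : ∀ {S} e → S ⊆ S ⊕ e
    ⊆-⊕ e x _ = ∨-introʳ

    ⊕-mono : ∀ {S T} e → S ⊆ T → S ⊕ e ⊆ T ⊕ e
    ⊕-mono e h x x<n m with ∨-true {x ≡ᵇ e} m
    ... | inj₁ eq = ∨-introˡ eq
    ... | inj₂ s  = ∨-introʳ (h x x<n s)

    ⊕-here : ∀ S e → (S ⊕ e) e ≡ true
    ⊕-here S e = ∨-introˡ (≡ᵇ-refl e)

    MaximalIn : FSet → FSet → Set
    MaximalIn S K = ∀ e → e < n → S e ≡ true → K e ≡ false → ind (K ⊕ e) ≡ false

    maximal-largest : ∀ {S K I} → ind K ≡ true → MaximalIn S K → ind I ≡ true → I ⊆ S → ∣ I ∣ ≤ ∣ K ∣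
    maximal-largest {S} {K} {I} iK mx iI I⊆S with ∣ I ∣ ≤? ∣ K ∣
    ... | yes le = le
    ... | no  gt with e , e<n , Ie , Ke , iKe ← ind-exch iK iI (≰⇒> gt) =
      ⊥-elim (true≢false iKe (mx e e<n (I⊆S e e<n Ie) Ke))

    -- Greedy extension of `A` through `S` in index order. From the empty set it yields ranks; from
    -- a basis of an intersection it yields the nested bases needed for submodularity.
    grow : FSet → FSet → ℕ → FSet
    grow A S zero    = A
    grow A S (suc m) = if S m ∧ ind (grow A S m ⊕ m) then grow A S m ⊕ m else grow A S m

    grow-step : ∀ A S m → grow A S m ⊆ grow A S (suc m)
    grow-step A S m e e<n h with S m ∧ ind (grow A S m ⊕ m)
    ... | true  = ∨-introʳ h
    ... | false = h

    grow-mono : ∀ A S m l → grow A S m ⊆ grow A S (l + m)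
    grow-mono A S m zero    e e<n h = h
    grow-mono A S m (suc l) e e<n h = grow-step A S (l + m) e e<n (grow-mono A S m l e e<n h)

    grow-≤ : ∀ A S {m l} → m ≤ l → grow A S m ⊆ grow A S l
    grow-≤ A S {m} {l} m≤l = subst (λ l′ → grow A S m ⊆ grow A S l′) (m∸n+n≡m m≤l) (grow-mono A S m (l ∸ m))

    grow-ind : ∀ {A} S m → ind A ≡ true → ind (grow A S m) ≡ true
    grow-ind S zero    iA = iA
    grow-ind {A} S (suc m) iA with S m ∧ ind (grow A S m ⊕ m) in eq
    ... | true  = proj₂ (∧-true {S m} eq)
    ... | false = grow-ind S m iA

    grow-⊆ : ∀ A S m → grow A S m ⊆ A ∪ S
    grow-⊆ A S zero    e e<n h = ∨-introˡ h
    grow-⊆ A S (suc m) e e<n h with S m ∧ ind (grow A S m ⊕ m) in eq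
    ... | false = grow-⊆ A S m e e<n h
    ... | true with ∨-true {e ≡ᵇ m} h
    ...   | inj₂ h′ = grow-⊆ A S m e e<n h′
    ...   | inj₁ e≡m with refl ← ≡ᵇ-true e m e≡m = ∨-introʳ (proj₁ (∧-true {S m} eq))

    -- An element refused at its turn stays refused, because the set only grows and supersets of
    -- dependent sets are dependent.
    grow-maximal : ∀ A S → MaximalIn S (grow A S n)
    grow-maximal A S e e<n Se Ge = dep-mono (⊕-mono e (grow-≤ A S (<⇒≤ e<n))) rejected
      where
      rejected : ind (grow A S e ⊕ e) ≡ false
      rejected with ind (grow A S e ⊕ e) in eq
      ... | false = refl
      ... | true  = ⊥-elim (true≢false (grow-≤ A S e<n e e<n taken) Ge)
        where
        taken : grow A S (suc e) e ≡ true
        taken rewrite Se | eq = ⊕-here (grow A S e) e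

    basisOf : FSet → FSet
    basisOf S = grow (λ _ → false) S n

    rank : FSet → ℕ
    rank S = ∣ basisOf S ∣

    basisOf-ind : ∀ S → ind (basisOf S) ≡ true
    basisOf-ind S = grow-ind S n ind-∅

    basisOf-⊆ : ∀ S → basisOf S ⊆ S
    basisOf-⊆ S = grow-⊆ (λ _ → false) S n

    ind-≤-rank : ∀ {I S} → ind I ≡ true → I ⊆ S → ∣ I ∣ ≤ rank S
    ind-≤-rank {I} {S} iI I⊆S = maximal-largest (basisOf-ind S) (grow-maximal _ S) iI I⊆S

    rank-≤-maximal : ∀ {K S} → ind K ≡ true → MaximalIn S K → rank S ≤ ∣ K ∣
    rank-≤-maximal iK mx = maximal-largest iK mx (basisOf-ind _) (basisOf-⊆ _)

    rank-mono : ∀ {S T} → S ⊆ T → rank S ≤ rank T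
    rank-mono h = ind-≤-rank (basisOf-ind _) λ e e<n m → h e e<n (basisOf-⊆ _ e e<n m)

    rank-cong : ∀ {S T} → (∀ e → e < n → S e ≡ T e) → rank S ≡ rank T
    rank-cong h = ≤-antisym
      (rank-mono λ e e<n s → trans (sym (h e e<n)) s) (rank-mono λ e e<n t → trans (h e e<n) t)

    rank-≤-size : ∀ S → rank S ≤ ∣ S ∣
    rank-≤-size S = ∣∣-mono (basisOf-⊆ S)

    size-≤-rank⇒ind : ∀ S → ∣ S ∣ ≤ rank S → ind S ≡ true
    size-≤-rank⇒ind S le = ind-mono included (basisOf-ind S)
      where
      included : S ⊆ basisOf S
      included e e<n Se with basisOf S e in eq
      ... | true  = refl
      ... | false = ⊥-elim (<⇒≱ (∑-mono-< n e e<n (λ i i<n → bit-mono (basisOf-⊆ S i i<n))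
                      (subst₂ (λ a b → bit a < bit b) (sym eq) (sym Se) ≤-refl)) le)

    -- A basis of `S ∩ T` extends to one of `S ∪ T`. Each element of the large basis lies in `S` or
    -- `T`, those of the small one lie in both, and both traces are independent.
    rank-submodular : ∀ S T → rank (S ∪ T) + rank (S ∩ T) ≤ rank S + rank T
    rank-submodular S T = ≤-trans
      (+-mono-≤ (rank-≤-maximal iK (grow-maximal K₀ (S ∪ T))) ≤-refl)
      (≤-trans counts (+-mono-≤ (part S λ _ _ → proj₂ ∘ ∧-true) (part T λ _ _ → proj₂ ∘ ∧-true)))
      where
      K₀ K : FSet
      K₀ = basisOf (S ∩ T)
      K  = grow K₀ (S ∪ T) n
      iK : ind K ≡ true
      iK = grow-ind (S ∪ T) n (basisOf-ind (S ∩ T))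
      part : ∀ P → K ∩ P ⊆ P → ∣ K ∩ P ∣ ≤ rank P
      part P = ind-≤-rank (ind-mono (λ e e<n m → proj₁ (∧-true m)) iK)
      pointwise : ∀ k k₀ s t → (k ≡ true → s ∨ t ≡ true) → (k₀ ≡ true → k ≡ true × s ≡ true × t ≡ true) →
        bit k + bit k₀ ≤ bit (k ∧ s) + bit (k ∧ t)
      pointwise false false s     t     f g = z≤n
      pointwise false true  s     t     f g with () ← proj₁ (g refl)
      pointwise true  true  s     t     f g with _ , refl , refl ← g refl = ≤-refl
      pointwise true  false true  t     f g = s≤s z≤n
      pointwise true  false false true  f g = ≤-refl
      pointwise true  false false false f g with () ← f refl
      K⊆ : K ⊆ S ∪ T
      K⊆ e e<n m with ∨-true {K₀ e} (grow-⊆ K₀ (S ∪ T) n e e<n m)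
      ... | inj₁ m₀ = ∨-introˡ {S e} (proj₁ (∧-true (basisOf-⊆ (S ∩ T) e e<n m₀)))
      ... | inj₂ m₁ = m₁
      counts : ∣ K ∣ + ∣ K₀ ∣ ≤ ∣ K ∩ S ∣ + ∣ K ∩ T ∣
      counts = subst₂ _≤_ (∑-+ n (bit ∘ K) (bit ∘ K₀)) (∑-+ n (bit ∘ (K ∩ S)) (bit ∘ (K ∩ T)))
        (∑-mono n λ e e<n → pointwise (K e) (K₀ e) (S e) (T e) (K⊆ e e<n)
          λ m → grow-≤ K₀ (S ∪ T) {0} {n} z≤n e e<n m , ∧-true (basisOf-⊆ (S ∩ T) e e<n m))

  -- Integer dependencies and the ratio test

  ∑ᶻ-neg : ∀ m f → ∑ᶻ m (λ i → ℤ.- f i) ≡ ℤ.- ∑ᶻ m f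
  ∑ᶻ-neg zero    f = refl
  ∑ᶻ-neg (suc m) f = trans (cong (ℤ._+ (ℤ.- f m)) (∑ᶻ-neg m f)) (sym (ℤP.neg-distrib-+ (∑ᶻ m f) (f m)))

  δ-at : ℕ → ℕ → ℤ → ℤ
  δ-at p i z = if i ≡ᵇ p then z else 0ℤ

  δ-at-hit : ∀ p z → δ-at p p z ≡ z
  δ-at-hit p z rewrite ≡ᵇ-refl p = refl

  δ-at-miss : ∀ {p i} z → i ≢ p → δ-at p i z ≡ 0ℤ
  δ-at-miss z i≢p rewrite ≡ᵇ-false i≢p = refl

  χ : Bool → ℤ
  χ b = if b then 1ℤ else 0ℤ

  -- Gaussian elimination without division: pivot on a vector a p with nonzero
  -- last coordinate, and replace every other a i by a combination with a p whose
  -- last coordinate vanishes.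
  dependency : ∀ n q (P U : ℕ → Bool) (a : ℕ → ℕ → ℤ) → ∑ q (bit ∘ U) < ∑ n (bit ∘ P) →
    Σ[ β ∈ (ℕ → ℤ) ] (∀ i → P i ≡ false → β i ≡ 0ℤ)
      × (∃[ i ] i < n × P i ≡ true × β i ≢ 0ℤ)
      × (∀ j → j < q → U j ≡ true → ∑ᶻ n (λ i → β i ℤ.* a i j) ≡ 0ℤ)
  dependency n zero P U a lt with search n P
  ... | inj₁ (i , i<n , Pi) = β , (λ j Pj → cong χ Pj)
      , (i , i<n , Pi , λ eq → case trans (sym (cong χ Pi)) eq of λ ()) , λ _ ()
    where
    β : ℕ → ℤ
    β i = χ (P i)
  ... | inj₂ none = ⊥-elim (<⇒≢ lt (sym (∑-zero n λ i i<n → cong bit (none i i<n))))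
  dependency n (suc q) P U a lt with U q in Uq
  ... | false with β , supp , nz , dep ← dependency n q P U a (subst (_< _) (+-identityʳ _) lt) =
    β , supp , nz , λ j j<1+q Uj → case j ≟ q of λ where
      (yes refl) → ⊥-elim (true≢false Uj Uq)
      (no j≢q)   → dep j (≤∧≢⇒< (≤-pred j<1+q) j≢q) Uj
  ... | true with search n (λ i → P i ∧ not (does (a i q ℤP.≟ 0ℤ)))
  -- No pivot: the last coordinate vanishes on all of `P`, so this constraint comes for free.
  ...   | inj₂ none with β , supp , nz , dep ← dependency n q P U a (≤-trans (s≤s (m≤m+n _ 1)) lt) =
    β , supp , nz , λ j j<1+q Uj → case j ≟ q of λ where
      (yes refl) → ∑ᶻ.∑-zero n λ i i<n → vanish i i<n
      (no j≢q)   → dep j (≤∧≢⇒< (≤-pred j<1+q) j≢q) Uj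
    where
    vanish : ∀ i → i < n → β i ℤ.* a i q ≡ 0ℤ
    vanish i i<n with P i in Pi | a i q ℤP.≟ 0ℤ | none i i<n
    ... | false | _      | _ = trans (cong (ℤ._* a i q) (supp i Pi)) (ℤP.*-zeroˡ (a i q))
    ... | true  | yes eq | _ = trans (cong (β i ℤ.*_) eq) (ℤP.*-zeroʳ (β i))
  ...   | inj₁ (p , p<n , Pp∧nz) = β , supp , nz , dep
    where
    Pp : P p ≡ true
    Pp = proj₁ (∧-true Pp∧nz)
    ap : ℤ
    ap = a p q
    ap≢0 : ap ≢ 0ℤ
    ap≢0 eq with a p q ℤP.≟ 0ℤ | proj₂ (∧-true {P p} Pp∧nz)
    ... | no ne | _ = ne eq
    P′ : ℕ → Bool
    P′ i = P i ∧ not (i ≡ᵇ p)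
    b : ℕ → ℕ → ℤ
    b i j = ap ℤ.* a i j ℤ.- a i q ℤ.* a p j
    count-split : ∀ i → bit (P i) ≡ bit (P′ i) + bit (i ≡ᵇ p)
    count-split i with i ≡ᵇ p in eq
    ... | true rewrite ≡ᵇ-true i p eq | Pp = refl
    ... | false with P i
    ...   | true  = refl
    ...   | false = refl
    count : ∑ n (bit ∘ P) ≡ ∑ n (bit ∘ P′) + 1
    count = trans (∑-cong n λ i _ → count-split i)
      (trans (∑-+ n _ _)
        (cong (λ c → ∑ n (bit ∘ P′) + c) (trans (∑-single n p p<n λ i _ i≢p → cong bit (≡ᵇ-false i≢p))
          (cong bit (≡ᵇ-refl p)))))
    rec = dependency n q P′ U b (+-cancelʳ-< 1 _ _ (subst (∑ q (bit ∘ U) + 1 <_) count lt))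
    γ : ℕ → ℤ
    γ = proj₁ rec
    s : ℤ
    s = ∑ᶻ n (λ i → γ i ℤ.* a i q)
    β : ℕ → ℤ
    -- The entry `- s` at the pivot supplies the multiples of `a p` that `b` subtracts, so the two
    -- combinations agree (`total`).
    β i = ap ℤ.* γ i ℤ.+ δ-at p i (ℤ.- s)
    supp : ∀ i → P i ≡ false → β i ≡ 0ℤ
    supp i Pi = trans (cong₂ ℤ._+_
        (trans (cong (ap ℤ.*_) (proj₁ (proj₂ rec) i (cong (_∧ _) Pi))) (ℤP.*-zeroʳ ap))
        (δ-at-miss {p} {i} _ λ where refl → true≢false Pp Pi)) refl
    nz : ∃[ i ] i < n × P i ≡ true × β i ≢ 0ℤ
    nz with i , i<n , P′i , γi ← proj₁ (proj₂ (proj₂ rec)) =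
      i , i<n , proj₁ (∧-true P′i) , λ eq → case ℤP.i*j≡0⇒i≡0∨j≡0 ap (trans (sym (βi i (i≢p i P′i))) eq) of λ where
        (inj₁ ap0) → ap≢0 ap0
        (inj₂ γ0)  → γi γ0
      where
      i≢p : ∀ i → P′ i ≡ true → i ≢ p
      i≢p i P′i refl with () ← trans (sym (proj₂ (∧-true {P i} P′i))) (cong not (≡ᵇ-refl i))
      βi : ∀ i → i ≢ p → β i ≡ ap ℤ.* γ i
      βi i i≢p = trans (cong (λ z → ap ℤ.* γ i ℤ.+ z) (δ-at-miss _ i≢p)) (ℤP.+-identityʳ _)
    expand : ∀ i j → β i ℤ.* a i j ≡ γ i ℤ.* b i j ℤ.+ (a p j ℤ.* (γ i ℤ.* a i q) ℤ.+ δ-at p i (ℤ.- (s ℤ.* a p j)))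
    expand i j with i ≡ᵇ p in eq
    ... | true rewrite ≡ᵇ-true i p eq = identity ap (γ p) s (a p j) (a p q)
      where
      identity : ∀ A g s x y → (A ℤ.* g ℤ.+ ℤ.- s) ℤ.* x
        ≡ g ℤ.* (A ℤ.* x ℤ.- y ℤ.* x) ℤ.+ (x ℤ.* (g ℤ.* y) ℤ.+ ℤ.- (s ℤ.* x))
      identity = ℤS.solve-∀
    ... | false = identity ap (γ i) (a i j) (a i q) (a p j)
      where
      identity : ∀ A g x y z → (A ℤ.* g ℤ.+ 0ℤ) ℤ.* x
        ≡ g ℤ.* (A ℤ.* x ℤ.- y ℤ.* z) ℤ.+ (z ℤ.* (g ℤ.* y) ℤ.+ 0ℤ)
      identity = ℤS.solve-∀
    total : ∀ j → ∑ᶻ n (λ i → β i ℤ.* a i j) ≡ ∑ᶻ n (λ i → γ i ℤ.* b i j)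
    total j = trans (∑ᶻ.∑-cong n λ i _ → expand i j) (trans (∑ᶻ.∑-+ n _ _)
      (trans (cong (λ z → ∑ᶻ n (λ i → γ i ℤ.* b i j) ℤ.+ z) (trans (∑ᶻ.∑-+ n _ _)
        (trans (cong₂ ℤ._+_ (∑ᶻ.∑-* n (a p j) _)
          (trans (∑ᶻ.∑-single n p p<n λ i _ i≢p → δ-at-miss _ i≢p) (δ-at-hit p _)))
          (cancel (a p j) s)))) (ℤP.+-identityʳ _)))
      where
      cancel : ∀ x s → x ℤ.* s ℤ.+ ℤ.- (s ℤ.* x) ≡ 0ℤ
      cancel = ℤS.solve-∀
    dep : ∀ j → j < suc q → U j ≡ true → ∑ᶻ n (λ i → β i ℤ.* a i j) ≡ 0ℤ
    dep j j<1+q Uj with j ≟ q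
    ... | no j≢q = trans (total j) (proj₂ (proj₂ (proj₂ rec)) j (≤∧≢⇒< (≤-pred j<1+q) j≢q) Uj)
    ... | yes refl = trans (total q) (∑ᶻ.∑-zero n λ i _ → trans (cong (γ i ℤ.*_) (cancel ap (a i q))) (ℤP.*-zeroʳ (γ i)))
      where
      cancel : ∀ x y → x ℤ.* y ℤ.- y ℤ.* x ≡ 0ℤ
      cancel = ℤS.solve-∀

  *-nonneg : ∀ {a b} → 0ℤ ℤ.≤ a → 0ℤ ℤ.≤ b → 0ℤ ℤ.≤ a ℤ.* b
  *-nonneg {a} {b} 0≤a 0≤b = subst (ℤ._≤ a ℤ.* b) (ℤP.*-zeroʳ a) (ℤP.*-monoˡ-≤-nonNeg a ⦃ ℤ.nonNegative 0≤a ⦄ 0≤b)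

  *-pos : ∀ {a b} → 0ℤ ℤ.< a → 0ℤ ℤ.< b → 0ℤ ℤ.< a ℤ.* b
  *-pos {a} {b} 0<a 0<b = subst (ℤ._< a ℤ.* b) (ℤP.*-zeroʳ a) (ℤP.*-monoˡ-<-pos a ⦃ ℤ.positive 0<a ⦄ 0<b)

  nonneg-cancel : ∀ {c a} → 0ℤ ℤ.< c → 0ℤ ℤ.≤ c ℤ.* a → 0ℤ ℤ.≤ a
  nonneg-cancel {c} {a} 0<c h =
    ℤP.*-cancelˡ-≤-pos 0ℤ a c ⦃ ℤ.positive 0<c ⦄ (subst (ℤ._≤ c ℤ.* a) (sym (ℤP.*-zeroʳ c)) h)

  neg-flip : ∀ {a} → a ℤ.< 0ℤ → 0ℤ ℤ.< ℤ.- a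
  neg-flip = ℤP.neg-mono-<

  +-nonneg : ∀ {a b} → 0ℤ ℤ.≤ a → 0ℤ ℤ.≤ b → 0ℤ ℤ.≤ a ℤ.+ b
  +-nonneg = ℤP.+-mono-≤

  abstract
    -- The ratio test of the simplex method by cross multiplication: among the indices with `u i`
    -- negative, one with the least quotient of `a i` by `- u i` is kept, and `β = - u i`, `α = a i`
    -- move exactly until that coordinate reaches 0. The second hypothesis keeps the minimiser away
    -- from coordinates that are already 0.
    ratioTest : ∀ m (a u : ℕ → ℤ) → (∀ i → i < m → 0ℤ ℤ.≤ a i) → (∀ i → i < m → a i ≡ 0ℤ → u i ≡ 0ℤ) →
      (∀ i → i < m → 0ℤ ℤ.≤ u i) ⊎
      Σ[ α ∈ ℤ ] Σ[ β ∈ ℤ ] 0ℤ ℤ.< β × (∀ i → i < m → 0ℤ ℤ.≤ β ℤ.* a i ℤ.+ α ℤ.* u i)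
        × (∃[ i ] i < m × a i ≢ 0ℤ × β ℤ.* a i ℤ.+ α ℤ.* u i ≡ 0ℤ)
    ratioTest m a u a≥0 a0u0 with best m ≤-refl
      where
      Best : ℕ → Set
      Best l = (∀ i → i < l → 0ℤ ℤ.≤ u i) ⊎
        (∃[ i ] i < m × u i ℤ.< 0ℤ × (∀ h → h < l → 0ℤ ℤ.≤ (ℤ.- u i) ℤ.* a h ℤ.+ a i ℤ.* u h))
      extend : ∀ {l} {Q : ℕ → Set} → (∀ h → h < l → Q h) → Q l → ∀ h → h < suc l → Q h
      extend {l} old new h h<1+l with h ≟ l
      ... | yes refl = new
      ... | no  h≢l  = old h (≤∧≢⇒< (≤-pred h<1+l) h≢l)
      best : ∀ l → l ≤ m → Best l
      best zero    _   = inj₁ λ _ ()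
      best (suc l) l<m with u l ℤP.<? 0ℤ | best l (<⇒≤ l<m)
      ... | no u≥0 | inj₁ none = inj₁ (extend none (ℤP.≮⇒≥ u≥0))
      ... | no u≥0 | inj₂ (i , i<m , ui<0 , opt) = inj₂ (i , i<m , ui<0 , extend opt
            (+-nonneg (*-nonneg (ℤP.<⇒≤ (neg-flip ui<0)) (a≥0 l l<m)) (*-nonneg (a≥0 i i<m) (ℤP.≮⇒≥ u≥0))))
      ... | yes ul<0 | inj₁ none = inj₂ (l , l<m , ul<0 , extend
            (λ h h<l → +-nonneg (*-nonneg (ℤP.<⇒≤ (neg-flip ul<0)) (a≥0 h (<-trans h<l l<m))) (*-nonneg (a≥0 l l<m) (none h h<l)))
            (ℤP.≤-reflexive (sym (self (u l) (a l)))))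
        where
        self : ∀ x y → (ℤ.- x) ℤ.* y ℤ.+ y ℤ.* x ≡ 0ℤ
        self = ℤS.solve-∀
      ... | yes ul<0 | inj₂ (i , i<m , ui<0 , opt) with (ℤ.- u i) ℤ.* a l ℤ.+ a i ℤ.* u l ℤP.<? 0ℤ
      ...   | no  ok  = inj₂ (i , i<m , ui<0 , extend opt (ℤP.≮⇒≥ ok))
      ...   | yes bad = inj₂ (l , l<m , ul<0 , extend better (ℤP.≤-reflexive (sym (self (u l) (a l)))))
        where
        self : ∀ x y → (ℤ.- x) ℤ.* y ℤ.+ y ℤ.* x ≡ 0ℤ
        self = ℤS.solve-∀
        -- Transitivity of the comparison of quotients, multiplied by the positive number `- ui` to
        -- stay in ℤ.
        chain : ∀ ui ul uh ai al ah →
          (ℤ.- ui) ℤ.* ((ℤ.- ul) ℤ.* ah ℤ.+ al ℤ.* uh)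
          ≡ (ℤ.- ul) ℤ.* ((ℤ.- ui) ℤ.* ah ℤ.+ ai ℤ.* uh) ℤ.+ (ℤ.- uh) ℤ.* (ℤ.- ((ℤ.- ui) ℤ.* al ℤ.+ ai ℤ.* ul))
        chain = ℤS.solve-∀
        better : ∀ h → h < l → 0ℤ ℤ.≤ (ℤ.- u l) ℤ.* a h ℤ.+ a l ℤ.* u h
        better h h<l with u h ℤP.<? 0ℤ
        ... | no uh≥0 = +-nonneg (*-nonneg (ℤP.<⇒≤ (neg-flip ul<0)) (a≥0 h (<-trans h<l l<m))) (*-nonneg (a≥0 l l<m) (ℤP.≮⇒≥ uh≥0))
        ... | yes uh<0 = nonneg-cancel (neg-flip ui<0) (subst (0ℤ ℤ.≤_) (sym (chain (u i) (u l) (u h) (a i) (a l) (a h)))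
              (+-nonneg (*-nonneg (ℤP.<⇒≤ (neg-flip ul<0)) (opt h h<l))
                        (*-nonneg (ℤP.<⇒≤ (neg-flip uh<0)) (ℤP.<⇒≤ (neg-flip bad)))))
    ... | inj₁ none = inj₁ none
    ... | inj₂ (i , i<m , ui<0 , opt) = inj₂ (a i , ℤ.- u i , neg-flip ui<0 , opt , i , i<m
        , (λ ai0 → ℤP.<-irrefl (a0u0 i i<m ai0) ui<0) , self (u i) (a i))
      where
      self : ∀ x y → (ℤ.- x) ℤ.* y ℤ.+ y ℤ.* x ≡ 0ℤ
      self = ℤS.solve-∀

  -- Numbering the subsets of an initial segment by binary codes

  setAt : ℕ → ℕ → FSet
  setAt zero    i = λ _ → false
  setAt (suc m) i = if i <ᵇ 2 ^ m then setAt m i else setAt m (i ∸ 2 ^ m) ⊕ m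

  setAt-support : ∀ m i e → m ≤ e → setAt m i e ≡ false
  setAt-support zero    i e m≤e = refl
  setAt-support (suc m) i e m≤e with i <ᵇ 2 ^ m
  ... | true  = setAt-support m i e (<⇒≤ m≤e)
  ... | false rewrite ≡ᵇ-false (>⇒≢ m≤e) = setAt-support m (i ∸ 2 ^ m) e (<⇒≤ m≤e)

  abstract
    setAt-onto : ∀ m (S : FSet) → ∃[ i ] i < 2 ^ m × (∀ e → e < m → setAt m i e ≡ S e)
    setAt-onto zero    S = 0 , s≤s z≤n , λ _ ()
    setAt-onto (suc m) S with S m in Sm | setAt-onto m S
    ... | false | i , i<2^m , eq = i , ≤-trans i<2^m (m≤m+n _ _) , eq′
      where
      eq′ : ∀ e → e < suc m → setAt (suc m) i e ≡ S e
      eq′ e e<1+m with i <ᵇ 2 ^ m in lt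
      ... | false = ⊥-elim (true≢false (T⇒true (<⇒<ᵇ i<2^m)) lt)
      ... | true with e ≟ m
      ...   | yes refl = trans (setAt-support m i m ≤-refl) (sym Sm)
      ...   | no  e≢m  = eq e (≤∧≢⇒< (≤-pred e<1+m) e≢m)
    ... | true | i , i<2^m , eq = 2 ^ m + i
        , subst (2 ^ m + i <_) (cong (2 ^ m +_) (sym (+-identityʳ (2 ^ m)))) (+-monoʳ-< (2 ^ m) i<2^m) , eq′
      where
      eq′ : ∀ e → e < suc m → setAt (suc m) (2 ^ m + i) e ≡ S e
      eq′ e e<1+m with (2 ^ m + i) <ᵇ 2 ^ m in lt
      ... | true = ⊥-elim (<⇒≱ (<ᵇ⇒< (2 ^ m + i) (2 ^ m) (true⇒T lt)) (m≤m+n (2 ^ m) i))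
      ... | false rewrite m+n∸m≡n (2 ^ m) i with e ≟ m
      ...   | yes refl rewrite ≡ᵇ-refl m = sym Sm
      ...   | no  e≢m rewrite ≡ᵇ-false e≢m = eq e (≤∧≢⇒< (≤-pred e<1+m) e≢m)

  -- Fractional bases

  ∑ᶻ-linear : ∀ n (g x v : ℕ → ℤ) α β →
    ∑ᶻ n (λ e → g e ℤ.* (β ℤ.* x e ℤ.+ α ℤ.* v e)) ≡ β ℤ.* ∑ᶻ n (λ e → g e ℤ.* x e) ℤ.+ α ℤ.* ∑ᶻ n (λ e → g e ℤ.* v e)
  ∑ᶻ-linear n g x v α β = trans (∑ᶻ.∑-cong n λ e _ → rearrange (g e) (x e) (v e) α β)
    (trans (∑ᶻ.∑-+ n _ _) (cong₂ ℤ._+_ (∑ᶻ.∑-* n β _) (∑ᶻ.∑-* n α _)))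
    where
    rearrange : ∀ g x v α β → g ℤ.* (β ℤ.* x ℤ.+ α ℤ.* v) ≡ β ℤ.* (g ℤ.* x) ℤ.+ α ℤ.* (g ℤ.* v)
    rearrange = ℤS.solve-∀

  ≡0? : ℤ → Bool
  ≡0? z = does (z ℤP.≟ 0ℤ)

  ≡0?-true : ∀ {z} → ≡0? z ≡ true → z ≡ 0ℤ
  ≡0?-true {z} h with z ℤP.≟ 0ℤ
  ... | yes eq = eq

  ≡0?-intro : ∀ {z} → z ≡ 0ℤ → ≡0? z ≡ true
  ≡0?-intro {z} eq with z ℤP.≟ 0ℤ
  ... | yes _ = refl
  ... | no ne = ⊥-elim (ne eq)

  module Polytope {n : ℕ} (M : FMatroid n) (k : ℕ) (c : ℕ → ℕ → ℕ) where
    open FMatroid M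
    open Matroids M

    full : FSet
    full _ = true

    wt : (ℕ → ℤ) → FSet → ℤ
    wt x S = ∑ᶻ n (λ e → χ (S e) ℤ.* x e)

    wt-cong : ∀ x {S T} → (∀ e → e < n → S e ≡ T e) → wt x S ≡ wt x T
    wt-cong x h = ∑ᶻ.∑-cong n λ e e<n → cong (λ b → χ b ℤ.* x e) (h e e<n)

    wt-modular : ∀ x S T → wt x (S ∪ T) ℤ.+ wt x (S ∩ T) ≡ wt x S ℤ.+ wt x T
    wt-modular x S T = trans (sym (∑ᶻ.∑-+ n _ _)) (trans (∑ᶻ.∑-cong n λ e _ → pointwise (S e) (T e) (x e)) (∑ᶻ.∑-+ n _ _))
      where
      pointwise : ∀ s t z → χ (s ∨ t) ℤ.* z ℤ.+ χ (s ∧ t) ℤ.* z ≡ χ s ℤ.* z ℤ.+ χ t ℤ.* z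
      pointwise true  true  z = refl
      pointwise true  false z = refl
      pointwise false true  z = ℤP.+-comm (1ℤ ℤ.* z) (0ℤ ℤ.* z)
      pointwise false false z = refl

    costᶻ : (ℕ → ℤ) → ℕ → ℤ
    costᶻ x j = ∑ᶻ n (λ e → pos (c j e) ℤ.* x e)

    -- x / D is a point of the basis polytope of the minor on F obtained by
    -- contracting A, within budget b on the rows in U.
    record Frac (A F U : FSet) (b : ℕ) : Set where
      field
        D      : ℤ
        x      : ℕ → ℤ
        D>0    : 0ℤ ℤ.< D
        x≥0    : ∀ e → e < n → 0ℤ ℤ.≤ x e
        onA    : ∀ e → e < n → A e ≡ true → x e ≡ D
        off    : ∀ e → e < n → A e ≡ false → F e ≡ false → x e ≡ 0ℤ
        below  : ∀ S → wt x S ℤ.≤ D ℤ.* pos (rank S)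
        total  : wt x full ≡ D ℤ.* pos (rank full)
        budget : ∀ j → j < k → U j ≡ true → costᶻ x j ℤ.≤ D ℤ.* pos b

    module _ {A F U : FSet} {b : ℕ} (X : Frac A F U b) where
      open Frac X

      x≤D : ∀ e → e < n → x e ℤ.≤ D
      x≤D e e<n = subst₂ ℤ._≤_ wt≡ (ℤP.*-identityʳ D) (ℤP.≤-trans (below ⁅e⁆)
        (ℤP.*-monoˡ-≤-nonNeg D ⦃ ℤ.nonNegative (ℤP.<⇒≤ D>0) ⦄ (ℤ.+≤+ (≤-trans (rank-≤-size ⁅e⁆) (≤-reflexive size≡)))))
        where
        ⁅e⁆ : FSet
        ⁅e⁆ i = i ≡ᵇ e
        wt≡ : wt x ⁅e⁆ ≡ x e
        wt≡ = trans (∑ᶻ.∑-single n e e<n λ i _ i≢e → cong (λ b → χ b ℤ.* x i) (≡ᵇ-false i≢e))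
          (trans (cong (λ b → χ b ℤ.* x e) (≡ᵇ-refl e)) (ℤP.*-identityˡ (x e)))
        size≡ : ∣ ⁅e⁆ ∣ ≡ 1
        size≡ = trans (∑-single n e e<n λ i _ i≢e → cong bit (≡ᵇ-false i≢e)) (cong bit (≡ᵇ-refl e))

      Tight : FSet → Set
      Tight S = D ℤ.* pos (rank S) ℤ.- wt x S ≡ 0ℤ

      tight-eq : ∀ {S} → Tight S → wt x S ≡ D ℤ.* pos (rank S)
      tight-eq t = sym (ℤP.i-j≡0⇒i≡j _ _ t)

      eq-tight : ∀ {S} → wt x S ≡ D ℤ.* pos (rank S) → Tight S
      eq-tight {S} eq = ℤP.i≡j⇒i-j≡0 (sym eq)

      -- Uncrossing: weight is modular and rank submodular, so the slacks of union and intersection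
      -- add up to at most 0, and both are nonnegative by `below`.
      tight-∪∩ : ∀ {S T} → Tight S → Tight T → Tight (S ∪ T) × Tight (S ∩ T)
      tight-∪∩ {S} {T} tS tT = eq-tight {S ∪ T} (squeeze (below (S ∪ T)) (below (S ∩ T)) sums)
        , eq-tight {S ∩ T} (squeeze (below (S ∩ T)) (below (S ∪ T))
            (subst₂ ℤ._≤_ (ℤP.+-comm (D ℤ.* pos (rank (S ∪ T))) _) (ℤP.+-comm (wt x (S ∪ T)) _) sums))
        where
        sums : D ℤ.* pos (rank (S ∪ T)) ℤ.+ D ℤ.* pos (rank (S ∩ T)) ℤ.≤ wt x (S ∪ T) ℤ.+ wt x (S ∩ T)
        sums = subst₂ ℤ._≤_ (ℤP.*-distribˡ-+ D _ _)
          (trans (ℤP.*-distribˡ-+ D _ _)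
            (trans (sym (cong₂ ℤ._+_ (tight-eq {S} tS) (tight-eq {T} tT))) (sym (wt-modular x S T))))
          (ℤP.*-monoˡ-≤-nonNeg D ⦃ ℤ.nonNegative (ℤP.<⇒≤ D>0) ⦄ (ℤ.+≤+ (rank-submodular S T)))
        squeeze : ∀ {a b a′ b′} → a ℤ.≤ a′ → b ℤ.≤ b′ → a′ ℤ.+ b′ ℤ.≤ a ℤ.+ b → a ≡ a′
        squeeze a≤a′ b≤b′ h = ℤP.≤-antisym a≤a′
          (ℤP.≮⇒≥ λ a<a′ → ℤP.<-irrefl refl (ℤP.<-≤-trans (ℤP.+-mono-<-≤ a<a′ b≤b′) h))

      tight? : FSet → Bool
      tight? S = ≡0? (D ℤ.* pos (rank S) ℤ.- wt x S)

      tight-full : Tight full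
      tight-full = eq-tight {full} total

      tight-∅ : Tight (λ _ → false)
      tight-∅ = eq-tight {λ _ → false} (trans (∑ᶻ.∑-zero n λ _ _ → refl)
        (sym (trans (cong (λ r → D ℤ.* pos r) (n≤0⇒n≡0 (≤-trans (rank-≤-size (λ _ → false)) (≤-reflexive (∑-zero n λ _ _ → refl)))))
          (ℤP.*-zeroʳ D))))

      -- At m = `2 ^ n` these are the least tight set containing e and the greatest tight set
      -- avoiding e; the starting values, the whole set and the empty set, are tight themselves.
      meet join : ℕ → ℕ → FSet
      meet e zero    = full
      meet e (suc m) = if tight? (setAt n m) ∧ setAt n m e then meet e m ∩ setAt n m else meet e m
      join e zero    = λ _ → false
      join e (suc m) = if tight? (setAt n m) ∧ not (setAt n m e) then join e m ∪ setAt n m else join e m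

      tight-meet : ∀ e m → Tight (meet e m)
      tight-meet e zero    = tight-full
      tight-meet e (suc m) with tight? (setAt n m) ∧ setAt n m e in eq
      ... | true  = proj₂ (tight-∪∩ {meet e m} {setAt n m} (tight-meet e m) (≡0?-true (proj₁ (∧-true eq))))
      ... | false = tight-meet e m

      tight-join : ∀ e m → Tight (join e m)
      tight-join e zero    = tight-∅
      tight-join e (suc m) with tight? (setAt n m) ∧ not (setAt n m e) in eq
      ... | true  = proj₁ (tight-∪∩ {join e m} {setAt n m} (tight-join e m) (≡0?-true (proj₁ (∧-true eq))))
      ... | false = tight-join e m

      Agree : ℕ → ℕ → ℕ → Set
      Agree m e f = ∀ i → i < m → Tight (setAt n i) → setAt n i e ≡ setAt n i f

      extend : ∀ {l} {Q : ℕ → Set} → (∀ h → h < l → Q h) → Q l → ∀ h → h < suc l → Q h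
      extend {l} old new h h<1+l with h ≟ l
      ... | yes refl = new
      ... | no  h≢l  = old h (≤∧≢⇒< (≤-pred h<1+l) h≢l)

      agree⇒meet : ∀ m e f → Agree m e f → meet e m f ≡ true
      agree⇒meet zero    e f ag = refl
      agree⇒meet (suc m) e f ag with tight? (setAt n m) ∧ setAt n m e in eq | agree⇒meet m e f (λ i i<m → ag i (m<n⇒m<1+n i<m))
      ... | false | rec = rec
      ... | true  | rec with t , Se ← ∧-true {tight? (setAt n m)} eq =
        ∧-intro rec (trans (sym (ag m ≤-refl (≡0?-true t))) Se)

      agree⇒join : ∀ m e f → Agree m e f → join e m f ≡ false
      agree⇒join zero    e f ag = refl
      agree⇒join (suc m) e f ag with tight? (setAt n m) ∧ not (setAt n m e) in eq | agree⇒join m e f (λ i i<m → ag i (m<n⇒m<1+n i<m))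
      ... | false | rec = rec
      ... | true  | rec rewrite rec with t , Se ← ∧-true {tight? (setAt n m)} eq =
        trans (sym (ag m ≤-refl (≡0?-true t))) (not-true Se)

      -- The elements that no tight set separates from e, presented as a difference of two tight
      -- sets because `class-weight` relies on that form.
      same : ℕ → FSet
      same e f = meet e (2 ^ n) f ∧ not (join e (2 ^ n) f)

      same⇒agree′ : ∀ m e f → meet e m f ≡ true → join e m f ≡ false → Agree m e f
      same⇒agree′ zero    e f hm hj = λ _ ()
      same⇒agree′ (suc m) e f hm hj with tight? (setAt n m) in eqT | setAt n m e in eqS
      ... | false | _     = extend (same⇒agree′ m e f hm hj) λ t → ⊥-elim (true≢false (≡0?-intro t) eqT)
      ... | true  | true  = extend (same⇒agree′ m e f (proj₁ (∧-true hm)) hj) λ _ → trans eqS (sym (proj₂ (∧-true {meet e m f} hm)))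
      ... | true  | false with join e m f in eqJ
      ...   | false = extend (same⇒agree′ m e f hm eqJ) λ _ → trans eqS (sym hj)

      agree⇒same : ∀ {e f} → Agree (2 ^ n) e f → same e f ≡ true
      agree⇒same {e} {f} ag rewrite agree⇒meet (2 ^ n) e f ag | agree⇒join (2 ^ n) e f ag = refl

      same⇒agree : ∀ {e f} → same e f ≡ true → Agree (2 ^ n) e f
      same⇒agree {e} {f} h with hm , hj ← ∧-true {meet e (2 ^ n) f} h = same⇒agree′ (2 ^ n) e f hm (not-true hj)

      same-refl : ∀ e → same e e ≡ true
      same-refl e = agree⇒same {e} {e} λ _ _ _ → refl

      same-class : ∀ {e f} g → same e f ≡ true → same e g ≡ same f g
      same-class {e} {f} g h = bool-ext
        (λ eg → agree⇒same {f} {g} λ i i< t → trans (sym (same⇒agree {e} {f} h i i< t)) (same⇒agree {e} {g} eg i i< t))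
        (λ fg → agree⇒same {e} {g} λ i i< t → trans (same⇒agree {e} {f} h i i< t) (same⇒agree {f} {g} fg i i< t))

      -- A class is the difference of two tight sets, so its weight is a multiple of D.
      class-weight : ∀ e → Σ[ z ∈ ℤ ] wt x (same e) ≡ D ℤ.* z
      class-weight e = pos (rank Tₑ) ℤ.- pos (rank (Tₑ ∩ Jₑ)) , (begin
        wt x (same e)                                          ≡⟨ difference ⟩
        wt x Tₑ ℤ.- wt x (Tₑ ∩ Jₑ)                             ≡⟨ cong₂ ℤ._-_ (tight-eq {Tₑ} tT) (tight-eq {Tₑ ∩ Jₑ} (proj₂ (tight-∪∩ {Tₑ} {Jₑ} tT tJ))) ⟩
        D ℤ.* pos (rank Tₑ) ℤ.- D ℤ.* pos (rank (Tₑ ∩ Jₑ))     ≡⟨ factor D _ _ ⟩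
        D ℤ.* (pos (rank Tₑ) ℤ.- pos (rank (Tₑ ∩ Jₑ)))         ∎)
        where
        open Relation.Binary.PropositionalEquality.≡-Reasoning
        Tₑ Jₑ : FSet
        Tₑ = meet e (2 ^ n)
        Jₑ = join e (2 ^ n)
        tT : Tight Tₑ
        tT = tight-meet e (2 ^ n)
        tJ : Tight Jₑ
        tJ = tight-join e (2 ^ n)
        factor : ∀ d a b → d ℤ.* a ℤ.- d ℤ.* b ≡ d ℤ.* (a ℤ.- b)
        factor = ℤS.solve-∀
        pointwise : ∀ s t z → χ (s ∧ not t) ℤ.* z ℤ.+ χ (s ∧ t) ℤ.* z ≡ χ s ℤ.* z
        pointwise true  true  z = ℤP.+-identityˡ _
        pointwise true  false z = ℤP.+-identityʳ _
        pointwise false t     z = refl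
        shift : ∀ {a b c} → a ℤ.+ b ≡ c → a ≡ c ℤ.- b
        shift {a} {b} refl = lemma a b
          where
          lemma : ∀ a b → a ≡ a ℤ.+ b ℤ.- b
          lemma = ℤS.solve-∀
        difference : wt x (same e) ≡ wt x Tₑ ℤ.- wt x (Tₑ ∩ Jₑ)
        difference = shift (trans (sym (∑ᶻ.∑-+ n _ _)) (∑ᶻ.∑-cong n λ f _ → pointwise (Tₑ f) (Jₑ f) (x f)))

  -- Rounding

  -- The value is 0 if nothing is found, which keeps `rep` below n for every element.
  greatest : ℕ → (ℕ → Bool) → ℕ
  greatest zero    p = 0
  greatest (suc m) p = if p m then m else greatest m p

  greatest-cong : ∀ m {p q} → (∀ i → p i ≡ q i) → greatest m p ≡ greatest m q
  greatest-cong zero    eq = refl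
  greatest-cong (suc m) {p} {q} eq rewrite eq m | greatest-cong m {p} {q} eq = refl

  greatest-≤ : ∀ m p → greatest m p ≤ m ∸ 1
  greatest-≤ zero    p = z≤n
  greatest-≤ (suc m) p with p m
  ... | true  = ≤-refl
  ... | false = ≤-trans (greatest-≤ m p) (m∸n≤m m 1)

  greatest-< : ∀ {m} p → 0 < m → greatest m p < m
  greatest-< {suc m} p _ = s≤s (greatest-≤ (suc m) p)

  greatest-hit : ∀ m (p : ℕ → Bool) i → i < m → p i ≡ true → p (greatest m p) ≡ true
  greatest-hit (suc m) p i i<1+m pi with p m in eq
  ... | true  = eq
  ... | false = greatest-hit m p i (≤∧≢⇒< (≤-pred i<1+m) λ where refl → true≢false pi eq) pi

  no-proper-multiple : ∀ {d} z → 0ℤ ℤ.< d ℤ.* z → d ℤ.* z ℤ.< d → 0ℤ ℤ.< d → ⊥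
  no-proper-multiple {d} z 0<dz dz<d 0<d with z ℤP.≤? 0ℤ
  ... | yes z≤0 = ℤP.<⇒≱ 0<dz (subst (d ℤ.* z ℤ.≤_) (ℤP.*-zeroʳ d)
    (ℤP.*-monoˡ-≤-nonNeg d ⦃ ℤ.nonNegative (ℤP.<⇒≤ 0<d) ⦄ z≤0))
  ... | no z≰0 = ℤP.<⇒≱ dz<d (subst (ℤ._≤ d ℤ.* z) (ℤP.*-identityʳ d)
    (ℤP.*-monoˡ-≤-nonNeg d ⦃ ℤ.nonNegative (ℤP.<⇒≤ 0<d) ⦄ (ℤP.i<j⇒suc[i]≤j (ℤP.≰⇒> z≰0))))

  ∧-not-false : ∀ {a b} → b ≡ false → a ∧ not b ≡ false → a ≡ false
  ∧-not-false {false} _    _ = refl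
  ∧-not-false {true}  {true}  () _
  ∧-not-false {true}  {false} _  ()

  ∧-false : ∀ a → a ∧ false ≡ false
  ∧-false true  = refl
  ∧-false false = refl

  δ-at-zero : ∀ p i → δ-at p i 0ℤ ≡ 0ℤ
  δ-at-zero p i with i ≡ᵇ p
  ... | true  = refl
  ... | false = refl

  abstract
    -- The sign of a dependency is free. A negative entry excludes the outcome of `ratioTest` in
    -- which the direction has no negative coordinate.
    negative-dependency : ∀ n q (P U : ℕ → Bool) (a : ℕ → ℕ → ℤ) → ∑ q (bit ∘ U) < ∑ n (bit ∘ P) →
      Σ[ β ∈ (ℕ → ℤ) ] (∀ i → P i ≡ false → β i ≡ 0ℤ)
        × (∃[ i ] i < n × P i ≡ true × β i ℤ.< 0ℤ)
        × (∀ j → j < q → U j ≡ true → ∑ᶻ n (λ i → β i ℤ.* a i j) ≡ 0ℤ)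
    negative-dependency n q P U a lt with dependency n q P U a lt
    ... | β , supp , (i , i<n , Pi , βi≢0) , dep with ℤP.<-cmp (β i) 0ℤ
    ...   | tri< βi<0 _ _ = β , supp , (i , i<n , Pi , βi<0) , dep
    ...   | tri≈ _ βi≡0 _ = ⊥-elim (βi≢0 βi≡0)
    ...   | tri> _ _ βi>0 = (λ i → ℤ.- β i) , (λ i Pi → cong ℤ.-_ (supp i Pi))
      , (i , i<n , Pi , ℤP.neg-mono-< βi>0)
      , λ j j<q Uj → trans (∑ᶻ.∑-cong n λ i _ → sym (ℤP.neg-distribˡ-* (β i) (a i j)))
          (trans (∑ᶻ-neg n _) (cong ℤ.-_ (dep j j<q Uj)))

  module Rounding {n : ℕ} (M : FMatroid n) (k : ℕ) (c : ℕ → ℕ → ℕ) where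
    open FMatroid M
    open Matroids M
    open Polytope M k c

    abstract
      -- All inequalities of the polytope in one vector, as the ratio test wants them: an entry for
      -- each of the `2 ^ n` subsets, then one for each coordinate. Being linear in the pair `D`,
      -- `x`, it also measures a direction, with `D` = 0.
      slack : ℤ → (ℕ → ℤ) → ℕ → ℤ
      slack D x i = if i <ᵇ 2 ^ n then D ℤ.* pos (rank (setAt n i)) ℤ.- wt x (setAt n i) else x (i ∸ 2 ^ n)

      slack-linear : ∀ D x v α β i →
        slack (β ℤ.* D) (λ e → β ℤ.* x e ℤ.+ α ℤ.* v e) i ≡ β ℤ.* slack D x i ℤ.+ α ℤ.* slack 0ℤ v i
      slack-linear D x v α β i with i <ᵇ 2 ^ n
      ... | false = refl
      ... | true  = trans (cong (λ w → β ℤ.* D ℤ.* pos (rank (setAt n i)) ℤ.- w) (∑ᶻ-linear n (χ ∘ setAt n i) x v α β)) (rearrange α β D _ _ _)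
        where
        rearrange : ∀ α β D r w u → β ℤ.* D ℤ.* r ℤ.- (β ℤ.* w ℤ.+ α ℤ.* u) ≡ β ℤ.* (D ℤ.* r ℤ.- w) ℤ.+ α ℤ.* (0ℤ ℤ.* r ℤ.- u)
        rearrange = ℤS.solve-∀

      slack-set : ∀ D x i → i < 2 ^ n → slack D x i ≡ D ℤ.* pos (rank (setAt n i)) ℤ.- wt x (setAt n i)
      slack-set D x i i< with i <ᵇ 2 ^ n in eq
      ... | true  = refl
      ... | false = ⊥-elim (true≢false (T⇒true (<⇒<ᵇ i<)) eq)

      slack-coord : ∀ D x e → slack D x (2 ^ n + e) ≡ x e
      slack-coord D x e with (2 ^ n + e) <ᵇ 2 ^ n in eq
      ... | true  = ⊥-elim (<⇒≱ (<ᵇ⇒< (2 ^ n + e) (2 ^ n) (true⇒T eq)) (m≤m+n (2 ^ n) e))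
      ... | false = cong x (m+n∸m≡n (2 ^ n) e)

    -- The termination measure of the moves: each makes a further inequality tight and none loose.
    loose : ∀ {A F U b} → Frac A F U b → ℕ
    loose X = ∑ (2 ^ n + n) λ i → bit (not (≡0? (slack (Frac.D X) (Frac.x X) i)))

    slack-cases : ∀ {D x} (Q : ℕ → ℤ → Set) →
      (∀ i → i < 2 ^ n → Q i (D ℤ.* pos (rank (setAt n i)) ℤ.- wt x (setAt n i))) →
      (∀ e → e < n → Q (2 ^ n + e) (x e)) → ∀ i → i < 2 ^ n + n → Q i (slack D x i)
    slack-cases {D} {x} Q qs qc i i< with i <? 2 ^ n
    ... | yes i<2^n = subst (Q i) (sym (slack-set D x i i<2^n)) (qs i i<2^n)
    ... | no  i≮2^n with e , refl ← m≤n⇒∃[o]m+o≡n (≮⇒≥ i≮2^n) =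
      subst (Q (2 ^ n + e)) (sym (slack-coord D x e)) (qc e (+-cancelˡ-< (2 ^ n) e n i<))

    -- Shifting value between a representative and another member of its class leaves all tight sets
    -- tight. There are more such exchanges than enforced rows, so some nontrivial combination of
    -- them also preserves the costs of those rows.
    module Move {A F U : FSet} {b : ℕ} (X : Frac A F U b)
      (fractional : ∀ e → e < n → F e ≡ true → 0ℤ ℤ.< Frac.x X e × Frac.x X e ℤ.< Frac.D X)
      (few : ∑ k (bit ∘ U) + ∑ k (bit ∘ U) < ∑ n (bit ∘ F)) where
      open Frac X

      _~_ : ℕ → FSet
      _~_ = same X

      rep : ℕ → ℕ
      rep e = greatest n λ f → F f ∧ (e ~ f)

      nonrep : FSet
      nonrep e = F e ∧ not (rep e ≡ᵇ e)

      rep-< : ∀ {e} → e < n → rep e < n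
      rep-< e<n = greatest-< _ (≤-<-trans z≤n e<n)

      rep-spec : ∀ {e} → e < n → F e ≡ true → F (rep e) ≡ true × e ~ rep e ≡ true
      rep-spec {e} e<n Fe = ∧-true (greatest-hit n (λ f → F f ∧ (e ~ f)) e e<n (∧-intro Fe (same-refl X e)))

      rep-cong : ∀ {e f} → e ~ f ≡ true → rep e ≡ rep f
      rep-cong {e} {f} h = greatest-cong n λ g → cong (F g ∧_) (same-class X {e} {f} g h)

      rep-rep : ∀ {e} → e < n → F e ≡ true → rep (rep e) ≡ rep e
      rep-rep {e} e<n Fe = sym (rep-cong {e} {rep e} (proj₂ (rep-spec e<n Fe)))

      -- If e were the only member of `F` in its class, the rest of the class would weigh a multiple
      -- of `D`, as fixed elements count `D` and the others 0. The whole class does too, so `x e`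
      -- would be a multiple of `D` strictly between 0 and `D`.
      partner : ∀ e → e < n → F e ≡ true → ∃[ p ] p < n × F p ≡ true × e ~ p ≡ true × p ≢ e
      partner e e<n Fe with search n (λ p → F p ∧ ((e ~ p) ∧ not (p ≡ᵇ e)))
      ... | inj₁ (p , p<n , h) with Fp , h′ ← ∧-true {F p} h with ep , p≢e ← ∧-true {e ~ p} h′ =
        p , p<n , Fp , ep , λ where refl → true≢false p≢e (cong not (≡ᵇ-refl p))
      ... | inj₂ none = ⊥-elim (no-proper-multiple (z ℤ.- Y) (subst (0ℤ ℤ.<_) xe (proj₁ (fractional e e<n Fe)))
          (subst (ℤ._< D) xe (proj₂ (fractional e e<n Fe))) D>0)
        where
        z Y : ℤ
        z = proj₁ (class-weight X e)
        y : ℕ → ℤ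
        y f = if f ≡ᵇ e then 0ℤ else χ ((e ~ f) ∧ A f)
        Y = ∑ᶻ n y
        pointwise : ∀ f → f < n → χ (e ~ f) ℤ.* x f ≡ δ-at e f (x e) ℤ.+ D ℤ.* y f
        pointwise f f<n with f ≡ᵇ e in eq
        ... | true rewrite ≡ᵇ-true f e eq | same-refl X e =
          trans (ℤP.*-identityˡ (x e)) (sym (trans (cong (λ w → x e ℤ.+ w) (ℤP.*-zeroʳ D)) (ℤP.+-identityʳ (x e))))
        ... | false with F f in Ff | none f f<n
        ...   | true | nf rewrite ∧-not-false {e ~ f} eq nf = sym (trans (ℤP.+-identityˡ _) (ℤP.*-zeroʳ D))
        ...   | false | _ with A f in Af
        ...     | true rewrite onA f f<n Af = trans (cases (e ~ f)) (sym (ℤP.+-identityˡ _))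
          where
          cases : ∀ s → χ s ℤ.* D ≡ D ℤ.* χ (s ∧ true)
          cases true  = ℤP.*-comm 1ℤ D
          cases false = ℤP.*-comm 0ℤ D
        ...     | false rewrite off f f<n Af Ff = trans (ℤP.*-zeroʳ (χ (e ~ f)))
          (sym (trans (ℤP.+-identityˡ _) (trans (cong (D ℤ.*_) (cases (e ~ f))) (ℤP.*-zeroʳ D))))
          where
          cases : ∀ s → χ (s ∧ false) ≡ 0ℤ
          cases true  = refl
          cases false = refl
        xe : x e ≡ D ℤ.* (z ℤ.- Y)
        xe = solveFor (trans (sym (trans (∑ᶻ.∑-cong n pointwise) (trans (∑ᶻ.∑-+ n _ _)
          (cong₂ ℤ._+_ (trans (∑ᶻ.∑-single n e e<n λ i _ i≢e → δ-at-miss _ i≢e) (δ-at-hit e (x e))) (∑ᶻ.∑-* n D y)))))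
          (proj₂ (class-weight X e)))
          where
          solveFor : ∀ {a} → a ℤ.+ D ℤ.* Y ≡ D ℤ.* z → a ≡ D ℤ.* (z ℤ.- Y)
          solveFor {a} eq = trans (step₁ a D Y) (trans (cong (λ w → w ℤ.- D ℤ.* Y) eq) (step₂ D z Y))
            where
            step₁ : ∀ a d y → a ≡ a ℤ.+ d ℤ.* y ℤ.- d ℤ.* y
            step₁ = ℤS.solve-∀
            step₂ : ∀ d z y → d ℤ.* z ℤ.- d ℤ.* y ≡ d ℤ.* (z ℤ.- y)
            step₂ = ℤS.solve-∀

      abstract
        -- Every class has at least two members in F, so representatives are at most half of F.
        many : ∑ k (bit ∘ U) < ∑ n (bit ∘ nonrep)
        many = half few (subst₂ _≤_ (sym split) refl (+-monoˡ-≤ _ reps≤nonreps))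
          where
          isRep : FSet
          isRep e = F e ∧ (rep e ≡ᵇ e)
          half : ∀ {u f p} → u + u < f → f ≤ p + p → u < p
          half {u} {f} {p} lt le with u <? p
          ... | yes u<p = u<p
          ... | no  u≮p = ⊥-elim (<⇒≱ (<-≤-trans lt le) (+-mono-≤ (≮⇒≥ u≮p) (≮⇒≥ u≮p)))
          split : ∑ n (bit ∘ F) ≡ ∑ n (bit ∘ isRep) + ∑ n (bit ∘ nonrep)
          split = trans (∑-cong n λ e _ → pointwise (F e) (rep e ≡ᵇ e)) (∑-+ n _ _)
            where
            pointwise : ∀ f r → bit f ≡ bit (f ∧ r) + bit (f ∧ not r)
            pointwise true  true  = refl
            pointwise true  false = refl
            pointwise false r     = refl
          pair : ℕ → ℕ → ℕ
          pair r e = bit (isRep r ∧ (nonrep e ∧ (rep e ≡ᵇ r)))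
          reps≤nonreps : ∑ n (bit ∘ isRep) ≤ ∑ n (bit ∘ nonrep)
          -- Double counting: every representative is the value of `rep` at some other element, and
          -- `rep` has only one value at each element.
          reps≤nonreps = ≤-trans (∑-mono n lower) (≤-trans (≤-reflexive (∑-swap n n pair)) (∑-mono n upper))
            where
            lower : ∀ r → r < n → bit (isRep r) ≤ ∑ n (pair r)
            lower r r<n with isRep r in eq
            ... | false = z≤n
            ... | true with Fr , rr ← ∧-true {F r} eq with p , p<n , Fp , rp , p≢r ← partner r r<n Fr =
              ≤-trans (≤-reflexive (sym (cong bit (∧-intro nonrep-p rep-p)))) (∑-term n p p<n)
              where
              reps : rep p ≡ r
              reps = trans (sym (rep-cong {r} {p} rp)) (≡ᵇ-true (rep r) r rr)
              rep-p : (rep p ≡ᵇ r) ≡ true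
              rep-p = trans (cong (_≡ᵇ r) reps) (≡ᵇ-refl r)
              nonrep-p : nonrep p ≡ true
              nonrep-p = ∧-intro Fp (cong not (≡ᵇ-false λ eq → p≢r (trans (sym eq) reps)))
            upper : ∀ e → e < n → ∑ n (λ r → pair r e) ≤ bit (nonrep e)
            upper e e<n with nonrep e in eq
            ... | false = ≤-reflexive (∑-zero n λ r _ → cong bit (∧-false (isRep r)))
            ... | true = ≤-trans (≤-reflexive (∑-single n (rep e) (rep-< e<n) λ r _ r≢ →
                trans (cong (λ z → bit (isRep r ∧ z)) (≡ᵇ-false (r≢ ∘ sym))) (cong bit (∧-false (isRep r)))))
                (bit-if (isRep (rep e) ∧ (rep e ≡ᵇ rep e)))

      gap : ℕ → ℕ → ℤ
      gap e j = pos (c j e) ℤ.- pos (c j (rep e))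

      abstract
        β : ℕ → ℤ
        β = proj₁ (negative-dependency n k nonrep U gap many)

        supp : ∀ e → nonrep e ≡ false → β e ≡ 0ℤ
        supp = proj₁ (proj₂ (negative-dependency n k nonrep U gap many))

        β-negative : ∃[ i ] i < n × nonrep i ≡ true × β i ℤ.< 0ℤ
        β-negative = proj₁ (proj₂ (proj₂ (negative-dependency n k nonrep U gap many)))

        β-budget : ∀ j → j < k → U j ≡ true → ∑ᶻ n (λ e → β e ℤ.* gap e j) ≡ 0ℤ
        β-budget = proj₂ (proj₂ (proj₂ (negative-dependency n k nonrep U gap many)))

      -- The sum over e of `β e` times the difference of the unit vectors of e and `rep e`, read off
      -- at coordinate i.
      direction : ℕ → ℤ
      direction i = β i ℤ.- ∑ᶻ n (λ e → δ-at (rep e) i (β e))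

      -- A linear functional sees only its differences between e and `rep e`. They vanish for the
      -- indicator of a tight set, and for a cost row they are the numbers `gap` that `β`
      -- annihilates.
      direction-sum : ∀ (g : ℕ → ℤ) → ∑ᶻ n (λ i → g i ℤ.* direction i) ≡ ∑ᶻ n (λ e → β e ℤ.* (g e ℤ.- g (rep e)))
      direction-sum g = trans (∑ᶻ.∑-cong n λ i _ → expand i)
        (trans (∑ᶻ.∑-+ n _ _) (trans (cong (λ w → ∑ᶻ n (λ i → g i ℤ.* β i) ℤ.+ w) inner)
          (trans (sym (∑ᶻ.∑-+ n _ _)) (∑ᶻ.∑-cong n λ e _ → collect (g e) (β e) (g (rep e))))))
        where
        expand : ∀ i → g i ℤ.* direction i ≡ g i ℤ.* β i ℤ.+ ∑ᶻ n (λ e → ℤ.- (g i ℤ.* δ-at (rep e) i (β e)))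
        expand i = trans (distribute (g i) (β i) _) (cong (λ w → g i ℤ.* β i ℤ.+ w)
          (trans (cong ℤ.-_ (sym (∑ᶻ.∑-* n (g i) _))) (sym (∑ᶻ-neg n _))))
          where
          distribute : ∀ a b c → a ℤ.* (b ℤ.- c) ≡ a ℤ.* b ℤ.+ ℤ.- (a ℤ.* c)
          distribute = ℤS.solve-∀
        inner : ∑ᶻ n (λ i → ∑ᶻ n (λ e → ℤ.- (g i ℤ.* δ-at (rep e) i (β e)))) ≡ ∑ᶻ n (λ e → ℤ.- (g (rep e) ℤ.* β e))
        inner = trans (∑ᶻ.∑-swap n n _) (∑ᶻ.∑-cong n λ e e<n → trans
          (∑ᶻ.∑-single n (rep e) (rep-< e<n) λ i _ i≢ → cong ℤ.-_ (trans (cong (g i ℤ.*_) (δ-at-miss _ i≢)) (ℤP.*-zeroʳ (g i))))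
          (cong (λ w → ℤ.- (g (rep e) ℤ.* w)) (δ-at-hit (rep e) (β e))))
        collect : ∀ a b c → a ℤ.* b ℤ.+ ℤ.- (c ℤ.* b) ≡ b ℤ.* (a ℤ.- c)
        collect = ℤS.solve-∀

      direction-off : ∀ i → F i ≡ false → direction i ≡ 0ℤ
      direction-off i Fi = cong₂ ℤ._-_ (supp i (cong (λ f → f ∧ not (rep i ≡ᵇ i)) Fi)) (∑ᶻ.∑-zero n vanish)
        where
        vanish : ∀ e → e < n → δ-at (rep e) i (β e) ≡ 0ℤ
        vanish e e<n with nonrep e in eq
        ... | false = trans (cong (δ-at (rep e) i) (supp e eq)) (δ-at-zero (rep e) i)
        ... | true  = δ-at-miss {rep e} {i} (β e) λ where refl → true≢false (proj₁ (rep-spec e<n (proj₁ (∧-true eq)))) Fi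

      -- A non-representative is never a value of `rep`, so nothing is subtracted there and the
      -- negative entry of `β` survives.
      direction-nonrep : ∀ i → nonrep i ≡ true → direction i ≡ β i
      direction-nonrep i Pi = trans (cong (λ w → β i ℤ.- w) (∑ᶻ.∑-zero n vanish)) (ℤP.+-identityʳ (β i))
        where
        vanish : ∀ e → e < n → δ-at (rep e) i (β e) ≡ 0ℤ
        vanish e e<n with nonrep e in eq
        ... | false = trans (cong (δ-at (rep e) i) (supp e eq)) (δ-at-zero (rep e) i)
        ... | true  = δ-at-miss {rep e} {i} (β e) λ where
          refl → true≢false (trans (cong (_≡ᵇ rep e) (rep-rep e<n (proj₁ (∧-true eq)))) (≡ᵇ-refl (rep e)))
            (not-true (proj₂ (∧-true {F (rep e)} Pi)))

      direction-tight : ∀ i → i < 2 ^ n → Tight X (setAt n i) → wt direction (setAt n i) ≡ 0ℤ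
      direction-tight i i< t = trans (direction-sum (χ ∘ setAt n i)) (∑ᶻ.∑-zero n vanish)
        where
        vanish : ∀ e → e < n → β e ℤ.* (χ (setAt n i e) ℤ.- χ (setAt n i (rep e))) ≡ 0ℤ
        vanish e e<n with nonrep e in eq
        ... | false = cong (ℤ._* (χ (setAt n i e) ℤ.- χ (setAt n i (rep e)))) (supp e eq)
        ... | true  = trans (cong (β e ℤ.*_) (ℤP.i≡j⇒i-j≡0 (cong χ
          (same⇒agree X {e} {rep e} (proj₂ (rep-spec e<n (proj₁ (∧-true eq)))) i i< t)))) (ℤP.*-zeroʳ (β e))

      direction-full : wt direction full ≡ 0ℤ
      direction-full with i , i< , eq ← setAt-onto n full =
        trans (sym (wt-cong direction eq)) (direction-tight i i< (eq-tight X {setAt n i}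
          (trans (wt-cong x eq) (trans total (cong (λ r → D ℤ.* pos r) (sym (rank-cong eq)))))))

      direction-budget : ∀ j → j < k → U j ≡ true → costᶻ direction j ≡ 0ℤ
      direction-budget j j<k Uj = trans (direction-sum (λ e → pos (c j e))) (β-budget j j<k Uj)

      slack-direction : ∀ i → i < 2 ^ n + n → slack D x i ≡ 0ℤ → slack 0ℤ direction i ≡ 0ℤ
      slack-direction = slack-cases {D} {x} (λ i z → z ≡ 0ℤ → slack 0ℤ direction i ≡ 0ℤ)
        (λ i i< t → trans (slack-set 0ℤ direction i i<)
          (trans (cong (λ w → 0ℤ ℤ.* pos (rank (setAt n i)) ℤ.- w) (direction-tight i i< t)) refl))
        (λ e e<n xe0 → trans (slack-coord 0ℤ direction e) (direction-off e (¬true⇒false λ Fe →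
          ℤP.<-irrefl (sym xe0) (proj₁ (fractional e e<n Fe)))))

      slack-nonneg : ∀ i → i < 2 ^ n + n → 0ℤ ℤ.≤ slack D x i
      slack-nonneg = slack-cases {D} {x} (λ _ z → 0ℤ ℤ.≤ z) (λ i _ → ℤP.i≤j⇒0≤j-i (below (setAt n i))) x≥0

      module Scaled (α β′ : ℤ) (β′>0 : 0ℤ ℤ.< β′)
        (ok : ∀ i → i < 2 ^ n + n → 0ℤ ℤ.≤ β′ ℤ.* slack D x i ℤ.+ α ℤ.* slack 0ℤ direction i) where

        x′ : ℕ → ℤ
        x′ e = β′ ℤ.* x e ℤ.+ α ℤ.* direction e

        D′ : ℤ
        D′ = β′ ℤ.* D

        slack′ : ∀ i → slack D′ x′ i ≡ β′ ℤ.* slack D x i ℤ.+ α ℤ.* slack 0ℤ direction i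
        slack′ = slack-linear D x direction α β′

        ok′ : ∀ i → i < 2 ^ n + n → 0ℤ ℤ.≤ slack D′ x′ i
        ok′ i i< = subst (0ℤ ℤ.≤_) (sym (slack′ i)) (ok i i<)

        fixed : ∀ {e} → F e ≡ false → x′ e ≡ β′ ℤ.* x e
        fixed {e} Fe = trans (cong (λ w → β′ ℤ.* x e ℤ.+ α ℤ.* w) (direction-off e Fe))
          (trans (cong (λ w → β′ ℤ.* x e ℤ.+ w) (ℤP.*-zeroʳ α)) (ℤP.+-identityʳ (β′ ℤ.* x e)))

        preserved : ∀ (g : ℕ → ℤ) → ∑ᶻ n (λ e → g e ℤ.* direction e) ≡ 0ℤ →
          ∑ᶻ n (λ e → g e ℤ.* x′ e) ≡ β′ ℤ.* ∑ᶻ n (λ e → g e ℤ.* x e)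
        preserved g v≡0 = trans (∑ᶻ-linear n g x direction α β′)
          (trans (cong (λ w → β′ ℤ.* ∑ᶻ n (λ e → g e ℤ.* x e) ℤ.+ α ℤ.* w) v≡0)
            (trans (cong (λ w → β′ ℤ.* ∑ᶻ n (λ e → g e ℤ.* x e) ℤ.+ w) (ℤP.*-zeroʳ α)) (ℤP.+-identityʳ _)))

        below′ : ∀ S → wt x′ S ℤ.≤ D′ ℤ.* pos (rank S)
        below′ S with i , i< , eq ← setAt-onto n S = subst₂ ℤ._≤_ (wt-cong x′ eq) (cong (λ r → D′ ℤ.* pos r) (rank-cong eq))
          (ℤP.0≤i-j⇒j≤i (subst (0ℤ ℤ.≤_) (slack-set D′ x′ i i<) (ok′ i (≤-trans i< (m≤m+n _ n)))))

        onA′ : ∀ e → e < n → A e ≡ true → x′ e ≡ D′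
        onA′ e e<n Ae = trans (fixed (¬true⇒false λ Fe → ℤP.<-irrefl (onA e e<n Ae) (proj₂ (fractional e e<n Fe))))
          (cong (β′ ℤ.*_) (onA e e<n Ae))

        off′ : ∀ e → e < n → A e ≡ false → F e ≡ false → x′ e ≡ 0ℤ
        off′ e e<n Ae Fe = trans (fixed Fe) (trans (cong (β′ ℤ.*_) (off e e<n Ae Fe)) (ℤP.*-zeroʳ β′))

        total′ : wt x′ full ≡ D′ ℤ.* pos (rank full)
        total′ = trans (preserved (χ ∘ full) direction-full) (trans (cong (β′ ℤ.*_) total) (sym (ℤP.*-assoc β′ D (pos (rank full)))))

        budget′ : ∀ j → j < k → U j ≡ true → costᶻ x′ j ℤ.≤ D′ ℤ.* pos b
        budget′ j j<k Uj = subst₂ ℤ._≤_ (sym (preserved (λ e → pos (c j e)) (direction-budget j j<k Uj)))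
          (sym (ℤP.*-assoc β′ D (pos b)))
          (ℤP.*-monoˡ-≤-nonNeg β′ ⦃ ℤ.nonNegative (ℤP.<⇒≤ β′>0) ⦄ (budget j j<k Uj))

        Y : Frac A F U b
        Y = record
          { D      = D′
          ; x      = x′
          ; D>0    = *-pos β′>0 D>0
          ; x≥0    = λ e e<n → subst (0ℤ ℤ.≤_) (slack-coord D′ x′ e) (ok′ (2 ^ n + e) (+-monoʳ-< (2 ^ n) e<n))
          ; onA    = onA′
          ; off    = off′
          ; below  = below′
          ; total  = total′
          ; budget = budget′
          }

        still : ∀ i → i < 2 ^ n + n → bit (not (≡0? (slack D′ x′ i))) ≤ bit (not (≡0? (slack D x i)))
        still i i< = bit-mono λ h → ¬≡0 λ eq → true≢false (≡0?-intro (trans (slack′ i)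
          (cong₂ ℤ._+_ (trans (cong (β′ ℤ.*_) eq) (ℤP.*-zeroʳ β′))
            (trans (cong (α ℤ.*_) (slack-direction i i< eq)) (ℤP.*-zeroʳ α))))) (not-true h)
          where
          ¬≡0 : (slack D x i ≡ 0ℤ → ⊥) → not (≡0? (slack D x i)) ≡ true
          ¬≡0 ne with ≡0? (slack D x i) in eq
          ... | true  = ⊥-elim (ne (≡0?-true eq))
          ... | false = refl

        becomes : ∀ i → slack D x i ≢ 0ℤ → β′ ℤ.* slack D x i ℤ.+ α ℤ.* slack 0ℤ direction i ≡ 0ℤ →
          bit (not (≡0? (slack D′ x′ i))) < bit (not (≡0? (slack D x i)))
        becomes i ne hit rewrite ≡0?-intro (trans (slack′ i) hit) with ≡0? (slack D x i) in eq
        ... | true  = ⊥-elim (ne (≡0?-true eq))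
        ... | false = s≤s z≤n

      moved : Σ[ Y ∈ Frac A F U b ] loose Y < loose X
      moved = build (ratioTest (2 ^ n + n) (slack D x) (slack 0ℤ direction) slack-nonneg slack-direction)
        where
        build : (∀ i → i < 2 ^ n + n → 0ℤ ℤ.≤ slack 0ℤ direction i) ⊎
          Σ[ α ∈ ℤ ] Σ[ β′ ∈ ℤ ] 0ℤ ℤ.< β′
            × (∀ i → i < 2 ^ n + n → 0ℤ ℤ.≤ β′ ℤ.* slack D x i ℤ.+ α ℤ.* slack 0ℤ direction i)
            × (∃[ i ] i < 2 ^ n + n × slack D x i ≢ 0ℤ × β′ ℤ.* slack D x i ℤ.+ α ℤ.* slack 0ℤ direction i ≡ 0ℤ) →
          Σ[ Y ∈ Frac A F U b ] loose Y < loose X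
        build (inj₁ none) with i , i<n , Pi , βi<0 ← β-negative =
          ⊥-elim (ℤP.<⇒≱ (subst (ℤ._< 0ℤ) (sym (direction-nonrep i Pi)) βi<0)
            (subst (0ℤ ℤ.≤_) (slack-coord 0ℤ direction i) (none (2 ^ n + i) (+-monoʳ-< (2 ^ n) i<n))))
        build (inj₂ (α , β′ , β′>0 , ok , i₀ , i₀< , ne , hit)) =
          Scaled.Y α β′ β′>0 ok
          , ∑-mono-< (2 ^ n + n) i₀ i₀< (Scaled.still α β′ β′>0 ok) (Scaled.becomes α β′ β′>0 ok i₀ ne hit)

    Integral : ∀ {A F U b} → Frac A F U b → Set
    Integral {F = F} X = ∃[ e ] e < n × F e ≡ true × (Frac.x X e ≡ 0ℤ ⊎ Frac.x X e ≡ Frac.D X)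

    -- Moves continue until some element of `F` has value 0 or `D`; m exceeds the number of loose
    -- inequalities and serves as fuel.
    toIntegral : ∀ {A F U b} m (X : Frac A F U b) → loose X < m → ∑ k (bit ∘ U) + ∑ k (bit ∘ U) < ∑ n (bit ∘ F) →
      Σ[ Y ∈ Frac A F U b ] Integral Y
    toIntegral {F = F} (suc m) X lt few
      with search n (λ e → F e ∧ (≡0? (Frac.x X e) ∨ ≡0? (Frac.x X e ℤ.- Frac.D X)))
    ... | inj₁ (e , e<n , h) with Fe , h′ ← ∧-true {F e} h = X , e , e<n , Fe , (case ∨-true {≡0? (Frac.x X e)} h′ of λ where
          (inj₁ z) → inj₁ (≡0?-true z)
          (inj₂ d) → inj₂ (ℤP.i-j≡0⇒i≡j _ _ (≡0?-true d)))
    ... | inj₂ none = let Y , less = Move.moved X fractional few in toIntegral m Y (<-≤-trans less (≤-pred lt)) few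
      where
      fractional : ∀ e → e < n → F e ≡ true → 0ℤ ℤ.< Frac.x X e × Frac.x X e ℤ.< Frac.D X
      fractional e e<n Fe =
          ℤP.≤∧≢⇒< (Frac.x≥0 X e e<n) (λ eq → true≢false (∧-intro Fe (∨-introˡ (≡0?-intro (sym eq)))) (none e e<n))
        , ℤP.≤∧≢⇒< (x≤D X e e<n) λ eq → true≢false
            (∧-intro Fe (∨-introʳ {≡0? (Frac.x X e)} (≡0?-intro (ℤP.i≡j⇒i-j≡0 eq)))) (none e e<n)

  -- Iterative relaxation

  _⊖_ : FSet → ℕ → FSet
  (S ⊖ e) i = S i ∧ not (i ≡ᵇ e)

  <ᵇ-true : ∀ m l → (m <ᵇ l) ≡ true → m < l
  <ᵇ-true m l h = <ᵇ⇒< m l (true⇒T h)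

  <ᵇ-false : ∀ m l → (m <ᵇ l) ≡ false → l ≤ m
  <ᵇ-false m l h = ≮⇒≥ λ m<l → true≢false (T⇒true (<⇒<ᵇ m<l)) h

  <ᵇ-intro : ∀ {m l} → m < l → (m <ᵇ l) ≡ true
  <ᵇ-intro m<l = T⇒true (<⇒<ᵇ m<l)

  <ᵇ-intro-false : ∀ {m l} → l ≤ m → (m <ᵇ l) ≡ false
  <ᵇ-intro-false {m} {l} l≤m = ¬true⇒false λ h → <⇒≱ (<ᵇ-true m l h) l≤m

  -- A number as the count of the levels below it. This gives the layer-cake decomposition of
  -- weights, and products for a machine that can only add.
  ∑-count : ∀ V m → m ≤ V → ∑ V (λ v → bit (v <ᵇ m)) ≡ m
  ∑-count zero    zero _ = refl
  ∑-count (suc V) m m≤1+V with m ≟ suc V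
  ... | yes refl = trans (cong₂ _+_ (trans (∑-cong V λ i i<V → cong bit (<ᵇ-intro (m<n⇒m<1+n i<V)))
          (trans (∑-const V 1) (*-identityʳ V))) (cong bit (<ᵇ-intro {V} ≤-refl))) (+-comm V 1)
  ... | no m≢1+V = trans (cong₂ _+_ (∑-count V m m≤V) (cong bit (<ᵇ-intro-false m≤V))) (+-identityʳ m)
    where
    m≤V : m ≤ V
    m≤V = ≤-pred (≤∧≢⇒< m≤1+V m≢1+V)

  am-gm : ∀ y d → 2 * (y * d) ≤ y * y + d * d
  am-gm y d with ≤-total y d
  ... | inj₁ y≤d with e , refl ← m≤n⇒∃[o]m+o≡n y≤d = ≤-trans (m≤m+n _ (e * e)) (≤-reflexive (identity y e))
    where
    identity : ∀ y e → 2 * (y * (y + e)) + e * e ≡ y * y + (y + e) * (y + e)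
    identity = ℕS.solve-∀
  ... | inj₂ d≤y with e , refl ← m≤n⇒∃[o]m+o≡n d≤y = ≤-trans (m≤m+n _ (e * e)) (≤-reflexive (identity d e))
    where
    identity : ∀ d e → 2 * ((d + e) * d) + e * e ≡ (d + e) * (d + e) + d * d
    identity = ℕS.solve-∀

  -- The expansion of the square of max(0, y + c - b), with the subtracted term moved to the left.
  -- Where the truncation acts, y is at most b - c and `am-gm` closes the gap.
  square-step : ∀ y c b B → c ≤ B → b ≤ B →
    (y + c ∸ b) * (y + c ∸ b) + 2 * (y * b) ≤ y * y + 2 * (y * c) + B * B
  square-step y c b B c≤B b≤B with ≤-total c b
  ... | inj₁ c≤b with d , refl ← m≤n⇒∃[o]m+o≡n c≤b = ≤-trans bound (+-monoʳ-≤ (y * y + 2 * (y * c)) (*-mono-≤ d≤B d≤B))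
    where
    d≤B : d ≤ B
    d≤B = ≤-trans (m≤n+m d c) b≤B
    gap : y + c ∸ (c + d) ≡ y ∸ d
    gap = trans (cong (_∸ (c + d)) (+-comm y c)) ([m+n]∸[m+o]≡n∸o c y d)
    bound : (y + c ∸ (c + d)) * (y + c ∸ (c + d)) + 2 * (y * (c + d)) ≤ y * y + 2 * (y * c) + d * d
    bound rewrite gap with ≤-total d y
    ... | inj₁ d≤y with q , refl ← m≤n⇒∃[o]m+o≡n d≤y rewrite m+n∸m≡n d q = ≤-reflexive (identity q d c)
      where
      identity : ∀ q d c → q * q + 2 * ((d + q) * (c + d)) ≡ (d + q) * (d + q) + 2 * ((d + q) * c) + d * d
      identity = ℕS.solve-∀
    ... | inj₂ y≤d rewrite m≤n⇒m∸n≡0 y≤d = ≤-trans (≤-reflexive (split y c d))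
        (≤-trans (+-monoʳ-≤ (2 * (y * c)) (am-gm y d)) (≤-reflexive (join y c d)))
      where
      split : ∀ y c d → 2 * (y * (c + d)) ≡ 2 * (y * c) + 2 * (y * d)
      split = ℕS.solve-∀
      join : ∀ y c d → 2 * (y * c) + (y * y + d * d) ≡ y * y + 2 * (y * c) + d * d
      join = ℕS.solve-∀
  ... | inj₂ b≤c with d , refl ← m≤n⇒∃[o]m+o≡n b≤c = ≤-trans bound (+-monoʳ-≤ (y * y + 2 * (y * (b + d))) (*-mono-≤ d≤B d≤B))
    where
    d≤B : d ≤ B
    d≤B = ≤-trans (m≤n+m d b) c≤B
    gap : y + (b + d) ∸ b ≡ y + d
    gap = trans (cong (_∸ b) (swap y b d)) (m+n∸m≡n b (y + d))
      where
      swap : ∀ y b d → y + (b + d) ≡ b + (y + d)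
      swap = ℕS.solve-∀
    bound : (y + (b + d) ∸ b) * (y + (b + d) ∸ b) + 2 * (y * b) ≤ y * y + 2 * (y * (b + d)) + d * d
    bound rewrite gap = ≤-reflexive (identity y b d)
      where
      identity : ∀ y b d → (y + d) * (y + d) + 2 * (y * b) ≡ y * y + 2 * (y * (b + d)) + d * d
      identity = ℕS.solve-∀

  module Relaxation {n : ℕ} (M : FMatroid n) (k : ℕ) (c : ℕ → ℕ → ℕ) (Θ : ℕ) where
    open FMatroid M
    open Matroids M
    open Polytope M k c
    open Rounding M k c

    costOf : FSet → ℕ → ℕ
    costOf S j = ∑ n (λ e → bit (S e) * c j e)

    -- Only these rows are enforced. In any other row even taking all of `A ∪ F` costs at most b +
    -- 2Θ, so the row may be forgotten whatever is decided later.
    unsafe : FSet → FSet → ℕ → FSet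
    unsafe A F b j = (b + (Θ + Θ)) <ᵇ costOf (A ∪ F) j

    Inv : FSet → FSet → ℕ → Set
    Inv A F b = Frac A F (unsafe A F b) b

    Light : FSet → Set
    Light F = ∀ e → e < n → F e ≡ true → ∑ k (λ j → c j e) ≤ Θ

    Disjoint : FSet → FSet → Set
    Disjoint A F = ∀ e → e < n → F e ≡ true → A e ≡ false

    costOf-mono : ∀ {S T} j → S ⊆ T → costOf S j ≤ costOf T j
    costOf-mono j h = ∑-mono n λ e e<n → *-monoˡ-≤ (c j e) (bit-mono (h e e<n))

    D*pos-cancel : ∀ {D a b} → 0ℤ ℤ.< D → D ℤ.* pos a ℤ.≤ D ℤ.* pos b → a ≤ b
    D*pos-cancel {D} {a} {b} D>0 h with ℤP.*-cancelˡ-≤-pos (pos a) (pos b) D ⦃ ℤ.positive D>0 ⦄ h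
    ... | ℤ.+≤+ le = le

    module _ {A F U : FSet} {b : ℕ} (X : Frac A F U b) where
      open Frac X

      cost-fixed : ∀ j → D ℤ.* pos (costOf A j) ℤ.≤ costᶻ x j
      cost-fixed j = ℤP.≤-trans (ℤP.≤-reflexive (trans (cong (D ℤ.*_) (pos-∑ n _)) (sym (∑ᶻ.∑-* n D _))))
        (∑ᶻ-mono n pointwise)
        where
        pointwise : ∀ e → e < n → D ℤ.* pos (bit (A e) * c j e) ℤ.≤ pos (c j e) ℤ.* x e
        pointwise e e<n with A e in Ae
        ... | false = subst (ℤ._≤ pos (c j e) ℤ.* x e) (sym (ℤP.*-zeroʳ D)) (*-nonneg {pos (c j e)} {x e} (ℤ.+≤+ z≤n) (x≥0 e e<n))
        ... | true rewrite onA e e<n Ae | +-identityʳ (c j e) = ℤP.≤-reflexive (ℤP.*-comm D _)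

      -- The point is constantly `D` on `A`, so `below` makes the size of `A` at most its rank.
      inv-independent : ind A ≡ true
      inv-independent = size-≤-rank⇒ind A (D*pos-cancel D>0 (ℤP.≤-trans (ℤP.≤-reflexive weight) (below A)))
        where
        weight : D ℤ.* pos ∣ A ∣ ≡ wt x A
        weight = trans (cong (D ℤ.*_) (pos-∑ n _)) (trans (sym (∑ᶻ.∑-* n D _)) (∑ᶻ.∑-cong n pointwise))
          where
          pointwise : ∀ e → e < n → D ℤ.* pos (bit (A e)) ≡ χ (A e) ℤ.* x e
          pointwise e e<n with A e in Ae
          ... | false = ℤP.*-zeroʳ D
          ... | true rewrite onA e e<n Ae = ℤP.*-comm D 1ℤ

      relabel : ∀ {A′ F′ U′} →
        (∀ e → e < n → A′ e ≡ true → x e ≡ D) →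
        (∀ e → e < n → A′ e ≡ false → F′ e ≡ false → x e ≡ 0ℤ) →
        (∀ j → j < k → U′ j ≡ true → U j ≡ true) → Frac A′ F′ U′ b
      relabel onA′ off′ rows = record
        { D = D ; x = x ; D>0 = D>0 ; x≥0 = x≥0 ; onA = onA′ ; off = off′ ; below = below ; total = total
        ; budget = λ j j<k U′j → budget j j<k (rows j j<k U′j) }

    -- Fixed elements use at most b of an unsafe row, so more than 2Θ of its load lies on `F`; a
    -- light element has only Θ to give to all rows together. Hence 2Θ + 1 times the number of
    -- unsafe rows is at most Θ times the size of `F`.
    few-unsafe : ∀ {A F b} → Inv A F b → Light F → (∃[ e ] e < n × F e ≡ true) →
      ∑ k (bit ∘ unsafe A F b) + ∑ k (bit ∘ unsafe A F b) < ∣ F ∣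
    few-unsafe {A} {F} {b} X light (e₀ , e₀<n , Fe₀) = conclude #U refl
      where
      open Frac X
      U : FSet
      U = unsafe A F b
      #U : ℕ
      #U = ∑ k (bit ∘ U)
      F-nonempty : 0 < ∣ F ∣
      F-nonempty = ≤-trans (≤-reflexive (sym (cong bit Fe₀))) (∑-term n e₀ e₀<n)
      heavy-row : ∀ j → j < k → bit (U j) * suc (Θ + Θ) ≤ costOf F j
      heavy-row j j<k with U j in Uj
      ... | false = z≤n
      ... | true  = subst (_≤ costOf F j) (sym (+-identityʳ _)) (+-cancelˡ-≤ b _ _
          (≤-trans (≤-reflexive (+-suc b (Θ + Θ))) (≤-trans (<ᵇ-true _ _ Uj) (≤-trans loaded (+-monoˡ-≤ _ A≤b)))))
        where
        A≤b : costOf A j ≤ b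
        A≤b = D*pos-cancel D>0 (ℤP.≤-trans (cost-fixed X j) (budget j j<k Uj))
        loaded : costOf (A ∪ F) j ≤ costOf A j + costOf F j
        loaded = ≤-trans (∑-mono n λ e _ → pointwise (A e) (F e) (c j e)) (≤-reflexive (∑-+ n _ _))
          where
          pointwise : ∀ a f z → bit (a ∨ f) * z ≤ bit a * z + bit f * z
          pointwise true  f z = m≤m+n _ (bit f * z)
          pointwise false f z = ≤-refl
      weight : #U * suc (Θ + Θ) ≤ ∣ F ∣ * Θ
      weight = ≤-trans (≤-reflexive (trans (*-comm #U _) (trans (sym (∑-* k (suc (Θ + Θ)) _)) (∑-cong k λ j _ → *-comm (suc (Θ + Θ)) (bit (U j))))))
        (≤-trans (∑-mono k heavy-row) (≤-trans (≤-reflexive (∑-swap k n _))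
        (≤-trans (∑-mono n column) (≤-reflexive (trans (∑-cong n λ e _ → *-comm (bit (F e)) Θ) (trans (∑-* n Θ _) (*-comm Θ ∣ F ∣)))))))
        where
        column : ∀ e → e < n → ∑ k (λ j → bit (F e) * c j e) ≤ bit (F e) * Θ
        column e e<n with F e in Fe
        ... | false = ≤-reflexive (∑-zero k λ _ _ → refl)
        ... | true  = subst₂ _≤_ (∑-cong k λ j _ → sym (+-identityʳ (c j e))) (sym (+-identityʳ Θ)) (light e e<n Fe)
      conclude : ∀ u → u ≡ #U → #U + #U < ∣ F ∣
      -- Without unsafe rows the weights give no strict inequality; it comes from `F` being
      -- nonempty.
      conclude zero    eq rewrite sym eq = F-nonempty
      conclude (suc u) eq = *-cancelʳ-< _ (#U + #U) ∣ F ∣ (≤-trans strict weight)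
        where
        expand : ∀ u t → u * suc (t + t) ≡ u + (u + u) * t
        expand = ℕS.solve-∀
        strict : (#U + #U) * Θ < #U * suc (Θ + Θ)
        strict = subst ((#U + #U) * Θ <_) (sym (expand #U Θ)) (+-monoˡ-≤ ((#U + #U) * Θ) (subst (1 ≤_) eq (s≤s z≤n)))

    unsafe-mono : ∀ {A F A′ F′ b b′} j → A′ ∪ F′ ⊆ A ∪ F → b ≤ b′ → unsafe A′ F′ b′ j ≡ true → unsafe A F b j ≡ true
    unsafe-mono j included b≤b′ h =
      <ᵇ-intro (≤-<-trans (+-monoˡ-≤ (Θ + Θ) b≤b′) (<-≤-trans (<ᵇ-true _ _ h) (costOf-mono j included)))

    -- The reason why a sweep cannot get stuck: while a fractional point exists and elements are
    -- free, some element can be taken or discarded at the same budget.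
    round-step : ∀ {A F b} → Inv A F b → Light F → Disjoint A F → (∃[ e ] e < n × F e ≡ true) →
      ∃[ e ] e < n × F e ≡ true × (Inv (A ⊕ e) (F ⊖ e) b ⊎ Inv A (F ⊖ e) b)
    round-step {A} {F} {b} X light disj nonempty
      with toIntegral (suc (loose X)) X ≤-refl (few-unsafe {A} {F} X light nonempty)
    ... | Y , e , e<n , Fe , inj₂ xe≡D = e , e<n , Fe , inj₁ (relabel Y on off′ λ j _ → unsafe-mono {A} {F} {A ⊕ e} {F ⊖ e} {b} j included ≤-refl)
      where
      open Frac Y
      on : ∀ i → i < n → (A ⊕ e) i ≡ true → x i ≡ D
      on i i<n h with ∨-true {i ≡ᵇ e} h
      ... | inj₁ i≡e rewrite ≡ᵇ-true i e i≡e = xe≡D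
      ... | inj₂ Ai  = onA i i<n Ai
      off′ : ∀ i → i < n → (A ⊕ e) i ≡ false → (F ⊖ e) i ≡ false → x i ≡ 0ℤ
      off′ i i<n h f with i ≡ᵇ e
      ... | false = off i i<n h (trans (sym (∧-true-id (F i))) f)
        where
        ∧-true-id : ∀ b → b ∧ true ≡ b
        ∧-true-id true  = refl
        ∧-true-id false = refl
      included : (A ⊕ e) ∪ (F ⊖ e) ⊆ A ∪ F
      included i i<n h with ∨-true {(A ⊕ e) i} h
      ... | inj₂ f = ∨-introʳ {A i} (proj₁ (∧-true f))
      ... | inj₁ a with ∨-true {i ≡ᵇ e} a
      ...   | inj₁ i≡e rewrite ≡ᵇ-true i e i≡e = ∨-introʳ {A e} Fe
      ...   | inj₂ Ai  = ∨-introˡ Ai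
    ... | Y , e , e<n , Fe , inj₁ xe≡0 = e , e<n , Fe , inj₂ (relabel Y onA off′ λ j _ → unsafe-mono {A} {F} {A} {F ⊖ e} {b} j included ≤-refl)
      where
      open Frac Y
      off′ : ∀ i → i < n → A i ≡ false → (F ⊖ e) i ≡ false → x i ≡ 0ℤ
      off′ i i<n a f with i ≡ᵇ e in eq
      ... | true rewrite ≡ᵇ-true i e eq = xe≡0
      ... | false = off i i<n a (trans (sym (∧-true-id (F i))) f)
        where
        ∧-true-id : ∀ b → b ∧ true ≡ b
        ∧-true-id true  = refl
        ∧-true-id false = refl
      included : A ∪ (F ⊖ e) ⊆ A ∪ F
      included i i<n h with ∨-true {A i} h
      ... | inj₁ a = ∨-introˡ a
      ... | inj₂ f = ∨-introʳ {A i} (proj₁ (∧-true f))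

  -- Greedy bases and the multiplicative-weights iteration

  module MultiplicativeWeights {n : ℕ} (M : FMatroid n) (k : ℕ) (c : ℕ → ℕ → ℕ) (Θ : ℕ) where
    open FMatroid M
    open Matroids M
    open Polytope M k c
    open Relaxation M k c Θ

    atMost : FSet → (ℕ → ℕ) → ℕ → FSet
    atMost F w v f = F f ∧ (w f <ᵇ suc v)

    -- Describes a greedy run without an order: a rejected element depends on `A` together with the
    -- chosen elements that are not heavier, ties included.
    record Greedy (A F : FSet) (w : ℕ → ℕ) (J : FSet) : Set where
      field
        contains : A ⊆ J
        within   : J ⊆ A ∪ F
        indep    : ind J ≡ true
        rejected : ∀ e → e < n → F e ≡ true → J e ≡ false → ind ((J ∩ (A ∪ atMost F w (w e))) ⊕ e) ≡ false

    module _ {A F : FSet} {w : ℕ → ℕ} {J : FSet} (G : Greedy A F w J) where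
      open Greedy G

      -- A rejection refers to the level of the rejected element, which is contained in every higher
      -- one; so `J` is maximal inside all level sets at once. This is the source of optimality.
      greedy-level : ∀ v → rank (A ∪ atMost F w v) ≤ ∣ J ∩ (A ∪ atMost F w v) ∣
      greedy-level v = rank-≤-maximal (ind-mono (λ e _ m → proj₁ (∧-true m)) indep) maximal
        where
        maximal : MaximalIn (A ∪ atMost F w v) (J ∩ (A ∪ atMost F w v))
        maximal e e<n Se Je with J e in eq
        ... | true = ⊥-elim (true≢false Se Je)
        ... | false with ∨-true {A e} Se
        ...   | inj₁ Ae = ⊥-elim (true≢false (contains e e<n Ae) eq)
        ...   | inj₂ Fe with F∋e , we≤v ← ∧-true {F e} Fe =
          dep-mono (⊕-mono e smaller) (rejected e e<n F∋e eq)
          where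
          smaller : J ∩ (A ∪ atMost F w (w e)) ⊆ J ∩ (A ∪ atMost F w v)
          smaller f f<n h with Jf , h′ ← ∧-true {J f} h with ∨-true {A f} h′
          ... | inj₁ Af = ∧-intro Jf (∨-introˡ Af)
          ... | inj₂ Lf with Ff , wf ← ∧-true {F f} Lf = ∧-intro Jf (∨-introʳ {A f} (∧-intro Ff
            (<ᵇ-intro (<-≤-trans (<ᵇ-true (w f) _ wf) (<ᵇ-true (w e) (suc v) we≤v)))))

      greedy-maximal : MaximalIn (A ∪ F) J
      greedy-maximal e e<n Se Je with ∨-true {A e} Se
      ... | inj₁ Ae = ⊥-elim (true≢false (contains e e<n Ae) Je)
      ... | inj₂ Fe = dep-mono (⊕-mono e λ f f<n h → proj₁ (∧-true h)) (rejected e e<n Fe Je)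

      greedy-size : ∣ J ∣ ≡ rank (A ∪ F)
      greedy-size = ≤-antisym (ind-≤-rank indep within) (rank-≤-maximal indep greedy-maximal)

    rank-support : ∀ {A F U b} → Frac A F U b → rank (A ∪ F) ≡ rank full
    rank-support {A} {F} X = ≤-antisym (rank-mono λ _ _ _ → refl) (D*pos-cancel D>0
      (subst (ℤ._≤ D ℤ.* pos (rank (A ∪ F))) (trans same-weight total) (below (A ∪ F))))
      where
      open Frac X
      same-weight : wt x (A ∪ F) ≡ wt x full
      same-weight = ∑ᶻ.∑-cong n pointwise
        where
        pointwise : ∀ e → e < n → χ (A e ∨ F e) ℤ.* x e ≡ 1ℤ ℤ.* x e
        pointwise e e<n with A e in Ae | F e in Fe
        ... | true  | _     = refl
        ... | false | true  = refl
        ... | false | false rewrite off e e<n Ae Fe = refl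

    -- The weight of J is ∑ᵥ |J ∩ {w > v}|, and at every level v the set J has
    -- full rank on {w ≤ v}.
    greedy-optimal : ∀ {A F U b w J} (X : Frac A F U b) → Greedy A F w J →
      Frac.D X ℤ.* pos (∑ n (λ e → bit (J e) * w e)) ℤ.≤ ∑ᶻ n (λ e → pos (w e) ℤ.* Frac.x X e)
    greedy-optimal {A} {F} {w = w} {J} X G =
      subst₂ ℤ._≤_ (sym lhs) (sym rhs) (ℤP.+-monoʳ-≤ fixedPart (∑ᶻ-mono V λ v _ → level v))
      where
      open Frac X
      open Greedy G
      V : ℕ
      V = ∑ n w
      -- Fixed elements contribute equally to both sides, so they are split off and count as weight
      -- 0 in the level sums.
      free : ℕ → ℕ
      free e = if A e then 0 else w e
      free≤V : ∀ e → e < n → free e ≤ V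
      free≤V e e<n with A e
      ... | true  = z≤n
      ... | false = ∑-term n e e<n
      above : ℕ → FSet
      above v e = v <ᵇ free e
      fixedPart : ℤ
      fixedPart = D ℤ.* pos (∑ n (λ e → bit (A e) * w e))
      J-split : ∀ e → e < n → bit (J e) * w e ≡ bit (A e) * w e + ∑ V (λ v → bit (J e ∧ above v e))
      J-split e e<n with J e in Je
      ... | false with A e in Ae
      ...   | true  = ⊥-elim (true≢false (contains e e<n Ae) Je)
      ...   | false = sym (∑-zero V λ _ _ → refl)
      J-split e e<n | true with A e in Ae | ∑-count V (free e) (free≤V e e<n)
      ...   | true  | count rewrite count = sym (+-identityʳ _)
      ...   | false | count rewrite count = +-identityʳ (w e)
      lhs : D ℤ.* pos (∑ n (λ e → bit (J e) * w e)) ≡ fixedPart ℤ.+ ∑ᶻ V (λ v → D ℤ.* pos ∣ J ∩ above v ∣)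
      lhs = trans (cong (λ m → D ℤ.* pos m) (trans (∑-cong n J-split) (trans (∑-+ n _ _) (cong (λ m → _ + m) (∑-swap n V _)))))
        (trans (ℤP.*-distribˡ-+ D (pos (∑ n (λ e → bit (A e) * w e))) _) (cong (λ z → fixedPart ℤ.+ z)
          (trans (cong (D ℤ.*_) (pos-∑ V _)) (sym (∑ᶻ.∑-* V D _)))))
      x-split : ∀ e → e < n → pos (w e) ℤ.* x e ≡ D ℤ.* pos (bit (A e) * w e) ℤ.+ ∑ᶻ V (λ v → χ (above v e) ℤ.* x e)
      x-split e e<n with A e in Ae | ∑-count V (free e) (free≤V e e<n)
      ... | true | _ rewrite onA e e<n Ae | +-identityʳ (w e) = sym (trans (cong (λ z → D ℤ.* pos (w e) ℤ.+ z) (∑ᶻ.∑-zero V λ _ _ → refl))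
            (trans (ℤP.+-identityʳ _) (ℤP.*-comm D _)))
      ... | false | count = sym (trans (cong (ℤ._+ ∑ᶻ V (λ v → χ (v <ᵇ w e) ℤ.* x e)) (ℤP.*-zeroʳ D)) (trans (ℤP.+-identityˡ _)
            (trans (∑ᶻ.∑-cong V λ v _ → ℤP.*-comm (χ (v <ᵇ w e)) (x e)) (trans (∑ᶻ.∑-* V (x e) _)
            (trans (cong (x e ℤ.*_) (trans (∑ᶻ.∑-cong V λ v _ → χ-pos (v <ᵇ w e)) (trans (sym (pos-∑ V _)) (cong pos count)))) (ℤP.*-comm (x e) _))))))
        where
        χ-pos : ∀ b → χ b ≡ pos (bit b)
        χ-pos true  = refl
        χ-pos false = refl
      rhs : ∑ᶻ n (λ e → pos (w e) ℤ.* x e) ≡ fixedPart ℤ.+ ∑ᶻ V (λ v → wt x (above v))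
      rhs = trans (∑ᶻ.∑-cong n x-split) (trans (∑ᶻ.∑-+ n _ _) (cong₂ ℤ._+_
        (trans (∑ᶻ.∑-* n D _) (cong (D ℤ.*_) (sym (pos-∑ n _)))) (∑ᶻ.∑-swap n V _)))
      -- By complements: `S` holds at least rank-many elements of `J`, and the weight of x on it is
      -- at most `D` times the rank, while the totals compare the other way round.
      level : ∀ v → D ℤ.* pos ∣ J ∩ above v ∣ ℤ.≤ wt x (above v)
      level v = cancel (ℤP.≤-trans (ℤP.≤-reflexive (trans (sym (ℤP.*-distribˡ-+ D _ _)) (cong (λ m → D ℤ.* pos m) split-J)))
        (ℤP.≤-trans (ℤP.*-monoˡ-≤-nonNeg D ⦃ ℤ.nonNegative (ℤP.<⇒≤ D>0) ⦄ (ℤ.+≤+ (ind-≤-rank indep λ _ _ _ → refl)))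
          (ℤP.≤-reflexive (trans (sym total) split-x)))) (ℤP.≤-trans (below S)
            (ℤP.*-monoˡ-≤-nonNeg D ⦃ ℤ.nonNegative (ℤP.<⇒≤ D>0) ⦄ (ℤ.+≤+ (greedy-level G v))))
        where
        S : FSet
        S = A ∪ atMost F w v
        cancel : ∀ {a b a′ b′} → a ℤ.+ b ℤ.≤ a′ ℤ.+ b′ → b′ ℤ.≤ b → a ℤ.≤ a′
        cancel h b′≤b = ℤP.≮⇒≥ λ a′<a → ℤP.<-irrefl refl (ℤP.<-≤-trans (ℤP.+-mono-<-≤ a′<a b′≤b) h)
        complementary : ∀ e → A e ∨ F e ≡ true → above v e ≡ not (S e)
        complementary e h with A e | F e | h
        ... | true  | _     | _ = refl
        ... | false | true  | _ = <ᵇ-not (w e)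
          where
          <ᵇ-not : ∀ m → (v <ᵇ m) ≡ not (m <ᵇ suc v)
          <ᵇ-not m with m <ᵇ suc v in eq
          ... | true  = <ᵇ-intro-false (≤-pred (<ᵇ-true m (suc v) eq))
          ... | false = <ᵇ-intro (<ᵇ-false m (suc v) eq)
        split-J : ∣ J ∩ above v ∣ + ∣ J ∩ S ∣ ≡ ∣ J ∣
        split-J = trans (sym (∑-+ n _ _)) (∑-cong n pointwise)
          where
          pointwise : ∀ e → e < n → bit (J e ∧ above v e) + bit (J e ∧ S e) ≡ bit (J e)
          pointwise e e<n with J e in Je
          ... | false = refl
          ... | true rewrite complementary e (within e e<n Je) with S e
          ...   | true  = refl
          ...   | false = refl
        split-x : wt x full ≡ wt x (above v) ℤ.+ wt x S
        split-x = trans (∑ᶻ.∑-cong n pointwise) (∑ᶻ.∑-+ n _ _)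
          where
          pointwise : ∀ e → e < n → 1ℤ ℤ.* x e ≡ χ (above v e) ℤ.* x e ℤ.+ χ (S e) ℤ.* x e
          pointwise e e<n with A e ∨ F e in eq
          ... | true rewrite complementary e eq with S e
          ...   | true  = sym (ℤP.+-identityˡ _)
          ...   | false = sym (ℤP.+-identityʳ _)
          pointwise e e<n | false with A e in Ae | F e in Fe
          ...   | false | false rewrite off e e<n Ae Fe | ℤP.*-zeroʳ (χ (v <ᵇ w e)) = refl

  module Iteration {n : ℕ} (M : FMatroid n) (k : ℕ) (c : ℕ → ℕ → ℕ) (Θ : ℕ)
    (A F : FSet) (b : ℕ) (J : ℕ → FSet) where
    open FMatroid M
    open Matroids M
    open Polytope M k c
    open Relaxation M k c Θ
    open MultiplicativeWeights M k c Θ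

    accumulated : ℕ → ℕ → ℕ
    accumulated t j = ∑ t (λ s → costOf (J s) j)

    excess : ℕ → ℕ → ℕ
    excess t j = if unsafe A F b j then accumulated t j ∸ t * b else 0

    weight : ℕ → ℕ → ℕ
    weight t e = ∑ k (λ j → c j e * excess t j)

    module Regret (X : Inv A F b) (B T : ℕ) (b≤B : b ≤ B)
      (small : ∀ t → t < T → ∀ j → j < k → costOf (J t) j ≤ B)
      (greedy : ∀ t → t < T → Greedy A F (weight t) (J t)) where
      open Frac X

      potential : ℕ → ℕ
      potential t = ∑ k (λ j → excess t j * excess t j)

      -- The point of `X` keeps every enforced row within b, hence also their combination weighted
      -- by the excesses; the greedy basis for these weights is no more expensive than the point.
      descent : ∀ t → t < T → ∑ k (λ j → excess t j * costOf (J t) j) ≤ ∑ k (λ j → excess t j * b)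
      descent t t<T = D*pos-cancel D>0 (subst₂ ℤ._≤_ (cong (λ m → D ℤ.* pos m) (swap-cost (bit ∘ J t))) upper
          (ℤP.≤-trans (greedy-optimal X (greedy t t<T)) (ℤP.≤-trans (ℤP.≤-reflexive swap-x) (∑ᶻ-mono k row))))
        where
        swap-cost : ∀ (g : ℕ → ℕ) → ∑ n (λ e → g e * weight t e) ≡ ∑ k (λ j → excess t j * ∑ n (λ e → g e * c j e))
        swap-cost g = trans (∑-cong n λ e _ → sym (∑-* k (g e) _)) (trans (∑-swap n k _)
          (∑-cong k λ j _ → trans (∑-cong n λ e _ → rearrange (g e) (c j e) (excess t j)) (∑-* n (excess t j) _)))
          where
          rearrange : ∀ a b c → a * (b * c) ≡ c * (a * b)
          rearrange = ℕS.solve-∀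
        swap-x : ∑ᶻ n (λ e → pos (weight t e) ℤ.* x e) ≡ ∑ᶻ k (λ j → pos (excess t j) ℤ.* costᶻ x j)
        swap-x = trans (∑ᶻ.∑-cong n λ e _ → trans (cong (ℤ._* x e) (pos-∑ k _)) (trans (ℤP.*-comm _ (x e)) (sym (∑ᶻ.∑-* k (x e) _))))
          (trans (∑ᶻ.∑-swap n k _) (∑ᶻ.∑-cong k λ j _ → trans (∑ᶻ.∑-cong n λ e _ →
            trans (cong (x e ℤ.*_) (ℤP.pos-* (c j e) (excess t j))) (rearrange (x e) (pos (c j e)) (pos (excess t j))))
            (∑ᶻ.∑-* n (pos (excess t j)) (λ e → pos (c j e) ℤ.* x e))))
          where
          rearrange : ∀ a b c → a ℤ.* (b ℤ.* c) ≡ c ℤ.* (b ℤ.* a)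
          rearrange = ℤS.solve-∀
        row : ∀ j → j < k → pos (excess t j) ℤ.* costᶻ x j ℤ.≤ D ℤ.* pos (excess t j * b)
        row j j<k with unsafe A F b j in Uj
        ... | false = ℤP.≤-reflexive (sym (ℤP.*-zeroʳ D))
        ... | true  = ℤP.≤-trans (ℤP.*-monoˡ-≤-nonNeg (pos (accumulated t j ∸ t * b)) (budget j j<k Uj))
            (ℤP.≤-reflexive (trans (rearrange (pos (accumulated t j ∸ t * b)) D (pos b)) (cong (D ℤ.*_) (sym (ℤP.pos-* (accumulated t j ∸ t * b) b)))))
          where
          rearrange : ∀ a d b → a ℤ.* (d ℤ.* b) ≡ d ℤ.* (a ℤ.* b)
          rearrange = ℤS.solve-∀
        upper : ∑ᶻ k (λ j → D ℤ.* pos (excess t j * b)) ≡ D ℤ.* pos (∑ k (λ j → excess t j * b))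
        upper = trans (∑ᶻ.∑-* k D _) (cong (D ℤ.*_) (sym (pos-∑ k _)))

      potential-step : ∀ t → t < T → potential (suc t) ≤ potential t + k * (B * B)
      potential-step t t<T = cancel {q = potential t} (≤-trans (≤-reflexive gather) (≤-trans (∑-mono k row) (≤-reflexive spread))) (descent t t<T)
        where
        row : ∀ j → j < k → excess (suc t) j * excess (suc t) j + 2 * (excess t j * b)
          ≤ excess t j * excess t j + 2 * (excess t j * costOf (J t) j) + B * B
        row j j<k with unsafe A F b j
        ... | false = z≤n
        ... | true  = ≤-trans (+-monoˡ-≤ _ (*-mono-≤ shrink shrink))
            (square-step (accumulated t j ∸ t * b) (costOf (J t) j) b B (small t t<T j j<k) b≤B)
          where
          -- Truncating at 0 after each step can only give more than truncating once at the end.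
          shrink : accumulated t j + costOf (J t) j ∸ suc t * b ≤ (accumulated t j ∸ t * b) + costOf (J t) j ∸ b
          shrink = m≤n+o⇒m∸n≤o (accumulated t j + costOf (J t) j) (suc t * b) (begin
            accumulated t j + costOf (J t) j                               ≤⟨ +-monoˡ-≤ _ (m≤n+m∸n (accumulated t j) (t * b)) ⟩
            t * b + y + costOf (J t) j                                     ≡⟨ +-assoc (t * b) y _ ⟩
            t * b + (y + costOf (J t) j)                                   ≤⟨ +-monoʳ-≤ (t * b) (m≤n+m∸n (y + costOf (J t) j) b) ⟩
            t * b + (b + (y + costOf (J t) j ∸ b))                         ≡⟨ shuffle (t * b) b _ ⟩
            b + t * b + (y + costOf (J t) j ∸ b)                           ∎)
            where
            open ≤-Reasoning
            y : ℕ
            y = accumulated t j ∸ t * b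
            shuffle : ∀ p q r → p + (q + r) ≡ q + p + r
            shuffle = ℕS.solve-∀
        gather : potential (suc t) + 2 * ∑ k (λ j → excess t j * b)
          ≡ ∑ k (λ j → excess (suc t) j * excess (suc t) j + 2 * (excess t j * b))
        gather = sym (trans (∑-+ k _ _) (cong (λ z → potential (suc t) + z) (∑-* k 2 _)))
        spread : ∑ k (λ j → excess t j * excess t j + 2 * (excess t j * costOf (J t) j) + B * B)
          ≡ potential t + 2 * ∑ k (λ j → excess t j * costOf (J t) j) + k * (B * B)
        spread = trans (∑-+ k _ _) (cong₂ _+_ (trans (∑-+ k _ _) (cong (λ z → potential t + z) (∑-* k 2 _))) (∑-const k (B * B)))
        cancel : ∀ {p q u v w} → p + 2 * v ≤ q + 2 * u + w → u ≤ v → p ≤ q + w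
        cancel {p} {q} {u} {v} {w} h u≤v = +-cancelʳ-≤ (2 * v) p (q + w) (≤-trans h
          (≤-trans (+-monoˡ-≤ w (+-monoʳ-≤ q (*-monoʳ-≤ 2 u≤v))) (≤-reflexive (shuffle q (2 * v) w))))
          where
          shuffle : ∀ a b c → a + b + c ≡ a + c + b
          shuffle = ℕS.solve-∀

      potential-bound : ∀ t → t ≤ T → potential t ≤ t * (k * (B * B))
      potential-bound zero    _   = ≤-reflexive (∑-zero k λ j _ → zeros (unsafe A F b j))
        where
        zeros : ∀ u → (if u then 0 else 0) * (if u then 0 else 0) ≡ 0
        zeros true  = refl
        zeros false = refl
      potential-bound (suc t) t<T = ≤-trans (potential-step t t<T)
        (≤-trans (+-monoˡ-≤ (k * (B * B)) (potential-bound t (<⇒≤ t<T))) (≤-reflexive (+-comm _ (k * (B * B)))))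

      -- The sum of squared excesses is at most T k B² < T², so no excess exceeds T: on average a
      -- basis overruns the budget by at most 1. This is the unit of budget paid for a test.
      regret : k * (B * B) < T → ∀ j → j < k → unsafe A F b j ≡ true → accumulated T j ≤ T * suc b
      regret big j j<k Uj = ≤-trans (m≤n+m∸n (accumulated T j) (T * b))
        (≤-trans (+-monoʳ-≤ (T * b) (≮⇒≥ not-large)) (≤-reflexive (trans (+-comm (T * b) T) (sym (*-suc T b)))))
        where
        y : ℕ
        y = accumulated T j ∸ T * b
        excess≡ : excess T j ≡ y
        excess≡ rewrite Uj = refl
        not-large : T < y → ⊥
        not-large T<y = <⇒≱ (*-monoʳ-< T ⦃ ℕB.>-nonZero (≤-<-trans z≤n big) ⦄ big) (≤-trans (*-mono-≤ (<⇒≤ T<y) (<⇒≤ T<y))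
          (≤-trans (subst (λ z → z * z ≤ potential T) excess≡ (∑-term k j j<k)) (potential-bound T ≤-refl)))

    -- Bases between `A` and `A ∪ F` average to a point with denominator T. A computed sequence that
    -- meets the loads is therefore a certificate by itself, without any appeal to the potential.
    average : ∀ T → 0 < T → (∀ t → t < T → ind (J t) ≡ true × ∣ J t ∣ ≡ rank full × A ⊆ J t × J t ⊆ A ∪ F) →
      (∀ j → j < k → unsafe A F b j ≡ true → accumulated T j ≤ T * suc b) → Inv A F (suc b)
    average T T>0 bases cheap = record
      { D      = pos T
      ; x      = pos ∘ x
      ; D>0    = ℤ.+<+ T>0
      ; x≥0    = λ _ _ → ℤ.+≤+ z≤n
      ; onA    = λ e e<n Ae → cong pos (trans (∑-cong T λ t t<T → cong bit (proj₁ (proj₂ (proj₂ (bases t t<T))) e e<n Ae))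
          (trans (∑-const T 1) (*-identityʳ T)))
      ; off    = λ e e<n Ae Fe → cong pos (∑-zero T λ t t<T → cong bit (¬true⇒false λ Je →
          true≢false (proj₂ (proj₂ (proj₂ (bases t t<T))) e e<n Je) (cong₂ _∨_ Ae Fe)))
      ; below  = λ S → ℤP.≤-trans (ℤP.≤-reflexive (weight-of S)) (ℤP.≤-trans (ℤ.+≤+ (∑-bound T λ t t<T →
          ind-≤-rank (ind-mono (λ e _ m → proj₁ (∧-true m)) (proj₁ (bases t t<T))) λ e _ m → proj₂ (∧-true m)))
          (ℤP.≤-reflexive (ℤP.pos-* T _)))
      ; total  = trans (weight-of full) (trans (cong pos (trans (∑-cong T λ t t<T → trans (∑-cong n λ e _ → cong bit (∧-identityʳ (J t e)))
          (proj₁ (proj₂ (bases t t<T)))) (∑-const T _))) (ℤP.pos-* T _))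
      ; budget = λ j j<k Uj → ℤP.≤-trans (ℤP.≤-reflexive (cost-of j)) (ℤP.≤-trans
          (ℤ.+≤+ (cheap j j<k (unsafe-mono {A} {F} {A} {F} {b} j (λ _ _ → id) (n≤1+n b) Uj))) (ℤP.≤-reflexive (ℤP.pos-* T (suc b))))
      }
      where
      open import Data.Bool.Properties using (∧-identityʳ)
      x : ℕ → ℕ
      x e = ∑ T (λ t → bit (J t e))
      exchange : ∀ (g : ℕ → ℕ) → ∑ n (λ e → g e * x e) ≡ ∑ T (λ t → ∑ n (λ e → g e * bit (J t e)))
      exchange g = trans (∑-cong n λ e _ → sym (∑-* T (g e) _)) (∑-swap n T _)
      to-ℕ : ∀ (g : ℕ → ℕ) → ∑ᶻ n (λ e → pos (g e) ℤ.* pos (x e)) ≡ pos (∑ n (λ e → g e * x e))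
      to-ℕ g = trans (∑ᶻ.∑-cong n λ e _ → sym (ℤP.pos-* (g e) (x e))) (sym (pos-∑ n _))
      χ-pos : ∀ b → χ b ≡ pos (bit b)
      χ-pos true  = refl
      χ-pos false = refl
      bit-∧ : ∀ s t → bit s * bit t ≡ bit (t ∧ s)
      bit-∧ true  true  = refl
      bit-∧ true  false = refl
      bit-∧ false true  = refl
      bit-∧ false false = refl
      weight-of : ∀ S → wt (pos ∘ x) S ≡ pos (∑ T (λ t → ∣ J t ∩ S ∣))
      weight-of S = trans (∑ᶻ.∑-cong n λ e _ → cong (ℤ._* pos (x e)) (χ-pos (S e))) (trans (to-ℕ (bit ∘ S))
        (cong pos (trans (exchange (bit ∘ S)) (∑-cong T λ t _ → ∑-cong n λ e _ → bit-∧ (S e) (J t e)))))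
      cost-of : ∀ j → costᶻ (pos ∘ x) j ≡ pos (accumulated T j)
      cost-of j = trans (to-ℕ (c j)) (cong pos (trans (exchange (c j)) (∑-cong T λ t _ → ∑-cong n λ e _ → *-comm (c j e) _)))

  -- Machine code

  -- The instructions that continue with the next line. `flip` is left out, so compiled programs
  -- never look at their coins; jumps arise only from `Code`.
  data Op : Set where
    const-op           : ℕ → ℕ → Op
    add-op sub-op      : ℕ → ℕ → ℕ → Op
    load-op store-op query-op : ℕ → ℕ → Op

  ⌊_⌋ : Op → Instr
  ⌊ const-op r c ⌋ = const r c
  ⌊ add-op r s t ⌋ = add r s t
  ⌊ sub-op r s t ⌋ = sub r s t
  ⌊ load-op r s  ⌋ = load r s
  ⌊ store-op r s ⌋ = store r s
  ⌊ query-op r s ⌋ = query r s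

  -- In `loop x y` the counter is register x with scratch register `suc x`, and register y holds the
  -- bound. The z of `branch` is a register set to 0 in order to jump unconditionally over the
  -- second alternative.
  data Code : Set where
    op     : Op → Code
    _⨾_    : Code → Code → Code
    loop   : ℕ → ℕ → Code → Code
    cond   : ℕ → Code → Code
    branch : ℕ → ℕ → Code → Code → Code

  infixr 5 _⨾_

  size : Code → ℕ
  size (op _)           = 1
  size (c ⨾ d)          = size c + size d
  size (loop x y c)     = 3 + (size c + 4)
  size (cond r c)       = 1 + size c
  size (branch r z c d) = 1 + (size c + (2 + size d))

  gen : Code → ℕ → List Instr
  gen (op o)           p = ⌊ o ⌋ ∷ []
  gen (c ⨾ d)          p = gen c p ++ gen d (p + size c)
  gen (loop x y c)     p =
    const x 0 ∷ sub (suc x) y x ∷ jzero (suc x) (p + (3 + (size c + 4))) ∷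
    (gen c (p + 3) ++ const (suc x) 1 ∷ add x x (suc x) ∷ const (suc x) 0 ∷ jzero (suc x) (p + 1) ∷ [])
  gen (cond r c)       p = jzero r (p + (1 + size c)) ∷ gen c (p + 1)
  gen (branch r z c d) p =
    jzero r (p + 1 + size c + 2) ∷
    (gen c (p + 1) ++ const z 0 ∷ jzero z (p + (1 + (size c + (2 + size d)))) ∷ gen d (p + 1 + size c + 2))

  length-gen : ∀ c p → length (gen c p) ≡ size c
  length-gen (op _)           p = refl
  length-gen (c ⨾ d)          p = trans (length-++ (gen c p)) (cong₂ _+_ (length-gen c p) (length-gen d (p + size c)))
  length-gen (loop x y c)     p = cong (3 +_) (trans (length-++ (gen c (p + 3))) (cong (_+ 4) (length-gen c (p + 3))))
  length-gen (cond r c)       p = cong suc (length-gen c (p + 1))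
  length-gen (branch r z c d) p = cong suc (trans (length-++ (gen c (p + 1)))
    (cong₂ _+_ (length-gen c (p + 1)) (cong (2 +_) (length-gen d (p + 1 + size c + 2)))))

  ≔-hit : ∀ (f : Store) a v → (f [ a ≔ v ]) a ≡ v
  ≔-hit f a v rewrite ≡ᵇ-refl a = refl

  ≔-miss : ∀ (f : Store) a b v → b ≢ a → (f [ a ≔ v ]) b ≡ f b
  ≔-miss f a b v b≢a rewrite ≡ᵇ-false b≢a = refl

  record Placed (P : Program) (p : ℕ) (is : List Instr) : Set where
    constructor placed
    field
      rest : List Instr
      here : drop p P ≡ is ++ rest

  drop-length : ∀ (is rest : List Instr) → drop (length is) (is ++ rest) ≡ rest
  drop-length []       rest = refl
  drop-length (i ∷ is) rest = drop-length is rest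

  placed-left : ∀ {P p} is js → Placed P p (is ++ js) → Placed P p is
  placed-left is js (placed rest eq) = placed (js ++ rest) $ trans eq (++-assoc is js rest)

  placed-right : ∀ {P p} is js → Placed P p (is ++ js) → Placed P (p + length is) js
  placed-right {P} {p} is js (placed rest eq) = placed rest $
    trans (sym (drop-drop p (length is) P)) (trans (cong (drop (length is)) (trans eq (++-assoc is js rest))) (drop-length is (js ++ rest)))

  placed-tail : ∀ {P p i is} → Placed P p (i ∷ is) → Placed P (p + 1) is
  placed-tail {i = i} {is} = placed-right (i ∷ []) is

  module Machine {n : ℕ} (oracle : Subset n → Bool) where

    regs mems : Op → Store → Store → Store
    regs (const-op r c) R M = R [ r ≔ c ]
    regs (add-op r s t) R M = R [ r ≔ R s + R t ]
    regs (sub-op r s t) R M = R [ r ≔ R s ∸ R t ]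
    regs (load-op r s)  R M = R [ r ≔ M (R s) ]
    regs (store-op r s) R M = R
    regs (query-op r s) R M = R [ r ≔ bit (oracle (readSet n M (R s))) ]
    mems (store-op r s) R M = M [ R r ≔ R s ]
    mems _              R M = M

    execute-op : ∀ b o p R M → execute oracle b ⌊ o ⌋ (config p R M) ≡ config (suc p) (regs o R M) (mems o R M)
    execute-op b (const-op r c) p R M = refl
    execute-op b (add-op r s t) p R M = refl
    execute-op b (sub-op r s t) p R M = refl
    execute-op b (load-op r s)  p R M = refl
    execute-op b (store-op r s) p R M = refl
    execute-op b (query-op r s) p R M = refl

    -- Each step must end the same way for either coin, so a `Reach` of length t describes every run
    -- of t steps.
    data Reach (P : Program) : ℕ → Config → Config → Set where
      here : ∀ {c} → Reach P 0 c c
      next : ∀ {t c d e} → (∀ b → step oracle P c b ≡ d) → Reach P t d e → Reach P (suc t) c e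

    reach-trans : ∀ {P} s {t c d e} → Reach P s c d → Reach P t d e → Reach P (s + t) c e
    reach-trans zero    here        r = r
    reach-trans (suc s) (next q rs) r = next q (reach-trans s rs r)

    reach-one : ∀ {P c d} → (∀ b → step oracle P c b ≡ d) → Reach P 1 c d
    reach-one q = next q here

    step-placed : ∀ {P p i is} R M b → Placed P p (i ∷ is) → step oracle P (config p R M) b ≡ execute oracle b i (config p R M)
    step-placed {P} {p} R M b (placed rest eq) with fetch P (config p R M) | cong head eq
    ... | just i | refl = refl

    record Runs (c : Code) (R M : Store) (t : ℕ) (R′ M′ : Store) : Set where
      constructor runs
      field
        reach : ∀ P p → Placed P p (gen c p) → Reach P t (config p R M) (config (p + size c) R′ M′)

    open Runs

    reach-op : ∀ {P p is} o R M → Placed P p (⌊ o ⌋ ∷ is) → Reach P 1 (config p R M) (config (p + 1) (regs o R M) (mems o R M))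
    reach-op {p = p} o R M pl = reach-one λ b → trans (trans (step-placed R M b pl) (execute-op b o p R M))
      (cong (λ q → config q (regs o R M) (mems o R M)) (+-comm 1 p))

    reach-jump : ∀ {P p is} r l R M → R r ≡ 0 → Placed P p (jzero r l ∷ is) → Reach P 1 (config p R M) (config l R M)
    reach-jump {p = p} r l R M eq pl = reach-one λ b → trans (step-placed R M b pl)
      (cong (λ v → config (if v ≡ᵇ 0 then l else suc p) R M) eq)

    reach-fall : ∀ {P p is} r l R M → R r ≢ 0 → Placed P p (jzero r l ∷ is) → Reach P 1 (config p R M) (config (p + 1) R M)
    reach-fall {p = p} r l R M ne pl = reach-one λ b → trans (step-placed R M b pl)
      (trans (cong (λ v → config (if v then l else suc p) R M) (≡ᵇ-false ne)) (cong (λ q → config q R M) (+-comm 1 p)))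

    move-to : ∀ {P t c p q R M} → p ≡ q → Reach P t c (config p R M) → Reach P t c (config q R M)
    move-to refl r = r

    move-time : ∀ {P s t c d} → s ≡ t → Reach P s c d → Reach P t c d
    move-time refl r = r

    move-from : ∀ {P t p q R M d} → p ≡ q → Reach P t (config p R M) d → Reach P t (config q R M) d
    move-from refl r = r

    move-placed : ∀ {P p q is} → p ≡ q → Placed P p is → Placed P q is
    move-placed refl pl = pl

    runs-op : ∀ o R M → Runs (op o) R M 1 (regs o R M) (mems o R M)
    runs-op o R M .reach P p pl = reach-op o R M pl

    placed-second : ∀ {P p} c js → Placed P p (gen c p ++ js) → Placed P (p + size c) js
    placed-second {P} {p} c js pl = subst (λ l → Placed P (p + l) js) (length-gen c p) (placed-right (gen c p) js pl)

    runs-⨾ : ∀ {c d R M R₁ M₁ R₂ M₂} s {t} → Runs c R M s R₁ M₁ → Runs d R₁ M₁ t R₂ M₂ → Runs (c ⨾ d) R M (s + t) R₂ M₂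
    runs-⨾ {c} {d} s r₁ r₂ .reach P p pl = reach-trans s (reach r₁ P p (placed-left (gen c p) _ pl))
      (move-to (+-assoc p (size c) (size d))
        (reach r₂ P (p + size c) (placed-second c _ pl)))

    runs-cond-zero : ∀ r c R M → R r ≡ 0 → Runs (cond r c) R M 1 R M
    runs-cond-zero r c R M eq .reach P p pl = reach-jump r _ R M eq pl

    runs-cond-nonzero : ∀ r {c R M t R′ M′} → R r ≢ 0 → Runs c R M t R′ M′ → Runs (cond r c) R M (1 + t) R′ M′
    runs-cond-nonzero r {c} ne run .reach P p pl = reach-trans 1 (reach-fall r _ _ _ ne pl)
      (move-to (+-assoc p 1 (size c)) (reach run P (p + 1) (placed-tail pl)))

    runs-branch-nonzero : ∀ r z {c d R M t R′ M′} → R r ≢ 0 → Runs c R M t R′ M′ →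
      Runs (branch r z c d) R M (1 + (t + 2)) (R′ [ z ≔ 0 ]) M′
    runs-branch-nonzero r z {c} {d} {R} {M} {t} {R′} {M′} ne run .reach P p pl = reach-trans 1 (reach-fall r _ R M ne pl)
      (reach-trans t (reach run P (p + 1) (placed-left (gen c (p + 1)) _ (placed-tail pl)))
      (reach-trans 1 (reach-op (const-op z 0) R′ M′ pl₁)
        (reach-jump z _ (R′ [ z ≔ 0 ]) M′ (≔-hit R′ z 0) (placed-tail pl₁))))
      where
      pl₁ = placed-second c _ (placed-tail pl)

    runs-branch-zero : ∀ r z {c d R M t R′ M′} → R r ≡ 0 → Runs d R M t R′ M′ → Runs (branch r z c d) R M (1 + t) R′ M′
    runs-branch-zero r z {c} {d} {R} {M} {t} eq run .reach P p pl = reach-trans 1 (reach-jump r _ R M eq pl)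
      (move-to (shuffle p (size c) (size d))
        (reach run P (p + 1 + size c + 2) (move-placed (+-assoc (p + 1 + size c) 1 1)
          (placed-tail (placed-tail (placed-second c _ (placed-tail pl)))))))
      where
      shuffle : ∀ p c d → p + 1 + c + 2 + d ≡ p + (1 + (c + (2 + d)))
      shuffle = ℕS.solve-∀

    -- The body may destroy all registers above x, provided that the counter is as before at its
    -- end; so the invariant may depend only on registers below x. The 6 counts the loop
    -- instructions of a round, the 3 those of initialisation and of the last exit test.
    runs-loop : ∀ x y c (I : ℕ → Store → Store → Set) (m : ℕ) (τ : ℕ → ℕ) →
      (∀ {i R M} → I i R M → R y ≡ m) →
      (∀ {i R R′ M} → (∀ z → z < x → R′ z ≡ R z) → I i R M → I i R′ M) →
      (∀ i R M → i < m → I i R M → R x ≡ i →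
        Σ[ R′ ∈ Store ] Σ[ M′ ∈ Store ] Runs c R M (τ i) R′ M′ × R′ x ≡ i × I (suc i) R′ M′) →
      ∀ R M → I 0 R M →
      Σ[ R′ ∈ Store ] Σ[ M′ ∈ Store ] Runs (loop x y c) R M (3 + ∑ m (λ i → τ i + 6)) R′ M′ × I m R′ M′
    runs-loop x y c I m τ bound stable body R M I₀ = finish (iterate m 0 refl R₀ M (stable (low R x 0 ≤-refl) I₀) (≔-hit R x 0))
      where
      R₀ : Store
      R₀ = R [ x ≔ 0 ]
      low : ∀ R a v → x ≤ a → ∀ z → z < x → (R [ a ≔ v ]) z ≡ R z
      low R a v x≤a z z<x = ≔-miss R a z v (<⇒≢ (<-≤-trans z<x x≤a))
      time : ℕ → ℕ → ℕ
      time zero    i = 2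
      time (suc d) i = τ i + 6 + time d (suc i)
      time-sum : ∀ d i → time d i + ∑ i (λ l → τ l + 6) ≡ 2 + ∑ (i + d) (λ l → τ l + 6)
      time-sum zero    i = cong (λ l → 2 + ∑ l (λ l → τ l + 6)) (sym (+-identityʳ i))
      time-sum (suc d) i = trans (shuffle (τ i + 6) (time d (suc i)) (∑ i (λ l → τ l + 6)))
        (trans (time-sum d (suc i)) (cong (λ l → 2 + ∑ l (λ l → τ l + 6)) (sym (+-suc i d))))
        where
        shuffle : ∀ a b c → a + b + c ≡ b + (c + a)
        shuffle = ℕS.solve-∀
      loopAt : Program → ℕ → Set
      loopAt P p = Placed P p (gen (loop x y c) p)
      Result : ℕ → Store → Store → ℕ → Set
      Result t R M i = Σ[ R′ ∈ Store ] Σ[ M′ ∈ Store ]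
        (∀ P p → loopAt P p → Reach P t (config (p + 1) R M) (config (p + (3 + (size c + 4))) R′ M′)) × I m R′ M′
      iterate : ∀ d i → i + d ≡ m → ∀ R M → I i R M → R x ≡ i → Result (time d i) R M i
      iterate zero i eq R M Ii Rx = R₁ , M , (λ P p pl → reach-trans 1 (reach-op (sub-op (suc x) y x) R M (placed-tail pl))
          (move-from (sym (+-assoc p 1 1)) (reach-jump (suc x) _ R₁ M zeroed
            (move-placed (+-assoc p 1 1) (placed-tail (placed-tail pl))))))
        , subst (λ l → I l R₁ M) (trans (sym (+-identityʳ i)) eq) (stable (low R (suc x) _ (n≤1+n x)) Ii)
        where
        R₁ : Store
        R₁ = R [ suc x ≔ R y ∸ R x ]
        zeroed : R₁ (suc x) ≡ 0
        zeroed = trans (≔-hit R (suc x) _) (trans (cong₂ _∸_ (bound Ii) (trans Rx (trans (sym (+-identityʳ i)) eq))) (n∸n≡0 m))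
      iterate (suc d) i eq R M Ii Rx = again (body i R₁ M i<m (stable (low R (suc x) _ (n≤1+n x)) Ii) R₁x)
        where
        i<m : i < m
        i<m = subst (suc i ≤_) eq (≤-trans (s≤s (m≤m+n i d)) (≤-reflexive (sym (+-suc i d))))
        R₁ : Store
        R₁ = R [ suc x ≔ R y ∸ R x ]
        R₁x : R₁ x ≡ i
        R₁x = trans (≔-miss R (suc x) x _ (<⇒≢ ≤-refl)) Rx
        nonzero : R₁ (suc x) ≢ 0
        nonzero h = <⇒≱ i<m (m∸n≡0⇒m≤n (trans (sym (cong₂ _∸_ (bound Ii) Rx)) (trans (sym (≔-hit R (suc x) _)) h)))
        again : (Σ[ R′ ∈ Store ] Σ[ M′ ∈ Store ] Runs c R₁ M (τ i) R′ M′ × R′ x ≡ i × I (suc i) R′ M′) →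
          Result (time (suc d) i) R M i
        again (R₂ , M₂ , run , R₂x , Ii₂) = wrap (iterate d (suc i) (trans (sym (+-suc i d)) eq) R₅ M₂ (stable lows Ii₂) R₅x)
          where
          R₃ R₄ R₅ : Store
          R₃ = R₂ [ suc x ≔ 1 ]
          R₄ = R₃ [ x ≔ R₃ x + R₃ (suc x) ]
          R₅ = R₄ [ suc x ≔ 0 ]
          R₅x : R₅ x ≡ suc i
          R₅x = trans (≔-miss R₄ (suc x) x 0 (<⇒≢ ≤-refl)) (trans (≔-hit R₃ x _)
            (trans (cong₂ _+_ (trans (≔-miss R₂ (suc x) x 1 (<⇒≢ ≤-refl)) R₂x) (≔-hit R₂ (suc x) 1)) (+-comm i 1)))
          lows : ∀ z → z < x → R₅ z ≡ R₂ z
          lows z z<x = trans (low R₄ (suc x) 0 (n≤1+n x) z z<x) (trans (low R₃ x _ ≤-refl z z<x) (low R₂ (suc x) 1 (n≤1+n x) z z<x))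
          wrap : Result (time d (suc i)) R₅ M₂ (suc i) → Result (time (suc d) i) R M i
          wrap (R′ , M′ , rest , Im) = R′ , M′ , (λ P p pl → move-time (count (τ i) (time d (suc i)))
              (reach-trans 1 (reach-op (sub-op (suc x) y x) R M (placed-tail pl))
              (reach-trans 1 (reach-fall (suc x) _ R₁ M nonzero (placed-tail (placed-tail pl)))
              (move-from (sym (trans (+-assoc (p + 1) 1 1) (+-assoc p 1 2)))
              (reach-trans (τ i) (reach run P (p + 3) (placed-left (gen c (p + 3)) _ (bodyAt P p pl)))
              (reach-trans 1 (reach-op (const-op (suc x) 1) R₂ M₂ (after P p pl))
              (reach-trans 1 (reach-op (add-op x x (suc x)) R₃ M₂ (placed-tail (after P p pl)))
              (reach-trans 1 (reach-op (const-op (suc x) 0) R₄ M₂ (placed-tail (placed-tail (after P p pl))))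
              (reach-trans 1 (reach-jump (suc x) (p + 1) R₅ M₂ (≔-hit R₄ (suc x) 0) (placed-tail (placed-tail (placed-tail (after P p pl)))))
                (rest P p pl)))))))))) , Im
            where
            count : ∀ a b → 1 + (1 + (a + (4 + b))) ≡ a + 6 + b
            count = ℕS.solve-∀
            bodyAt : ∀ P p → loopAt P p → Placed P (p + 3) _
            bodyAt P p pl = move-placed (trans (+-assoc (p + 1) 1 1) (+-assoc p 1 2)) (placed-tail (placed-tail (placed-tail pl)))
            after : ∀ P p → loopAt P p → Placed P (p + 3 + size c) _
            after P p pl = placed-second c _ (bodyAt P p pl)
      finish : Result (time m 0) R₀ M 0 →
        Σ[ R′ ∈ Store ] Σ[ M′ ∈ Store ] Runs (loop x y c) R M (3 + ∑ m (λ i → τ i + 6)) R′ M′ × I m R′ M′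
      finish (R′ , M′ , rest , Im) = R′ , M′ , runs (λ P p pl → move-time (cong suc $
           trans (sym (+-identityʳ _)) (time-sum m 0)) (reach-trans 1 (reach-op (const-op x 0) R M pl) (rest P p pl))) , Im

  -- A structured language and its compiler

  -- Products and quotients are expressed through `sumE`, as the machine has neither; `ifE e f g` is
  -- `f` when `e` is nonzero.
  data Exp : Set where
    con  : ℕ → Exp
    var  : ℕ → Exp
    arr  : ℕ → Exp → Exp
    _∔_  : Exp → Exp → Exp
    _∸′_ : Exp → Exp → Exp
    sumE : ℕ → ℕ → Exp → Exp
    ifE  : Exp → Exp → Exp → Exp

  infixl 6 _∔_ _∸′_

  data Stm : Set where
    set  : ℕ → Exp → Exp → Stm
    _⍮_  : Stm → Stm → Stm
    for  : ℕ → ℕ → Stm → Stm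
    when : Exp → Stm → Stm
    letS : ℕ → Exp → Stm → Stm
    ask  : ℕ → ℕ → Stm

  infixr 4 _⍮_

  Arrays : Set
  Arrays = ℕ → ℕ → ℕ

  put : ℕ → ℕ → ℕ → Arrays → Arrays
  put a i v σ b j = if (b ≡ᵇ a) ∧ (j ≡ᵇ i) then v else σ b j

  iterate : (ℕ → Arrays → Arrays) → ℕ → Arrays → Arrays
  iterate f zero    σ = σ
  iterate f (suc m) σ = f m (iterate f m σ)

  eval : Exp → Store → Arrays → ℕ
  eval (con c)      ρ σ = c
  eval (var x)      ρ σ = ρ x
  eval (arr a e)    ρ σ = σ a (eval e ρ σ)
  eval (e ∔ f)      ρ σ = eval e ρ σ + eval f ρ σ
  eval (e ∸′ f)     ρ σ = eval e ρ σ ∸ eval f ρ σ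
  eval (sumE x y e) ρ σ = ∑ (ρ y) λ v → eval e (ρ [ x ≔ v ]) σ
  eval (ifE e f g)  ρ σ = if eval e ρ σ ≡ᵇ 0 then eval g ρ σ else eval f ρ σ

  timeE : Exp → Store → Arrays → ℕ
  timeE (con c)      ρ σ = 1
  timeE (var x)      ρ σ = 2
  timeE (arr a e)    ρ σ = timeE e ρ σ + 8
  timeE (e ∔ f)      ρ σ = timeE e ρ σ + (timeE f ρ σ + 1)
  timeE (e ∸′ f)     ρ σ = timeE e ρ σ + (timeE f ρ σ + 1)
  timeE (sumE x y e) ρ σ = 1 + (3 + ∑ (ρ y) λ v → timeE e (ρ [ x ≔ v ]) σ + 1 + 6)
  timeE (ifE e f g)  ρ σ = timeE e ρ σ + (if eval e ρ σ ≡ᵇ 0 then 1 + timeE g ρ σ else 1 + (timeE f ρ σ + 2))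

  -- Four doublings multiply by 16, the number of interleaved arrays; register 0 holds the base
  -- address.
  addrCode : ℕ → ℕ → Code
  addrCode a t = op (add-op t t t) ⨾ op (add-op t t t) ⨾ op (add-op t t t) ⨾ op (add-op t t t)
    ⨾ op (const-op (suc t) a) ⨾ op (add-op t t (suc t)) ⨾ op (add-op t t 0)

  compileE : Exp → ℕ → Code
  compileE (con c)      t = op (const-op t c)
  compileE (var x)      t = op (const-op t 0) ⨾ op (add-op t t x)
  compileE (arr a e)    t = compileE e t ⨾ addrCode a t ⨾ op (load-op t t)
  compileE (e ∔ f)      t = compileE e t ⨾ compileE f (suc t) ⨾ op (add-op t t (suc t))
  compileE (e ∸′ f)     t = compileE e t ⨾ compileE f (suc t) ⨾ op (sub-op t t (suc t))
  compileE (sumE x y e) t = op (const-op t 0) ⨾ loop x y (compileE e (suc x) ⨾ op (add-op t t (suc x)))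
  compileE (ifE e f g)  t = compileE e t ⨾ branch t (suc t) (compileE f t) (compileE g t)

  -- The second argument is the first free register. A `query` reads consecutive cells, so `ask`
  -- first copies its array from the interleaved layout to a buffer at address 0.
  compile : Stm → ℕ → Code
  compile (set a e f)  t = compileE e t ⨾ addrCode a t ⨾ compileE f (suc t) ⨾ op (store-op t (suc t))
  compile (s ⍮ s′)     t = compile s t ⨾ compile s′ t
  compile (for x y s)  t = loop x y (compile s (suc x))
  compile (when e s)   t = compileE e t ⨾ cond t (compile s t)
  compile (letS x e s) t = compileE e x ⨾ compile s (suc x)
  compile (ask a b)    t = loop t 1 (compileE (arr a (var t)) (suc t) ⨾ op (store-op t (suc t)))
    ⨾ op (const-op t 0) ⨾ op (query-op t t) ⨾ op (const-op (suc t) 0) ⨾ addrCode b (suc t) ⨾ op (store-op (suc t) t)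

  -- wfE v t e: the variables of e are visible (v) and its binders lie above the
  -- registers below t, which compileE e t leaves unchanged.
  wfE : (ℕ → Bool) → ℕ → Exp → Bool
  wfE v t (con c)      = true
  wfE v t (var x)      = v x
  wfE v t (arr a e)    = (a <ᵇ 16) ∧ wfE v t e
  wfE v t (e ∔ f)      = wfE v t e ∧ wfE v (suc t) f
  wfE v t (e ∸′ f)     = wfE v t e ∧ wfE v (suc t) f
  wfE v t (sumE x y e) = (t <ᵇ x) ∧ (v y ∧ wfE (v ⊕ x) (suc x) e)
  wfE v t (ifE e f g)  = wfE v t e ∧ (wfE v t f ∧ wfE v t g)

  wf : (ℕ → Bool) → ℕ → Stm → Bool
  wf v t (set a e f)  = (a <ᵇ 16) ∧ (wfE v t e ∧ wfE v (suc t) f)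
  wf v t (s ⍮ s′)     = wf v t s ∧ wf v t s′
  wf v t (for x y s)  = (t <ᵇ suc x) ∧ (v y ∧ wf (v ⊕ x) (suc x) s)
  wf v t (when e s)   = wfE v t e ∧ wf v t s
  wf v t (letS x e s) = (t <ᵇ suc x) ∧ (wfE v x e ∧ wf (v ⊕ x) (suc x) s)
  wf v t (ask a b)    = (a <ᵇ 16) ∧ (b <ᵇ 16)

  -- Array a is interleaved with the 15 others above the base address.
  address : ℕ → ℕ → ℕ → ℕ
  address base a i = i * 16 + a + base

  address-injective : ∀ base {a b i j} → a < 16 → b < 16 → address base a i ≡ address base b j → a ≡ b × i ≡ j
  address-injective base {a} {b} {i} {j} a<16 b<16 eq = a≡b , *-cancelʳ-≡ i j 16 (+-cancelʳ-≡ b _ _ (trans (cong (i * 16 +_) (sym a≡b)) eq′))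
    where
    eq′ : i * 16 + a ≡ j * 16 + b
    eq′ = +-cancelʳ-≡ base _ _ eq
    mod : ∀ i {a} → a < 16 → (i * 16 + a) % 16 ≡ a
    mod i {a} a<16 = trans (cong (_% 16) (+-comm (i * 16) a)) (trans ([m+kn]%n≡m%n a i 16) (m<n⇒m%n≡m a<16))
    a≡b : a ≡ b
    a≡b = trans (sym (mod i a<16)) (trans (cong (_% 16) eq′) (mod j b<16))

  module Compilation {n : ℕ} (oracle : Subset n → Bool) where
    open Machine oracle

    askValue : Arrays → ℕ → ℕ
    askValue σ a = bit (oracle (tabulate λ e → 0 <ᵇ σ a (toℕ e)))

    exec : Stm → Store → Arrays → Arrays
    exec (set a e f)  ρ σ = put a (eval e ρ σ) (eval f ρ σ) σ
    exec (s ⍮ s′)     ρ σ = exec s′ ρ (exec s ρ σ)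
    exec (for x y s)  ρ σ = iterate (λ v → exec s (ρ [ x ≔ v ])) (ρ y) σ
    exec (when e s)   ρ σ = if eval e ρ σ ≡ᵇ 0 then σ else exec s ρ σ
    exec (letS x e s) ρ σ = exec s (ρ [ x ≔ eval e ρ σ ]) σ
    exec (ask a b)    ρ σ = put b 0 (askValue σ a) σ

    time : Stm → Store → Arrays → ℕ
    time (set a e f)  ρ σ = timeE e ρ σ + (7 + (timeE f ρ σ + 1))
    time (s ⍮ s′)     ρ σ = time s ρ σ + time s′ ρ (exec s ρ σ)
    time (for x y s)  ρ σ = 3 + ∑ (ρ y) λ v → time s (ρ [ x ≔ v ]) (iterate (λ v → exec s (ρ [ x ≔ v ])) v σ) + 6
    time (when e s)   ρ σ = timeE e ρ σ + (if eval e ρ σ ≡ᵇ 0 then 1 else 1 + time s ρ σ)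
    time (letS x e s) ρ σ = timeE e ρ σ + time s (ρ [ x ≔ eval e ρ σ ]) σ
    time (ask a b)    ρ σ = 3 + ∑ n (λ _ → 17) + (1 + (1 + (1 + (7 + 1))))

    module Layout (base : ℕ) (n≤base : n ≤ base) where

      record Stored (σ : Arrays) (M : Store) : Set where
        constructor stored-at
        field
          at : ∀ a i → a < 16 → M (address base a i) ≡ σ a i

      -- Visible variables sit in registers below t, so everything from t on is scratch space.
      record Agrees (v : ℕ → Bool) (t : ℕ) (ρ R : Store) : Set where
        field
          below   : ∀ z → v z ≡ true → z < t
          agree   : ∀ z → v z ≡ true → R z ≡ ρ z
          visible : v 0 ≡ true × v 1 ≡ true
          ρ-base  : ρ 0 ≡ base
          ρ-size  : ρ 1 ≡ n

      open Agrees
      open Stored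

      Same : ℕ → Store → Store → Set
      Same t R R′ = ∀ z → z < t → R′ z ≡ R z

      agrees-same : ∀ {v t t′ ρ R R′} → t ≤ t′ → Same t R R′ → Agrees v t ρ R → Agrees v t′ ρ R′
      agrees-same t≤t′ sm ag = record
        { below   = λ z vz → <-≤-trans (below ag z vz) t≤t′
        ; agree   = λ z vz → trans (sm z (below ag z vz)) (agree ag z vz)
        ; visible = visible ag
        ; ρ-base  = ρ-base ag
        ; ρ-size  = ρ-size ag }

      agrees-bind : ∀ {v t ρ R R′ x} w → t ≤ x → Same t R R′ → R′ x ≡ w → Agrees v t ρ R → Agrees (v ⊕ x) (suc x) (ρ [ x ≔ w ]) R′
      agrees-bind {v} {t} {ρ} {R} {R′} {x} w t≤x sm R′x ag = record
        { below   = λ z vz → case ∨-true {z ≡ᵇ x} vz of λ where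
            (inj₁ z≡x) → ≤-reflexive (cong suc (≡ᵇ-true z x z≡x))
            (inj₂ vz′) → m<n⇒m<1+n (<-≤-trans (below ag z vz′) t≤x)
        ; agree   = agree′
        ; visible = ∨-introʳ {0 ≡ᵇ x} (proj₁ (visible ag)) , ∨-introʳ {1 ≡ᵇ x} (proj₂ (visible ag))
        ; ρ-base  = trans (≔-miss ρ x 0 w (<⇒≢ (<-≤-trans (below ag 0 (proj₁ (visible ag))) t≤x))) (ρ-base ag)
        ; ρ-size  = trans (≔-miss ρ x 1 w (<⇒≢ (<-≤-trans (below ag 1 (proj₂ (visible ag))) t≤x))) (ρ-size ag) }
        where
        agree′ : ∀ z → (v ⊕ x) z ≡ true → R′ z ≡ (ρ [ x ≔ w ]) z
        agree′ z vz with z ≡ᵇ x in eq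
        ... | true rewrite ≡ᵇ-true z x eq = R′x
        ... | false = trans (sm z (below ag z vz)) (agree ag z vz)

      same-trans : ∀ {s t R R₁ R₂} → s ≤ t → Same s R R₁ → Same t R₁ R₂ → Same s R R₂
      same-trans s≤t a b z z<s = trans (b z (<-≤-trans z<s s≤t)) (a z z<s)

      same-write : ∀ {t} R a w → t ≤ a → Same t R (R [ a ≔ w ])
      same-write R a w t≤a z z<t = ≔-miss R a z w (<⇒≢ (<-≤-trans z<t t≤a))

      runs-addr : ∀ a t R M → 0 < t → R 0 ≡ base →
        Σ[ R′ ∈ Store ] Runs (addrCode a t) R M 7 R′ M × R′ t ≡ address base a (R t) × Same t R R′
      runs-addr a t R M 0<t R0 = R₇ , chain , value , same
        where
        dbl : Store → Store
        dbl S = S [ t ≔ S t + S t ]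
        R₄ R₅ R₆ R₇ : Store
        R₄ = dbl (dbl (dbl (dbl R)))
        R₅ = R₄ [ suc t ≔ a ]
        R₆ = R₅ [ t ≔ R₅ t + R₅ (suc t) ]
        R₇ = R₆ [ t ≔ R₆ t + R₆ 0 ]
        chain : Runs (addrCode a t) R M 7 R₇ M
        chain = runs-⨾ 1 (runs-op (add-op t t t) R M) (runs-⨾ 1 (runs-op (add-op t t t) (dbl R) M)
          (runs-⨾ 1 (runs-op (add-op t t t) (dbl (dbl R)) M) (runs-⨾ 1 (runs-op (add-op t t t) (dbl (dbl (dbl R))) M)
          (runs-⨾ 1 (runs-op (const-op (suc t) a) R₄ M) (runs-⨾ 1 (runs-op (add-op t t (suc t)) R₅ M) (runs-op (add-op t t 0) R₆ M))))))
        dbl-hit : ∀ S → dbl S t ≡ S t + S t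
        dbl-hit S = ≔-hit S t _
        quad : R₄ t ≡ R t * 16
        quad = trans (dbl-hit (dbl (dbl (dbl R)))) (trans (twice (trans (dbl-hit (dbl (dbl R))) (twice (trans (dbl-hit (dbl R)) (twice (dbl-hit R)))))) (sixteen (R t)))
          where
          twice : ∀ {x y} → x ≡ y → x + x ≡ y + y
          twice refl = refl
          sixteen : ∀ x → (x + x + (x + x)) + (x + x + (x + x)) + ((x + x + (x + x)) + (x + x + (x + x))) ≡ x * 16
          sixteen = ℕS.solve-∀
        dbl-same : ∀ S → Same t S (dbl S)
        dbl-same S = same-write S t _ ≤-refl
        same₆ : Same t R R₆
        same₆ = same-trans ≤-refl (same-trans ≤-refl (same-trans ≤-refl (same-trans ≤-refl (same-trans ≤-refl (dbl-same R) (dbl-same (dbl R)))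
          (dbl-same (dbl (dbl R)))) (dbl-same (dbl (dbl (dbl R))))) (same-write R₄ (suc t) a (n≤1+n t))) (same-write R₅ t _ ≤-refl)
        same : Same t R R₇
        same = same-trans ≤-refl same₆ (same-write R₆ t _ ≤-refl)
        value : R₇ t ≡ address base a (R t)
        value = trans (≔-hit R₆ t _) (cong₂ _+_ (trans (≔-hit R₅ t _)
          (cong₂ _+_ (trans (≔-miss R₄ (suc t) t a (<⇒≢ ≤-refl)) quad) (≔-hit R₄ (suc t) a))) (trans (same₆ 0 0<t) R0))

      record Computes (c : Code) (t : ℕ) (R M : Store) (τ u : ℕ) : Set where
        constructor computes
        field
          R′   : Store
          run  : Runs c R M τ R′ M
          val  : R′ t ≡ u
          same : Same t R R′

      module _ {v : ℕ → Bool} {t : ℕ} {ρ R : Store} (ag : Agrees v t ρ R) where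

        agrees-positive : 0 < t
        agrees-positive = below ag 0 (proj₁ (visible ag))

        agrees-base : R 0 ≡ base
        agrees-base = trans (agree ag 0 (proj₁ (visible ag))) (ρ-base ag)

      computes-arr : ∀ {c a t R M τ u w} → 0 < t → R 0 ≡ base → M (address base a u) ≡ w →
        Computes c t R M τ u → Computes (c ⨾ addrCode a t ⨾ op (load-op t t)) t R M (τ + 8) w
      computes-arr {a = a} {t} {R} {M} {τ} 0<t R0 Mw (computes R₁ run₁ val₁ sm₁) =
        finish (runs-addr a t R₁ M 0<t (trans (sm₁ 0 0<t) R0))
        where
        finish : Σ[ R₂ ∈ Store ] Runs (addrCode a t) R₁ M 7 R₂ M × R₂ t ≡ address base a (R₁ t) × Same t R₁ R₂ → _
        finish (R₂ , run₂ , val₂ , sm₂) = computes (R₂ [ t ≔ M (R₂ t) ])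
          (runs-⨾ τ run₁ (runs-⨾ 7 run₂ (runs-op (load-op t t) R₂ M)))
          (trans (≔-hit R₂ t _) (trans (cong M (trans val₂ (cong (address base a) val₁))) Mw))
          (same-trans ≤-refl (same-trans ≤-refl sm₁ sm₂) (same-write R₂ t _ ≤-refl))

      computes-add : ∀ {c d t R M τ υ u w} → (X : Computes c t R M τ u) → Computes d (suc t) (Computes.R′ X) M υ w →
        Computes (c ⨾ d ⨾ op (add-op t t (suc t))) t R M (τ + (υ + 1)) (u + w)
      computes-add {t = t} {M = M} {τ} {υ} (computes R₁ run₁ val₁ sm₁) (computes R₂ run₂ val₂ sm₂) =
        computes (R₂ [ t ≔ R₂ t + R₂ (suc t) ])
          (runs-⨾ τ run₁ (runs-⨾ υ run₂ (runs-op (add-op t t (suc t)) R₂ M)))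
          (trans (≔-hit R₂ t _) (cong₂ _+_ (trans (sm₂ t ≤-refl) val₁) val₂))
          (same-trans ≤-refl (same-trans (n≤1+n t) sm₁ sm₂) (same-write R₂ t _ ≤-refl))

      computes-sub : ∀ {c d t R M τ υ u w} → (X : Computes c t R M τ u) → Computes d (suc t) (Computes.R′ X) M υ w →
        Computes (c ⨾ d ⨾ op (sub-op t t (suc t))) t R M (τ + (υ + 1)) (u ∸ w)
      computes-sub {t = t} {M = M} {τ} {υ} (computes R₁ run₁ val₁ sm₁) (computes R₂ run₂ val₂ sm₂) =
        computes (R₂ [ t ≔ R₂ t ∸ R₂ (suc t) ])
          (runs-⨾ τ run₁ (runs-⨾ υ run₂ (runs-op (sub-op t t (suc t)) R₂ M)))
          (trans (≔-hit R₂ t _) (cong₂ _∸_ (trans (sm₂ t ≤-refl) val₁) val₂))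
          (same-trans ≤-refl (same-trans (n≤1+n t) sm₁ sm₂) (same-write R₂ t _ ≤-refl))

      computes-branch : ∀ {c d e t R M τ u x y p q} (X : Computes c t R M τ u) →
        Computes d t (Computes.R′ X) M x p → Computes e t (Computes.R′ X) M y q →
        Computes (c ⨾ branch t (suc t) d e) t R M (τ + (if u ≡ᵇ 0 then 1 + y else 1 + (x + 2))) (if u ≡ᵇ 0 then q else p)
      computes-branch {t = t} {τ = τ} {u = zero} (computes R₁ run₁ val₁ sm₁) _ (computes R₂ run₂ val₂ sm₂) =
        computes R₂ (runs-⨾ τ run₁ (runs-branch-zero t (suc t) val₁ run₂)) val₂ (same-trans ≤-refl sm₁ sm₂)
      computes-branch {t = t} {τ = τ} {u = suc _} (computes R₁ run₁ val₁ sm₁) (computes R₂ run₂ val₂ sm₂) _ =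
        computes (R₂ [ suc t ≔ 0 ]) (runs-⨾ τ run₁ (runs-branch-nonzero t (suc t) (λ z → case trans (sym val₁) z of λ ()) run₂))
          (trans (≔-miss R₂ (suc t) t 0 (<⇒≢ ≤-refl)) val₂)
          (same-trans ≤-refl (same-trans ≤-refl sm₁ sm₂) (same-write R₂ (suc t) 0 (n≤1+n t)))

      computes-sum : ∀ {c t x y R M m} (τ g : ℕ → ℕ) → t < x → y < t → R y ≡ m →
        (∀ i R₁ → Same t R R₁ → R₁ x ≡ i → Computes c (suc x) R₁ M (τ i) (g i)) →
        Computes (op (const-op t 0) ⨾ loop x y (c ⨾ op (add-op t t (suc x)))) t R M (1 + (3 + ∑ m (λ i → τ i + 1 + 6))) (∑ m g)
      computes-sum {c} {t} {x} {y} {R} {M} {m} τ g t<x y<t Ry term =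
        finish (runs-loop x y (c ⨾ op (add-op t t (suc x))) I m (λ i → τ i + 1)
          (λ {i} {R₁} {M₁} → bound {i} {R₁} {M₁}) (λ {i} {R₁} {R₂} {M₁} → stable {i} {R₁} {R₂} {M₁}) body R₀ M
          (same-write R t 0 ≤-refl , ≔-hit R t 0 , refl))
        where
        R₀ : Store
        R₀ = R [ t ≔ 0 ]
        I : ℕ → Store → Store → Set
        I i R₁ M₁ = Same t R R₁ × R₁ t ≡ ∑ i g × M₁ ≡ M
        bound : ∀ {i R₁ M₁} → I i R₁ M₁ → R₁ y ≡ m
        bound (sm , _) = trans (sm y y<t) Ry
        stable : ∀ {i R₁ R₂ M₁} → (∀ z → z < x → R₂ z ≡ R₁ z) → I i R₁ M₁ → I i R₂ M₁
        stable h (sm , val , eq) = same-trans (<⇒≤ t<x) sm h , trans (h t t<x) val , eq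
        body : ∀ i R₁ M₁ → i < m → I i R₁ M₁ → R₁ x ≡ i →
          Σ[ R₂ ∈ Store ] Σ[ M₂ ∈ Store ] Runs (c ⨾ op (add-op t t (suc x))) R₁ M₁ (τ i + 1) R₂ M₂ × R₂ x ≡ i × I (suc i) R₂ M₂
        body i R₁ M₁ _ (sm , val , refl) R₁x = add-term (term i R₁ sm R₁x)
          where
          add-term : Computes c (suc x) R₁ M (τ i) (g i) → _
          add-term (computes R₂ run₂ val₂ sm₂) = R₂ [ t ≔ R₂ t + R₂ (suc x) ] , M
            , runs-⨾ (τ i) run₂ (runs-op (add-op t t (suc x)) R₂ M)
            , trans (≔-miss R₂ t x _ (>⇒≢ t<x)) (trans (sm₂ x ≤-refl) R₁x)
            , same-trans ≤-refl (same-trans (m≤n⇒m≤1+n (<⇒≤ t<x)) sm sm₂) (same-write R₂ t _ ≤-refl)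
            , trans (≔-hit R₂ t _) (cong₂ _+_ (trans (sm₂ t (m<n⇒m<1+n t<x)) val) val₂) , refl
        finish : Σ[ R₁ ∈ Store ] Σ[ M₁ ∈ Store ]
          Runs (loop x y (c ⨾ op (add-op t t (suc x)))) R₀ M (3 + ∑ m (λ i → τ i + 1 + 6)) R₁ M₁ × I m R₁ M₁ → _
        finish (R₁ , M₁ , run , sm , val , refl) = computes R₁ (runs-⨾ 1 (runs-op (const-op t 0) R M) run) val sm

      compileE-correct : ∀ e v t ρ σ R M → wfE v t e ≡ true → Agrees v t ρ R → Stored σ M →
        Computes (compileE e t) t R M (timeE e ρ σ) (eval e ρ σ)
      compileE-correct (con c) v t ρ σ R M w ag st =
        computes (R [ t ≔ c ]) (runs-op (const-op t c) R M) (≔-hit R t c) (same-write R t c ≤-refl)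
      compileE-correct (var x) v t ρ σ R M w ag st =
        computes (R₁ [ t ≔ R₁ t + R₁ x ]) (runs-⨾ 1 (runs-op (const-op t 0) R M) (runs-op (add-op t t x) R₁ M))
          (trans (≔-hit R₁ t _) (cong₂ _+_ (≔-hit R t 0) (trans (≔-miss R t x 0 (<⇒≢ (below ag x w))) (agree ag x w))))
          (same-trans ≤-refl (same-write R t 0 ≤-refl) (same-write R₁ t _ ≤-refl))
        where
        R₁ : Store
        R₁ = R [ t ≔ 0 ]
      compileE-correct (arr a e) v t ρ σ R M w ag st =
        computes-arr (agrees-positive ag) (agrees-base ag) (at st a (eval e ρ σ) (<ᵇ-true a 16 (proj₁ (∧-true w))))
          (compileE-correct e v t ρ σ R M (proj₂ (∧-true {a <ᵇ 16} w)) ag st)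
      compileE-correct (e ∔ f) v t ρ σ R M w ag st = computes-add X
          (compileE-correct f v (suc t) ρ σ _ M (proj₂ (∧-true {wfE v t e} w)) (agrees-same (n≤1+n t) (Computes.same X) ag) st)
        where
        X = compileE-correct e v t ρ σ R M (proj₁ (∧-true w)) ag st
      compileE-correct (e ∸′ f) v t ρ σ R M w ag st = computes-sub X
          (compileE-correct f v (suc t) ρ σ _ M (proj₂ (∧-true {wfE v t e} w)) (agrees-same (n≤1+n t) (Computes.same X) ag) st)
        where
        X = compileE-correct e v t ρ σ R M (proj₁ (∧-true w)) ag st
      compileE-correct (sumE x y e) v t ρ σ R M w ag st =
        computes-sum (λ i → timeE e (ρ [ x ≔ i ]) σ) (λ i → eval e (ρ [ x ≔ i ]) σ) t<x (below ag y vy) (agree ag y vy)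
          λ i R₁ sm R₁x → compileE-correct e (v ⊕ x) (suc x) (ρ [ x ≔ i ]) σ R₁ M
            (proj₂ (∧-true {v y} (proj₂ (∧-true {t <ᵇ x} w)))) (agrees-bind i (<⇒≤ t<x) sm R₁x ag) st
        where
        t<x : t < x
        t<x = <ᵇ-true t x (proj₁ (∧-true w))
        vy : v y ≡ true
        vy = proj₁ (∧-true (proj₂ (∧-true {t <ᵇ x} w)))
      compileE-correct (ifE e f g) v t ρ σ R M w ag st = computes-branch X
          (compileE-correct f v t ρ σ _ M (proj₁ (∧-true (proj₂ (∧-true {wfE v t e} w)))) (agrees-same ≤-refl (Computes.same X) ag) st)
          (compileE-correct g v t ρ σ _ M (proj₂ (∧-true {wfE v t f} (proj₂ (∧-true {wfE v t e} w)))) (agrees-same ≤-refl (Computes.same X) ag) st)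
        where
        X = compileE-correct e v t ρ σ R M (proj₁ (∧-true w)) ag st

  -- Correctness of compiled statements

  module Statements {n : ℕ} (oracle : Subset n → Bool) (base : ℕ) (n≤base : n ≤ base) where
    open Machine oracle
    open Compilation oracle
    open Layout base n≤base
    open Agrees
    open Stored

    stored-put : ∀ {σ M a} i v → a < 16 → Stored σ M → Stored (put a i v σ) (M [ address base a i ≔ v ])
    stored-put {σ} {M} {a} i v a<16 st .at b j b<16 with b ≡ᵇ a in eq₁ | j ≡ᵇ i in eq₂
    ... | true  | true  rewrite ≡ᵇ-true b a eq₁ | ≡ᵇ-true j i eq₂ = ≔-hit M (address base a i) v
    ... | true  | false = trans (≔-miss M _ _ v λ eq → true≢false (≡ᵇ-intro (proj₂ (address-injective base {b} {a} {j} {i} b<16 a<16 eq))) eq₂) (at st b j b<16)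
    ... | false | _     = trans (≔-miss M _ _ v λ eq → true≢false (≡ᵇ-intro (proj₁ (address-injective base {b} {a} {j} {i} b<16 a<16 eq))) eq₁) (at st b j b<16)

    -- Array cells have addresses from the base on, so the query buffer below it never disturbs
    -- them.
    stored-buffer : ∀ {σ M} z v → z < base → Stored σ M → Stored σ (M [ z ≔ v ])
    stored-buffer {σ} {M} z v z<base st .at b j b<16 =
      trans (≔-miss M z _ v (>⇒≢ (<-≤-trans z<base (m≤n+m base (j * 16 + b))))) (at st b j b<16)

    record Executes (c : Code) (t : ℕ) (R M : Store) (τ : ℕ) (σ′ : Arrays) : Set where
      constructor executes
      field
        R′ M′  : Store
        run    : Runs c R M τ R′ M′
        same   : Same t R R′
        stored : Stored σ′ M′

    executes-set : ∀ {c d a t R M τ υ i v σ} → a < 16 → 0 < t → R 0 ≡ base → Stored σ M → Computes c t R M τ i →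
      (∀ R₁ → Same t R R₁ → Computes d (suc t) R₁ M υ v) →
      Executes (c ⨾ addrCode a t ⨾ d ⨾ op (store-op t (suc t))) t R M (τ + (7 + (υ + 1))) (put a i v σ)
    executes-set {c} {d} {a} {t} {R} {M} {τ} {υ} {i} {v} {σ} a<16 0<t R0 st (computes R₁ run₁ val₁ sm₁) value =
      address-then (runs-addr a t R₁ M 0<t (trans (sm₁ 0 0<t) R0))
      where
      address-then : Σ[ R₂ ∈ Store ] Runs (addrCode a t) R₁ M 7 R₂ M × R₂ t ≡ address base a (R₁ t) × Same t R₁ R₂ → _
      address-then (R₂ , run₂ , val₂ , sm₂) = store-then (value R₂ (same-trans ≤-refl sm₁ sm₂))
        where
        store-then : Computes d (suc t) R₂ M υ v → _
        store-then (computes R₃ run₃ val₃ sm₃) = executes R₃ (M [ R₃ t ≔ R₃ (suc t) ])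
          (runs-⨾ τ run₁ (runs-⨾ 7 run₂ (runs-⨾ υ run₃ (runs-op (store-op t (suc t)) R₃ M))))
          (same-trans ≤-refl (same-trans ≤-refl sm₁ sm₂) (λ z z<t → sm₃ z (m<n⇒m<1+n z<t)))
          (subst₂ (λ p w → Stored (put a i v σ) (M [ p ≔ w ])) (sym (trans (sm₃ t ≤-refl) (trans val₂ (cong (address base a) val₁))))
            (sym val₃) (stored-put i v a<16 st))

    executes-seq : ∀ {c d t R M τ υ σ₁ σ₂} (X : Executes c t R M τ σ₁) → Executes d t (Executes.R′ X) (Executes.M′ X) υ σ₂ →
      Executes (c ⨾ d) t R M (τ + υ) σ₂
    executes-seq {τ = τ} (executes R₁ M₁ run₁ sm₁ st₁) (executes R₂ M₂ run₂ sm₂ st₂) =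
      executes R₂ M₂ (runs-⨾ τ run₁ run₂) (same-trans ≤-refl sm₁ sm₂) st₂

    executes-loop : ∀ {c x y t R M m} (τ : ℕ → ℕ) (f : ℕ → Arrays → Arrays) σ → t ≤ x → y < t → R y ≡ m → Stored σ M →
      (∀ i R₁ M₁ → Same t R R₁ → R₁ x ≡ i → Stored (iterate f i σ) M₁ → Executes c (suc x) R₁ M₁ (τ i) (f i (iterate f i σ))) →
      Executes (loop x y c) t R M (3 + ∑ m (λ i → τ i + 6)) (iterate f m σ)
    executes-loop {c} {x} {y} {t} {R} {M} {m} τ f σ t≤x y<t Ry st body =
      finish (runs-loop x y c I m τ (λ {i} {R₁} {M₁} → bound {i} {R₁} {M₁}) (λ {i} {R₁} {R₂} {M₁} → stable {i} {R₁} {R₂} {M₁}) once R M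
        ((λ _ _ → refl) , st))
      where
      I : ℕ → Store → Store → Set
      I i R₁ M₁ = Same t R R₁ × Stored (iterate f i σ) M₁
      bound : ∀ {i R₁ M₁} → I i R₁ M₁ → R₁ y ≡ m
      bound (sm , _) = trans (sm y y<t) Ry
      stable : ∀ {i R₁ R₂ M₁} → (∀ z → z < x → R₂ z ≡ R₁ z) → I i R₁ M₁ → I i R₂ M₁
      stable h (sm , s) = same-trans t≤x sm h , s
      once : ∀ i R₁ M₁ → i < m → I i R₁ M₁ → R₁ x ≡ i →
        Σ[ R₂ ∈ Store ] Σ[ M₂ ∈ Store ] Runs c R₁ M₁ (τ i) R₂ M₂ × R₂ x ≡ i × I (suc i) R₂ M₂
      once i R₁ M₁ _ (sm , s) R₁x = pack (body i R₁ M₁ sm R₁x s)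
        where
        pack : Executes c (suc x) R₁ M₁ (τ i) (f i (iterate f i σ)) → _
        pack (executes R₂ M₂ run₂ sm₂ st₂) = R₂ , M₂ , run₂ , trans (sm₂ x ≤-refl) R₁x , same-trans (m≤n⇒m≤1+n t≤x) sm sm₂ , st₂
      finish : Σ[ R₁ ∈ Store ] Σ[ M₁ ∈ Store ] Runs (loop x y c) R M (3 + ∑ m (λ i → τ i + 6)) R₁ M₁ × I m R₁ M₁ → _
      finish (R₁ , M₁ , run , sm , s) = executes R₁ M₁ run sm s

    executes-when : ∀ {c d t R M τ υ u σ σ′} (X : Computes c t R M τ u) → Stored σ M → Executes d t (Computes.R′ X) M υ σ′ →
      Executes (c ⨾ cond t d) t R M (τ + (if u ≡ᵇ 0 then 1 else 1 + υ)) (if u ≡ᵇ 0 then σ else σ′)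
    executes-when {d = d} {t} {M = M} {τ} {u = zero} (computes R₁ run₁ val₁ sm₁) st _ =
      executes R₁ M (runs-⨾ τ run₁ (runs-cond-zero t d R₁ M val₁)) sm₁ st
    executes-when {t = t} {τ = τ} {u = suc _} (computes R₁ run₁ val₁ sm₁) st (executes R₂ M₂ run₂ sm₂ st₂) =
      executes R₂ M₂ (runs-⨾ τ run₁ (runs-cond-nonzero t (λ z → case trans (sym val₁) z of λ ()) run₂)) (same-trans ≤-refl sm₁ sm₂) st₂

    copyCode : ℕ → ℕ → Code
    copyCode a t = loop t 1 (compileE (arr a (var t)) (suc t) ⨾ op (store-op t (suc t)))

    -- The loop fills the contiguous buffer at address 0 with array a.
    record Copied (a t : ℕ) (σ : Arrays) (R M : Store) : Set where
      constructor copied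
      field
        R′ M′  : Store
        run    : Runs (copyCode a t) R M (3 + ∑ n (λ _ → 17)) R′ M′
        same   : Same t R R′
        stored : Stored σ M′
        buffer : ∀ e → e < n → M′ e ≡ σ a e

    copy-correct : ∀ {v t ρ R M} a σ → a < 16 → Agrees v t ρ R → Stored σ M → Copied a t σ R M
    copy-correct {v} {t} {ρ} {R} {M} a σ a<16 ag st =
      finish (runs-loop t 1 (compileE (arr a (var t)) (suc t) ⨾ op (store-op t (suc t))) I n (λ _ → 11)
        (λ {i} {R₁} {M₁} → bound {i} {R₁} {M₁}) (λ {i} {R₁} {R₂} {M₁} → stable {i} {R₁} {R₂} {M₁}) once R M ((λ _ _ → refl) , st , λ _ ()))
      where
      I : ℕ → Store → Store → Set
      I i R₁ M₁ = Same t R R₁ × Stored σ M₁ × (∀ e → e < i → M₁ e ≡ σ a e)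
      bound : ∀ {i R₁ M₁} → I i R₁ M₁ → R₁ 1 ≡ n
      bound (sm , _) = trans (sm 1 (below ag 1 (proj₂ (visible ag)))) (trans (agree ag 1 (proj₂ (visible ag))) (ρ-size ag))
      stable : ∀ {i R₁ R₂ M₁} → (∀ z → z < t → R₂ z ≡ R₁ z) → I i R₁ M₁ → I i R₂ M₁
      stable h (sm , s) = same-trans ≤-refl sm h , s
      once : ∀ i R₁ M₁ → i < n → I i R₁ M₁ → R₁ t ≡ i → Σ[ R₂ ∈ Store ] Σ[ M₂ ∈ Store ]
        Runs (compileE (arr a (var t)) (suc t) ⨾ op (store-op t (suc t))) R₁ M₁ 11 R₂ M₂ × R₂ t ≡ i × I (suc i) R₂ M₂
      once i R₁ M₁ i<n (sm , s , buf) R₁t = pack (compileE-correct (arr a (var t)) (v ⊕ t) (suc t) (ρ [ t ≔ i ]) σ R₁ M₁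
          (∧-intro (<ᵇ-intro a<16) (⊕-self v t)) (agrees-bind i ≤-refl sm R₁t ag) s)
        where
        ⊕-self : ∀ (v : ℕ → Bool) t → (v ⊕ t) t ≡ true
        ⊕-self v t = ∨-introˡ (≡ᵇ-refl t)
        pack : Computes (compileE (arr a (var t)) (suc t)) (suc t) R₁ M₁ 10 (σ a ((ρ [ t ≔ i ]) t)) → _
        pack (computes R₂ run₂ val₂ sm₂) = R₂ , M₁ [ R₂ t ≔ R₂ (suc t) ]
          , runs-⨾ 10 run₂ (runs-op (store-op t (suc t)) R₂ M₁) , R₂t
          , same-trans (n≤1+n t) sm sm₂
          , stored-buffer (R₂ t) (R₂ (suc t)) (subst (_< base) (sym R₂t) (<-≤-trans i<n n≤base)) s
          , buf′
          where
          R₂t : R₂ t ≡ i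
          R₂t = trans (sm₂ t ≤-refl) R₁t
          buf′ : ∀ e → e < suc i → (M₁ [ R₂ t ≔ R₂ (suc t) ]) e ≡ σ a e
          buf′ e e<1+i with e ≟ i
          ... | yes refl = trans (cong (λ z → (M₁ [ z ≔ R₂ (suc t) ]) e) R₂t) (trans (≔-hit M₁ e _)
                  (trans val₂ (cong (σ a) (≔-hit ρ t e))))
          ... | no e≢i = trans (≔-miss M₁ (R₂ t) e _ (λ eq → e≢i (trans eq R₂t))) (buf e (≤∧≢⇒< (≤-pred e<1+i) e≢i))
      finish : Σ[ R₁ ∈ Store ] Σ[ M₁ ∈ Store ] Runs (copyCode a t) R M (3 + ∑ n (λ _ → 17)) R₁ M₁ × I n R₁ M₁ → _
      finish (R₁ , M₁ , run , sm , s , buf) = copied R₁ M₁ run sm s buf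

    readSet-buffer : ∀ (M : Store) (σ : Arrays) a → (∀ e → e < n → M e ≡ σ a e) → readSet n M 0 ≡ tabulate (λ e → 0 <ᵇ σ a (toℕ e))
    readSet-buffer M σ a h = tabulate-cong λ e → cong (0 <ᵇ_) (h (toℕ e) (toℕ<n e))

    executes-ask : ∀ {v t ρ R M} a b σ → a < 16 → b < 16 → Agrees v t ρ R → Stored σ M →
      Executes (compile (ask a b) t) t R M (3 + ∑ n (λ _ → 17) + (1 + (1 + (1 + (7 + 1))))) (put b 0 (askValue σ a) σ)
    executes-ask {v} {t} {ρ} {R} {M} a b σ a<16 b<16 ag st = after-copy (copy-correct a σ a<16 ag st)
      where
      after-copy : Copied a t σ R M → _
      after-copy (copied R₁ M₁ run₁ sm₁ st₁ buf) = after-address (runs-addr b (suc t) R₄ M₁ (s≤s z≤n)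
          (trans (same₄ 0 (agrees-positive ag)) (agrees-base ag)))
        where
        R₂ R₃ R₄ : Store
        R₂ = R₁ [ t ≔ 0 ]
        R₃ = R₂ [ t ≔ bit (oracle (readSet n M₁ (R₂ t))) ]
        R₄ = R₃ [ suc t ≔ 0 ]
        same₄ : Same t R R₄
        same₄ = same-trans ≤-refl (same-trans ≤-refl (same-trans ≤-refl sm₁ (same-write R₁ t 0 ≤-refl)) (same-write R₂ t _ ≤-refl)) (same-write R₃ (suc t) 0 (n≤1+n t))
        answer : R₄ t ≡ askValue σ a
        answer = trans (≔-miss R₃ (suc t) t 0 (<⇒≢ ≤-refl)) (trans (≔-hit R₂ t _)
          (cong (bit ∘ oracle) (trans (cong (readSet n M₁) (≔-hit R₁ t 0)) (readSet-buffer M₁ σ a buf))))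
        after-address : Σ[ R₅ ∈ Store ] Runs (addrCode b (suc t)) R₄ M₁ 7 R₅ M₁ × R₅ (suc t) ≡ address base b (R₄ (suc t)) × Same (suc t) R₄ R₅ → _
        after-address (R₅ , run₅ , val₅ , sm₅) = executes R₅ (M₁ [ R₅ (suc t) ≔ R₅ t ])
          (runs-⨾ (3 + ∑ n (λ _ → 17)) run₁ (runs-⨾ 1 (runs-op (const-op t 0) R₁ M₁) (runs-⨾ 1 (runs-op (query-op t t) R₂ M₁)
            (runs-⨾ 1 (runs-op (const-op (suc t) 0) R₃ M₁) (runs-⨾ 7 run₅ (runs-op (store-op (suc t) t) R₅ M₁))))))
          (same-trans ≤-refl same₄ (λ z z<t → sm₅ z (m<n⇒m<1+n z<t)))
          (subst₂ (λ p w → Stored (put b 0 (askValue σ a) σ) (M₁ [ p ≔ w ]))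
            (sym (trans val₅ (cong (address base b) (≔-hit R₃ (suc t) 0)))) (sym (trans (sm₅ t ≤-refl) answer))
            (stored-put 0 (askValue σ a) b<16 st₁))

    compile-correct : ∀ s v t ρ σ R M → wf v t s ≡ true → Agrees v t ρ R → Stored σ M →
      Executes (compile s t) t R M (time s ρ σ) (exec s ρ σ)
    compile-correct (set a e f) v t ρ σ R M w ag st =
      executes-set (<ᵇ-true a 16 (proj₁ (∧-true w))) (agrees-positive ag) (agrees-base ag) st
        (compileE-correct e v t ρ σ R M (proj₁ (∧-true (proj₂ (∧-true {a <ᵇ 16} w)))) ag st)
        λ R₁ sm → compileE-correct f v (suc t) ρ σ R₁ M (proj₂ (∧-true {wfE v t e} (proj₂ (∧-true {a <ᵇ 16} w))))
          (agrees-same (n≤1+n t) sm ag) st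
    compile-correct (s ⍮ s′) v t ρ σ R M w ag st = executes-seq X
      (compile-correct s′ v t ρ (exec s ρ σ) _ _ (proj₂ (∧-true {wf v t s} w)) (agrees-same ≤-refl (Executes.same X) ag) (Executes.stored X))
      where
      X = compile-correct s v t ρ σ R M (proj₁ (∧-true w)) ag st
    compile-correct (for x y s) v t ρ σ R M w ag st =
      executes-loop (λ i → time s (ρ [ x ≔ i ]) (iterate (λ v → exec s (ρ [ x ≔ v ])) i σ)) (λ v → exec s (ρ [ x ≔ v ])) σ
        t≤x (below ag y vy) (agree ag y vy) st
        λ i R₁ M₁ sm R₁x st₁ → compile-correct s (v ⊕ x) (suc x) (ρ [ x ≔ i ]) _ R₁ M₁
          (proj₂ (∧-true {v y} (proj₂ (∧-true {t <ᵇ suc x} w)))) (agrees-bind i t≤x sm R₁x ag) st₁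
      where
      t≤x : t ≤ x
      t≤x = ≤-pred (<ᵇ-true t (suc x) (proj₁ (∧-true w)))
      vy : v y ≡ true
      vy = proj₁ (∧-true (proj₂ (∧-true {t <ᵇ suc x} w)))
    compile-correct (when e s) v t ρ σ R M w ag st = executes-when X st
      (compile-correct s v t ρ σ _ M (proj₂ (∧-true {wfE v t e} w)) (agrees-same ≤-refl (Computes.same X) ag) st)
      where
      X = compileE-correct e v t ρ σ R M (proj₁ (∧-true w)) ag st
    compile-correct (letS x e s) v t ρ σ R M w ag st = bind
        (compileE-correct e v x ρ σ R M (proj₁ (∧-true (proj₂ (∧-true {t <ᵇ suc x} w)))) (agrees-same t≤x (λ _ _ → refl) ag) st)
      where
      t≤x : t ≤ x
      t≤x = ≤-pred (<ᵇ-true t (suc x) (proj₁ (∧-true w)))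
      bind : Computes (compileE e x) x R M (timeE e ρ σ) (eval e ρ σ) → _
      bind (computes R₁ run₁ val₁ sm₁) = continue
          (compile-correct s (v ⊕ x) (suc x) (ρ [ x ≔ eval e ρ σ ]) σ R₁ M (proj₂ (∧-true {wfE v x e} (proj₂ (∧-true {t <ᵇ suc x} w))))
            (agrees-bind (eval e ρ σ) t≤x (λ z z<t → sm₁ z (<-≤-trans z<t t≤x)) val₁ ag) st)
        where
        continue : Executes (compile s (suc x)) (suc x) R₁ M (time s (ρ [ x ≔ eval e ρ σ ]) σ) (exec s (ρ [ x ≔ eval e ρ σ ]) σ) → _
        continue (executes R₂ M₂ run₂ sm₂ st₂) = executes R₂ M₂ (runs-⨾ (timeE e ρ σ) run₁ run₂)
          (λ z z<t → trans (sm₂ z (m<n⇒m<1+n (<-≤-trans z<t t≤x))) (sm₁ z (<-≤-trans z<t t≤x))) st₂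
    compile-correct (ask a b) v t ρ σ R M w ag st =
      executes-ask a b σ (<ᵇ-true a 16 (proj₁ (∧-true w))) (<ᵇ-true b 16 (proj₂ (∧-true {a <ᵇ 16} w))) ag st

  -- Start-up code and complete programs

  prelude : Code
  prelude = op (const-op 3 0) ⨾ op (load-op 1 3) ⨾ op (const-op 3 1) ⨾ op (load-op 2 3)
    ⨾ op (const-op 0 4) ⨾ op (add-op 0 0 1) ⨾ op (add-op 0 0 2) ⨾ loop 3 2 (op (add-op 0 0 1))
    ⨾ loop 3 0 (op (const-op 4 0) ⨾ op (add-op 4 4 3) ⨾ addrCode 0 4 ⨾ op (load-op 5 3) ⨾ op (store-op 4 5))

  -- Array 0 holds the input, array out the result.
  program : ℕ → Stm → Program
  program out s = gen (prelude ⨾ compile s 3 ⨾ loop 3 1 (compileE (arr out (var 3)) 4 ⨾ op (store-op 3 4))) 0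

  -- The input fills 4 + k + k n cells. The additional n lets the query buffer fit below the base
  -- even when k = 0.
  baseOf : ℕ → ℕ → ℕ
  baseOf n k = 4 + n + k + k * n

  n≤baseOf : ∀ n k → n ≤ baseOf n k
  n≤baseOf n k = ≤-trans (≤-trans (m≤n+m n 4) (m≤m+n (4 + n) k)) (m≤m+n (4 + n + k) (k * n))

  inputArrays : Store → Arrays
  inputArrays M a i = if a ≡ᵇ 0 then M i else 0

  startEnv : ℕ → ℕ → Store
  startEnv n k = (((λ _ → 0) [ 0 ≔ baseOf n k ]) [ 1 ≔ n ]) [ 2 ≔ k ]

  visible₃ : ℕ → Bool
  visible₃ z = z <ᵇ 3

  preludeTime : ℕ → ℕ → ℕ
  preludeTime n k = 1 + (1 + (1 + (1 + (1 + (1 + (1 + (3 + ∑ k (λ _ → 1 + 6) + (3 + ∑ (baseOf n k) (λ _ → 11 + 6)))))))))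

  module Start {n : ℕ} (oracle : Subset n → Bool) (k : ℕ) where
    open Machine oracle
    open Compilation oracle
    open Layout (baseOf n k) (n≤baseOf n k)
    open Statements oracle (baseOf n k) (n≤baseOf n k)

    private
      base : ℕ
      base = baseOf n k

    record Prepared (M₀ : Store) : Set where
      constructor prepared
      field
        R M    : Store
        run    : Runs prelude (λ _ → 0) M₀ (preludeTime n k) R M
        env    : Agrees visible₃ 3 (startEnv n k) R
        stored : Stored (inputArrays M₀) M

    module _ (M₀ : Store) (M₀-n : M₀ 0 ≡ n) (M₀-k : M₀ 1 ≡ k) (M₀-zero : ∀ z → base ≤ z → M₀ z ≡ 0) where

      private
        R₁ R₂ R₃ R₄ R₅ R₆ R₇ : Store
        R₁ = (λ _ → 0) [ 3 ≔ 0 ]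
        R₂ = R₁ [ 1 ≔ M₀ 0 ]
        R₃ = R₂ [ 3 ≔ 1 ]
        R₄ = R₃ [ 2 ≔ M₀ 1 ]
        R₅ = R₄ [ 0 ≔ 4 ]
        R₆ = R₅ [ 0 ≔ 4 + M₀ 0 ]
        R₇ = R₆ [ 0 ≔ 4 + M₀ 0 + M₀ 1 ]

      sizeLoop : Σ[ R ∈ Store ] Σ[ M ∈ Store ] Runs (loop 3 2 (op (add-op 0 0 1))) R₇ M₀ (3 + ∑ k (λ _ → 1 + 6)) R M
        × R 1 ≡ n × R 2 ≡ k × R 0 ≡ 4 + n + k + k * n × M ≡ M₀
      sizeLoop = runs-loop 3 2 (op (add-op 0 0 1)) I k (λ _ → 1) (λ (_ , b , _) → b) (λ {i} {R} {R′} {M} → stable {i} {R} {R′} {M}) body R₇ M₀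
        (M₀-n , M₀-k , trans (cong₂ (λ x y → 4 + x + y) M₀-n M₀-k) (sym (+-identityʳ _)) , refl)
        where
        I : ℕ → Store → Store → Set
        I i R M = R 1 ≡ n × R 2 ≡ k × R 0 ≡ 4 + n + k + i * n × M ≡ M₀
        stable : ∀ {i R R′ M} → (∀ z → z < 3 → R′ z ≡ R z) → I i R M → I i R′ M
        stable h (a , b , c , d) = trans (h 1 (s≤s (s≤s z≤n))) a , trans (h 2 ≤-refl) b , trans (h 0 (s≤s z≤n)) c , d
        body : ∀ i R M → i < k → I i R M → R 3 ≡ i →
          Σ[ R′ ∈ Store ] Σ[ M′ ∈ Store ] Runs (op (add-op 0 0 1)) R M 1 R′ M′ × R′ 3 ≡ i × I (suc i) R′ M′
        body i R M _ (a , b , c , d) R3 = _ , M , runs-op (add-op 0 0 1) R M , R3 , a , b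
          , trans (cong₂ _+_ c a) (trans (+-assoc (4 + n + k) (i * n) n) (cong (4 + n + k +_) (+-comm (i * n) n))) , d

      record Copying (i : ℕ) (R M : Store) : Set where
        constructor copying
        field
          R0    : R 0 ≡ base
          R1    : R 1 ≡ n
          R2    : R 2 ≡ k
          low   : ∀ z → z < base → M z ≡ M₀ z
          done  : ∀ j → j < i → M (address base 0 j) ≡ M₀ j
          fresh : ∀ a j → a < 16 → (a ≡ 0 → i ≤ j) → M (address base a j) ≡ 0

      copyBody : Code
      copyBody = op (const-op 4 0) ⨾ op (add-op 4 4 3) ⨾ addrCode 0 4 ⨾ op (load-op 5 3) ⨾ op (store-op 4 5)

      copyLoop : ∀ R → R 0 ≡ base → R 1 ≡ n → R 2 ≡ k → Σ[ R′ ∈ Store ] Σ[ M′ ∈ Store ]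
        Runs (loop 3 0 copyBody) R M₀ (3 + ∑ base (λ _ → 11 + 6)) R′ M′ × Copying base R′ M′
      copyLoop R r0 r1 r2 = runs-loop 3 0 copyBody Copying base (λ _ → 11) Copying.R0
        (λ h (copying a b c d e f) → copying (trans (h 0 (s≤s z≤n)) a) (trans (h 1 (s≤s (s≤s z≤n))) b) (trans (h 2 ≤-refl) c) d e f)
        body R M₀ (copying r0 r1 r2 (λ _ _ → refl) (λ _ ()) λ a j _ _ → M₀-zero _ (m≤n+m base (j * 16 + a)))
        where
        body : ∀ i R M → i < base → Copying i R M → R 3 ≡ i →
          Σ[ R′ ∈ Store ] Σ[ M′ ∈ Store ] Runs copyBody R M 11 R′ M′ × R′ 3 ≡ i × Copying (suc i) R′ M′
        body i R M i<base (copying r0 r1 r2 low done fresh) R3 = after (runs-addr 0 4 Rᵇ M (s≤s z≤n) r0)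
          where
          Rᵃ Rᵇ : Store
          Rᵃ = R [ 4 ≔ 0 ]
          Rᵇ = Rᵃ [ 4 ≔ R 3 ]
          after : Σ[ R′ ∈ Store ] Runs (addrCode 0 4) Rᵇ M 7 R′ M × R′ 4 ≡ address base 0 (R 3) × Same 4 Rᵇ R′ → _
          after (Rᶜ , run , val , sm) = Rᵈ , M [ Rᶜ 4 ≔ M (Rᶜ 3) ]
            , runs-⨾ 1 (runs-op (const-op 4 0) R M) (runs-⨾ 1 (runs-op (add-op 4 4 3) Rᵃ M)
                (runs-⨾ 7 run (runs-⨾ 1 (runs-op (load-op 5 3) Rᶜ M) (runs-op (store-op 4 5) Rᵈ M))))
            , trans (sm 3 ≤-refl) R3
            , subst₂ (λ p v → Copying (suc i) Rᵈ (M [ p ≔ v ])) (sym (trans val (cong (address base 0) R3)))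
                (sym (trans (cong M (trans (sm 3 ≤-refl) R3)) (low i i<base))) next-state
            where
            Rᵈ : Store
            Rᵈ = Rᶜ [ 5 ≔ M (Rᶜ 3) ]
            p : ℕ
            p = address base 0 i
            miss : ∀ {z} → z ≢ p → (M [ p ≔ M₀ i ]) z ≡ M z
            miss {z} = ≔-miss M p z (M₀ i)
            done′ : ∀ j → j < suc i → (M [ p ≔ M₀ i ]) (address base 0 j) ≡ M₀ j
            done′ j j<1+i with j ≟ i
            ... | yes refl = ≔-hit M p (M₀ i)
            ... | no j≢i = trans (miss λ eq → j≢i (proj₂ (address-injective base {0} {0} {j} {i} (s≤s z≤n) (s≤s z≤n) eq)))
                (done j (≤∧≢⇒< (≤-pred j<1+i) j≢i))
            fresh′ : ∀ a j → a < 16 → (a ≡ 0 → suc i ≤ j) → (M [ p ≔ M₀ i ]) (address base a j) ≡ 0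
            fresh′ a j a<16 h = trans (miss λ eq → differ (address-injective base {a} {0} {j} {i} a<16 (s≤s z≤n) eq))
                (fresh a j a<16 λ a≡0 → <⇒≤ (h a≡0))
              where
              differ : a ≡ 0 × j ≡ i → ⊥
              differ (a≡0 , refl) = <-irrefl refl (h a≡0)
            next-state : Copying (suc i) Rᵈ (M [ p ≔ M₀ i ])
            next-state = copying (trans (sm 0 (s≤s z≤n)) r0) (trans (sm 1 (s≤s (s≤s z≤n))) r1) (trans (sm 2 (s≤s (s≤s (s≤s z≤n)))) r2)
              (λ z z<base → trans (miss (<⇒≢ (<-≤-trans z<base (m≤n+m base (i * 16 + 0))))) (low z z<base)) done′ fresh′

      prepare : Prepared M₀
      prepare = step₁ sizeLoop
        where
        step₂ : ∀ {R} → Runs (loop 3 2 (op (add-op 0 0 1))) R₇ M₀ (3 + ∑ k (λ _ → 1 + 6)) R M₀ →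
          Σ[ R′ ∈ Store ] Σ[ M′ ∈ Store ] Runs (loop 3 0 copyBody) R M₀ (3 + ∑ base (λ _ → 11 + 6)) R′ M′ × Copying base R′ M′ → Prepared M₀
        step₂ run₁ (R , M , run₂ , copying r0 r1 r2 low done fresh) = prepared R M
          (runs-⨾ 1 (runs-op (const-op 3 0) (λ _ → 0) M₀) (runs-⨾ 1 (runs-op (load-op 1 3) R₁ M₀) (runs-⨾ 1 (runs-op (const-op 3 1) R₂ M₀)
            (runs-⨾ 1 (runs-op (load-op 2 3) R₃ M₀) (runs-⨾ 1 (runs-op (const-op 0 4) R₄ M₀) (runs-⨾ 1 (runs-op (add-op 0 0 1) R₅ M₀)
            (runs-⨾ 1 (runs-op (add-op 0 0 2) R₆ M₀) (runs-⨾ (3 + ∑ k (λ _ → 1 + 6)) run₁ run₂))))))))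
          (record { below = λ z h → <ᵇ-true z 3 h ; agree = agree ; visible = refl , refl ; ρ-base = refl ; ρ-size = refl })
          (stored-at contents)
          where
          agree : ∀ z → (z <ᵇ 3) ≡ true → R z ≡ startEnv n k z
          agree 0 _ = r0
          agree 1 _ = r1
          agree 2 _ = r2
          agree (suc (suc (suc z))) ()
          contents : ∀ a i → a < 16 → M (address base a i) ≡ inputArrays M₀ a i
          contents (suc a) i a<16 = fresh (suc a) i a<16 λ ()
          contents zero i a<16 with i <? base
          ... | yes i<base = done i i<base
          ... | no  i≮base = trans (fresh 0 i a<16 λ _ → ≮⇒≥ i≮base) (sym (M₀-zero i (≮⇒≥ i≮base)))
        step₁ : (Σ[ R ∈ Store ] Σ[ M ∈ Store ] Runs (loop 3 2 (op (add-op 0 0 1))) R₇ M₀ (3 + ∑ k (λ _ → 1 + 6)) R M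
          × R 1 ≡ n × R 2 ≡ k × R 0 ≡ 4 + n + k + k * n × M ≡ M₀) → Prepared M₀
        step₁ (R , M , run , r1 , r2 , r0 , refl) = step₂ run (copyLoop R r0 r1 r2)

      totalTime : Stm → ℕ
      totalTime s = preludeTime n k + (time s (startEnv n k) (inputArrays M₀) + (3 + ∑ n (λ _ → 17)))

      -- The final configuration of a program does not depend on the coins.
      program-correct : ∀ out s → out < 16 → wf visible₃ 3 s ≡ true → Σ[ c ∈ Config ]
        Halted (program out s) c
        × (∀ (ω : Vec Bool (totalTime s)) → Defs.run oracle (program out s) (config 0 (λ _ → 0) M₀) ω ≡ c)
        × Defs.output n c ≡ tabulate (λ e → 0 <ᵇ exec s (startEnv n k) (inputArrays M₀) out (toℕ e))
      program-correct out s out<16 w = go prepare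
        where
        P : Program
        P = program out s
        σ : Arrays
        σ = exec s (startEnv n k) (inputArrays M₀)
        run-reach : ∀ {t c d} → Reach P t c d → (ω : Vec Bool t) → Defs.run oracle P c ω ≡ d
        run-reach here []            = refl
        run-reach (next q r) (b ∷ ω) = trans (cong (λ c → Defs.run oracle P c ω) (q b)) (run-reach r ω)
        code : Code
        code = prelude ⨾ compile s 3 ⨾ copyCode out 3
        at-start : Placed P 0 (gen code 0)
        at-start = placed [] (sym (++-identityʳ P))
        halted : ∀ R M → Halted P (config (size code) R M)
        halted R M = cong head (trans (cong (λ l → drop l P) (sym (length-gen code 0))) (drop-all (length P) P ≤-refl))
        go : Prepared M₀ → _
        go (prepared R₁ M₁ run₁ env st₁) = go₂ (compile-correct s visible₃ 3 (startEnv n k) (inputArrays M₀) R₁ M₁ w env st₁)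
          where
          go₂ : Executes (compile s 3) 3 R₁ M₁ (time s (startEnv n k) (inputArrays M₀)) σ → _
          go₂ (executes R₂ M₂ run₂ sm₂ st₂) = go₃ (copy-correct out σ out<16 (agrees-same ≤-refl sm₂ env) st₂)
            where
            go₃ : Copied out 3 σ R₂ M₂ → _
            go₃ (copied R₃ M₃ run₃ _ _ buf) = config (size code) R₃ M₃ , halted R₃ M₃
              , run-reach (Runs.reach (runs-⨾ (preludeTime n k) run₁ (runs-⨾ (time s (startEnv n k) (inputArrays M₀)) run₂ run₃)) P 0 at-start)
              , readSet-buffer M₃ σ out buf

  -- Running times and program logic

  -- With all loop bounds at most m ^ d for known degrees d, the
  -- running time is at most m ^ d′ for a degree d′ computed from the syntax.

  -- For m ≥ 2 the sum of two powers of m is at most the next power after the larger one.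
  plus : ℕ → ℕ → ℕ
  plus p q = suc (p ⊔ q)

  -- A constant c gets degree c because c ≤ m^c. The 0 for array reads carries no information;
  -- `bounded` excludes them wherever the degree of a value is relied on.
  valueDegree : Exp → (ℕ → ℕ) → ℕ
  valueDegree (con c)      δ = c
  valueDegree (var x)      δ = δ x
  valueDegree (arr a e)    δ = 0
  valueDegree (e ∔ f)      δ = plus (valueDegree e δ) (valueDegree f δ)
  valueDegree (e ∸′ f)     δ = valueDegree e δ
  valueDegree (sumE x y e) δ = δ y + valueDegree e (δ [ x ≔ δ y ])
  valueDegree (ifE e f g)  δ = valueDegree f δ ⊔ valueDegree g δ

  -- No array cell contributes to the value, except through conditions.
  bounded : Exp → Bool
  bounded (con c)      = true
  bounded (var x)      = true
  bounded (arr a e)    = false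
  bounded (e ∔ f)      = bounded e ∧ bounded f
  bounded (e ∸′ f)     = bounded e
  bounded (sumE x y e) = bounded e
  bounded (ifE e f g)  = bounded f ∧ bounded g

  withLets : List (ℕ × Exp) → Stm → Stm
  withLets []             s = s
  withLets ((x , e) ∷ ps) s = letS x e (withLets ps s)

  letEnv : List (ℕ × Exp) → Store → Arrays → Store
  letEnv []             ρ σ = ρ
  letEnv ((x , e) ∷ ps) ρ σ = letEnv ps (ρ [ x ≔ eval e ρ σ ]) σ

  letDegrees : List (ℕ × Exp) → (ℕ → ℕ) → ℕ → ℕ
  letDegrees []             δ = δ
  letDegrees ((x , e) ∷ ps) δ = letDegrees ps (δ [ x ≔ valueDegree e δ ])

  letsBounded : List (ℕ × Exp) → Bool
  letsBounded []             = true
  letsBounded ((x , e) ∷ ps) = bounded e ∧ letsBounded ps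

  timeDegreeE : Exp → (ℕ → ℕ) → ℕ
  timeDegreeE (con c)      δ = 1
  timeDegreeE (var x)      δ = 2
  timeDegreeE (arr a e)    δ = plus (timeDegreeE e δ) 8
  timeDegreeE (e ∔ f)      δ = plus (timeDegreeE e δ) (plus (timeDegreeE f δ) 1)
  timeDegreeE (e ∸′ f)     δ = plus (timeDegreeE e δ) (plus (timeDegreeE f δ) 1)
  timeDegreeE (sumE x y e) δ = plus 4 (δ y + plus (timeDegreeE e (δ [ x ≔ δ y ])) 7)
  timeDegreeE (ifE e f g)  δ = plus (timeDegreeE e δ) (plus (timeDegreeE f δ ⊔ timeDegreeE g δ) 3)

  timeDegree : Stm → (ℕ → ℕ) → ℕ
  timeDegree (set a e f)  δ = plus (timeDegreeE e δ) (plus (timeDegreeE f δ) 8)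
  timeDegree (s ⍮ s′)     δ = plus (timeDegree s δ) (timeDegree s′ δ)
  timeDegree (for x y s)  δ = plus 3 (δ y + plus (timeDegree s (δ [ x ≔ δ y ])) 6)
  timeDegree (when e s)   δ = plus (timeDegreeE e δ) (plus (timeDegree s δ) 1)
  timeDegree (letS x e s) δ = plus (timeDegreeE e δ) (timeDegree s (δ [ x ≔ valueDegree e δ ]))
  timeDegree (ask a b)    δ = plus 14 (δ 1 + 17)

  -- The let that reads the number of guesses from memory fails this check, so the loop over all
  -- guesses is timed separately.
  analysable : Stm → Bool
  analysable (set a e f)  = true
  analysable (s ⍮ s′)     = analysable s ∧ analysable s′
  analysable (for x y s)  = analysable s ∧ (1 <ᵇ x)
  analysable (when e s)   = analysable s
  analysable (letS x e s) = bounded e ∧ (analysable s ∧ (1 <ᵇ x))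
  analysable (ask a b)    = true

  module Degrees (m : ℕ) (2≤m : 2 ≤ m) where

    private instance
      m≢0 : ℕB.NonZero m
      m≢0 = ℕB.>-nonZero (≤-trans (s≤s z≤n) 2≤m)

    pow-mono : ∀ {p q} → p ≤ q → m ^ p ≤ m ^ q
    pow-mono = ^-monoʳ-≤ m

    pow-const : ∀ c → c ≤ m ^ c
    pow-const zero    = z≤n
    pow-const (suc c) = ≤-trans (+-mono-≤ (m^n>0 m c) (pow-const c))
      (≤-trans (≤-reflexive (cong (λ z → m ^ c + z) (sym (+-identityʳ (m ^ c))))) (*-monoˡ-≤ (m ^ c) 2≤m))

    pow-+ : ∀ {a b p q} → a ≤ m ^ p → b ≤ m ^ q → a + b ≤ m ^ plus p q
    pow-+ {p = p} {q} a≤ b≤ = ≤-trans (+-mono-≤ (≤-trans a≤ (pow-mono (m≤m⊔n p q))) (≤-trans b≤ (pow-mono (m≤n⊔m p q))))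
      (≤-trans (≤-reflexive (cong (λ z → m ^ (p ⊔ q) + z) (sym (+-identityʳ (m ^ (p ⊔ q)))))) (*-monoˡ-≤ (m ^ (p ⊔ q)) 2≤m))

    pow-∑ : ∀ {l p q f} → l ≤ m ^ p → (∀ i → i < l → f i ≤ m ^ q) → ∑ l f ≤ m ^ (p + q)
    pow-∑ {l} {p} {q} l≤ f≤ = ≤-trans (∑-bound l f≤) (≤-trans (*-monoˡ-≤ (m ^ q) l≤) (≤-reflexive (sym (^-distribˡ-+-* m p q))))

    Bounded : (ℕ → ℕ) → Store → Set
    Bounded δ ρ = ∀ x → ρ x ≤ m ^ δ x

    bounded-bind : ∀ {δ ρ} x d v → v ≤ m ^ d → Bounded δ ρ → Bounded (δ [ x ≔ d ]) (ρ [ x ≔ v ])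
    bounded-bind x d v v≤ b z with z ≡ᵇ x
    ... | true  = v≤
    ... | false = b z

    value-bound : ∀ e {δ ρ} σ → bounded e ≡ true → Bounded δ ρ → eval e ρ σ ≤ m ^ valueDegree e δ
    value-bound (con c)      σ ok b = pow-const c
    value-bound (var x)      σ ok b = b x
    value-bound (e ∔ f)      {δ} σ ok b = pow-+ {p = valueDegree e δ} {valueDegree f δ}
      (value-bound e σ (proj₁ (∧-true ok)) b) (value-bound f σ (proj₂ (∧-true {bounded e} ok)) b)
    value-bound (e ∸′ f)     {δ} {ρ} σ ok b = ≤-trans (m∸n≤m (eval e ρ σ) (eval f ρ σ)) (value-bound e σ ok b)
    value-bound (sumE x y e) {δ} σ ok b = pow-∑ {p = δ y} (b y)
      λ i i<y → value-bound e σ ok (bounded-bind x (δ y) i (≤-trans (<⇒≤ i<y) (b y)) b)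
    value-bound (ifE e f g)  {δ} {ρ} σ ok b with eval e ρ σ ≡ᵇ 0
    ... | true  = ≤-trans (value-bound g σ (proj₂ (∧-true {bounded f} ok)) b) (pow-mono (m≤n⊔m (valueDegree f δ) (valueDegree g δ)))
    ... | false = ≤-trans (value-bound f σ (proj₁ (∧-true ok)) b) (pow-mono (m≤m⊔n (valueDegree f δ) (valueDegree g δ)))

    lets-bound : ∀ ps {δ ρ} σ → letsBounded ps ≡ true → Bounded δ ρ → Bounded (letDegrees ps δ) (letEnv ps ρ σ)
    lets-bound []             σ ok b = b
    lets-bound ((x , e) ∷ ps) {δ} {ρ} σ ok b = lets-bound ps σ (proj₂ (∧-true {bounded e} ok))
      (bounded-bind x (valueDegree e δ) (eval e ρ σ) (value-bound e σ (proj₁ (∧-true ok)) b) b)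

    timeE-bound : ∀ e {δ ρ} σ → Bounded δ ρ → timeE e ρ σ ≤ m ^ timeDegreeE e δ
    timeE-bound (con c)      σ b = pow-const 1
    timeE-bound (var x)      σ b = pow-const 2
    timeE-bound (arr a e)    {δ} σ b = pow-+ {p = timeDegreeE e δ} {8} (timeE-bound e σ b) (pow-const 8)
    timeE-bound (e ∔ f)      {δ} σ b = pow-+ {p = timeDegreeE e δ} {plus (timeDegreeE f δ) 1} (timeE-bound e σ b)
      (pow-+ {p = timeDegreeE f δ} {1} (timeE-bound f σ b) (pow-const 1))
    timeE-bound (e ∸′ f)     {δ} σ b = pow-+ {p = timeDegreeE e δ} {plus (timeDegreeE f δ) 1} (timeE-bound e σ b)
      (pow-+ {p = timeDegreeE f δ} {1} (timeE-bound f σ b) (pow-const 1))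
    timeE-bound (sumE x y e) {δ} {ρ} σ b = pow-+ {4} {p = 4} {δ y + plus (timeDegreeE e δ′) 7} (pow-const 4)
      (pow-∑ {p = δ y} {plus (timeDegreeE e δ′) 7} (b y) λ i i<y →
        ≤-trans (≤-reflexive (+-assoc (timeE e (ρ [ x ≔ i ]) σ) 1 6))
          (pow-+ {p = timeDegreeE e δ′} {7} (timeE-bound e σ (bounded-bind x (δ y) i (≤-trans (<⇒≤ i<y) (b y)) b)) (pow-const 7)))
      where
      δ′ : ℕ → ℕ
      δ′ = δ [ x ≔ δ y ]
    timeE-bound (ifE e f g) {δ} {ρ} σ b = pow-+ {p = timeDegreeE e δ} {plus (timeDegreeE f δ ⊔ timeDegreeE g δ) 3} (timeE-bound e σ b) branches
      where
      branches : (if eval e ρ σ ≡ᵇ 0 then 1 + timeE g ρ σ else 1 + (timeE f ρ σ + 2)) ≤ m ^ plus (timeDegreeE f δ ⊔ timeDegreeE g δ) 3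
      branches with eval e ρ σ ≡ᵇ 0
      ... | true  = ≤-trans (≤-trans (≤-reflexive (+-comm 1 _)) (+-monoʳ-≤ (timeE g ρ σ) (s≤s z≤n)))
          (pow-+ {p = timeDegreeE f δ ⊔ timeDegreeE g δ} {3} (≤-trans (timeE-bound g σ b) (pow-mono (m≤n⊔m (timeDegreeE f δ) _))) (pow-const 3))
      ... | false = ≤-trans (≤-reflexive (sym (+-suc (timeE f ρ σ) 2)))
          (pow-+ {p = timeDegreeE f δ ⊔ timeDegreeE g δ} {3} (≤-trans (timeE-bound f σ b) (pow-mono (m≤m⊔n (timeDegreeE f δ) _))) (pow-const 3))

    module _ {n : ℕ} (oracle : Subset n → Bool) where
      open Compilation oracle

      time-bound : ∀ s {δ ρ} σ → analysable s ≡ true → ρ 1 ≡ n → Bounded δ ρ → time s ρ σ ≤ m ^ timeDegree s δ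
      time-bound (set a e f) {δ} {ρ} σ ok ρ1 b = pow-+ {p = timeDegreeE e δ} {plus (timeDegreeE f δ) 8} (timeE-bound e σ b)
        (≤-trans (≤-reflexive (shuffle (timeE f ρ σ))) (pow-+ {p = timeDegreeE f δ} {8} (timeE-bound f σ b) (pow-const 8)))
        where
        shuffle : ∀ t → 7 + (t + 1) ≡ t + 8
        shuffle = ℕS.solve-∀
      time-bound (s ⍮ s′) {δ} {ρ} σ ok ρ1 b = pow-+ {p = timeDegree s δ} {timeDegree s′ δ}
        (time-bound s σ (proj₁ (∧-true ok)) ρ1 b) (time-bound s′ (exec s ρ σ) (proj₂ (∧-true {analysable s} ok)) ρ1 b)
      time-bound (for x y s) {δ} {ρ} σ ok ρ1 b = pow-+ {3} {p = 3} {δ y + plus (timeDegree s δ′) 6} (pow-const 3)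
        (pow-∑ {p = δ y} {plus (timeDegree s δ′) 6} (b y) λ i i<y → pow-+ {p = timeDegree s δ′} {6}
          (time-bound s _ (proj₁ (∧-true ok)) (trans (≔-miss ρ x 1 i (<⇒≢ (<ᵇ-true 1 x (proj₂ (∧-true {analysable s} ok))))) ρ1)
            (bounded-bind x (δ y) i (≤-trans (<⇒≤ i<y) (b y)) b)) (pow-const 6))
        where
        δ′ : ℕ → ℕ
        δ′ = δ [ x ≔ δ y ]
      time-bound (when e s) {δ} {ρ} σ ok ρ1 b = pow-+ {p = timeDegreeE e δ} {plus (timeDegree s δ) 1} (timeE-bound e σ b) branches
        where
        branches : (if eval e ρ σ ≡ᵇ 0 then 1 else 1 + time s ρ σ) ≤ m ^ plus (timeDegree s δ) 1
        branches with eval e ρ σ ≡ᵇ 0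
        ... | true  = m^n>0 m (plus (timeDegree s δ) 1)
        ... | false = ≤-trans (≤-reflexive (+-comm 1 (time s ρ σ))) (pow-+ {p = timeDegree s δ} {1} (time-bound s σ ok ρ1 b) (pow-const 1))
      time-bound (letS x e s) {δ} {ρ} σ ok ρ1 b = pow-+ {p = timeDegreeE e δ} {timeDegree s (δ [ x ≔ valueDegree e δ ])} (timeE-bound e σ b)
        (time-bound s σ (proj₁ (∧-true rest)) (trans (≔-miss ρ x 1 _ (<⇒≢ (<ᵇ-true 1 x (proj₂ (∧-true {analysable s} rest))))) ρ1)
          (bounded-bind x (valueDegree e δ) (eval e ρ σ) (value-bound e σ (proj₁ (∧-true ok)) b) b))
        where
        rest : analysable s ∧ (1 <ᵇ x) ≡ true
        rest = proj₂ (∧-true {bounded e} ok)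
      time-bound (ask a b) {δ} {ρ} σ ok ρ1 bd = ≤-trans (≤-reflexive (shuffle (∑ n (λ _ → 17))))
        (pow-+ {14} {p = 14} {δ 1 + 17} (pow-const 14) (pow-∑ {p = δ 1} {17} (subst (_≤ m ^ δ 1) ρ1 (bd 1)) λ _ _ → pow-const 17))
        where
        shuffle : ∀ t → 3 + t + (1 + (1 + (1 + (7 + 1)))) ≡ 14 + t
        shuffle = ℕS.solve-∀

  -- Frame rules and loop invariants of the source language

  reads : Exp → ℕ → Bool
  reads (con c)      b = false
  reads (var x)      b = false
  reads (arr a e)    b = (b ≡ᵇ a) ∨ reads e b
  reads (e ∔ f)      b = reads e b ∨ reads f b
  reads (e ∸′ f)     b = reads e b ∨ reads f b
  reads (sumE x y e) b = reads e b
  reads (ifE e f g)  b = reads e b ∨ (reads f b ∨ reads g b)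

  eval-cong : ∀ e ρ {σ σ′ : Arrays} → (∀ b → reads e b ≡ true → ∀ j → σ b j ≡ σ′ b j) → eval e ρ σ ≡ eval e ρ σ′
  eval-cong (con c)      ρ h = refl
  eval-cong (var x)      ρ h = refl
  eval-cong (arr a e)    ρ {σ} {σ′} h = trans (cong (σ a) (eval-cong e ρ λ b r → h b (∨-introʳ {b ≡ᵇ a} r)))
    (h a (∨-introˡ (≡ᵇ-refl a)) (eval e ρ σ′))
  eval-cong (e ∔ f)      ρ h = cong₂ _+_ (eval-cong e ρ λ b r → h b (∨-introˡ r)) (eval-cong f ρ λ b r → h b (∨-introʳ {reads e b} r))
  eval-cong (e ∸′ f)     ρ h = cong₂ _∸_ (eval-cong e ρ λ b r → h b (∨-introˡ r)) (eval-cong f ρ λ b r → h b (∨-introʳ {reads e b} r))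
  eval-cong (sumE x y e) ρ h = ∑-cong (ρ y) λ i _ → eval-cong e (ρ [ x ≔ i ]) h
  eval-cong (ifE e f g)  ρ {σ} {σ′} h = branches (eval-cong e ρ λ b r → h b (∨-introˡ r))
    (eval-cong f ρ λ b r → h b (∨-introʳ {reads e b} (∨-introˡ r))) (eval-cong g ρ λ b r → h b (∨-introʳ {reads e b} (∨-introʳ {reads f b} r)))
    where
    branches : ∀ {u u′ v v′ w w′ : ℕ} → u ≡ u′ → v ≡ v′ → w ≡ w′ → (if u ≡ᵇ 0 then w else v) ≡ (if u′ ≡ᵇ 0 then w′ else v′)
    branches refl refl refl = refl

  writes : Stm → ℕ → Bool
  writes (set a e f)  b = b ≡ᵇ a
  writes (s ⍮ s′)     b = writes s b ∨ writes s′ b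
  writes (for x y s)  b = writes s b
  writes (when e s)   b = writes s b
  writes (letS x e s) b = writes s b
  writes (ask a c)    b = b ≡ᵇ c

  ∨-falseˡ : ∀ {a b} → a ∨ b ≡ false → a ≡ false
  ∨-falseˡ {false} _ = refl

  ∨-falseʳ : ∀ {a b} → a ∨ b ≡ false → b ≡ false
  ∨-falseʳ {false} h = h

  iterate-inv : ∀ (I : ℕ → Arrays → Set) (f : ℕ → Arrays → Arrays) m {σ} → I 0 σ →
    (∀ i σ′ → i < m → I i σ′ → I (suc i) (f i σ′)) → I m (iterate f m σ)
  iterate-inv I f zero    I₀ step = I₀
  iterate-inv I f (suc m) I₀ step =
    step m _ ≤-refl (iterate-inv I f m I₀ λ i σ′ i<m → step i σ′ (m<n⇒m<1+n i<m))

  put-miss : ∀ a i v (σ : Arrays) b j → (b ≡ᵇ a) ≡ false → put a i v σ b j ≡ σ b j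
  put-miss a i v σ b j h rewrite h = refl

  module ProgramLogic {n : ℕ} (oracle : Subset n → Bool) where
    open Compilation oracle

    exec-lets : ∀ ps s ρ σ → exec (withLets ps s) ρ σ ≡ exec s (letEnv ps ρ σ) σ
    exec-lets []             s ρ σ = refl
    exec-lets ((x , e) ∷ ps) s ρ σ = exec-lets ps s (ρ [ x ≔ eval e ρ σ ]) σ

    time-lets : ∀ ps s s′ ρ σ → time (withLets ps (s ⍮ s′)) ρ σ
      ≡ time (withLets ps s) ρ σ + time s′ (letEnv ps ρ σ) (exec s (letEnv ps ρ σ) σ)
    time-lets []             s s′ ρ σ = refl
    time-lets ((x , e) ∷ ps) s s′ ρ σ =
      trans (cong (timeE e ρ σ +_) (time-lets ps s s′ (ρ [ x ≔ eval e ρ σ ]) σ)) (sym (+-assoc (timeE e ρ σ) _ _))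

    frame : ∀ s ρ σ b → writes s b ≡ false → ∀ j → exec s ρ σ b j ≡ σ b j
    frame (set a e f)  ρ σ b h j = put-miss a (eval e ρ σ) (eval f ρ σ) σ b j h
    frame (s ⍮ s′)     ρ σ b h j = trans (frame s′ ρ _ b (∨-falseʳ {writes s b} h) j) (frame s ρ σ b (∨-falseˡ h) j)
    frame (for x y s)  ρ σ b h j = iterate-inv (λ _ σ′ → σ′ b j ≡ σ b j) (λ v → exec s (ρ [ x ≔ v ])) (ρ y) refl
      λ i σ′ _ eq → trans (frame s (ρ [ x ≔ i ]) σ′ b h j) eq
    frame (when e s)   ρ σ b h j with eval e ρ σ ≡ᵇ 0
    ... | true  = refl
    ... | false = frame s ρ σ b h j
    frame (letS x e s) ρ σ b h j = frame s _ σ b h j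
    frame (ask a c)    ρ σ b h j = put-miss c 0 (askValue σ a) σ b j h

    for-inv : ∀ (I : ℕ → Arrays → Set) x y s {ρ σ l} → ρ y ≡ l → I 0 σ →
      (∀ i σ′ → i < l → I i σ′ → I (suc i) (exec s (ρ [ x ≔ i ]) σ′)) → I l (exec (for x y s) ρ σ)
    for-inv I x y s {ρ} refl I₀ step = iterate-inv I (λ v → exec s (ρ [ x ≔ v ])) (ρ y) I₀ step

    -- Since `e` does not read the array being filled, each cell receives the value that `e` has in
    -- the state before the loop.
    fill-loop : ∀ x y a e {ρ l} σ → ρ y ≡ l → reads e a ≡ false → ∀ i → i < l →
      exec (for x y (set a (var x) e)) ρ σ a i ≡ eval e (ρ [ x ≔ i ]) σ
    fill-loop x y a e {ρ} {l} σ ρy fresh i i<l =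
      proj₂ (for-inv I x y (set a (var x) e) {ρ} {σ} ρy ((λ _ _ _ → refl) , λ _ ()) next-step) i i<l
      where
      I : ℕ → Arrays → Set
      I m σ′ = (∀ b → reads e b ≡ true → ∀ j → σ′ b j ≡ σ b j) × (∀ j → j < m → σ′ a j ≡ eval e (ρ [ x ≔ j ]) σ)
      next-step : ∀ m σ′ → m < l → I m σ′ → I (suc m) (exec (set a (var x) e) (ρ [ x ≔ m ]) σ′)
      next-step m σ′ m<l (others , done) = others′ , done′
        where
        others′ : ∀ b → reads e b ≡ true → ∀ j → exec (set a (var x) e) (ρ [ x ≔ m ]) σ′ b j ≡ σ b j
        others′ b r j = trans (put-miss a _ _ σ′ b j (≡ᵇ-false {b} {a} λ b≡a → true≢false r (trans (cong (reads e) b≡a) fresh))) (others b r j)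
        done′ : ∀ j → j < suc m → exec (set a (var x) e) (ρ [ x ≔ m ]) σ′ a j ≡ eval e (ρ [ x ≔ j ]) σ
        done′ j j<1+m rewrite ≡ᵇ-refl a | ≔-hit ρ x m with j ≡ᵇ m in eq
        ... | true rewrite ≡ᵇ-true j m eq = eval-cong e (ρ [ x ≔ m ]) others
        ... | false = done j (≤∧≢⇒< (≤-pred j<1+m) λ where refl → true≢false (≡ᵇ-refl j) eq)

  -- The program

  -- Registers: 0 base address, 1 n, 2 k, 3 h, 4 W, 5 N, 6 Θ, 7 cap, 8 U, 9 initial
  -- budget, 10 bound on costs and budgets, 11 T, 12 bound on weights, 13 number of
  -- guesses; loops over elements use 30 and 45, loops over rows 35.
  -- Arrays: 0 input, 1 digits of the guess, 2 A, 3 F, 4 A′, 5 F′, 6 J, 7 query and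
  -- scratch, 8 oracle answer, 9 accumulated costs, 10 weights, 11 budget, 12 rank,
  -- 13 outcome of a test, 14 best solution, 15 carry (initially the number of guesses).

  cell : ℕ → Exp
  cell a = arr a (con 0)

  distanceE equalE : Exp → Exp → Exp
  distanceE e f = (e ∸′ f) ∔ (f ∸′ e)
  equalE e f = ifE (distanceE e f) (con 0) (con 1)

  -- Costs are stored row by row after four parameters and k budgets; the row index is in register
  -- 35, and `sumE` forms its product with n.
  demandE costE : ℕ → Exp
  demandE e = arr 0 (con 4 ∔ var 2 ∔ sumE 80 35 (var 1) ∔ var e)

  supplyE : Exp
  supplyE = arr 0 (con 4 ∔ var 35)

  -- Division by counting: the number of x with x B < N d is N d / B rounded up for B > 0, and the
  -- cap only limits the count.
  costE e = sumE 50 7 (ifE (sumE 60 5 (demandE e) ∸′ sumE 60 50 supplyE) (con 1) (con 0))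

  unsafeE : Exp
  unsafeE = sumE 45 1 (ifE (arr 4 (var 45) ∔ arr 5 (var 45)) (costE 45) (con 0)) ∸′ (cell 11 ∔ var 6 ∔ var 6)

  sizeE : ℕ → Exp
  sizeE a = sumE 45 1 (ifE (arr a (var 45)) (con 1) (con 0))

  -- The product of a cost and an excess in `weightE` is the excess summed over the levels below the
  -- cost. `lightE` is 0 throughout when h = n: then the guess has to name a whole basis.
  excessE weightE lightE : Exp
  excessE = ifE unsafeE (arr 9 (var 35) ∸′ sumE 45 20 (cell 11)) (con 0)
  weightE = sumE 35 2 (sumE 40 7 (ifE (costE 30 ∸′ var 40) excessE (con 0)))
  lightE  = ifE (var 1 ∸′ var 3) (ifE (sumE 35 2 (costE 30) ∸′ var 6) (con 0) (con 1)) (con 0)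

  candidateE : Exp
  candidateE = ifE (arr 5 (var 22)) (equalE (arr 10 (var 22)) (var 21)) (con 0)

  queryE : Exp
  queryE = ifE (equalE (var 23) (var 22)) (con 1) (arr 6 (var 23))

  -- Instead of sorting, the scan visits every possible weight and every element of that weight. The
  -- rounded costs keep the range of weights polynomial in n and k.
  tryAdd greedyScan greedy : Stm
  tryAdd = for 23 1 (set 7 (var 23) queryE)
    ⍮ ask 7 8 ⍮ when (cell 8) (set 6 (var 22) (con 1))
  greedyScan = for 21 12 (for 22 1 (when candidateE tryAdd))
  greedy = for 21 1 (set 6 (var 21) (arr 4 (var 21))) ⍮ greedyScan

  addCosts iteration : Stm
  addCosts = for 35 2 (set 9 (var 35) (arr 9 (var 35) ∔ sumE 45 1 (ifE (arr 6 (var 45)) (costE 45) (con 0))))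
  iteration = for 30 1 (set 10 (var 30) weightE) ⍮ greedy ⍮ addCosts

  outcomeE : Exp
  outcomeE = ifE (cell 8) (ifE (distanceE (sizeE 6) (cell 12)) (con 0)
    (ifE (sumE 35 2 (ifE unsafeE (arr 9 (var 35) ∸′ sumE 40 11 (con 1 ∔ cell 11)) (con 0))) (con 0) (con 1))) (con 0)

  test : Stm
  test = for 20 2 (set 9 (var 20) (con 0)) ⍮ for 20 11 iteration ⍮ ask 6 8 ⍮ set 13 (con 0) outcomeE

  -- Register 18 is the decision on the element in register 16: 0 takes it, 1 discards it. n passes
  -- suffice, as each pass that starts with free elements settles at least one.
  propose commit attempt sweep : Stm
  propose = for 19 1 (set 4 (var 19) (arr 2 (var 19) ∔ ifE (var 18) (con 0) (equalE (var 19) (var 16))))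
    ⍮ for 19 1 (set 5 (var 19) (ifE (equalE (var 19) (var 16)) (con 0) (arr 3 (var 19))))
  commit = for 19 1 (set 2 (var 19) (arr 4 (var 19))) ⍮ for 19 1 (set 3 (var 19) (arr 5 (var 19)))
    ⍮ set 11 (con 0) (cell 11 ∔ con 1)
  attempt = propose ⍮ test ⍮ when (cell 13) commit
  sweep = for 15 1 (for 16 1 (letS 17 (con 2) (for 18 17 (when (arr 3 (var 16)) attempt))))

  initialise : Stm
  initialise = for 30 1 (set 2 (var 30) (con 0)) ⍮ for 30 3 (set 2 (arr 1 (var 30)) (con 1))
    ⍮ for 30 1 (set 3 (var 30) lightE) ⍮ set 11 (con 0) (var 9)

  acceptableE : Exp
  acceptableE = ifE (cell 8) (ifE (distanceE (sizeE 2) (cell 12)) (con 0)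
    (ifE (sumE 35 2 (sumE 40 5 (sumE 45 1 (ifE (arr 2 (var 45)) (demandE 45) (con 0))) ∸′ sumE 40 8 supplyE)) (con 0) (con 1))) (con 0)

  -- Guesses are h-digit numbers in base n + 1. `nextDigit` first saves n minus the digit, because
  -- the new digit and the carry both depend on the old value.
  accept nextDigit nextGuess guessRound : Stm
  accept = ask 2 8 ⍮ set 13 (con 0) acceptableE ⍮ when (cell 13) (for 30 1 (set 14 (var 30) (arr 2 (var 30))))
  nextDigit = set 7 (con 0) (var 1 ∸′ arr 1 (var 30))
    ⍮ set 1 (var 30) (ifE (cell 7) (arr 1 (var 30) ∔ con 1) (con 0)) ⍮ set 15 (con 0) (ifE (cell 7) (con 0) (con 1))
  nextGuess = set 15 (con 0) (con 1) ⍮ for 30 3 (when (cell 15) nextDigit)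
  guessRound = initialise ⍮ sweep ⍮ accept ⍮ nextGuess

  -- The power of W, which is the number of guesses, arises by repeated summation. With nothing
  -- fixed, everything free and all weights still 0, `greedy` yields a basis of the matroid, whose
  -- size is the rank.
  setup : Stm
  setup = set 15 (con 0) (con 1) ⍮ for 13 3 (set 15 (con 0) (sumE 40 4 (cell 15)))
    ⍮ for 30 1 (set 5 (var 30) (con 1)) ⍮ greedy ⍮ set 12 (con 0) (sizeE 6)

  -- The minimum of n and 6k/ε rounded down, found by counting the x below n with (x + 1) p ≤ 6 k q,
  -- where ε = p/q.
  guessSizeE : Exp
  guessSizeE = sumE 4 1 (ifE ((arr 0 (con 2) ∔ sumE 8 4 (arr 0 (con 2))) ∸′ sumE 9 2 (q ∔ q ∔ q ∔ q ∔ q ∔ q)) (con 0) (con 1))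
    where
    q : Exp
    q = arr 0 (con 3)

  search-all : Stm
  search-all = letS 13 (cell 15) (for 14 13 guessRound)

  -- The values are W = n + 1, N = (h + 1) W, Θ = 2 k W, a cap above both N and Θ so that no usable
  -- cost is truncated, the limit U = N + 3Θ (or N if h = n) and the initial budget N + n. The last
  -- three bound all loads and budgets, exceed the number of iterations that `regret` asks for, and
  -- bound the weights.
  widthE scaleE thetaE capE limitE budgetE rangeE stepsE weightBoundE : Exp
  widthE       = var 1 ∔ con 1
  scaleE       = var 4 ∔ sumE 40 3 (var 4)
  thetaE       = sumE 40 2 (var 4 ∔ var 4)
  capE         = var 6 ∔ var 5 ∔ con 1
  limitE       = ifE (var 1 ∸′ var 3) (var 5 ∔ var 6 ∔ var 6 ∔ var 6) (var 5)
  budgetE      = var 5 ∔ var 1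
  rangeE       = sumE 40 1 (var 7) ∔ var 9 ∔ var 1
  stepsE       = con 1 ∔ sumE 40 2 (sumE 42 10 (var 10))
  weightBoundE = con 1 ∔ sumE 40 2 (sumE 42 7 (sumE 44 11 (sumE 46 1 (var 7))))

  parameters : List (ℕ × Exp)
  parameters = (3 , guessSizeE) ∷ (4 , widthE) ∷ (5 , scaleE) ∷ (6 , thetaE) ∷ (7 , capE)
    ∷ (8 , limitE) ∷ (9 , budgetE) ∷ (10 , rangeE) ∷ (11 , stepsE) ∷ (12 , weightBoundE) ∷ []

  -- Opaque names, so that the programs are never unfolded when types are compared.
  abstract
    enumerated main : Stm
    enumerated = setup
    main = withLets parameters (setup ⍮ search-all)

    enumerated-text : enumerated ≡ setup
    enumerated-text = refl

    main-text : main ≡ withLets parameters (setup ⍮ search-all)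
    main-text = refl

  main-wf : wf visible₃ 3 main ≡ true
  main-wf = subst (λ s → wf visible₃ 3 s ≡ true) (sym main-text) refl

  -- Correctness of the program

  ∑-cong₂ : ∀ {m l f g} → m ≡ l → (∀ i → i < l → f i ≡ g i) → ∑ m f ≡ ∑ l g
  ∑-cong₂ {m} refl eq = ∑-cong m eq

  if-cong : ∀ {u u′ v v′ w w′ : ℕ} → u ≡ u′ → v ≡ v′ → w ≡ w′ → (if u ≡ᵇ 0 then v else w) ≡ (if u′ ≡ᵇ 0 then v′ else w′)
  if-cong refl refl refl = refl

  if-bit : ∀ u v → (if u ≡ᵇ 0 then 0 else v) ≡ bit (0 <ᵇ u) * v
  if-bit zero    v = refl
  if-bit (suc u) v = sym (+-identityʳ v)

  distance : ℕ → ℕ → ℕ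
  distance x y = (x ∸ y) + (y ∸ x)

  distance≡0 : ∀ x y → (distance x y ≡ᵇ 0) ≡ (x ≡ᵇ y)
  distance≡0 x y = bool-ext
    (λ h → ≡ᵇ-intro {x} (≤-antisym (m∸n≡0⇒m≤n (m+n≡0⇒m≡0 (x ∸ y) (≡ᵇ-true _ 0 h))) (m∸n≡0⇒m≤n (m+n≡0⇒n≡0 (x ∸ y) (≡ᵇ-true _ 0 h)))))
    (λ h → ≡ᵇ-intro {distance x y} (zero-distance (≡ᵇ-true x y h)))
    where
    zero-distance : ∀ {x y} → x ≡ y → distance x y ≡ 0
    zero-distance {x} refl = cong₂ _+_ (n∸n≡0 x) (n∸n≡0 x)

  setOf : Arrays → ℕ → FSet
  setOf σ a e = 0 <ᵇ σ a e

  module GreedySpec {n : ℕ} (oracle : Subset n → Bool) (M : FMatroid n)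
    (ind-oracle : ∀ S → oracle (tabulate λ e → S (toℕ e)) ≡ FMatroid.ind M S) where
    open FMatroid M
    open Matroids M
    open Compilation oracle
    open ProgramLogic oracle

    ind-ext : ∀ {S T} → (∀ e → e < n → S e ≡ T e) → ind S ≡ ind T
    ind-ext h = bool-ext (ind-mono λ e e<n t → trans (h e e<n) t) (ind-mono λ e e<n s → trans (sym (h e e<n)) s)

    ask-ind : ∀ σ a {S} → (∀ e → e < n → setOf σ a e ≡ S e) → askValue σ a ≡ bit (ind S)
    ask-ind σ a h = cong bit (trans (ind-oracle (setOf σ a)) (ind-ext h))

    tryAdd-spec : ∀ ρ σ → ρ 1 ≡ n → ∀ x → x < n →
      setOf (exec tryAdd ρ σ) 6 x ≡ (if ind (setOf σ 6 ⊕ ρ 22) then setOf σ 6 ⊕ ρ 22 else setOf σ 6) x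
    tryAdd-spec ρ σ ρ1 x x<n = trans (cong (0 <ᵇ_) result) (decide (ind (setOf σ 6 ⊕ ρ 22)))
      where
      copy : Stm
      copy = for 23 1 (set 7 (var 23) queryE)
      σ₁ : Arrays
      σ₁ = exec copy ρ σ
      query-set : ∀ i → i < n → setOf σ₁ 7 i ≡ (setOf σ 6 ⊕ ρ 22) i
      query-set i i<n = trans (cong (0 <ᵇ_) (fill-loop 23 1 7 queryE {ρ} σ ρ1 refl i i<n)) (value (distance i (ρ 22)) (distance≡0 i (ρ 22)))
        where
        value : ∀ d → (d ≡ᵇ 0) ≡ (i ≡ᵇ ρ 22) →
          (0 <ᵇ (if (if d ≡ᵇ 0 then 1 else 0) ≡ᵇ 0 then σ 6 i else 1)) ≡ ((i ≡ᵇ ρ 22) ∨ setOf σ 6 i)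
        value d eq rewrite eq with i ≡ᵇ ρ 22
        ... | true  = refl
        ... | false = refl
      answer : askValue σ₁ 7 ≡ bit (ind (setOf σ 6 ⊕ ρ 22))
      answer = ask-ind σ₁ 7 query-set
      result : exec tryAdd ρ σ 6 x ≡ (if askValue σ₁ 7 ≡ᵇ 0 then σ₁ 6 x else (if x ≡ᵇ ρ 22 then 1 else σ₁ 6 x))
      result with askValue σ₁ 7 ≡ᵇ 0
      ... | true  = refl
      ... | false = refl
      unchanged : σ₁ 6 x ≡ σ 6 x
      unchanged = frame copy ρ σ 6 refl x
      decide : ∀ (b : Bool) → (0 <ᵇ (if askValue σ₁ 7 ≡ᵇ 0 then σ₁ 6 x else (if x ≡ᵇ ρ 22 then 1 else σ₁ 6 x)))
        ≡ (if ind (setOf σ 6 ⊕ ρ 22) then setOf σ 6 ⊕ ρ 22 else setOf σ 6) x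
      decide _ rewrite answer | unchanged with ind (setOf σ 6 ⊕ ρ 22)
      ... | false = refl
      ... | true with x ≡ᵇ ρ 22
      ...   | true  = refl
      ...   | false = refl

    module _ (k : ℕ) (c : ℕ → ℕ → ℕ) (Θ : ℕ) where
      open MultiplicativeWeights M k c Θ

      -- After the scan has passed all pairs (w x , x) below (v , e) in
      -- lexicographic order, J is a greedy choice among those elements.
      record Scanned (A F : FSet) (w : ℕ → ℕ) (v e : ℕ) (σ : Arrays) : Set where
        constructor scanned
        field
          keepF    : ∀ x → x < n → setOf σ 5 x ≡ F x
          keepw    : ∀ x → x < n → σ 10 x ≡ w x
          contains : A ⊆ setOf σ 6
          within   : setOf σ 6 ⊆ A ∪ atMost F w v
          indep    : ind A ≡ true → ind (setOf σ 6) ≡ true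
          rejected : ∀ x → x < n → F x ≡ true → setOf σ 6 x ≡ false → w x < v ⊎ (w x ≡ v × x < e) →
            ind ((setOf σ 6 ∩ (A ∪ atMost F w (w x))) ⊕ x) ≡ false

      ∩-⊕-mono : ∀ {S T L x} → S ⊆ T → (S ∩ L) ⊕ x ⊆ (T ∩ L) ⊕ x
      ∩-⊕-mono {S} {T} {L} {x} h = ⊕-mono x λ y y<n m → ∧-intro (h y y<n (proj₁ (∧-true m))) (proj₂ (∧-true {S y} m))

      candidate-value : ∀ ρ σ {A F w v e} → e < n → Scanned A F w v e σ →
        eval candidateE (ρ [ 21 ≔ v ] [ 22 ≔ e ]) σ ≡ bit (F e ∧ (w e ≡ᵇ v))
      candidate-value ρ σ {A} {F} {w} {v} {e} e<n sc = value (σ 5 e) (distance (σ 10 e) v) (Scanned.keepF sc e e<n)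
          (trans (distance≡0 (σ 10 e) v) (cong (_≡ᵇ v) (Scanned.keepw sc e e<n)))
        where
        value : ∀ f d {p q} → (0 <ᵇ f) ≡ p → (d ≡ᵇ 0) ≡ q → (if f ≡ᵇ 0 then 0 else (if d ≡ᵇ 0 then 1 else 0)) ≡ bit (p ∧ q)
        value zero    d refl refl = refl
        value (suc f) d refl refl = refl

      scan-step : ∀ ρ σ {A F w v e} → ρ 1 ≡ n → e < n → Scanned A F w v e σ →
        Scanned A F w v (suc e) (exec (when candidateE tryAdd) (ρ [ 21 ≔ v ] [ 22 ≔ e ]) σ)
      scan-step ρ σ {A} {F} {w} {v} {e} ρ1 e<n sc rewrite candidate-value ρ σ e<n sc with F e ∧ (w e ≡ᵇ v) in cand
      ... | false = scanned keepF keepw contains within indep rejected′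
        where
        open Scanned sc
        rejected′ : ∀ x → x < n → F x ≡ true → setOf σ 6 x ≡ false → w x < v ⊎ (w x ≡ v × x < suc e) → _
        rejected′ x x<n Fx Jx (inj₁ lt) = rejected x x<n Fx Jx (inj₁ lt)
        rejected′ x x<n Fx Jx (inj₂ (eq , x≤e)) with x ≟ e
        ... | yes refl = ⊥-elim (true≢false (∧-intro Fx (≡ᵇ-intro eq)) cand)
        ... | no  x≢e  = rejected x x<n Fx Jx (inj₂ (eq , ≤∧≢⇒< (≤-pred x≤e) x≢e))
      ... | true = decide (ind (J ⊕ e)) refl
        where
        open Scanned sc
        J : FSet
        J = setOf σ 6
        ρ′ : Store
        ρ′ = ρ [ 21 ≔ v ] [ 22 ≔ e ]
        σ′ : Arrays
        σ′ = exec tryAdd ρ′ σ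
        we : w e ≡ v
        we = ≡ᵇ-true (w e) v (proj₂ (∧-true {F e} cand))
        keepF′ : ∀ x → x < n → setOf σ′ 5 x ≡ F x
        keepF′ x x<n = trans (cong (0 <ᵇ_) (frame tryAdd ρ′ σ 5 refl x)) (keepF x x<n)
        keepw′ : ∀ x → x < n → σ′ 10 x ≡ w x
        keepw′ x x<n = trans (frame tryAdd ρ′ σ 10 refl x) (keepw x x<n)
        decide : ∀ b → ind (J ⊕ e) ≡ b → Scanned A F w v (suc e) σ′
        decide true added = scanned keepF′ keepw′ (λ x x<n Ax → trans (J′ x x<n) (∨-introʳ {x ≡ᵇ e} (contains x x<n Ax))) within′
            (λ _ → trans (ind-ext J′) added) rejected′
          where
          J′ : ∀ x → x < n → setOf σ′ 6 x ≡ (J ⊕ e) x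
          J′ x x<n = trans (tryAdd-spec ρ′ σ ρ1 x x<n) (cong (λ b → (if b then J ⊕ e else J) x) added)
          within′ : setOf σ′ 6 ⊆ A ∪ atMost F w v
          within′ x x<n h with ∨-true {x ≡ᵇ e} (trans (sym (J′ x x<n)) h)
          ... | inj₂ Jx = within x x<n Jx
          ... | inj₁ eq rewrite ≡ᵇ-true x e eq = ∨-introʳ {A e} (∧-intro (proj₁ (∧-true cand)) (<ᵇ-intro (≤-reflexive (cong suc we))))
          J⊆J′ : J ⊆ setOf σ′ 6
          J⊆J′ x x<n Jx = trans (J′ x x<n) (∨-introʳ {x ≡ᵇ e} Jx)
          rejected′ : ∀ x → x < n → F x ≡ true → setOf σ′ 6 x ≡ false → w x < v ⊎ (w x ≡ v × x < suc e) →
            ind ((setOf σ′ 6 ∩ (A ∪ atMost F w (w x))) ⊕ x) ≡ false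
          rejected′ x x<n Fx J′x before = dep-mono (∩-⊕-mono J⊆J′)
            (rejected x x<n Fx (¬true⇒false λ Jx → true≢false (J⊆J′ x x<n Jx) J′x) (earlier before))
            where
            earlier : w x < v ⊎ (w x ≡ v × x < suc e) → w x < v ⊎ (w x ≡ v × x < e)
            earlier (inj₁ lt) = inj₁ lt
            earlier (inj₂ (eq , x≤e)) with x ≟ e
            ... | yes refl = ⊥-elim (true≢false (trans (J′ x x<n) (⊕-here J x)) J′x)
            ... | no  x≢e  = inj₂ (eq , ≤∧≢⇒< (≤-pred x≤e) x≢e)
        decide false refused = scanned keepF′ keepw′ (λ x x<n Ax → trans (J′ x x<n) (contains x x<n Ax))
            (λ x x<n h → within x x<n (trans (sym (J′ x x<n)) h)) (λ iA → trans (ind-ext J′) (indep iA)) rejected′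
          where
          J′ : ∀ x → x < n → setOf σ′ 6 x ≡ J x
          J′ x x<n = trans (tryAdd-spec ρ′ σ ρ1 x x<n) (cong (λ b → (if b then J ⊕ e else J) x) refused)
          J⊆J′ : J ⊆ setOf σ′ 6
          J⊆J′ x x<n Jx = trans (J′ x x<n) Jx
          rejected′ : ∀ x → x < n → F x ≡ true → setOf σ′ 6 x ≡ false → w x < v ⊎ (w x ≡ v × x < suc e) →
            ind ((setOf σ′ 6 ∩ (A ∪ atMost F w (w x))) ⊕ x) ≡ false
          rejected′ x x<n Fx J′x (inj₁ lt) = dep-mono (∩-⊕-mono J⊆J′) (rejected x x<n Fx (trans (sym (J′ x x<n)) J′x) (inj₁ lt))
          rejected′ x x<n Fx J′x (inj₂ (eq , x≤e)) with x ≟ e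
          ... | no x≢e = dep-mono (∩-⊕-mono J⊆J′)
              (rejected x x<n Fx (trans (sym (J′ x x<n)) J′x) (inj₂ (eq , ≤∧≢⇒< (≤-pred x≤e) x≢e)))
          -- The element refused just now: all of `J` lies in `A` or at weights up to v = w x, so
          -- intersecting with that level loses nothing.
          ... | yes refl = dep-mono (⊕-mono x λ y y<n Jy → ∧-intro (J⊆J′ y y<n Jy)
              (subst (λ u → (A ∪ atMost F w u) y ≡ true) (sym eq) (within y y<n Jy))) refused

      -- The two inclusions stand apart from the independence of `A`, so that a test can infer this
      -- independence from an oracle answer about `J`.
      greedy-spec : ∀ ρ σ A F w V → ρ 1 ≡ n → ρ 12 ≡ V →
        (∀ x → x < n → setOf σ 4 x ≡ A x) → (∀ x → x < n → setOf σ 5 x ≡ F x) → (∀ x → x < n → σ 10 x ≡ w x) →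
        (∀ x → x < n → w x < V) →
        let J = setOf (exec greedy ρ σ) 6 in
        A ⊆ J × J ⊆ A ∪ F × (ind A ≡ true → Greedy A F w J)
      greedy-spec ρ σ A F w V ρ1 ρV hA hF hw small = Scanned.contains end , within-all , λ iA → record
          { contains = Scanned.contains end ; within = within-all ; indep = Scanned.indep end iA
          ; rejected = λ x x<n Fx Jx → Scanned.rejected end x x<n Fx Jx (inj₁ (small x x<n)) }
        where
        copy : Stm
        copy = for 21 1 (set 6 (var 21) (arr 4 (var 21)))
        σ₁ : Arrays
        σ₁ = exec copy ρ σ
        J₁ : ∀ x → x < n → setOf σ₁ 6 x ≡ A x
        J₁ x x<n = trans (cong (0 <ᵇ_) (fill-loop 21 1 6 (arr 4 (var 21)) {ρ} σ ρ1 refl x x<n)) (hA x x<n)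
        start : Scanned A F w 0 0 σ₁
        start = scanned (λ x x<n → trans (cong (0 <ᵇ_) (frame copy ρ σ 5 refl x)) (hF x x<n)) (λ x x<n → trans (frame copy ρ σ 10 refl x) (hw x x<n))
          (λ x x<n Ax → trans (J₁ x x<n) Ax) (λ x x<n Jx → ∨-introˡ (trans (sym (J₁ x x<n)) Jx)) (λ iA → trans (ind-ext J₁) iA)
          λ { x x<n Fx Jx (inj₁ ()) ; x x<n Fx Jx (inj₂ (_ , ())) }
        next-level : ∀ {v σ′} → Scanned A F w v n σ′ → Scanned A F w (suc v) 0 σ′
        next-level {v} {σ′} sc = scanned keepF keepw contains (λ x x<n Jx → raise x (∨-true {A x} (within x x<n Jx))) indep
            λ { x x<n Fx Jx (inj₁ lt) → rejected x x<n Fx Jx (split x x<n lt) ; x x<n Fx Jx (inj₂ (_ , ())) }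
          where
          open Scanned sc
          raise : ∀ x → A x ≡ true ⊎ atMost F w v x ≡ true → (A ∪ atMost F w (suc v)) x ≡ true
          raise x (inj₁ Ax) = ∨-introˡ Ax
          raise x (inj₂ Lx) = ∨-introʳ {A x} (∧-intro (proj₁ (∧-true Lx)) (<ᵇ-intro (m<n⇒m<1+n (<ᵇ-true (w x) (suc v) (proj₂ (∧-true {F x} Lx))))))
          split : ∀ x → x < n → w x < suc v → w x < v ⊎ (w x ≡ v × x < n)
          split x x<n lt with w x ≟ v
          ... | yes eq = inj₂ (eq , x<n)
          ... | no  ne = inj₁ (≤∧≢⇒< (≤-pred lt) ne)
        end : Scanned A F w V 0 (exec greedy ρ σ)
        end = for-inv (λ v → Scanned A F w v 0) 21 12 (for 22 1 (when candidateE tryAdd)) {ρ} ρV start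
          λ v σ′ v<V sc → next-level (for-inv (λ e → Scanned A F w v e) 22 1 (when candidateE tryAdd) {ρ [ 21 ≔ v ]} ρ1 sc
            λ e σ″ e<n sc′ → scan-step ρ σ″ ρ1 e<n sc′)
        within-all : setOf (exec greedy ρ σ) 6 ⊆ A ∪ F
        within-all x x<n Jx with ∨-true {A x} (Scanned.within end x x<n Jx)
        ... | inj₁ Ax = ∨-introˡ Ax
        ... | inj₂ Lx = ∨-introʳ {A x} (proj₁ (∧-true Lx))

  -- The quantities held in registers 3 to 12, as functions of the input.
  module Parameters (n k : ℕ) (input : ℕ → ℕ) where

    h W N Θ cap U b₀ D₀ steps V : ℕ
    h = ∑ n λ x → if (input 2 + ∑ x λ _ → input 2) ∸ (∑ k λ _ → input 3 + input 3 + input 3 + input 3 + input 3 + input 3) ≡ᵇ 0 then 1 else 0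
    W = n + 1
    N = W + ∑ h λ _ → W
    Θ = ∑ k λ _ → W + W
    cap = Θ + N + 1
    U = if n ∸ h ≡ᵇ 0 then N else N + Θ + Θ + Θ
    b₀ = N + n
    D₀ = (∑ n λ _ → cap) + b₀ + n
    steps = 1 + ∑ k λ _ → ∑ D₀ λ _ → D₀
    V = 1 + ∑ k λ _ → ∑ cap λ _ → ∑ steps λ _ → ∑ n λ _ → cap

    demand : ℕ → ℕ → ℕ
    demand j e = input (4 + k + (∑ j λ _ → n) + e)

    supply : ℕ → ℕ
    supply j = input (4 + j)

    -- N d / B rounded up, and truncated at cap.
    c : ℕ → ℕ → ℕ
    c j e = ∑ cap λ x → if (∑ N λ _ → demand j e) ∸ (∑ x λ _ → supply j) ≡ᵇ 0 then 0 else 1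

    c≤cap : ∀ j e → c j e ≤ cap
    c≤cap j e = ≤-trans (∑-bound cap λ x _ → le (((∑ N λ _ → demand j e) ∸ (∑ x λ _ → supply j)) ≡ᵇ 0)) (≤-reflexive (*-identityʳ cap))
      where
      le : ∀ b → (if b then 0 else 1) ≤ 1
      le true  = z≤n
      le false = ≤-refl

    Good : Store → Set
    Good ρ = ρ 1 ≡ n × ρ 2 ≡ k × ρ 3 ≡ h × ρ 4 ≡ W × ρ 5 ≡ N × ρ 6 ≡ Θ × ρ 7 ≡ cap × ρ 8 ≡ U × ρ 9 ≡ b₀ × ρ 10 ≡ D₀ × ρ 11 ≡ steps × ρ 12 ≡ V

    module _ {ρ : Store} (good : Good ρ) where
      ρ1 : ρ 1 ≡ n
      ρ1 = proj₁ good
      ρ2 : ρ 2 ≡ k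
      ρ2 = proj₁ (proj₂ good)
      ρ3 : ρ 3 ≡ h
      ρ3 = proj₁ (proj₂ (proj₂ good))
      ρ4 : ρ 4 ≡ W
      ρ4 = proj₁ (proj₂ (proj₂ (proj₂ good)))
      ρ5 : ρ 5 ≡ N
      ρ5 = proj₁ (proj₂ (proj₂ (proj₂ (proj₂ good))))
      ρ6 : ρ 6 ≡ Θ
      ρ6 = proj₁ (proj₂ (proj₂ (proj₂ (proj₂ (proj₂ good)))))
      ρ7 : ρ 7 ≡ cap
      ρ7 = proj₁ (proj₂ (proj₂ (proj₂ (proj₂ (proj₂ (proj₂ good))))))
      ρ8 : ρ 8 ≡ U
      ρ8 = proj₁ (proj₂ (proj₂ (proj₂ (proj₂ (proj₂ (proj₂ (proj₂ good)))))))
      ρ9 : ρ 9 ≡ b₀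
      ρ9 = proj₁ (proj₂ (proj₂ (proj₂ (proj₂ (proj₂ (proj₂ (proj₂ (proj₂ good))))))))
      ρ11 : ρ 11 ≡ steps
      ρ11 = proj₁ (proj₂ (proj₂ (proj₂ (proj₂ (proj₂ (proj₂ (proj₂ (proj₂ (proj₂ (proj₂ good))))))))))
      ρ12 : ρ 12 ≡ V
      ρ12 = proj₂ (proj₂ (proj₂ (proj₂ (proj₂ (proj₂ (proj₂ (proj₂ (proj₂ (proj₂ (proj₂ good))))))))))

    Input : Arrays → Set
    Input σ = ∀ i → σ 0 i ≡ input i

    module _ {ρ : Store} {σ : Arrays} (good : Good ρ) (inp : Input σ) where

      demand-eval : ∀ j e → σ 0 (4 + ρ 2 + (∑ j λ _ → ρ 1) + e) ≡ demand j e
      demand-eval j e = trans (inp _) (cong (λ i → input (i + e)) (cong₂ _+_ (cong (4 +_) (ρ2 {ρ} good)) (∑-cong j λ _ _ → ρ1 {ρ} good)))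

      cost-eval : ∀ j e → (∑ (ρ 7) λ x → if (∑ (ρ 5) λ _ → σ 0 (4 + ρ 2 + (∑ j λ _ → ρ 1) + e)) ∸ (∑ x λ _ → σ 0 (4 + j)) ≡ᵇ 0 then 0 else 1) ≡ c j e
      cost-eval j e = ∑-cong₂ (ρ7 {ρ} good) λ x _ → if-cong (cong₂ _∸_ (∑-cong₂ (ρ5 {ρ} good) λ _ _ → demand-eval j e) (∑-cong x λ _ _ → inp (4 + j))) refl refl

  -- Soundness and completeness of the feasibility test

  module TestSpec {n : ℕ} (oracle : Subset n → Bool) (M : FMatroid n)
    (ind-oracle : ∀ S → oracle (tabulate λ e → S (toℕ e)) ≡ FMatroid.ind M S) (k : ℕ) (input : ℕ → ℕ) where
    open FMatroid M
    open Matroids M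
    open Parameters n k input
    open Polytope M k c using (full)
    open Relaxation M k c Θ
    open MultiplicativeWeights M k c Θ
    open Compilation oracle
    open ProgramLogic oracle
    open GreedySpec oracle M ind-oracle

    record Setting (A F : FSet) (b : ℕ) (σ : Arrays) : Set where
      constructor setting
      field
        inp   : Input σ
        setA  : ∀ x → x < n → setOf σ 4 x ≡ A x
        setF  : ∀ x → x < n → setOf σ 5 x ≡ F x
        bud   : σ 11 0 ≡ b
        ranks : σ 12 0 ≡ rank full

    open Setting

    preserves : Stm → Bool
    preserves s = not (writes s 0) ∧ (not (writes s 4) ∧ (not (writes s 5) ∧ (not (writes s 11) ∧ not (writes s 12))))

    setting-frame : ∀ s ρ σ {A F b} → preserves s ≡ true → Setting A F b σ → Setting A F b (exec s ρ σ)
    setting-frame s ρ σ ok st = setting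
      (λ i → trans (frame s ρ σ 0 (not-true (proj₁ (∧-true ok))) i) (inp st i))
      (λ x x<n → trans (cong (0 <ᵇ_) (frame s ρ σ 4 (not-true (proj₁ (∧-true ok₁))) x)) (setA st x x<n))
      (λ x x<n → trans (cong (0 <ᵇ_) (frame s ρ σ 5 (not-true (proj₁ (∧-true ok₂))) x)) (setF st x x<n))
      (trans (frame s ρ σ 11 (not-true (proj₁ (∧-true ok₃))) 0) (bud st))
      (trans (frame s ρ σ 12 (not-true (proj₂ (∧-true {not (writes s 11)} ok₃))) 0) (ranks st))
      where
      ok₁ = proj₂ (∧-true {not (writes s 0)} ok)
      ok₂ = proj₂ (∧-true {not (writes s 4)} ok₁)
      ok₃ = proj₂ (∧-true {not (writes s 5)} ok₂)

    sum-cost : ∀ ρ σ S a → Good ρ → Input σ → (∀ x → x < n → setOf σ a x ≡ S x) →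
      eval (sumE 45 1 (ifE (arr a (var 45)) (costE 45) (con 0))) ρ σ ≡ costOf S (ρ 35)
    sum-cost ρ σ S a good inp eq = ∑-cong₂ (ρ1 {ρ} good) λ e e<n →
      trans (if-bit (σ a e) _) (cong₂ (λ s z → bit s * z) (eq e e<n) (cost-eval {ρ} {σ} good inp (ρ 35) e))

    size-eval : ∀ ρ σ S a → ρ 1 ≡ n → (∀ x → x < n → setOf σ a x ≡ S x) → eval (sizeE a) ρ σ ≡ ∣ S ∣
    size-eval ρ σ S a r1 eq = ∑-cong₂ r1 λ e e<n → trans (if-bit (σ a e) 1) (trans (*-identityʳ _) (cong bit (eq e e<n)))

    module _ {ρ : Store} {σ : Arrays} {A F : FSet} {b : ℕ} (good : Good ρ) (st : Setting A F b σ) where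

      unsafe-eval : (eval unsafeE ρ σ ≡ᵇ 0) ≡ not (unsafe A F b (ρ 35))
      unsafe-eval = trans (cong (_≡ᵇ 0) (cong₂ _∸_ total-load limit)) (∸-zero (costOf (A ∪ F) (ρ 35)) (b + (Θ + Θ)))
        where
        0<ᵇ-+ : ∀ x y → (0 <ᵇ (x + y)) ≡ (0 <ᵇ x) ∨ (0 <ᵇ y)
        0<ᵇ-+ zero    y = refl
        0<ᵇ-+ (suc x) y = refl
        total-load : (∑ (ρ 1) λ e → if σ 4 e + σ 5 e ≡ᵇ 0 then 0
            else ∑ (ρ 7) λ x → if (∑ (ρ 5) λ _ → σ 0 (4 + ρ 2 + (∑ (ρ 35) λ _ → ρ 1) + e)) ∸ (∑ x λ _ → σ 0 (4 + ρ 35)) ≡ᵇ 0 then 0 else 1)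
          ≡ costOf (A ∪ F) (ρ 35)
        total-load = ∑-cong₂ (ρ1 {ρ} good) λ e e<n → trans (if-bit (σ 4 e + σ 5 e) _) (cong₂ (λ s z → bit s * z)
          (trans (0<ᵇ-+ (σ 4 e) (σ 5 e)) (cong₂ _∨_ (setA st e e<n) (setF st e e<n))) (cost-eval {ρ} {σ} good (inp st) (ρ 35) e))
        limit : σ 11 0 + ρ 6 + ρ 6 ≡ b + (Θ + Θ)
        limit = trans (cong₂ (λ x y → x + y + y) (bud st) (ρ6 {ρ} good)) (+-assoc b Θ Θ)
        ∸-zero : ∀ x y → (x ∸ y ≡ᵇ 0) ≡ not (y <ᵇ x)
        ∸-zero x y with y <ᵇ x in eq
        ... | true  = ≡ᵇ-false λ h → <⇒≱ (<ᵇ-true y x eq) (m∸n≡0⇒m≤n h)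
        ... | false = ≡ᵇ-intro (m≤n⇒m∸n≡0 (<ᵇ-false y x eq))

      excess-eval : eval excessE ρ σ ≡ (if unsafe A F b (ρ 35) then σ 9 (ρ 35) ∸ ρ 20 * b else 0)
      excess-eval rewrite unsafe-eval with unsafe A F b (ρ 35)
      ... | true  = cong (σ 9 (ρ 35) ∸_) (trans (∑-cong (ρ 20) λ _ _ → bud st) (∑-const (ρ 20) b))
      ... | false = refl

    weight-eval : ∀ {ρ σ A F b} (X : ℕ → ℕ) → Good ρ → Setting A F b σ → (∀ j → j < k → σ 9 j ≡ X j) →
      eval weightE ρ σ ≡ ∑ k (λ j → c j (ρ 30) * (if unsafe A F b j then X j ∸ ρ 20 * b else 0))
    weight-eval {ρ} {σ} {A} {F} {b} X good st hX = ∑-cong₂ (ρ2 {ρ} good) row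
      where
      row : ∀ j → j < k → eval (sumE 40 7 (ifE (costE 30 ∸′ var 40) excessE (con 0))) (ρ [ 35 ≔ j ]) σ
        ≡ c j (ρ 30) * (if unsafe A F b j then X j ∸ ρ 20 * b else 0)
      row j j<k = trans (∑-cong₂ (ρ7 {ρ} good) term) (trans (∑-* cap E _)
          (trans (cong (E *_) (∑-count cap (c j (ρ 30)) (c≤cap j (ρ 30)))) (*-comm E (c j (ρ 30)))))
        where
        E : ℕ
        E = if unsafe A F b j then X j ∸ ρ 20 * b else 0
        pick : ∀ u v w → (if u ∸ v ≡ᵇ 0 then 0 else w) ≡ w * bit (v <ᵇ u)
        pick u v w with v <ᵇ u in eq
        ... | true rewrite ≡ᵇ-false {u ∸ v} {0} (λ h → <⇒≱ (<ᵇ-true v u eq) (m∸n≡0⇒m≤n h)) = sym (*-identityʳ w)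
        ... | false rewrite m≤n⇒m∸n≡0 (<ᵇ-false v u eq) = sym (*-zeroʳ w)
        term : ∀ v → v < cap → eval (ifE (costE 30 ∸′ var 40) excessE (con 0)) (ρ [ 35 ≔ j ] [ 40 ≔ v ]) σ ≡ E * bit (v <ᵇ c j (ρ 30))
        term v _ = trans (if-cong (cong (_∸ v) (cost-eval {ρ} {σ} good (inp st) j (ρ 30))) refl
            (trans (excess-eval {ρ [ 35 ≔ j ] [ 40 ≔ v ]} good st) (cong (λ x → if unsafe A F b j then x ∸ ρ 20 * b else 0) (hX j j<k))))
          (pick (c j (ρ 30)) v E)

    addCosts-spec : ∀ ρ σ → Good ρ → Input σ → ∀ j → j < k → exec addCosts ρ σ 9 j ≡ σ 9 j + costOf (setOf σ 6) j
    addCosts-spec ρ σ good inp₀ = proj₂ (proj₂ end)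
      where
      rowE : Exp
      rowE = arr 9 (var 35) ∔ sumE 45 1 (ifE (arr 6 (var 45)) (costE 45) (con 0))
      I : ℕ → Arrays → Set
      I m σ′ = (Input σ′ × (∀ e → σ′ 6 e ≡ σ 6 e)) × (∀ j → m ≤ j → σ′ 9 j ≡ σ 9 j) × (∀ j → j < m → σ′ 9 j ≡ σ 9 j + costOf (setOf σ 6) j)
      end : I k (exec addCosts ρ σ)
      end = for-inv I 35 2 (set 9 (var 35) rowE) {ρ} {σ} (ρ2 {ρ} good) ((inp₀ , λ _ → refl) , (λ _ _ → refl) , λ _ ())
        λ m σ′ m<k ((inp′ , six) , later , done) → ((λ i → inp′ i) , λ e → six e)
          , (λ j m<j → trans (other m σ′ j (>⇒≢ m<j)) (later j (<⇒≤ m<j)))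
          , λ j j≤m → case j ≟ m of λ where
              (yes refl) → trans (this j σ′) (cong₂ _+_ (later j ≤-refl)
                (sum-cost (ρ [ 35 ≔ j ]) σ′ (setOf σ 6) 6 good inp′ λ x _ → cong (0 <ᵇ_) (six x)))
              (no j≢m)   → trans (other m σ′ j j≢m) (done j (≤∧≢⇒< (≤-pred j≤m) j≢m))
        where
        other : ∀ m σ′ j → j ≢ m → exec (set 9 (var 35) rowE) (ρ [ 35 ≔ m ]) σ′ 9 j ≡ σ′ 9 j
        other m σ′ j j≢m rewrite ≡ᵇ-false j≢m = refl
        this : ∀ j σ′ → exec (set 9 (var 35) rowE) (ρ [ 35 ≔ j ]) σ′ 9 j ≡ eval rowE (ρ [ 35 ≔ j ]) σ′
        this j σ′ rewrite ≡ᵇ-refl j = refl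

    costOf-bound : ∀ S j → costOf S j ≤ ∑ n λ _ → cap
    costOf-bound S j = ∑-mono n λ e _ → ≤-trans (cell-bound (S e) (c j e)) (c≤cap j e)
      where
      cell-bound : ∀ s x → bit s * x ≤ x
      cell-bound true  x = ≤-reflexive (+-identityʳ x)
      cell-bound false x = z≤n

    module TestRun (ρ : Store) (good : Good ρ) (A F : FSet) (b : ℕ) (σ : Arrays) (st : Setting A F b σ) where

      clear : Stm
      clear = for 20 2 (set 9 (var 20) (con 0))

      σ₀ : Arrays
      σ₀ = exec clear ρ σ

      loopBody : ℕ → Arrays → Arrays
      loopBody t = exec iteration (ρ [ 20 ≔ t ])

      state : ℕ → Arrays
      state t = iterate loopBody t σ₀

      J : ℕ → FSet
      J t = setOf (state (suc t)) 6

      open Iteration M k c Θ A F b J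

      state-setting : ∀ t → Setting A F b (state t)
      state-setting zero    = setting-frame clear ρ σ refl st
      state-setting (suc t) = setting-frame iteration (ρ [ 20 ≔ t ]) (state t) refl (state-setting t)

      weighed : ℕ → Arrays
      weighed t = exec (for 30 1 (set 10 (var 30) weightE)) (ρ [ 20 ≔ t ]) (state t)

      chosen : ℕ → Arrays
      chosen t = exec greedy (ρ [ 20 ≔ t ]) (weighed t)

      weighed-setting : ∀ t → Setting A F b (weighed t)
      weighed-setting t = setting-frame (for 30 1 (set 10 (var 30) weightE)) (ρ [ 20 ≔ t ]) (state t) refl (state-setting t)

      state-costs : ∀ t j → j < k → state t 9 j ≡ accumulated t j
      state-costs zero    j j<k = fill-loop 20 2 9 (con 0) {ρ} σ (ρ2 {ρ} good) refl j j<k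
      state-costs (suc t) j j<k = trans (addCosts-spec (ρ [ 20 ≔ t ]) (chosen t) good
          (inp (setting-frame greedy (ρ [ 20 ≔ t ]) (weighed t) refl (weighed-setting t))) j j<k)
        (cong₂ _+_ (trans (frame greedy (ρ [ 20 ≔ t ]) (weighed t) 9 refl j)
            (trans (frame (for 30 1 (set 10 (var 30) weightE)) (ρ [ 20 ≔ t ]) (state t) 9 refl j) (state-costs t j j<k)))
          (∑-cong n λ e _ → cong (λ x → bit (0 <ᵇ x) * c j e) (sym (frame addCosts (ρ [ 20 ≔ t ]) (chosen t) 6 refl e))))

      weighed-weights : ∀ t x → x < n → weighed t 10 x ≡ weight t x
      weighed-weights t x x<n = trans (fill-loop 30 1 10 weightE {ρ [ 20 ≔ t ]} (state t) (ρ1 {ρ} good) refl x x<n)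
        (weight-eval {ρ [ 20 ≔ t ] [ 30 ≔ x ]} (accumulated t) good (state-setting t) (state-costs t))

      -- Ensures that the scan through the weights below `V` reaches every element.
      weight-small : ∀ t → t < steps → ∀ x → x < n → weight t x < V
      weight-small t t<T x x<n = s≤s (∑-mono k λ j _ → ≤-trans (*-mono-≤ (c≤cap j x) (excess≤ j)) (≤-reflexive (sym (∑-const cap _))))
        where
        excess≤ : ∀ j → excess t j ≤ ∑ steps λ _ → ∑ n λ _ → cap
        excess≤ j with unsafe A F b j
        ... | false = z≤n
        ... | true  = ≤-trans (m∸n≤m (accumulated t j) (t * b)) (≤-trans (∑-bound t λ s _ → costOf-bound (J s) j)
            (≤-trans (*-monoˡ-≤ (∑ n λ _ → cap) (<⇒≤ t<T)) (≤-reflexive (sym (∑-const steps (∑ n λ _ → cap))))))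

      chosen-J : ∀ t x → setOf (chosen t) 6 x ≡ J t x
      chosen-J t x = cong (0 <ᵇ_) (sym (frame addCosts (ρ [ 20 ≔ t ]) (chosen t) 6 refl x))

      greedy-cong : ∀ {A F w J J′} → (∀ x → J x ≡ J′ x) → Greedy A F w J → Greedy A F w J′
      greedy-cong eq G = record
        { contains = λ x x<n Ax → trans (sym (eq x)) (Greedy.contains G x x<n Ax)
        ; within   = λ x x<n Jx → Greedy.within G x x<n (trans (eq x) Jx)
        ; indep    = trans (ind-ext λ x _ → sym (eq x)) (Greedy.indep G)
        ; rejected = λ x x<n Fx Jx → trans (ind-ext λ y _ → cong (λ s → (y ≡ᵇ x) ∨ (s ∧ _)) (sym (eq y))) (Greedy.rejected G x x<n Fx (trans (eq x) Jx)) }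

      J-spec : ∀ t → t < steps → A ⊆ J t × J t ⊆ A ∪ F × (ind A ≡ true → Greedy A F (weight t) (J t))
      J-spec t t<T = (λ x x<n Ax → trans (sym (chosen-J t x)) (proj₁ spec x x<n Ax))
        , (λ x x<n Jx → proj₁ (proj₂ spec) x x<n (trans (chosen-J t x) Jx))
        , λ iA → greedy-cong (chosen-J t) (proj₂ (proj₂ spec) iA)
        where
        spec = greedy-spec k c Θ (ρ [ 20 ≔ t ]) (weighed t) A F (weight t) V (ρ1 {ρ} good) (ρ12 {ρ} good)
          (setA (weighed-setting t)) (setF (weighed-setting t)) (weighed-weights t) (weight-small t t<T)

      -- `steps` is its successor, so this indexes the final iteration, whose basis is still in
      -- array 6 when the oracle is asked.
      last : ℕ
      last = ∑ k λ _ → ∑ D₀ λ _ → D₀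

      σ₁ : Arrays
      σ₁ = exec (for 20 11 iteration) ρ σ₀

      σ₁≡ : σ₁ ≡ state steps
      σ₁≡ = cong (λ m → iterate loopBody m σ₀) (ρ11 {ρ} good)

      σ₂ : Arrays
      σ₂ = exec (ask 6 8) ρ σ₁

      Passed : Set
      Passed = ind (J last) ≡ true × ∣ J last ∣ ≡ rank full × (∀ j → j < k → unsafe A F b j ≡ true → accumulated steps j ≤ steps * suc b)

      setting₂ : Setting A F b σ₂
      setting₂ = setting-frame (ask 6 8) ρ σ₁ refl (subst (Setting A F b) (sym σ₁≡) (state-setting steps))

      answer : σ₂ 8 0 ≡ bit (ind (J last))
      answer = ask-ind σ₁ 6 λ x _ → cong (λ σ′ → setOf σ′ 6 x) σ₁≡

      size-value : eval (distanceE (sizeE 6) (cell 12)) ρ σ₂ ≡ distance ∣ J last ∣ (rank full)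
      size-value = cong₂ distance (size-eval ρ σ₂ (J last) 6 (ρ1 {ρ} good) λ x _ → cong (λ σ′ → setOf σ′ 6 x) σ₁≡) (ranks setting₂)

      rowValue : ℕ → ℕ
      rowValue j = if unsafe A F b j then accumulated steps j ∸ steps * suc b else 0

      rows-value : eval (sumE 35 2 (ifE unsafeE (arr 9 (var 35) ∸′ sumE 40 11 (con 1 ∔ cell 11)) (con 0))) ρ σ₂ ≡ ∑ k rowValue
      rows-value = ∑-cong₂ (ρ2 {ρ} good) row
        where
        row : ∀ j → j < k → eval (ifE unsafeE (arr 9 (var 35) ∸′ sumE 40 11 (con 1 ∔ cell 11)) (con 0)) (ρ [ 35 ≔ j ]) σ₂ ≡ rowValue j
        row j j<k rewrite unsafe-eval {ρ [ 35 ≔ j ]} {σ₂} good setting₂ with unsafe A F b j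
        ... | false = refl
        ... | true  = cong₂ _∸_ (trans (cong (λ σ′ → σ′ 9 j) σ₁≡) (state-costs steps j j<k))
            (trans (∑-cong₂ (ρ11 {ρ} good) λ _ _ → cong suc (bud setting₂)) (∑-const steps (suc b)))

      outcome-value : eval outcomeE ρ σ₂ ≡ (if bit (ind (J last)) ≡ᵇ 0 then 0
        else (if distance ∣ J last ∣ (rank full) ≡ᵇ 0 then (if ∑ k rowValue ≡ᵇ 0 then 1 else 0) else 0))
      outcome-value = if-cong answer refl (if-cong size-value (if-cong rows-value refl refl) refl)

      outcome-sound : eval outcomeE ρ σ₂ ≢ 0 → Passed
      outcome-sound ne = decide (ind (J last)) (distance ∣ J last ∣ (rank full) ≡ᵇ 0) (∑ k rowValue ≡ᵇ 0) refl refl refl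
          λ eq → ne (trans outcome-value eq)
        where
        decide : ∀ i d r → ind (J last) ≡ i → (distance ∣ J last ∣ (rank full) ≡ᵇ 0) ≡ d → (∑ k rowValue ≡ᵇ 0) ≡ r →
          ((if bit (ind (J last)) ≡ᵇ 0 then 0 else (if distance ∣ J last ∣ (rank full) ≡ᵇ 0 then (if ∑ k rowValue ≡ᵇ 0 then 1 else 0) else 0)) ≢ 0) → Passed
        decide false d     r     i≡ d≡ r≡ ne′ rewrite i≡ = ⊥-elim (ne′ refl)
        decide true  false r     i≡ d≡ r≡ ne′ rewrite i≡ | d≡ = ⊥-elim (ne′ refl)
        decide true  true  false i≡ d≡ r≡ ne′ rewrite i≡ | d≡ | r≡ = ⊥-elim (ne′ refl)
        decide true  true  true  i≡ d≡ r≡ ne′ = i≡ , ≡ᵇ-true _ _ (trans (sym (distance≡0 ∣ J last ∣ (rank full))) d≡) , row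
          where
          row : ∀ j → j < k → unsafe A F b j ≡ true → accumulated steps j ≤ steps * suc b
          row j j<k Uj = m∸n≡0⇒m≤n (n≤0⇒n≡0 (≤-trans (≤-reflexive (sym (cong (λ u → if u then accumulated steps j ∸ steps * suc b else 0) Uj)))
            (≤-trans (∑-term k j j<k) (≤-reflexive (≡ᵇ-true (∑ k rowValue) 0 r≡)))))

      outcome-complete : Passed → eval outcomeE ρ σ₂ ≡ 1
      outcome-complete (i , size , rows) = trans outcome-value
        (trans (cong (λ z → if bit z ≡ᵇ 0 then 0 else (if distance ∣ J last ∣ (rank full) ≡ᵇ 0 then (if ∑ k rowValue ≡ᵇ 0 then 1 else 0) else 0)) i)
        (trans (cong (λ z → if z then (if ∑ k rowValue ≡ᵇ 0 then 1 else 0) else 0) (trans (distance≡0 ∣ J last ∣ (rank full)) (≡ᵇ-intro size)))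
        (cong (λ z → if z ≡ᵇ 0 then 1 else 0) (∑-zero k zero-row))))
        where
        zero-row : ∀ j → j < k → rowValue j ≡ 0
        zero-row j j<k with unsafe A F b j | rows j j<k
        ... | false | _ = refl
        ... | true  | r = m≤n⇒m∸n≡0 (r refl)

      -- Only the last basis is shown to the oracle. Its independence makes `A` independent, so
      -- every iteration has produced a greedy basis of `A ∪ F`; these have equal sizes, and the
      -- last one vouches for the rank of all.
      test-sound : exec test ρ σ 13 0 ≢ 0 → Inv A F (suc b)
      test-sound ne = average steps (s≤s z≤n) bases (proj₂ (proj₂ passed))
        where
        passed = outcome-sound ne
        iA : ind A ≡ true
        iA = ind-mono (proj₁ (J-spec last ≤-refl)) (proj₁ passed)
        bases : ∀ t → t < steps → ind (J t) ≡ true × ∣ J t ∣ ≡ rank full × A ⊆ J t × J t ⊆ A ∪ F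
        bases t t<T = Greedy.indep G
          , trans (greedy-size G) (trans (sym (greedy-size (proj₂ (proj₂ (J-spec last ≤-refl)) iA))) (proj₁ (proj₂ passed)))
          , proj₁ (J-spec t t<T) , proj₁ (proj₂ (J-spec t t<T))
          where
          G = proj₂ (proj₂ (J-spec t t<T)) iA

      -- The bound on b puts it below `D₀`, from which the number of steps was computed.
      test-complete : Inv A F b → b ≤ b₀ + n → exec test ρ σ 13 0 ≢ 0
      test-complete X b≤ eq = case trans (sym eq) (outcome-complete passed) of λ ()
        where
        iA : ind A ≡ true
        iA = inv-independent X
        greedy-all : ∀ t → t < steps → Greedy A F (weight t) (J t)
        greedy-all t t<T = proj₂ (proj₂ (J-spec t t<T)) iA
        cost≤D₀ : ∀ t → t < steps → ∀ j → j < k → costOf (J t) j ≤ D₀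
        cost≤D₀ t _ j _ = ≤-trans (costOf-bound (J t) j) (≤-trans (m≤m+n _ b₀) (m≤m+n _ n))
        b≤D₀ : b ≤ D₀
        b≤D₀ = ≤-trans b≤ (≤-trans (m≤n+m (b₀ + n) (∑ n λ _ → cap)) (≤-reflexive (sym (+-assoc (∑ n λ _ → cap) b₀ n))))
        many-steps : k * (D₀ * D₀) < steps
        many-steps = s≤s (≤-reflexive (sym (trans (∑-cong k λ _ _ → ∑-const D₀ D₀) (∑-const k (D₀ * D₀)))))
        passed : Passed
        passed = Greedy.indep (greedy-all last ≤-refl)
          , trans (greedy-size (greedy-all last ≤-refl)) (rank-support X)
          , Regret.regret X D₀ steps b≤D₀ cost≤D₀ greedy-all many-steps

  -- Sweeps: fixing the free elements one at a time

  module SweepSpec {n : ℕ} (oracle : Subset n → Bool) (M : FMatroid n)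
    (ind-oracle : ∀ S → oracle (tabulate λ e → S (toℕ e)) ≡ FMatroid.ind M S) (k : ℕ) (input : ℕ → ℕ) (E : FSet) where
    open FMatroid M
    open Matroids M
    open Parameters n k input
    open Polytope M k c using (full; Frac)
    open Relaxation M k c Θ
    open Compilation oracle
    open ProgramLogic oracle
    open TestSpec oracle M ind-oracle k input

    proposed : ℕ → FSet → ℕ → FSet
    proposed v A e = if v ≡ᵇ 0 then A ⊕ e else A

    -- By `fuel` each success trades a free element for a unit of budget, so the budget never
    -- exceeds b₀ + n. `inside` confines the result to `E`, which will consist of elements whose
    -- costs are not truncated.
    record Track (A F : FSet) (b : ℕ) (σ : Arrays) : Set where
      constructor track
      field
        inp   : Input σ
        ranks : σ 12 0 ≡ rank full
        setA  : ∀ x → x < n → setOf σ 2 x ≡ A x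
        setF  : ∀ x → x < n → setOf σ 3 x ≡ F x
        bud   : σ 11 0 ≡ b
        light : Light F
        disj  : Disjoint A F
        inv   : Inv A F b
        fuel  : b + ∣ F ∣ ≤ b₀ + n
        inside : A ∪ F ⊆ E

    propose-spec : ∀ ρ σ {A F b} → ρ 1 ≡ n → Track A F b σ →
      Setting (proposed (ρ 18) A (ρ 16)) (F ⊖ ρ 16) b (exec propose ρ σ)
    propose-spec ρ σ {A} {F} {b} r1 tr = setting
      (λ i → trans (frame propose ρ σ 0 refl i) (Track.inp tr i)) newA newF
      (trans (frame propose ρ σ 11 refl 0) (Track.bud tr)) (trans (frame propose ρ σ 12 refl 0) (Track.ranks tr))
      where
      e v : ℕ
      e = ρ 16
      v = ρ 18
      exprA exprF : Exp
      exprA = arr 2 (var 19) ∔ ifE (var 18) (con 0) (equalE (var 19) (var 16))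
      exprF = ifE (equalE (var 19) (var 16)) (con 0) (arr 3 (var 19))
      σ₁ : Arrays
      σ₁ = exec (for 19 1 (set 4 (var 19) exprA)) ρ σ
      newA : ∀ x → x < n → setOf (exec propose ρ σ) 4 x ≡ proposed v A e x
      newA x x<n = trans (cong (0 <ᵇ_) (trans (frame (for 19 1 (set 5 (var 19) exprF)) ρ σ₁ 4 refl x)
          (fill-loop 19 1 4 exprA {ρ} σ r1 refl x x<n)))
        (trans (value (σ 2 x) (v ≡ᵇ 0) (distance x e ≡ᵇ 0) (distance≡0 x e) (Track.setA tr x x<n)) (proposed-at (v ≡ᵇ 0)))
        where
        value : ∀ a z d {p q} → d ≡ p → (0 <ᵇ a) ≡ q →
          (0 <ᵇ (a + (if z then (if d then 1 else 0) else 0))) ≡ (if z then p ∨ q else q)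
        value a false d refl refl = cong (0 <ᵇ_) (+-identityʳ a)
        value zero    true true  refl refl = refl
        value zero    true false refl refl = refl
        value (suc a) true true  refl refl = refl
        value (suc a) true false refl refl = refl
        proposed-at : ∀ z → (if z then (x ≡ᵇ e) ∨ A x else A x) ≡ (if z then A ⊕ e else A) x
        proposed-at true  = refl
        proposed-at false = refl
      newF : ∀ x → x < n → setOf (exec propose ρ σ) 5 x ≡ (F ⊖ e) x
      newF x x<n = trans (cong (0 <ᵇ_) (trans (fill-loop 19 1 5 exprF {ρ} σ₁ r1 refl x x<n)
          (cong (λ z → if (if distance x e ≡ᵇ 0 then 1 else 0) ≡ᵇ 0 then z else 0) (frame (for 19 1 (set 4 (var 19) exprA)) ρ σ 3 refl x))))
        (value (σ 3 x) (distance x e ≡ᵇ 0) (distance≡0 x e) (Track.setF tr x x<n))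
        where
        value : ∀ f d {p q} → d ≡ p → (0 <ᵇ f) ≡ q → (0 <ᵇ (if (if d then 1 else 0) ≡ᵇ 0 then f else 0)) ≡ q ∧ not p
        value f true  refl refl = sym (∧-false (0 <ᵇ f))
        value f false refl refl = sym (∧-identityʳ (0 <ᵇ f))
          where open import Data.Bool.Properties using (∧-identityʳ)

    ⊖-⊆ : ∀ {F} e → F ⊖ e ⊆ F
    ⊖-⊆ e x x<n h = proj₁ (∧-true h)

    ⊖-smaller : ∀ {F e} → e < n → F e ≡ true → ∣ F ⊖ e ∣ < ∣ F ∣
    ⊖-smaller {F} {e} e<n Fe = ∑-mono-< n e e<n (λ x x<n → bit-mono (⊖-⊆ {F} e x x<n)) strict
      where
      strict : bit ((F ⊖ e) e) < bit (F e)
      strict rewrite Fe | ≡ᵇ-refl e = s≤s z≤n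

    -- A rejection refutes the proposal at the current budget b, by completeness of the test; an
    -- acceptance establishes it only at b + 1.
    attempt-spec : ∀ ρ σ {A F b} → Good ρ → Track A F b σ → ρ 16 < n → F (ρ 16) ≡ true →
      let A′ = proposed (ρ 18) A (ρ 16); F′ = F ⊖ ρ 16 in
      (Track A F b (exec attempt ρ σ) × (Inv A′ F′ b → ⊥)) ⊎ Track A′ F′ (suc b) (exec attempt ρ σ)
    attempt-spec ρ σ {A} {F} {b} good tr e<n Fe = decide (σ₂ 13 0) refl
      where
      e v : ℕ
      e = ρ 16
      v = ρ 18
      A′ F′ : FSet
      A′ = proposed v A e
      F′ = F ⊖ e
      σ₁ σ₂ : Arrays
      σ₁ = exec propose ρ σ
      σ₂ = exec test ρ σ₁
      st₁ : Setting A′ F′ b σ₁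
      st₁ = propose-spec ρ σ (proj₁ good) tr
      module Run = TestRun ρ good A′ F′ b σ₁ st₁
      keeps : Stm → Bool
      keeps s = not (writes s 0) ∧ (not (writes s 12) ∧ (not (writes s 2) ∧ (not (writes s 3) ∧ not (writes s 11))))
      track-frame : ∀ s ρ σ → keeps s ≡ true → Track A F b σ → Track A F b (exec s ρ σ)
      track-frame s ρ σ ok t = track
        (λ i → trans (frame s ρ σ 0 (not-true (proj₁ (∧-true ok))) i) (Track.inp t i))
        (trans (frame s ρ σ 12 (not-true (proj₁ (∧-true ok₁))) 0) (Track.ranks t))
        (λ x x<n → trans (cong (0 <ᵇ_) (frame s ρ σ 2 (not-true (proj₁ (∧-true ok₂))) x)) (Track.setA t x x<n))
        (λ x x<n → trans (cong (0 <ᵇ_) (frame s ρ σ 3 (not-true (proj₁ (∧-true ok₃))) x)) (Track.setF t x x<n))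
        (trans (frame s ρ σ 11 (not-true (proj₂ (∧-true {not (writes s 3)} ok₃))) 0) (Track.bud t))
        (Track.light t) (Track.disj t) (Track.inv t) (Track.fuel t) (Track.inside t)
        where
        ok₁ = proj₂ (∧-true {not (writes s 0)} ok)
        ok₂ = proj₂ (∧-true {not (writes s 12)} ok₁)
        ok₃ = proj₂ (∧-true {not (writes s 2)} ok₂)
      b≤ : b ≤ b₀ + n
      b≤ = ≤-trans (m≤m+n b ∣ F ∣) (Track.fuel tr)
      result : exec attempt ρ σ ≡ (if σ₂ 13 0 ≡ᵇ 0 then σ₂ else exec commit ρ σ₂)
      result = refl
      decide : ∀ u → σ₂ 13 0 ≡ u → (Track A F b (exec attempt ρ σ) × (Inv A′ F′ b → ⊥)) ⊎ Track A′ F′ (suc b) (exec attempt ρ σ)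
      decide zero eq = inj₁ (subst (Track A F b) (sym (cong (λ u → if u ≡ᵇ 0 then σ₂ else exec commit ρ σ₂) eq))
          (track-frame test ρ σ₁ refl (track-frame propose ρ σ refl tr))
        , λ X → Run.test-complete X b≤ eq)
      decide (suc u) eq = inj₂ (subst (Track A′ F′ (suc b)) (sym (cong (λ u → if u ≡ᵇ 0 then σ₂ else exec commit ρ σ₂) eq)) committed)
        where
        st₂ : Setting A′ F′ b σ₂
        st₂ = setting-frame test ρ σ₁ refl st₁
        copyA copyF : Stm
        copyA = for 19 1 (set 2 (var 19) (arr 4 (var 19)))
        copyF = for 19 1 (set 3 (var 19) (arr 5 (var 19)))
        σ₃ : Arrays
        σ₃ = exec copyA ρ σ₂
        light′ : Light F′
        light′ x x<n h = Track.light tr x x<n (proj₁ (∧-true h))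
        disj′ : Disjoint A′ F′
        disj′ x x<n h = separate (v ≡ᵇ 0)
          where
          separate : ∀ z → (if z then A ⊕ e else A) x ≡ false
          separate true  = cong₂ _∨_ (not-true (proj₂ (∧-true {F x} h))) (Track.disj tr x x<n (proj₁ (∧-true h)))
          separate false = Track.disj tr x x<n (proj₁ (∧-true h))
        inside′ : A′ ∪ F′ ⊆ E
        inside′ x x<n h = Track.inside tr x x<n (from (v ≡ᵇ 0) (∨-true h))
          where
          from : ∀ z → (if z then A ⊕ e else A) x ≡ true ⊎ F′ x ≡ true → (A ∪ F) x ≡ true
          from z     (inj₂ f) = ∨-introʳ {A x} (proj₁ (∧-true f))
          from false (inj₁ a) = ∨-introˡ a
          from true  (inj₁ a) with ∨-true {x ≡ᵇ e} a
          ... | inj₁ x≡e = ∨-introʳ {A x} (trans (cong F (≡ᵇ-true x e x≡e)) Fe)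
          ... | inj₂ Ax  = ∨-introˡ Ax
        committed : Track A′ F′ (suc b) (exec commit ρ σ₂)
        committed = track
          (λ i → trans (frame commit ρ σ₂ 0 refl i) (Setting.inp st₂ i))
          (trans (frame commit ρ σ₂ 12 refl 0) (Setting.ranks st₂))
          (λ x x<n → trans (cong (0 <ᵇ_) (trans (frame copyF ρ σ₃ 2 refl x) (fill-loop 19 1 2 (arr 4 (var 19)) {ρ} σ₂ (proj₁ good) refl x x<n)))
            (Setting.setA st₂ x x<n))
          (λ x x<n → trans (cong (0 <ᵇ_) (trans (fill-loop 19 1 3 (arr 5 (var 19)) {ρ} σ₃ (proj₁ good) refl x x<n)
            (frame copyA ρ σ₂ 5 refl x))) (Setting.setF st₂ x x<n))
          (trans (cong (_+ 1) (trans (frame copyF ρ σ₃ 11 refl 0) (trans (frame copyA ρ σ₂ 11 refl 0) (Setting.bud st₂)))) (+-comm b 1))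
          light′ disj′ (Run.test-sound λ z → case trans (sym eq) z of λ ())
          (≤-trans (≤-reflexive (sym (+-suc b ∣ F′ ∣))) (≤-trans (+-monoʳ-≤ b (⊖-smaller e<n Fe)) (Track.fuel tr))) inside′

    Done : FSet → Arrays → Set
    Done F₀ σ = Σ[ A ∈ FSet ] Σ[ F ∈ FSet ] Σ[ b ∈ ℕ ] Track A F b σ × ∣ F ∣ < ∣ F₀ ∣

    try : Stm
    try = when (arr 3 (var 16)) attempt

    try-spec : ∀ ρ σ {A F b} → Good ρ → ρ 16 < n → Track A F b σ →
      (Track A F b (exec try ρ σ) × (F (ρ 16) ≡ true → Inv (proposed (ρ 18) A (ρ 16)) (F ⊖ ρ 16) b → ⊥)) ⊎ Done F (exec try ρ σ)
    try-spec ρ σ {A} {F} {b} good e<n tr = decide (σ 3 (ρ 16)) refl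
      where
      decide : ∀ u → σ 3 (ρ 16) ≡ u →
        (Track A F b (exec try ρ σ) × (F (ρ 16) ≡ true → Inv (proposed (ρ 18) A (ρ 16)) (F ⊖ ρ 16) b → ⊥)) ⊎ Done F (exec try ρ σ)
      decide zero eq = inj₁ (subst (Track A F b) (sym (cong (λ u → if u ≡ᵇ 0 then σ else exec attempt ρ σ) eq)) tr
        , λ Fe → ⊥-elim (true≢false Fe (trans (sym (Track.setF tr (ρ 16) e<n)) (cong (0 <ᵇ_) eq))))
      decide (suc u) eq = subst (λ σ′ → (Track A F b σ′ × (F (ρ 16) ≡ true → Inv (proposed (ρ 18) A (ρ 16)) (F ⊖ ρ 16) b → ⊥)) ⊎ Done F σ′)
          (sym (cong (λ u → if u ≡ᵇ 0 then σ else exec attempt ρ σ) eq)) (outcome (attempt-spec ρ σ good tr e<n Fe))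
        where
        Fe : F (ρ 16) ≡ true
        Fe = trans (sym (Track.setF tr (ρ 16) e<n)) (cong (0 <ᵇ_) eq)
        outcome : (Track A F b (exec attempt ρ σ) × (Inv (proposed (ρ 18) A (ρ 16)) (F ⊖ ρ 16) b → ⊥)) ⊎
            Track (proposed (ρ 18) A (ρ 16)) (F ⊖ ρ 16) (suc b) (exec attempt ρ σ) → _
        outcome (inj₁ (tr′ , refuted)) = inj₁ (tr′ , λ _ → refuted)
        outcome (inj₂ tr′)        = inj₂ (_ , _ , _ , tr′ , ⊖-smaller e<n Fe)

    try-done : ∀ ρ σ {F₀} → Good ρ → ρ 16 < n → Done F₀ σ → Done F₀ (exec try ρ σ)
    try-done ρ σ good e<n (A , F , b , tr , lt) = outcome (try-spec ρ σ good e<n tr)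
      where
      outcome : _ ⊎ Done F (exec try ρ σ) → Done _ (exec try ρ σ)
      outcome (inj₁ (tr′ , _)) = A , F , b , tr′ , lt
      outcome (inj₂ (A′ , F′ , b′ , tr′ , lt′)) = A′ , F′ , b′ , tr′ , <-trans lt′ lt

    pass : Stm
    pass = for 16 1 (letS 17 (con 2) (for 18 17 try))

    -- If a whole pass accepts nothing, `A`, `F` and b have not changed meanwhile, so all proposals
    -- are refuted for the same state; by `round-step` nothing is free any more.
    pass-spec : ∀ ρ σ {A F b} → Good ρ → Track A F b σ →
      Done F (exec pass ρ σ) ⊎ (Track A F b (exec pass ρ σ) × ∣ F ∣ ≡ 0)
    pass-spec ρ σ {A} {F} {b} good tr = conclude (for-inv Outer 16 1 (letS 17 (con 2) (for 18 17 try)) {ρ} (proj₁ good) (inj₂ (tr , λ _ ())) outer)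
      where
      Failed : ℕ → ℕ → Set
      Failed e v = F e ≡ true → Inv (proposed v A e) (F ⊖ e) b → ⊥
      Outer : ℕ → Arrays → Set
      Outer m σ′ = Done F σ′ ⊎ (Track A F b σ′ × (∀ e → e < m → ∀ v → v < 2 → Failed e v))
      Inner : ℕ → ℕ → Arrays → Set
      Inner e l σ′ = Done F σ′ ⊎ (Track A F b σ′ × (∀ f → f < e → ∀ v → v < 2 → Failed f v) × (∀ v → v < l → Failed e v))
      inner : ∀ e → e < n → ∀ v σ′ → v < 2 → Inner e v σ′ → Inner e (suc v) (exec try (ρ [ 16 ≔ e ] [ 17 ≔ 2 ] [ 18 ≔ v ]) σ′)
      inner e e<n v σ′ _ (inj₁ done) = inj₁ (try-done (ρ [ 16 ≔ e ] [ 17 ≔ 2 ] [ 18 ≔ v ]) σ′ good e<n done)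
      inner e e<n v σ′ _ (inj₂ (tr′ , before , failed)) = outcome (try-spec (ρ [ 16 ≔ e ] [ 17 ≔ 2 ] [ 18 ≔ v ]) σ′ good e<n tr′)
        where
        outcome : (Track A F b (exec try (ρ [ 16 ≔ e ] [ 17 ≔ 2 ] [ 18 ≔ v ]) σ′) × Failed e v) ⊎ Done F (exec try (ρ [ 16 ≔ e ] [ 17 ≔ 2 ] [ 18 ≔ v ]) σ′) → _
        outcome (inj₂ done) = inj₁ done
        outcome (inj₁ (tr″ , refuted)) = inj₂ (tr″ , before , λ u u≤v → case u ≟ v of λ where
          (yes refl) → refuted
          (no u≢v)   → failed u (≤∧≢⇒< (≤-pred u≤v) u≢v))
      outer : ∀ e σ′ → e < n → Outer e σ′ → Outer (suc e) (exec (letS 17 (con 2) (for 18 17 try)) (ρ [ 16 ≔ e ]) σ′)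
      outer e σ′ e<n state = finish (for-inv (Inner e) 18 17 try {ρ [ 16 ≔ e ] [ 17 ≔ 2 ]} {σ′} {2} refl (begin′ state) (inner e e<n))
        where
        begin′ : Outer e σ′ → Inner e 0 σ′
        begin′ (inj₁ done)           = inj₁ done
        begin′ (inj₂ (tr′ , before)) = inj₂ (tr′ , before , λ _ ())
        finish : Inner e 2 (exec (for 18 17 try) (ρ [ 16 ≔ e ] [ 17 ≔ 2 ]) σ′) → _
        finish (inj₁ done) = inj₁ done
        finish (inj₂ (tr′ , before , now)) = inj₂ (tr′ , λ f f≤e → case f ≟ e of λ where
          (yes refl) → now
          (no f≢e)   → before f (≤∧≢⇒< (≤-pred f≤e) f≢e))
      stuck : (∀ e → e < n → ∀ v → v < 2 → Failed e v) →
        ∃[ e ] e < n × F e ≡ true × (Inv (A ⊕ e) (F ⊖ e) b ⊎ Inv A (F ⊖ e) b) → ⊥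
      stuck failed (e , e<n , Fe , inj₁ X) = failed e e<n 0 (s≤s z≤n) Fe X
      stuck failed (e , e<n , Fe , inj₂ X) = failed e e<n 1 (s≤s (s≤s z≤n)) Fe X
      exhausted : (∀ e → e < n → ∀ v → v < 2 → Failed e v) → (∃[ e ] e < n × F e ≡ true) ⊎ (∀ e → e < n → F e ≡ false) → ∣ F ∣ ≡ 0
      exhausted failed (inj₁ nonempty) = ⊥-elim (stuck failed (round-step (Track.inv tr) (Track.light tr) (Track.disj tr) nonempty))
      exhausted failed (inj₂ none)     = ∑-zero n λ x x<n → cong bit (none x x<n)
      conclude : Outer n (exec pass ρ σ) → Done F (exec pass ρ σ) ⊎ (Track A F b (exec pass ρ σ) × ∣ F ∣ ≡ 0)
      conclude (inj₁ done)           = inj₁ done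
      conclude (inj₂ (tr′ , failed)) = inj₂ (tr′ , exhausted failed (search n F))

    sweep-spec : ∀ ρ σ {A F b} → Good ρ → Track A F b σ →
      Σ[ A′ ∈ FSet ] Σ[ F′ ∈ FSet ] Σ[ b′ ∈ ℕ ] Track A′ F′ b′ (exec sweep ρ σ) × ∣ F′ ∣ ≡ 0
    sweep-spec ρ σ {A} {F} {b} good tr = finish (for-inv I 15 1 pass {ρ} (proj₁ good) (A , F , b , tr , size≤n F) next-pass)
      where
      size≤n : ∀ S → ∣ S ∣ ≤ n
      size≤n S = ≤-trans (∑-bound n λ e _ → bit-if (S e)) (≤-reflexive (*-identityʳ n))
      I : ℕ → Arrays → Set
      I s σ′ = Σ[ A′ ∈ FSet ] Σ[ F′ ∈ FSet ] Σ[ b′ ∈ ℕ ] Track A′ F′ b′ σ′ × ∣ F′ ∣ ≤ n ∸ s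
      next-pass : ∀ s σ′ → s < n → I s σ′ → I (suc s) (exec pass (ρ [ 15 ≔ s ]) σ′)
      next-pass s σ′ s<n (A′ , F′ , b′ , tr′ , le) = outcome (pass-spec (ρ [ 15 ≔ s ]) σ′ good tr′)
        where
        outcome : Done F′ (exec pass (ρ [ 15 ≔ s ]) σ′) ⊎ (Track A′ F′ b′ (exec pass (ρ [ 15 ≔ s ]) σ′) × ∣ F′ ∣ ≡ 0) → _
        outcome (inj₂ (tr″ , empty)) = A′ , F′ , b′ , tr″ , subst (_≤ n ∸ suc s) (sym empty) z≤n
        outcome (inj₁ (A″ , F″ , b″ , tr″ , lt)) = A″ , F″ , b″ , tr″
          , ≤-trans (<⇒≤pred (<-≤-trans lt le)) (≤-reflexive (pred[m∸n]≡m∸[1+n] n s))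
      finish : I n (exec sweep ρ σ) → _
      finish (A′ , F′ , b′ , tr′ , le) = A′ , F′ , b′ , tr′ , n≤0⇒n≡0 (subst (∣ F′ ∣ ≤_) (n∸n≡0 n) le)

    module _ {A F : FSet} {b : ℕ} {σ : Arrays} (tr : Track A F b σ) (empty : ∣ F ∣ ≡ 0) where
      open Track tr

      private
        F-false : ∀ e → e < n → F e ≡ false
        F-false e e<n = ¬true⇒false λ Fe → <⇒≱ (subst (_≤ ∣ F ∣) (cong bit Fe) (∑-term n e e<n)) (≤-reflexive empty)

        open Frac inv

      final-independent : ind A ≡ true
      final-independent = inv-independent inv

      -- With nothing free, x is `D` times the indicator of `A`, and its total weight is `D` times
      -- the rank.
      final-size : ∣ A ∣ ≡ rank full
      final-size = ≤-antisym (ind-≤-rank final-independent λ _ _ _ → refl) (D*pos-cancel D>0 (ℤP.≤-reflexive (sym (begin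
        D ℤ.* pos ∣ A ∣                            ≡⟨ cong (D ℤ.*_) (pos-∑ n _) ⟩
        D ℤ.* ∑ᶻ n (λ e → pos (bit (A e)))         ≡⟨ sym (∑ᶻ.∑-* n D _) ⟩
        ∑ᶻ n (λ e → D ℤ.* pos (bit (A e)))         ≡⟨ ∑ᶻ.∑-cong n pointwise ⟩
        ∑ᶻ n (λ e → χ (full e) ℤ.* x e)            ≡⟨ total ⟩
        D ℤ.* pos (rank full)                      ∎))))
        where
        open Relation.Binary.PropositionalEquality.≡-Reasoning
        pointwise : ∀ e → e < n → D ℤ.* pos (bit (A e)) ≡ 1ℤ ℤ.* x e
        pointwise e e<n with A e in Ae
        ... | true rewrite onA e e<n Ae = ℤP.*-comm D 1ℤ
        ... | false rewrite off e e<n Ae (F-false e e<n) = ℤP.*-zeroʳ D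

      -- An enforced row bounds the cost of `A` through the point; a dropped row bounds it by the
      -- very condition under which it was dropped.
      final-cost : ∀ j → j < k → costOf A j ≤ b₀ + n + (Θ + Θ)
      final-cost j j<k = decide (unsafe A F b j) refl
        where
        b≤ : b ≤ b₀ + n
        b≤ = ≤-trans (m≤m+n b ∣ F ∣) fuel
        decide : ∀ u → unsafe A F b j ≡ u → costOf A j ≤ b₀ + n + (Θ + Θ)
        decide true  Uj = ≤-trans (D*pos-cancel D>0 (ℤP.≤-trans (cost-fixed inv j) (budget j j<k Uj))) (≤-trans b≤ (m≤m+n (b₀ + n) (Θ + Θ)))
        decide false Uj = ≤-trans (costOf-mono {A} {A ∪ F} j λ e _ → ∨-introˡ) (≤-trans (<ᵇ-false _ _ Uj) (+-monoˡ-≤ (Θ + Θ) b≤))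

  -- Odometer

  digitsBelow : ℕ → (ℕ → ℕ) → ℕ → ℕ
  digitsBelow W g i = ∑ i λ l → g l * W ^ l

  digits-small : ∀ n g i → (∀ l → l < i → g l ≤ n) → digitsBelow (n + 1) g i < (n + 1) ^ i
  digits-small n g zero    le = s≤s z≤n
  digits-small n g (suc i) le = <-≤-trans (+-mono-<-≤ (digits-small n g i λ l l<i → le l (m<n⇒m<1+n l<i)) (*-monoˡ-≤ ((n + 1) ^ i) (le i ≤-refl)))
    (≤-reflexive (cong (_* (n + 1) ^ i) (+-comm 1 n)))

  -- The digits below position i amount to less than (n + 1)^i, so they cannot make up for a
  -- difference in the top digit.
  digits-unique : ∀ n g τ i → (∀ l → l < i → g l ≤ n) → (∀ l → l < i → τ l ≤ n) →
    digitsBelow (n + 1) g i ≡ digitsBelow (n + 1) τ i → ∀ l → l < i → g l ≡ τ l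
  digits-unique n g τ (suc i) g≤ τ≤ eq l l<1+i = case l ≟ i of λ where
      (yes refl) → top
      (no l≢i)   → digits-unique n g τ i g≤′ τ≤′ (+-cancelʳ-≡ (τ i * (n + 1) ^ i) _ _
        (trans (cong (λ z → digitsBelow (n + 1) g i + z * (n + 1) ^ i) (sym top)) eq)) l (≤∧≢⇒< (≤-pred l<1+i) l≢i)
    where
    g≤′ : ∀ l → l < i → g l ≤ n
    g≤′ l l<i = g≤ l (m<n⇒m<1+n l<i)
    τ≤′ : ∀ l → l < i → τ l ≤ n
    τ≤′ l l<i = τ≤ l (m<n⇒m<1+n l<i)
    not-less : ∀ (a b : ℕ → ℕ) → (∀ l → l < i → a l ≤ n) → digitsBelow (n + 1) a (suc i) ≡ digitsBelow (n + 1) b (suc i) → a i < b i → ⊥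
    not-less a b a≤ eq lt = <⇒≢ (<-≤-trans (+-monoˡ-< (a i * (n + 1) ^ i) (digits-small n a i a≤))
      (≤-trans (*-monoˡ-≤ ((n + 1) ^ i) lt) (m≤n+m _ (digitsBelow (n + 1) b i)))) eq
    top : g i ≡ τ i
    top = ≤-antisym (≮⇒≥ (not-less τ g τ≤′ (sym eq))) (≮⇒≥ (not-less g τ g≤′ eq))

  hits : (ℕ → ℕ) → ℕ → ℕ → Bool
  hits τ zero    x = false
  hits τ (suc m) x = (x ≡ᵇ τ m) ∨ hits τ m x

  hits-cong : ∀ {τ υ} m x → (∀ i → i < m → τ i ≡ υ i) → hits τ m x ≡ hits υ m x
  hits-cong zero    x eq = refl
  hits-cong (suc m) x eq = cong₂ _∨_ (cong (x ≡ᵇ_) (eq m ≤-refl)) (hits-cong m x λ i i<m → eq i (m<n⇒m<1+n i<m))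

  listing : ∀ n m (S : FSet) → m ≤ n → Σ[ τ ∈ (ℕ → ℕ) ] (∀ i → τ i ≤ n)
    × (∀ i → ∑ m (bit ∘ S) ≤ i → τ i ≡ n) × (∀ x → hits τ (∑ m (bit ∘ S)) x ≡ (x <ᵇ m) ∧ S x)
  listing n zero    S m≤n = (λ _ → n) , (λ _ → ≤-refl) , (λ _ _ → refl) , λ x → cong (_∧ S x) (sym (<ᵇ-intro-false {x} {0} z≤n))
  listing n (suc m) S m<n = extend (S m) refl (listing n m S (<⇒≤ m<n))
    where
    l : ℕ
    l = ∑ m (bit ∘ S)
    Listing : ℕ → ℕ → Set
    Listing m l = Σ[ τ ∈ (ℕ → ℕ) ] (∀ i → τ i ≤ n) × (∀ i → l ≤ i → τ i ≡ n) × (∀ x → hits τ l x ≡ (x <ᵇ m) ∧ S x)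
    extend : ∀ b → S m ≡ b → Listing m l → Listing (suc m) (l + bit (S m))
    extend false Sm (τ , τ≤ , rest , hit) rewrite Sm | +-identityʳ l = τ , τ≤ , rest , λ x → trans (hit x) (grow x)
      where
      grow : ∀ x → (x <ᵇ m) ∧ S x ≡ (x <ᵇ suc m) ∧ S x
      grow x with x ≟ m
      ... | yes refl = trans (cong (_∧ S x) (<ᵇ-intro-false {x} ≤-refl)) (sym (trans (cong ((x <ᵇ suc x) ∧_) Sm) (∧-false (x <ᵇ suc x))))
      ... | no x≢m = cong (_∧ S x) (bool-ext (λ h → <ᵇ-intro (m<n⇒m<1+n (<ᵇ-true x m h))) (λ h → <ᵇ-intro (≤∧≢⇒< (≤-pred (<ᵇ-true x (suc m) h)) x≢m)))
    extend true Sm (τ , τ≤ , rest , hit) rewrite Sm | +-comm l 1 = υ , υ≤ , rest′ , hit′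
      where
      υ : ℕ → ℕ
      υ i = if i ≡ᵇ l then m else τ i
      υ≤ : ∀ i → υ i ≤ n
      υ≤ i with i ≡ᵇ l
      ... | true  = <⇒≤ m<n
      ... | false = τ≤ i
      rest′ : ∀ i → suc l ≤ i → υ i ≡ n
      rest′ i l<i rewrite ≡ᵇ-false (>⇒≢ l<i) = rest i (<⇒≤ l<i)
      hit′ : ∀ x → (x ≡ᵇ υ l) ∨ hits υ l x ≡ (x <ᵇ suc m) ∧ S x
      hit′ x = trans (cong₂ (λ p q → (x ≡ᵇ p) ∨ q) υl (trans (hits-cong l x below) (hit x))) (grow x)
        where
        υl : υ l ≡ m
        υl rewrite ≡ᵇ-refl l = refl
        below : ∀ i → i < l → υ i ≡ τ i
        below i i<l rewrite ≡ᵇ-false (<⇒≢ i<l) = refl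
        grow : ∀ x → (x ≡ᵇ m) ∨ ((x <ᵇ m) ∧ S x) ≡ (x <ᵇ suc m) ∧ S x
        grow x with x ≟ m
        ... | yes refl = trans (cong (_∨ ((x <ᵇ x) ∧ S x)) (≡ᵇ-refl x)) (sym (trans (cong (_∧ S x) (<ᵇ-intro {x} ≤-refl)) Sm))
        ... | no x≢m = trans (cong (_∨ ((x <ᵇ m) ∧ S x)) (≡ᵇ-false x≢m)) (cong (_∧ S x)
          (bool-ext (λ h → <ᵇ-intro (m<n⇒m<1+n (<ᵇ-true x m h))) (λ h → <ᵇ-intro (≤∧≢⇒< (≤-pred (<ᵇ-true x (suc m) h)) x≢m))))

  -- Unused digits take the value n, which is not an element.
  small-set-listed : ∀ n h (S : FSet) → ∑ n (bit ∘ S) ≤ h →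
    Σ[ τ ∈ (ℕ → ℕ) ] (∀ i → τ i ≤ n) × (∀ x → x < n → hits τ h x ≡ S x)
  small-set-listed n h S le = pad (listing n n S ≤-refl)
    where
    l : ℕ
    l = ∑ n (bit ∘ S)
    pad : _ → _
    pad (τ , τ≤ , rest , hit) = τ , τ≤ , λ x x<n → trans (padding (h ∸ l) x x<n (m+[n∸m]≡n le)) (trans (hit x) (cong (_∧ S x) (<ᵇ-intro x<n)))
      where
      more : ∀ d x → x < n → hits τ (l + d) x ≡ hits τ l x
      more zero    x x<n = cong (λ m → hits τ m x) (+-identityʳ l)
      more (suc d) x x<n = trans (cong (λ m → hits τ m x) (+-suc l d))
        (trans (cong₂ _∨_ (trans (cong (x ≡ᵇ_) (rest (l + d) (m≤m+n l d))) (≡ᵇ-false (<⇒≢ x<n))) (more d x x<n)) refl)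
      padding : ∀ d x → x < n → l + d ≡ h → hits τ h x ≡ hits τ l x
      padding d x x<n eq = trans (cong (λ m → hits τ m x) (sym eq)) (more d x x<n)

  module _ {n : ℕ} (oracle : Subset n → Bool) where
    open Compilation oracle
    open ProgramLogic oracle

    -- An increment in progress: the processed digits and the pending carry at place i are together
    -- worth one more than the original digits below i.
    record Counting (W : ℕ) (g : ℕ → ℕ) (i : ℕ) (σ : Arrays) : Set where
      constructor counting
      field
        above  : ∀ l → i ≤ l → σ 1 l ≡ g l
        digits : ∀ l → l < i → σ 1 l ≤ n
        sum    : digitsBelow W (σ 1) i + bit (0 <ᵇ σ 15 0) * W ^ i ≡ digitsBelow W g i + 1

    nextGuess-spec : ∀ ρ σ h → ρ 1 ≡ n → ρ 3 ≡ h → (∀ l → l < h → σ 1 l ≤ n) → digitsBelow (n + 1) (σ 1) h + 1 < (n + 1) ^ h →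
      (∀ l → l < h → exec nextGuess ρ σ 1 l ≤ n) × digitsBelow (n + 1) (exec nextGuess ρ σ 1) h ≡ digitsBelow (n + 1) (σ 1) h + 1
    nextGuess-spec ρ σ h r1 r3 le small = Counting.digits end , no-carry (0 <ᵇ exec nextGuess ρ σ 15 0) (Counting.sum end)
      where
      W : ℕ
      W = n + 1
      σ₁ : Arrays
      σ₁ = exec (set 15 (con 0) (con 1)) ρ σ
      digit-step : ∀ i σ′ → i < h → Counting W (σ 1) i σ′ → Counting W (σ 1) (suc i) (exec (when (cell 15) nextDigit) (ρ [ 30 ≔ i ]) σ′)
      digit-step i σ′ i<h (counting above digits sum) = decide (σ′ 15 0) refl
        where
        σ″ : Arrays
        σ″ = exec nextDigit (ρ [ 30 ≔ i ]) σ′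
        decide : ∀ u → σ′ 15 0 ≡ u → Counting W (σ 1) (suc i) (exec (when (cell 15) nextDigit) (ρ [ 30 ≔ i ]) σ′)
        decide zero eq = subst (Counting W (σ 1) (suc i)) (sym (cong (λ u → if u ≡ᵇ 0 then σ′ else σ″) eq))
          (counting (λ l i<l → above l (<⇒≤ i<l))
            (λ l l≤i → case l ≟ i of λ where
              (yes refl) → ≤-trans (≤-reflexive (above l ≤-refl)) (le l i<h)
              (no l≢i)   → digits l (≤∧≢⇒< (≤-pred l≤i) l≢i))
            (trans (cong (λ z → digitsBelow W (σ′ 1) i + σ′ 1 i * W ^ i + bit (0 <ᵇ z) * W ^ suc i) eq)
              (trans (+-identityʳ _) (trans (cong₂ _+_
                (trans (sym (+-identityʳ _)) (trans (cong (λ z → digitsBelow W (σ′ 1) i + bit (0 <ᵇ z) * W ^ i) (sym eq)) sum))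
                (cong (_* W ^ i) (above i ≤-refl))) (shuffle (digitsBelow W (σ 1) i) (σ 1 i * W ^ i))))))
          where
          shuffle : ∀ a b → a + 1 + b ≡ a + b + 1
          shuffle = ℕS.solve-∀
        decide (suc u) eq = subst (Counting W (σ 1) (suc i)) (sym (cong (λ u → if u ≡ᵇ 0 then σ′ else σ″) eq))
            (split (n ∸ g) refl)
          where
          g : ℕ
          g = σ′ 1 i
          gap : ℕ
          gap = ρ 1 ∸ σ′ 1 i
          new-digit : σ″ 1 i ≡ (if gap ≡ᵇ 0 then 0 else σ′ 1 i + 1)
          new-digit rewrite ≡ᵇ-refl i = refl
          others : ∀ l → l ≢ i → σ″ 1 l ≡ σ′ 1 l
          others l l≢i rewrite ≡ᵇ-false l≢i = refl
          gi : g ≡ σ 1 i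
          gi = above i ≤-refl
          g≤n : g ≤ n
          g≤n = ≤-trans (≤-reflexive gi) (le i i<h)
          lower : digitsBelow W (σ″ 1) i ≡ digitsBelow W (σ′ 1) i
          lower = ∑-cong i λ l l<i → cong (_* W ^ l) (others l (<⇒≢ l<i))
          carried : digitsBelow W (σ′ 1) i + W ^ i ≡ digitsBelow W (σ 1) i + 1
          carried = trans (cong (digitsBelow W (σ′ 1) i +_) (sym (trans (cong (λ z → bit (0 <ᵇ z) * W ^ i) eq) (*-identityˡ (W ^ i))))) sum
          gap≡ : gap ≡ n ∸ g
          gap≡ = cong (_∸ g) r1
          build : ∀ d cr → σ″ 1 i ≡ d → σ″ 15 0 ≡ cr → d ≤ n → d * W ^ i + bit (0 <ᵇ cr) * W ^ suc i ≡ g * W ^ i + W ^ i → Counting W (σ 1) (suc i) σ″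
          build d cr dig car d≤n eqn = counting (λ l i<l → trans (others l (>⇒≢ i<l)) (above l (<⇒≤ i<l)))
            (λ l l≤i → case l ≟ i of λ where
              (yes refl) → ≤-trans (≤-reflexive dig) d≤n
              (no l≢i)   → ≤-trans (≤-reflexive (others l l≢i)) (digits l (≤∧≢⇒< (≤-pred l≤i) l≢i)))
            (trans (cong₂ (λ y z → y + bit (0 <ᵇ z) * W ^ suc i) (cong₂ (λ y z → y + z * W ^ i) lower dig) car)
              (trans (+-assoc (digitsBelow W (σ′ 1) i) _ _) (trans (cong (digitsBelow W (σ′ 1) i +_) eqn)
              (trans (swap (digitsBelow W (σ′ 1) i) (g * W ^ i) (W ^ i)) (trans (cong (_+ g * W ^ i) carried)
              (trans (swap′ (digitsBelow W (σ 1) i) (g * W ^ i)) (cong (λ z → digitsBelow W (σ 1) i + z * W ^ i + 1) gi)))))))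
            where
            swap : ∀ a b c → a + (b + c) ≡ a + c + b
            swap = ℕS.solve-∀
            swap′ : ∀ a b → a + 1 + b ≡ a + b + 1
            swap′ = ℕS.solve-∀
          split : ∀ v → n ∸ g ≡ v → Counting W (σ 1) (suc i) σ″
          split zero eq′ = build 0 1 (trans new-digit (cong (λ z → if z ≡ᵇ 0 then 0 else g + 1) (trans gap≡ eq′)))
              (cong (λ z → if z ≡ᵇ 0 then 1 else 0) (trans gap≡ eq′)) z≤n
              (trans (*-identityˡ (W ^ suc i)) (trans (cong (λ z → (z + 1) * W ^ i) (≤-antisym (m∸n≡0⇒m≤n eq′) g≤n)) (expand g (W ^ i))))
            where
            expand : ∀ g w → (g + 1) * w ≡ g * w + w
            expand = ℕS.solve-∀
          split (suc v) eq′ = build (g + 1) 0 (trans new-digit (cong (λ z → if z ≡ᵇ 0 then 0 else g + 1) (trans gap≡ eq′)))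
              (cong (λ z → if z ≡ᵇ 0 then 1 else 0) (trans gap≡ eq′)) (subst (_≤ n) (+-comm 1 g) (m∸n≢0⇒n<m λ z → case trans (sym eq′) z of λ ()))
              (expand g (W ^ i))
            where
            expand : ∀ g w → (g + 1) * w + 0 ≡ g * w + w
            expand = ℕS.solve-∀
      end : Counting W (σ 1) h (exec nextGuess ρ σ)
      end = for-inv (Counting W (σ 1)) 30 3 (when (cell 15) nextDigit) {ρ} {σ₁} r3
        (counting (λ _ _ → refl) (λ _ ()) refl) digit-step
      no-carry : ∀ b → digitsBelow W (exec nextGuess ρ σ 1) h + bit b * W ^ h ≡ digitsBelow W (σ 1) h + 1 →
        digitsBelow W (exec nextGuess ρ σ 1) h ≡ digitsBelow W (σ 1) h + 1
      no-carry false eq = trans (sym (+-identityʳ _)) eq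
      no-carry true  eq = ⊥-elim (<⇒≱ small (≤-trans (≤-trans (≤-reflexive (sym (*-identityˡ (W ^ h)))) (m≤n+m (1 * W ^ h) (digitsBelow W (exec nextGuess ρ σ 1) h))) (≤-reflexive eq)))

  -- Counting a decreasing predicate finds its threshold; h and the rounded costs are computed in
  -- this way.
  count-decreasing : ∀ m (f : ℕ → Bool) → (∀ x y → x ≤ y → f y ≡ true → f x ≡ true) →
    (∀ x → x < ∑ m (bit ∘ f) → f x ≡ true) × (∀ x → ∑ m (bit ∘ f) ≤ x → x < m → f x ≡ false)
  count-decreasing zero    f dec = (λ _ ()) , λ _ _ ()
  count-decreasing (suc m) f dec with f m in fm
  ... | true = (λ x x< → dec x m (≤-pred (≤-trans x< (≤-trans (+-monoˡ-≤ 1 (all≤ m)) (≤-reflexive (+-comm m 1))))) fm)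
      , λ x le x<1+m → ⊥-elim (<⇒≱ x<1+m (≤-trans (≤-reflexive (sym total)) le))
    where
    all≤ : ∀ m → ∑ m (bit ∘ f) ≤ m
    all≤ m = ≤-trans (∑-bound m λ x _ → bit-if (f x)) (≤-reflexive (*-identityʳ m))
    total : ∑ m (bit ∘ f) + 1 ≡ suc m
    total = trans (cong (_+ 1) (trans (∑-cong m λ x x<m → cong bit (dec x m (<⇒≤ x<m) fm)) (trans (∑-const m 1) (*-identityʳ m)))) (+-comm m 1)
  ... | false rewrite +-identityʳ (∑ m (bit ∘ f)) = proj₁ (count-decreasing m f dec) , λ x le x<1+m → case x ≟ m of λ where
      (yes refl) → fm
      (no x≢m)   → proj₂ (count-decreasing m f dec) x le (≤∧≢⇒< (≤-pred x<1+m) x≢m)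

  -- Arithmetic of the constants and of the rounded costs

  module Numerics (n k : ℕ) (input : ℕ → ℕ) where
    open Parameters n k input

    h≤n : h ≤ n
    h≤n = ≤-trans (∑-bound n λ x _ → bit-if _) (≤-reflexive (*-identityʳ n))

    private
      p q : ℕ
      p = input 2
      q = input 3
      fits : ℕ → Bool
      fits x = (p + ∑ x (λ _ → p)) ∸ ∑ k (λ _ → q + q + q + q + q + q) ≡ᵇ 0
      lhs : ∀ x → p + ∑ x (λ _ → p) ≡ suc x * p
      lhs x = cong (p +_) (∑-const x p)
      rhs : ∑ k (λ _ → q + q + q + q + q + q) ≡ 6 * (k * q)
      rhs = trans (∑-const k _) (six k q)
        where
        six : ∀ k q → k * (q + q + q + q + q + q) ≡ 6 * (k * q)
        six = ℕS.solve-∀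
      fits-≤ : ∀ x → fits x ≡ true → suc x * p ≤ 6 * (k * q)
      fits-≤ x f = subst₂ _≤_ (lhs x) rhs (m∸n≡0⇒m≤n (≡ᵇ-true _ 0 f))
      ≤-fits : ∀ x → suc x * p ≤ 6 * (k * q) → fits x ≡ true
      ≤-fits x le = ≡ᵇ-intro (m≤n⇒m∸n≡0 (subst₂ _≤_ (sym (lhs x)) (sym rhs) le))
      counted : (∀ x → x < h → fits x ≡ true) × (∀ x → h ≤ x → x < n → fits x ≡ false)
      counted = count-decreasing n fits λ x y x≤y fy → ≤-fits x (≤-trans (*-monoˡ-≤ p (s≤s x≤y)) (fits-≤ y fy))

    h-fits : h * p ≤ 6 * (k * q)
    h-fits = below h refl
      where
      below : ∀ m → m ≡ h → m * p ≤ 6 * (k * q)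
      below zero    _  = z≤n
      below (suc m) eq = fits-≤ m (proj₁ counted m (≤-reflexive eq))

    h-maximal : h < n → 6 * (k * q) < suc h * p
    h-maximal h<n = ≰⇒> λ le → true≢false (≤-fits h le) (proj₂ counted h ≤-refl h<n)

    N≡ : N ≡ suc h * W
    N≡ = cong (W +_) (∑-const h W)

    Θ≡ : Θ ≡ k * (W + W)
    Θ≡ = ∑-const k (W + W)

    private
      short : ℕ → ℕ → ℕ → Bool
      short j e x = not ((∑ N λ _ → demand j e) ∸ (∑ x λ _ → supply j) ≡ᵇ 0)
      short-< : ∀ j e x → short j e x ≡ true → x * supply j < N * demand j e
      short-< j e x s = ≰⇒> λ le → true≢false (≡ᵇ-intro (m≤n⇒m∸n≡0 (subst₂ _≤_ (sym (∑-const N _)) (sym (∑-const x _)) le))) (not-true s)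
      <-short : ∀ j e x → x * supply j < N * demand j e → short j e x ≡ true
      <-short j e x lt = cong not (≡ᵇ-false {_} {0} λ z → <⇒≱ lt (subst₂ _≤_ (∑-const N _) (∑-const x _) (m∸n≡0⇒m≤n z)))
      c≡ : ∀ j e → c j e ≡ ∑ cap (bit ∘ short j e)
      c≡ j e = ∑-cong cap λ x _ → flip-bit ((∑ N λ _ → demand j e) ∸ (∑ x λ _ → supply j) ≡ᵇ 0)
        where
        flip-bit : ∀ b → (if b then 0 else 1) ≡ bit (not b)
        flip-bit true  = refl
        flip-bit false = refl
      c-counted : ∀ j e → (∀ x → x < ∑ cap (bit ∘ short j e) → short j e x ≡ true) × (∀ x → ∑ cap (bit ∘ short j e) ≤ x → x < cap → short j e x ≡ false)
      c-counted j e = count-decreasing cap (short j e) λ x y x≤y sy → <-short j e x (≤-<-trans (*-monoˡ-≤ (supply j) x≤y) (short-< j e y sy))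

    below-c : ∀ j e x → x < c j e → x * supply j < N * demand j e
    below-c j e x x<c = short-< j e x (proj₁ (c-counted j e) x (subst (x <_) (c≡ j e) x<c))

    c-ceiling : ∀ j e → c j e < cap → N * demand j e ≤ c j e * supply j
    c-ceiling j e c<cap = ≮⇒≥ λ lt → true≢false (<-short j e (c j e) lt) (proj₂ (c-counted j e) (c j e) (≤-reflexive (sym (c≡ j e))) c<cap)

    c-affordable : ∀ j e → demand j e ≤ supply j → c j e ≤ N
    c-affordable j e le = ≮⇒≥ λ N<c → <⇒≱ (below-c j e N N<c) (*-monoʳ-≤ N le)

    -- Scaled by N and divided by the budget, the cost of `S` is at most N before rounding, and
    -- rounding up adds at most 1 per element. A zero budget admits no division, but it forces all
    -- costs on `S` to be 0.
    c-cost : ∀ j (S : FSet) → ∑ n (λ e → bit (S e) * demand j e) ≤ supply j → ∑ n (λ e → bit (S e) * c j e) ≤ N + n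
    c-cost j S le = decide (supply j) refl
      where
      each : ∀ e → e < n → S e ≡ true → demand j e ≤ ∑ n (λ e → bit (S e) * demand j e)
      each e e<n Se = ≤-trans (≤-reflexive (sym (trans (cong (λ s → bit s * demand j e) Se) (*-identityˡ _)))) (∑-term n e e<n)
      decide : ∀ s → supply j ≡ s → ∑ n (λ e → bit (S e) * c j e) ≤ N + n
      decide zero eq = ≤-trans (≤-reflexive (∑-zero n none)) z≤n
        where
        none : ∀ e → e < n → bit (S e) * c j e ≡ 0
        none e e<n with S e in Se
        ... | false = refl
        ... | true  = trans (*-identityˡ (c j e)) (n≤0⇒n≡0 (≮⇒≥ λ 0<c → n≮0 (subst (0 <_)
            (trans (cong (N *_) (n≤0⇒n≡0 (≤-trans (each e e<n Se) (≤-trans le (≤-reflexive eq))))) (*-zeroʳ N)) (below-c j e 0 0<c))))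
      decide (suc s) eq = ≤-trans (∑-mono n λ e _ → split (S e) (c j e)) (≤-trans (≤-reflexive (∑-+ n _ _))
          (+-mono-≤ (*-cancelʳ-≤ _ N (suc s) scaled) (≤-trans (∑-bound n λ e _ → bit-if (S e)) (≤-reflexive (*-identityʳ n)))))
        where
        split : ∀ s x → bit s * x ≤ bit s * (x ∸ 1) + bit s
        split false x       = z≤n
        split true  zero    = z≤n
        split true  (suc x) = ≤-reflexive (shuffle x)
          where
          shuffle : ∀ x → 1 * suc x ≡ 1 * x + 1
          shuffle = ℕS.solve-∀
        term : ∀ e → suc s * (bit (S e) * (c j e ∸ 1)) ≤ N * (bit (S e) * demand j e)
        term e with S e | c j e in ce
        ... | false | _ = ≤-trans (≤-reflexive (*-zeroʳ (suc s))) z≤n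
        ... | true  | zero = ≤-trans (≤-reflexive (*-zeroʳ (suc s))) z≤n
        ... | true  | suc x = subst₂ _≤_ (trans (*-comm x (suc s)) (cong (suc s *_) (sym (*-identityˡ x)))) (cong (N *_) (sym (*-identityˡ _)))
            (<⇒≤ (subst (λ b → x * b < N * demand j e) eq (below-c j e x (≤-reflexive (sym ce)))))
        scaled : ∑ n (λ e → bit (S e) * (c j e ∸ 1)) * suc s ≤ N * suc s
        scaled = ≤-trans (≤-reflexive (trans (*-comm _ (suc s)) (sym (∑-* n (suc s) _)))) (≤-trans (∑-mono n λ e _ → term e)
          (≤-trans (≤-reflexive (∑-* n N _)) (*-monoʳ-≤ N (≤-trans le (≤-reflexive eq)))))

    lightSet : FSet
    lightSet x = not (n ∸ h ≡ᵇ 0) ∧ (∑ k (λ j → c j x) ∸ Θ ≡ᵇ 0)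

    lightSet-light : ∀ x → lightSet x ≡ true → ∑ k (λ j → c j x) ≤ Θ
    lightSet-light x lx = m∸n≡0⇒m≤n (≡ᵇ-true _ 0 (proj₂ (∧-true {not (n ∸ h ≡ᵇ 0)} lx)))

    -- If h < n, each heavy element has total rounded cost at least Θ + 1, while that of `S` is at
    -- most k (N + n) ≤ (h + 1) Θ. If h = n, the size of the ground set suffices.
    few-heavy : ∀ (S : FSet) → (∀ j → j < k → ∑ n (λ e → bit (S e) * demand j e) ≤ supply j) →
      ∑ n (λ e → bit (S e ∧ not (lightSet e))) ≤ h
    few-heavy S feasible = decide (n ∸ h) refl
      where
      #H : ℕ
      #H = ∑ n λ e → bit (S e ∧ not (lightSet e))
      decide : ∀ g → n ∸ h ≡ g → #H ≤ h
      decide zero    eq = ≤-trans (≤-trans (∑-bound n λ e _ → bit-if _) (≤-reflexive (*-identityʳ n))) (m∸n≡0⇒m≤n eq)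
      decide (suc g) eq = ≮⇒≥ λ h<#H → contradiction-from h<#H
        where
        heavy : ∀ e → bit (S e ∧ not (lightSet e)) * suc Θ ≤ ∑ k (λ j → bit (S e) * c j e)
        heavy e with S e
        ... | false = z≤n
        ... | true with lightSet e in le
        ...   | true  = z≤n
        ...   | false = ≤-trans (≤-reflexive (*-identityˡ (suc Θ))) (≤-trans (≰⇒> not-light) (≤-reflexive (∑-cong k λ j _ → sym (*-identityˡ (c j e)))))
          where
          not-light : ¬ (∑ k (λ j → c j e) ≤ Θ)
          not-light small = true≢false (∧-intro {not (n ∸ h ≡ᵇ 0)} (cong (λ z → not (z ≡ᵇ 0)) eq) (≡ᵇ-intro (m≤n⇒m∸n≡0 small))) le
        weight : #H * suc Θ ≤ k * (N + n)
        weight = ≤-trans (≤-reflexive (trans (*-comm #H (suc Θ)) (sym (∑-* n (suc Θ) _))))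
          (≤-trans (∑-mono n λ e _ → ≤-trans (≤-reflexive (*-comm (suc Θ) _)) (heavy e))
          (≤-trans (≤-reflexive (∑-swap n k _)) (∑-bound k λ j j<k → c-cost j S (feasible j j<k))))
        contradiction-from : h < #H → ⊥
        contradiction-from h<#H = <⇒≱ (≤-trans growth (≤-trans (*-monoˡ-≤ (suc Θ) h<#H) weight)) upper
          where
          open ≤-Reasoning
          growth : suc h * Θ < suc h * suc Θ
          growth = *-monoʳ-< (suc h) (n<1+n Θ)
          upper : k * (N + n) ≤ suc h * Θ
          upper = begin
            k * (N + n)                     ≤⟨ *-monoʳ-≤ k (+-mono-≤ (≤-reflexive N≡) (≤-trans (m≤m+n n 1) (m≤m+n W (h * W)))) ⟩
            k * (suc h * W + suc h * W)     ≡⟨ rearrange k (suc h) W ⟩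
            suc h * (k * (W + W))           ≡⟨ cong (suc h *_) (sym Θ≡) ⟩
            suc h * Θ                       ∎
            where
            rearrange : ∀ k a w → k * (a * w + a * w) ≡ a * (k * (w + w))
            rearrange = ℕS.solve-∀

    U-bounded : n ∸ h ≡ 0 → U ≡ N
    U-bounded eq = cong (λ z → if z ≡ᵇ 0 then N else N + Θ + Θ + Θ) eq

    U-slack : ∀ {g} → n ∸ h ≡ suc g → U ≡ N + Θ + Θ + Θ
    U-slack eq = cong (λ z → if z ≡ᵇ 0 then N else N + Θ + Θ + Θ) eq

    2n≤Θ : ∀ {j} → j < k → n + n ≤ Θ
    2n≤Θ {j} j<k = ≤-trans (+-mono-≤ (m≤m+n n 1) (m≤m+n n 1)) (≤-trans (≤-reflexive (sym (*-identityˡ (W + W))))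
      (≤-trans (*-monoˡ-≤ (W + W) (≤-trans (s≤s z≤n) j<k)) (≤-reflexive (sym Θ≡))))

  -- From a correct guess to an acceptable basis

  module SearchSpec {n : ℕ} (oracle : Subset n → Bool) (M : FMatroid n)
    (ind-oracle : ∀ S → oracle (tabulate λ e → S (toℕ e)) ≡ FMatroid.ind M S) (k : ℕ) (input : ℕ → ℕ) where
    open FMatroid M
    open Matroids M
    open Parameters n k input
    open Numerics n k input
    open Polytope M k c using (full; Frac; wt; costᶻ)
    open Relaxation M k c Θ
    open Compilation oracle
    open ProgramLogic oracle
    open GreedySpec oracle M ind-oracle
    open TestSpec oracle M ind-oracle k input

    total-demand : FSet → ℕ → ℕ
    total-demand S j = ∑ n λ e → bit (S e) * demand j e

    -- The quotient of `U` by `N` stands for 1 + ε; multiplied out, the condition can be checked by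
    -- the machine.
    Valid : FSet → Set
    Valid S = ind S ≡ true × ∣ S ∣ ≡ rank full × (∀ j → j < k → N * total-demand S j ≤ U * supply j)

    valid-cong : ∀ {S S′} → (∀ x → x < n → S x ≡ S′ x) → Valid S → Valid S′
    valid-cong eq (i , size , cheap) = trans (sym (ind-ext eq)) i
      , trans (∑-cong n λ x x<n → cong bit (sym (eq x x<n))) size
      , λ j j<k → ≤-trans (≤-reflexive (cong (N *_) (∑-cong n λ x x<n → cong (λ s → bit s * demand j x) (sym (eq x x<n))))) (cheap j j<k)

    record Known (σ : Arrays) : Set where
      constructor known
      field
        inp   : Input σ
        ranks : σ 12 0 ≡ rank full

    open Known

    known-frame : ∀ s ρ σ → writes s 0 ≡ false → writes s 12 ≡ false → Known σ → Known (exec s ρ σ)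
    known-frame s ρ σ w₀ w₁₂ kn = known (λ i → trans (frame s ρ σ 0 w₀ i) (inp kn i)) (trans (frame s ρ σ 12 w₁₂ 0) (ranks kn))

    saveBest decide-accept : Stm
    saveBest = for 30 1 (set 14 (var 30) (arr 2 (var 30)))
    decide-accept = ask 2 8 ⍮ set 13 (con 0) acceptableE

    module _ (ρ : Store) (good : Good ρ) (σ : Arrays) (kn : Known σ) where
      private
        S : FSet
        S = setOf σ 2
        σ₁ σ₂ : Arrays
        σ₁ = exec (ask 2 8) ρ σ
        σ₂ = exec decide-accept ρ σ
        kn₁ : Known σ₁
        kn₁ = known-frame (ask 2 8) ρ σ refl refl kn
        rowValue : ℕ → ℕ
        rowValue j = N * total-demand S j ∸ U * supply j
        row-eval : eval (sumE 35 2 (sumE 40 5 (sumE 45 1 (ifE (arr 2 (var 45)) (demandE 45) (con 0))) ∸′ sumE 40 8 supplyE)) ρ σ₁ ≡ ∑ k rowValue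
        row-eval = ∑-cong₂ (ρ2 {ρ} good) λ j _ → cong₂ _∸_
          (trans (∑-cong₂ (ρ5 {ρ} good) λ _ _ → demands j) (∑-const N (total-demand S j)))
          (trans (∑-cong₂ (ρ8 {ρ} good) λ _ _ → inp kn₁ (4 + j)) (∑-const U (supply j)))
          where
          demands : ∀ j → eval (sumE 45 1 (ifE (arr 2 (var 45)) (demandE 45) (con 0))) (ρ [ 35 ≔ j ]) σ₁ ≡ total-demand S j
          demands j = ∑-cong₂ (ρ1 {ρ} good) λ e _ → trans (if-bit (σ 2 e) _) (cong (bit (S e) *_) (demand-eval {ρ} {σ₁} good (inp kn₁) j e))
        acceptable-eval : eval acceptableE ρ σ₁ ≡ (if bit (ind S) ≡ᵇ 0 then 0
          else (if distance ∣ S ∣ (rank full) ≡ᵇ 0 then (if ∑ k rowValue ≡ᵇ 0 then 1 else 0) else 0))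
        acceptable-eval = if-cong (ask-ind σ 2 λ _ _ → refl) refl
          (if-cong (cong₂ distance (size-eval ρ σ₁ S 2 (ρ1 {ρ} good) λ _ _ → refl) (ranks kn₁)) (if-cong row-eval refl refl) refl)

      acceptable-sound : σ₂ 13 0 ≢ 0 → Valid S
      acceptable-sound ne = decide (ind S) (distance ∣ S ∣ (rank full) ≡ᵇ 0) (∑ k rowValue ≡ᵇ 0) refl refl refl λ eq → ne (trans acceptable-eval eq)
        where
        decide : ∀ i d r → ind S ≡ i → (distance ∣ S ∣ (rank full) ≡ᵇ 0) ≡ d → (∑ k rowValue ≡ᵇ 0) ≡ r →
          ((if bit (ind S) ≡ᵇ 0 then 0 else (if distance ∣ S ∣ (rank full) ≡ᵇ 0 then (if ∑ k rowValue ≡ᵇ 0 then 1 else 0) else 0)) ≢ 0) → Valid S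
        decide false d     r     i≡ d≡ r≡ ne′ rewrite i≡ = ⊥-elim (ne′ refl)
        decide true  false r     i≡ d≡ r≡ ne′ rewrite i≡ | d≡ = ⊥-elim (ne′ refl)
        decide true  true  false i≡ d≡ r≡ ne′ rewrite i≡ | d≡ | r≡ = ⊥-elim (ne′ refl)
        decide true  true  true  i≡ d≡ r≡ ne′ = i≡ , ≡ᵇ-true _ _ (trans (sym (distance≡0 ∣ S ∣ (rank full))) d≡)
          , λ j j<k → m∸n≡0⇒m≤n (n≤0⇒n≡0 (≤-trans (∑-term k {rowValue} j j<k) (≤-reflexive (≡ᵇ-true (∑ k rowValue) 0 r≡))))

      acceptable-complete : Valid S → σ₂ 13 0 ≡ 1
      acceptable-complete (i , size , rows) = trans acceptable-eval
        (trans (cong (λ z → if bit z ≡ᵇ 0 then 0 else (if distance ∣ S ∣ (rank full) ≡ᵇ 0 then (if ∑ k rowValue ≡ᵇ 0 then 1 else 0) else 0)) i)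
        (trans (cong (λ z → if z then (if ∑ k rowValue ≡ᵇ 0 then 1 else 0) else 0) (trans (distance≡0 ∣ S ∣ (rank full)) (≡ᵇ-intro size)))
        (cong (λ z → if z ≡ᵇ 0 then 1 else 0) (∑-zero k λ j j<k → m≤n⇒m∸n≡0 (rows j j<k)))))

      private
        saved : ∀ x → x < n → setOf (exec saveBest ρ σ₂) 14 x ≡ S x
        saved x x<n = cong (0 <ᵇ_) (trans (fill-loop 30 1 14 (arr 2 (var 30)) {ρ} σ₂ (ρ1 {ρ} good) refl x x<n) (frame decide-accept ρ σ 2 refl x))

      accept-keeps : Valid (setOf σ 14) → Valid (setOf (exec accept ρ σ) 14)
      accept-keeps valid = decide (σ₂ 13 0) refl
        where
        decide : ∀ u → σ₂ 13 0 ≡ u → Valid (setOf (exec accept ρ σ) 14)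
        decide zero    eq = subst (λ σ′ → Valid (setOf σ′ 14)) (sym (cong (λ u → if u ≡ᵇ 0 then σ₂ else exec saveBest ρ σ₂) eq))
          (valid-cong (λ x _ → cong (0 <ᵇ_) (sym (frame decide-accept ρ σ 14 refl x))) valid)
        decide (suc u) eq = subst (λ σ′ → Valid (setOf σ′ 14)) (sym (cong (λ u → if u ≡ᵇ 0 then σ₂ else exec saveBest ρ σ₂) eq))
          (valid-cong (λ x x<n → sym (saved x x<n)) (acceptable-sound λ z → case trans (sym eq) z of λ ()))

      accept-takes : Valid S → Valid (setOf (exec accept ρ σ) 14)
      accept-takes valid = subst (λ σ′ → Valid (setOf σ′ 14))
        (sym (cong (λ u → if u ≡ᵇ 0 then σ₂ else exec saveBest ρ σ₂) (acceptable-complete valid)))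
        (valid-cong (λ x x<n → sym (saved x x<n)) valid)

    initialise-spec : ∀ ρ σ → Good ρ → Known σ →
      (∀ x → x < n → setOf (exec initialise ρ σ) 2 x ≡ hits (σ 1) h x)
      × (∀ x → x < n → setOf (exec initialise ρ σ) 3 x ≡ lightSet x) × exec initialise ρ σ 11 0 ≡ b₀
    initialise-spec ρ σ good kn = setA , setF , ρ9 {ρ} good
      where
      clear mark fill : Stm
      clear = for 30 1 (set 2 (var 30) (con 0))
      mark  = for 30 3 (set 2 (arr 1 (var 30)) (con 1))
      fill  = for 30 1 (set 3 (var 30) lightE)
      σ₁ σ₂ : Arrays
      σ₁ = exec clear ρ σ
      σ₂ = exec mark ρ σ₁
      kn₂ : Known σ₂
      kn₂ = known-frame mark ρ σ₁ refl refl (known-frame clear ρ σ refl refl kn)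
      Marked : ℕ → Arrays → Set
      Marked m σ′ = (∀ i → σ′ 1 i ≡ σ 1 i) × (∀ x → x < n → setOf σ′ 2 x ≡ hits (σ 1) m x)
      mark-step : ∀ m σ′ → m < h → Marked m σ′ → Marked (suc m) (exec (set 2 (arr 1 (var 30)) (con 1)) (ρ [ 30 ≔ m ]) σ′)
      mark-step m σ′ _ (same , marked) = (λ i → same i) , λ x x<n → trans (value (x ≡ᵇ σ′ 1 m) (σ′ 2 x))
          (cong₂ _∨_ (cong (x ≡ᵇ_) (same m)) (marked x x<n))
        where
        value : ∀ t u → (0 <ᵇ (if t then 1 else u)) ≡ t ∨ (0 <ᵇ u)
        value true  u = refl
        value false u = refl
      marked : Marked h σ₂
      marked = for-inv Marked 30 3 (set 2 (arr 1 (var 30)) (con 1)) {ρ} {σ₁} (ρ3 {ρ} good)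
        ((λ i → frame clear ρ σ 1 refl i) , λ x x<n → cong (0 <ᵇ_) (fill-loop 30 1 2 (con 0) {ρ} σ (ρ1 {ρ} good) refl x x<n)) mark-step
      setA : ∀ x → x < n → setOf (exec initialise ρ σ) 2 x ≡ hits (σ 1) h x
      setA x x<n = trans (cong (0 <ᵇ_) (frame fill ρ σ₂ 2 refl x)) (proj₂ marked x x<n)
      setF : ∀ x → x < n → setOf (exec initialise ρ σ) 3 x ≡ lightSet x
      setF x x<n = trans (cong (0 <ᵇ_) (trans (fill-loop 30 1 3 lightE {ρ} σ₂ (ρ1 {ρ} good) refl x x<n) light-eval))
          (value (n ∸ h) (∑ k (λ j → c j x) ∸ Θ))
        where
        light-eval : eval lightE (ρ [ 30 ≔ x ]) σ₂ ≡ (if n ∸ h ≡ᵇ 0 then 0 else (if ∑ k (λ j → c j x) ∸ Θ ≡ᵇ 0 then 1 else 0))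
        light-eval = if-cong (cong₂ _∸_ (ρ1 {ρ} good) (ρ3 {ρ} good)) refl
          (if-cong (cong₂ _∸_ (∑-cong₂ (ρ2 {ρ} good) λ j _ → cost-eval {ρ} {σ₂} good (inp kn₂) j x) (ρ6 {ρ} good)) refl refl)
        value : ∀ u v → (0 <ᵇ (if u ≡ᵇ 0 then 0 else (if v ≡ᵇ 0 then 1 else 0))) ≡ not (u ≡ᵇ 0) ∧ (v ≡ᵇ 0)
        value zero    v       = refl
        value (suc u) zero    = refl
        value (suc u) (suc v) = refl

    module Guess (B : FSet) (B-ind : ind B ≡ true) (B-size : ∣ B ∣ ≡ rank full)
      (B-cheap : ∀ j → j < k → total-demand B j ≤ supply j) where

      heavy E : FSet
      heavy x = B x ∧ not (lightSet x)
      E = heavy ∪ lightSet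

      open SweepSpec oracle M ind-oracle k input E

      -- The assumed basis is itself a point, with denominator 1, and its heavy part is what the
      -- right guess fixes. The n in b₀ pays for rounding up its costs.
      guess-point : Inv heavy lightSet b₀
      guess-point = record
        { D      = 1ℤ
        ; x      = χ ∘ B
        ; D>0    = ℤ.+<+ (s≤s z≤n)
        ; x≥0    = λ e _ → χ≥0 (B e)
        ; onA    = λ e _ He → cong χ (proj₁ (∧-true He))
        ; off    = λ e _ He Le → cong χ (outside (B e) (lightSet e) He Le)
        ; below  = λ S → ℤP.≤-trans (ℤP.≤-reflexive (weight-of S)) (ℤP.≤-trans (ℤ.+≤+ (ind-≤-rank
            (ind-mono (λ _ _ m → proj₁ (∧-true m)) B-ind) λ e _ m → proj₂ (∧-true {B e} m))) (ℤP.≤-reflexive (sym (ℤP.*-identityˡ _))))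
        ; total  = trans (weight-of full) (trans (cong pos (trans (∑-cong n λ e _ → cong bit (∧-identityʳ (B e))) B-size)) (sym (ℤP.*-identityˡ _)))
        ; budget = λ j j<k _ → ℤP.≤-trans (ℤP.≤-reflexive (cost-of j)) (ℤP.≤-trans (ℤ.+≤+ (c-cost j B (B-cheap j j<k))) (ℤP.≤-reflexive (sym (ℤP.*-identityˡ _))))
        }
        where
        open import Data.Bool.Properties using (∧-identityʳ)
        χ≥0 : ∀ b → 0ℤ ℤ.≤ χ b
        χ≥0 true  = ℤ.+≤+ z≤n
        χ≥0 false = ℤ.+≤+ z≤n
        outside : ∀ b l → b ∧ not l ≡ false → l ≡ false → b ≡ false
        outside false l _ _ = refl
        outside true  true  _ ()
        outside true  false () _
        weight-of : ∀ S → wt (χ ∘ B) S ≡ pos ∣ B ∩ S ∣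
        weight-of S = trans (∑ᶻ.∑-cong n λ e _ → pointwise (S e) (B e)) (sym (pos-∑ n _))
          where
          pointwise : ∀ s t → χ s ℤ.* χ t ≡ pos (bit (t ∧ s))
          pointwise true  true  = refl
          pointwise true  false = refl
          pointwise false true  = refl
          pointwise false false = refl
        cost-of : ∀ j → costᶻ (χ ∘ B) j ≡ pos (costOf B j)
        cost-of j = trans (∑ᶻ.∑-cong n λ e _ → pointwise (c j e) (B e)) (sym (pos-∑ n _))
          where
          pointwise : ∀ u t → pos u ℤ.* χ t ≡ pos (bit t * u)
          pointwise u true  = trans (ℤP.*-identityʳ (pos u)) (cong pos (sym (+-identityʳ u)))
          pointwise u false = ℤP.*-zeroʳ (pos u)

      initial-track : ∀ ρ σ → Good ρ → Known σ → (∀ x → x < n → hits (σ 1) h x ≡ heavy x) → Track heavy lightSet b₀ (exec initialise ρ σ)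
      initial-track ρ σ good kn guessed = track (inp kn′) (ranks kn′)
        (λ x x<n → trans (proj₁ spec x x<n) (guessed x x<n)) (proj₁ (proj₂ spec)) (proj₂ (proj₂ spec))
        (λ x _ lx → lightSet-light x lx) (λ x _ lx → trans (cong (λ l → B x ∧ not l) lx) (∧-false (B x))) guess-point
        (+-monoʳ-≤ b₀ (≤-trans (∑-bound n λ e _ → bit-if (lightSet e)) (≤-reflexive (*-identityʳ n)))) (λ _ _ m → m)
        where
        kn′ : Known (exec initialise ρ σ)
        kn′ = known-frame initialise ρ σ refl refl kn
        spec = initialise-spec ρ σ good kn

      -- If h = n, the result lies in the assumed basis and keeps the exact budgets. Otherwise N d ≤
      -- c B for every chosen element, and the rounded cost is at most N + 2n + 2Θ ≤ N + 3Θ.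
      final-valid : ∀ {A F b σ} → Track A F b σ → ∣ F ∣ ≡ 0 → Valid A
      final-valid {A} {F} {b} {σ} tr empty = final-independent tr empty , final-size tr empty , λ j j<k → cheap j j<k (n ∸ h) refl
        where
        A⊆E : ∀ e → e < n → A e ≡ true → E e ≡ true
        A⊆E e e<n Ae = Track.inside tr e e<n (∨-introˡ Ae)
        cheap : ∀ j → j < k → ∀ g → n ∸ h ≡ g → N * total-demand A j ≤ U * supply j
        cheap j j<k zero eq = subst (λ u → N * total-demand A j ≤ u * supply j) (sym (U-bounded eq))
            (*-monoʳ-≤ N (≤-trans (∑-mono n λ e e<n → *-monoˡ-≤ (demand j e) (bit-mono λ Ae → A⊆B e (A⊆E e e<n Ae))) (B-cheap j j<k)))
          where
          A⊆B : ∀ e → E e ≡ true → B e ≡ true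
          A⊆B e Ee with ∨-true {heavy e} Ee
          ... | inj₁ He = proj₁ (∧-true He)
          ... | inj₂ Le = ⊥-elim (true≢false (proj₁ (∧-true Le)) (cong (λ z → not (z ≡ᵇ 0)) eq))
        cheap j j<k (suc g) eq = begin
          N * total-demand A j                          ≡⟨ sym (∑-* n N _) ⟩
          ∑ n (λ e → N * (bit (A e) * demand j e))      ≤⟨ ∑-mono n term ⟩
          ∑ n (λ e → supply j * (bit (A e) * c j e))    ≡⟨ trans (∑-* n (supply j) _) (*-comm (supply j) _) ⟩
          costOf A j * supply j                         ≤⟨ *-monoˡ-≤ (supply j) (≤-trans (final-cost tr empty j j<k) slack-bound) ⟩
          U * supply j                                  ∎
          where
          open ≤-Reasoning
          slack-bound : b₀ + n + (Θ + Θ) ≤ U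
          slack-bound = ≤-trans (≤-reflexive (shuffle N n Θ)) (≤-trans (+-monoˡ-≤ (Θ + Θ) (+-monoʳ-≤ N (2n≤Θ j<k)))
            (≤-reflexive (trans (shuffle′ N Θ) (sym (U-slack eq)))))
            where
            shuffle : ∀ N n Θ → N + n + n + (Θ + Θ) ≡ N + (n + n) + (Θ + Θ)
            shuffle = ℕS.solve-∀
            shuffle′ : ∀ N Θ → N + Θ + (Θ + Θ) ≡ N + Θ + Θ + Θ
            shuffle′ = ℕS.solve-∀
          -- A guessed element belongs to a feasible basis, so it is affordable and its cost rounds
          -- to at most N; a light element has at most Θ. Neither is truncated.
          c<cap : ∀ e → e < n → E e ≡ true → c j e < cap
          c<cap e e<n Ee with ∨-true {heavy e} Ee
          ... | inj₁ He = ≤-<-trans (c-affordable j e (≤-trans (≤-reflexive (sym (trans (cong (λ s → bit s * demand j e) (proj₁ (∧-true {B e} He))) (*-identityˡ _))))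
              (≤-trans (∑-term n e e<n) (B-cheap j j<k)))) (≤-trans (s≤s (m≤n+m N Θ)) (≤-reflexive (+-comm 1 (Θ + N))))
          ... | inj₂ Le = ≤-<-trans (≤-trans (∑-term k j j<k) (lightSet-light e Le)) (≤-trans (s≤s (m≤m+n Θ N)) (≤-reflexive (+-comm 1 (Θ + N))))
          term : ∀ e → e < n → N * (bit (A e) * demand j e) ≤ supply j * (bit (A e) * c j e)
          term e e<n with A e in Ae
          ... | false = ≤-reflexive (trans (*-zeroʳ N) (sym (*-zeroʳ (supply j))))
          ... | true  = subst₂ _≤_ (cong (N *_) (sym (*-identityˡ _))) (trans (*-comm _ (supply j)) (cong (supply j *_) (sym (*-identityˡ _))))
            (c-ceiling j e (c<cap e e<n (A⊆E e e<n Ae)))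

      correct-guess : ∀ ρ σ → Good ρ → Known σ → (∀ x → x < n → hits (σ 1) h x ≡ heavy x) →
        Valid (setOf (exec sweep ρ (exec initialise ρ σ)) 2)
      correct-guess ρ σ good kn guessed = conclude (sweep-spec ρ (exec initialise ρ σ) good (initial-track ρ σ good kn guessed))
        where
        conclude : _ → _
        conclude (A , F , b , tr , empty) = valid-cong (λ x x<n → sym (Track.setA tr x x<n)) (final-valid tr empty)

  module MainSpec {n : ℕ} (oracle : Subset n → Bool) (M : FMatroid n)
    (ind-oracle : ∀ S → oracle (tabulate λ e → S (toℕ e)) ≡ FMatroid.ind M S) (k : ℕ) (input : ℕ → ℕ) where
    open FMatroid M
    open Matroids M
    open Parameters n k input
    open Numerics n k input
    open Polytope M k c using (full)
    open Compilation oracle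
    open ProgramLogic oracle
    open GreedySpec oracle M ind-oracle
    open TestSpec oracle M ind-oracle k input
    open SearchSpec oracle M ind-oracle k input
    open MultiplicativeWeights M k c Θ

    under-lets : ∀ (Q : Arrays → Set) ps s ρ σ → Q (exec s (letEnv ps ρ σ) σ) → Q (exec (withLets ps s) ρ σ)
    under-lets Q ps s ρ σ = subst Q (sym (exec-lets ps s ρ σ))

    rename : ∀ (Q : Arrays → Set) s s′ ρ σ → s ≡ s′ → Q (exec s ρ σ) → Q (exec s′ ρ σ)
    rename Q s s′ ρ σ eq = subst (λ s → Q (exec s ρ σ)) eq

    good-parameters : Good (letEnv parameters (startEnv n k) (inputArrays input))
    good-parameters = refl , refl , refl , refl , refl , refl , refl , refl , refl , refl , refl , refl

    setup-spec : ∀ ρ σ → Good ρ → Input σ → (∀ a i → σ (suc a) i ≡ 0) →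
      Known (exec setup ρ σ) × exec setup ρ σ 15 0 ≡ W ^ h × (∀ i → exec setup ρ σ 1 i ≡ 0)
    setup-spec ρ σ good inp₀ zeros = known inp₅ rank₅ , count₅ , λ i → trans (frame setup ρ σ 1 refl i) (zeros 0 i)
      where
      power fillF : Stm
      power = for 13 3 (set 15 (con 0) (sumE 40 4 (cell 15)))
      fillF = for 30 1 (set 5 (var 30) (con 1))
      σ₁ σ₂ σ₃ σ₄ : Arrays
      σ₁ = exec (set 15 (con 0) (con 1)) ρ σ
      σ₂ = exec power ρ σ₁
      σ₃ = exec fillF ρ σ₂
      σ₄ = exec greedy ρ σ₃
      inp₅ : Input (exec setup ρ σ)
      inp₅ i = trans (frame setup ρ σ 0 refl i) (inp₀ i)
      count₂ : σ₂ 15 0 ≡ W ^ h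
      count₂ = for-inv (λ m σ′ → σ′ 15 0 ≡ W ^ m) 13 3 (set 15 (con 0) (sumE 40 4 (cell 15))) {ρ} {σ₁} (ρ3 {ρ} good) refl
        λ m σ′ _ eq → trans (∑-cong₂ (ρ4 {ρ} good) λ _ _ → eq) (∑-const W (W ^ m))
      count₅ : exec setup ρ σ 15 0 ≡ W ^ h
      count₅ = trans (frame greedy ρ σ₃ 15 refl 0) (trans (frame fillF ρ σ₂ 15 refl 0) count₂)
      zero₃ : ∀ a → writes power (suc a) ≡ false → writes (set 15 (con 0) (con 1)) (suc a) ≡ false → writes fillF (suc a) ≡ false → ∀ x → σ₃ (suc a) x ≡ 0
      zero₃ a w₁ w₂ w₃ x = trans (frame fillF ρ σ₂ (suc a) w₃ x) (trans (frame power ρ σ₁ (suc a) w₁ x)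
        (trans (frame (set 15 (con 0) (con 1)) ρ σ (suc a) w₂ x) (zeros a x)))
      spec = greedy-spec k c Θ ρ σ₃ (λ _ → false) full (λ _ → 0) V (ρ1 {ρ} good) (ρ12 {ρ} good)
        (λ x _ → cong (0 <ᵇ_) (zero₃ 3 refl refl refl x))
        (λ x x<n → cong (0 <ᵇ_) (fill-loop 30 1 5 (con 1) {ρ} σ₂ (ρ1 {ρ} good) refl x x<n))
        (λ x _ → zero₃ 9 refl refl refl x) (λ _ _ → s≤s z≤n)
      rank₅ : exec setup ρ σ 12 0 ≡ rank full
      rank₅ = trans (size-eval ρ σ₄ (setOf σ₄ 6) 6 (ρ1 {ρ} good) λ _ _ → refl)
        (trans (greedy-size (proj₂ (proj₂ spec) ind-∅)) (rank-cong λ _ _ → refl))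

    setup-count : exec setup (letEnv parameters (startEnv n k) (inputArrays input)) (inputArrays input) 15 0 ≡ W ^ h
    setup-count = proj₁ (proj₂ (setup-spec (letEnv parameters (startEnv n k) (inputArrays input)) (inputArrays input) good-parameters (λ _ → refl) (λ _ _ → refl)))

    guess-count : exec enumerated (letEnv parameters (startEnv n k) (inputArrays input)) (inputArrays input) 15 0 ≡ W ^ h
    guess-count = subst (λ s → exec s (letEnv parameters (startEnv n k) (inputArrays input)) (inputArrays input) 15 0 ≡ W ^ h)
      {setup} {enumerated} (sym enumerated-text) setup-count

    module _ (B : FSet) (B-ind : ind B ≡ true) (B-size : ∣ B ∣ ≡ rank full)
      (B-cheap : ∀ j → j < k → total-demand B j ≤ supply j) where
      open Guess B B-ind B-size B-cheap

      private
        guess : Σ[ τ ∈ (ℕ → ℕ) ] (∀ i → τ i ≤ n) × (∀ x → x < n → hits τ h x ≡ heavy x)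
        guess = small-set-listed n h heavy (few-heavy B B-cheap)
        τ : ℕ → ℕ
        τ = proj₁ guess
        target : ℕ
        target = digitsBelow W τ h

      -- `accept` stores only valid sets, so a later guess may replace the stored solution but not
      -- spoil it. `digits` becomes void after the last guess, where the counter overflows.
      record Searching (i : ℕ) (σ : Arrays) : Set where
        constructor searching
        field
          facts  : Known σ
          digits : i < W ^ h → (∀ l → l < h → σ 1 l ≤ n) × digitsBelow W (σ 1) h ≡ i
          solved : target < i → Valid (setOf σ 14)

      -- The states are variables here, so that they are not unfolded when types are compared.
      module _ {i : ℕ} {σ σ₂ σ₃ σ₄ : Arrays} (i<G : i < W ^ h) (state : Searching i σ) (facts₄ : Known σ₄)
        (kept₂ : ∀ x → σ₂ 14 x ≡ σ 14 x) (digits₃ : ∀ l → σ₃ 1 l ≡ σ 1 l) (kept₄ : ∀ x → σ₄ 14 x ≡ σ₃ 14 x)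
        (correct : (∀ x → x < n → hits (σ 1) h x ≡ heavy x) → Valid (setOf σ₂ 2))
        (keep : Valid (setOf σ₂ 14) → Valid (setOf σ₃ 14)) (take : Valid (setOf σ₂ 2) → Valid (setOf σ₃ 14))
        (next : (∀ l → l < h → σ₃ 1 l ≤ n) → digitsBelow W (σ₃ 1) h + 1 < W ^ h →
          (∀ l → l < h → σ₄ 1 l ≤ n) × digitsBelow W (σ₄ 1) h ≡ digitsBelow W (σ₃ 1) h + 1) where
        open Searching state

        private
          value₃ : digitsBelow W (σ₃ 1) h ≡ i
          value₃ = trans (∑-cong h λ l _ → cong (_* W ^ l) (digits₃ l)) (proj₂ (digits i<G))

          digits₄ : suc i < W ^ h → (∀ l → l < h → σ₄ 1 l ≤ n) × digitsBelow W (σ₄ 1) h ≡ suc i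
          digits₄ 1+i<G = proj₁ advanced , trans (proj₂ advanced) (trans (cong (_+ 1) value₃) (+-comm i 1))
            where
            advanced = next (λ l l<h → ≤-trans (≤-reflexive (digits₃ l)) (proj₁ (digits i<G) l l<h))
              (≤-trans (≤-reflexive (cong suc (trans (cong (_+ 1) value₃) (+-comm i 1)))) 1+i<G)

          guessed : target ≡ i → ∀ x → x < n → hits (σ 1) h x ≡ heavy x
          guessed t≡i x x<n = trans (hits-cong h x (digits-unique n (σ 1) τ h (proj₁ (digits i<G)) (λ l _ → proj₁ (proj₂ guess) l)
            (trans (proj₂ (digits i<G)) (sym t≡i)))) (proj₂ (proj₂ guess) x x<n)

          solved₃ : target < suc i → Dec (target ≡ i) → Valid (setOf σ₃ 14)
          solved₃ t<1+i (yes t≡i) = take (correct (guessed t≡i))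
          solved₃ t<1+i (no t≢i)  = keep (valid-cong (λ x _ → cong (0 <ᵇ_) (sym (kept₂ x))) (solved (≤∧≢⇒< (≤-pred t<1+i) t≢i)))

        searching-next : Searching (suc i) σ₄
        searching-next = searching facts₄ digits₄ λ t<1+i →
          valid-cong (λ x _ → cong (0 <ᵇ_) (sym (kept₄ x))) (solved₃ t<1+i (target ≟ i))

      round-spec : ∀ ρ σ i → Good ρ → i < W ^ h → Searching i σ → Searching (suc i) (exec guessRound ρ σ)
      round-spec ρ σ i good i<G state = searching-next {i} {σ} {exec sweep ρ (exec initialise ρ σ)}
        {exec accept ρ (exec sweep ρ (exec initialise ρ σ))} {exec nextGuess ρ (exec accept ρ (exec sweep ρ (exec initialise ρ σ)))} i<G state
        (known-frame guessRound ρ σ refl refl facts)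
        (λ x → trans (frame sweep ρ (exec initialise ρ σ) 14 refl x) (frame initialise ρ σ 14 refl x))
        (λ l → trans (frame accept ρ (exec sweep ρ (exec initialise ρ σ)) 1 refl l)
          (trans (frame sweep ρ (exec initialise ρ σ) 1 refl l) (frame initialise ρ σ 1 refl l)))
        (λ x → frame nextGuess ρ (exec accept ρ (exec sweep ρ (exec initialise ρ σ))) 14 refl x)
        (correct-guess ρ σ good facts)
        (accept-keeps ρ good (exec sweep ρ (exec initialise ρ σ)) facts₂)
        (accept-takes ρ good (exec sweep ρ (exec initialise ρ σ)) facts₂)
        (nextGuess-spec oracle ρ (exec accept ρ (exec sweep ρ (exec initialise ρ σ))) h (ρ1 {ρ} good) (ρ3 {ρ} good))
        where
        facts : Known σ
        facts = Searching.facts state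
        facts₂ : Known (exec sweep ρ (exec initialise ρ σ))
        facts₂ = known-frame sweep ρ (exec initialise ρ σ) refl refl (known-frame initialise ρ σ refl refl facts)

      search-spec : ∀ ρ σ → Good ρ → σ 15 0 ≡ W ^ h → Searching 0 σ → Searching (W ^ h) (exec search-all ρ σ)
      search-spec ρ σ good G start = for-inv Searching 14 13 guessRound {ρ [ 13 ≔ eval (cell 15) ρ σ ]} {σ} G start
        λ i σ′ i<G state → round-spec (ρ [ 13 ≔ eval (cell 15) ρ σ ] [ 14 ≔ i ]) σ′ i good i<G state

      body-spec : ∀ ρ σ → Good ρ → Input σ → (∀ a i → σ (suc a) i ≡ 0) → Valid (setOf (exec (setup ⍮ search-all) ρ σ) 14)
      body-spec ρ σ good inp₀ zeros = Searching.solved (search-spec ρ (exec setup ρ σ) good (proj₁ (proj₂ spec)) start)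
          (digits-small n τ h λ l _ → proj₁ (proj₂ guess) l)
        where
        spec = setup-spec ρ σ good inp₀ zeros
        start : Searching 0 (exec setup ρ σ)
        start = searching (proj₁ spec) (λ _ → (λ l _ → ≤-trans (≤-reflexive (proj₂ (proj₂ spec) l)) z≤n)
            , ∑-zero h λ l _ → cong (_* W ^ l) (proj₂ (proj₂ spec) l)) λ ()

      body-spec₀ : Valid (setOf (exec (setup ⍮ search-all) (letEnv parameters (startEnv n k) (inputArrays input)) (inputArrays input)) 14)
      body-spec₀ = body-spec (letEnv parameters (startEnv n k) (inputArrays input)) (inputArrays input) good-parameters (λ _ → refl) (λ _ _ → refl)

      unfolded-spec : Valid (setOf (exec (withLets parameters (setup ⍮ search-all)) (startEnv n k) (inputArrays input)) 14)
      unfolded-spec = under-lets (λ σ → Valid (setOf σ 14)) parameters (setup ⍮ search-all) (startEnv n k) (inputArrays input) body-spec₀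

      main-spec : Valid (setOf (exec main (startEnv n k) (inputArrays input)) 14)
      main-spec = rename (λ σ → Valid (setOf σ 14)) (withLets parameters (setup ⍮ search-all)) main (startEnv n k) (inputArrays input)
        (sym {x = main} {withLets parameters (setup ⍮ search-all)} main-text) unfolded-spec

  -- The running time

  startDegrees : ℕ → ℕ
  startDegrees x = if x <ᵇ 3 then 2 else 0

  parameterDegrees : ℕ → ℕ
  parameterDegrees = letDegrees parameters startDegrees

  -- The degree is evaluated by the type checker; 150 is a round number above it.
  setup-degree : timeDegree (withLets parameters setup) startDegrees ≤ 150
  setup-degree = ≤ᵇ⇒≤ _ 150 _

  -- Registers 13 and 14 bound no loop within a round, so g and i disappear on evaluation and the
  -- number of guesses does not enter.
  round-degree : ∀ g i → timeDegree guessRound (parameterDegrees [ 13 ≔ g ] [ 14 ≔ i ]) ≤ 180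
  round-degree g i = ≤ᵇ⇒≤ _ 180 _

  size-bound : ∀ n k → baseOf n k ≤ (2 + n + k) ^ 2
  size-bound n k = ≤-trans (m≤m+n _ (n * n + k * k + 3 * n + 3 * k + n * k)) (≤-reflexive (square n k))
    where
    square : ∀ n k → 4 + n + k + k * n + (n * n + k * k + 3 * n + 3 * k + n * k) ≡ (2 + n + k) * ((2 + n + k) * 1)
    square = ℕS.solve-∀

  module TimeBound {n : ℕ} (oracle : Subset n → Bool) (k m : ℕ) (2≤m : 2 ≤ m) (base-bound : baseOf n k ≤ m ^ 2) where
    open Compilation oracle
    open ProgramLogic oracle
    open Degrees m 2≤m

    start-bounded : Bounded startDegrees (startEnv n k)
    start-bounded 0 = base-bound
    start-bounded 1 = ≤-trans (n≤baseOf n k) base-bound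
    start-bounded 2 = ≤-trans (≤-trans (m≤n+m k (4 + n)) (m≤m+n (4 + n + k) (k * n))) base-bound
    start-bounded (suc (suc (suc x))) = z≤n

    parameters-bounded : ∀ σ → Bounded parameterDegrees (letEnv parameters (startEnv n k) σ)
    parameters-bounded σ = lets-bound parameters σ refl start-bounded

    time-repeated : ∀ s ρ σ t → (∀ i σ′ → i < σ 15 0 → time s (ρ [ 13 ≔ σ 15 0 ] [ 14 ≔ i ]) σ′ ≤ t) →
      time (letS 13 (cell 15) (for 14 13 s)) ρ σ ≤ 12 + σ 15 0 * (t + 6)
    -- Reading the number of guesses takes 9 steps, entering and leaving the loop 3.
    time-repeated s ρ σ t le = +-monoʳ-≤ 12 (∑-bound (σ 15 0) λ i i< → +-monoˡ-≤ 6 (le i _ i<))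

    at-degree : ∀ d s δ {ρ} σ → analysable s ≡ true → ρ 1 ≡ n → Bounded δ ρ → timeDegree s δ ≤ d → time s ρ σ ≤ m ^ d
    at-degree d s δ {ρ} σ ok r1 b le = ≤-trans (time-bound oracle s σ ok r1 b) (pow-mono {timeDegree s δ} {d} le)

    round-bound : ∀ ρ σ g i → ρ 1 ≡ n → Bounded parameterDegrees ρ → time guessRound (ρ [ 13 ≔ g ] [ 14 ≔ i ]) σ ≤ m ^ 180
    round-bound ρ σ g i r1 bd = at-degree 180 guessRound (parameterDegrees [ 13 ≔ g ] [ 14 ≔ i ]) {ρ [ 13 ≔ g ] [ 14 ≔ i ]} σ refl r1
      (bounded-bind {parameterDegrees [ 13 ≔ g ]} {ρ [ 13 ≔ g ]} 14 i i (pow-const i) (bounded-bind {parameterDegrees} {ρ} 13 g g (pow-const g) bd)) (round-degree g i)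

    time-search : ∀ ρ σ → ρ 1 ≡ n → Bounded parameterDegrees ρ → time search-all ρ σ ≤ 12 + σ 15 0 * (m ^ 180 + 6)
    time-search ρ σ r1 bd = time-repeated guessRound ρ σ (m ^ 180) λ i σ′ _ → round-bound ρ σ′ (σ 15 0) i r1 bd

    prelude-bound : preludeTime n k ≤ m ^ 21
    prelude-bound = ≤-trans (≤-reflexive (shuffle (∑ k λ _ → 7) (∑ (baseOf n k) λ _ → 17)))
      (pow-+ {13} {(∑ k λ _ → 7) + (∑ (baseOf n k) λ _ → 17)} {13} {20} (pow-const 13)
        (pow-+ {∑ k λ _ → 7} {∑ (baseOf n k) λ _ → 17} {9} {19} (pow-∑ {p = 2} {7} (start-bounded 2) λ _ _ → pow-const 7)
          (pow-∑ {p = 2} {17} base-bound λ _ _ → pow-const 17)))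
      where
      shuffle : ∀ u v → 7 + (3 + u + (3 + v)) ≡ 13 + (u + v)
      shuffle = ℕS.solve-∀

    output-bound : 3 + (∑ n λ _ → 17) ≤ m ^ 20
    output-bound = pow-+ {3} {∑ n λ _ → 17} {3} {19} (pow-const 3) (pow-∑ {p = 2} {17} (start-bounded 1) λ _ _ → pow-const 17)

    -- What lies outside the loop is below m^187, hence below G m^187 as there is at least one
    -- guess; adding this to the loop costs the last power of m.
    combine : ∀ a b c d G → 1 ≤ G → a ≤ m ^ 21 → b ≤ m ^ 150 → c ≤ 12 + G * (m ^ 180 + 6) → d ≤ m ^ 20 → a + (b + c + d) ≤ G * m ^ 188
    combine a b c d G 1≤G a≤ b≤ c≤ d≤ = begin
      a + (b + c + d)                                        ≤⟨ +-mono-≤ a≤ (+-mono-≤ (+-mono-≤ b≤ c≤) d≤) ⟩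
      m ^ 21 + (m ^ 150 + (12 + G * (m ^ 180 + 6)) + m ^ 20) ≡⟨ shuffle (m ^ 21) (m ^ 150) G (m ^ 180) (m ^ 20) ⟩
      (m ^ 21 + (m ^ 150 + (12 + m ^ 20))) + G * (m ^ 180 + 6) ≤⟨ +-mono-≤ small (*-monoʳ-≤ G large) ⟩
      m ^ 187 + G * m ^ 187                                  ≤⟨ +-monoˡ-≤ (G * m ^ 187) (m≤m*n′ (m ^ 187) G 1≤G) ⟩
      G * m ^ 187 + G * m ^ 187                              ≡⟨ double G (m ^ 187) ⟩
      G * (2 * m ^ 187)                                      ≤⟨ *-monoʳ-≤ G (*-monoˡ-≤ (m ^ 187) 2≤m) ⟩
      G * m ^ 188                                            ∎
      where
      open ≤-Reasoning
      shuffle : ∀ x y G z w → x + (y + (12 + G * (z + 6)) + w) ≡ (x + (y + (12 + w))) + G * (z + 6)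
      shuffle = ℕS.solve-∀
      double : ∀ G x → G * x + G * x ≡ G * (2 * x)
      double = ℕS.solve-∀
      m≤m*n′ : ∀ x G → 1 ≤ G → x ≤ G * x
      m≤m*n′ x G le = ≤-trans (≤-reflexive (sym (*-identityˡ x))) (*-monoˡ-≤ x le)
      small : m ^ 21 + (m ^ 150 + (12 + m ^ 20)) ≤ m ^ 187
      small = ≤-trans (pow-+ {m ^ 21} {m ^ 150 + (12 + m ^ 20)} {21} {151} ≤-refl
        (pow-+ {m ^ 150} {12 + m ^ 20} {150} {21} ≤-refl (pow-+ {12} {m ^ 20} {12} {20} (pow-const 12) ≤-refl))) (pow-mono {152} {187} (≤ᵇ⇒≤ 152 187 _))
      large : m ^ 180 + 6 ≤ m ^ 187
      large = ≤-trans (pow-+ {m ^ 180} {6} {180} {6} ≤-refl (pow-const 6)) (pow-mono {181} {187} (≤ᵇ⇒≤ 181 187 _))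

    assemble : ∀ ps s s′ ρ σ G → exec s (letEnv ps ρ σ) σ 15 0 ≡ G → 1 ≤ G → time (withLets ps s) ρ σ ≤ m ^ 150 →
      (∀ σ′ → time s′ (letEnv ps ρ σ) σ′ ≤ 12 + σ′ 15 0 * (m ^ 180 + 6)) →
      preludeTime n k + (time (withLets ps (s ⍮ s′)) ρ σ + (3 + ∑ n λ _ → 17)) ≤ G * m ^ 188
    assemble ps s s′ ρ σ G refl 1≤G first second = ≤-trans
      (≤-reflexive (cong (λ t → preludeTime n k + (t + (3 + ∑ n λ _ → 17))) (time-lets ps s s′ ρ σ)))
      (combine (preludeTime n k) (time (withLets ps s) ρ σ) (time s′ (letEnv ps ρ σ) (exec s (letEnv ps ρ σ) σ)) (3 + ∑ n λ _ → 17)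
        (exec s (letEnv ps ρ σ) σ 15 0) 1≤G prelude-bound first (second (exec s (letEnv ps ρ σ) σ)) output-bound)

    setup-bound : ∀ σ → time (withLets parameters setup) (startEnv n k) σ ≤ m ^ 150
    setup-bound σ = at-degree 150 (withLets parameters setup) startDegrees {startEnv n k} σ refl refl start-bounded setup-degree

    search-bound : ∀ σ σ′ → time search-all (letEnv parameters (startEnv n k) σ) σ′ ≤ 12 + σ′ 15 0 * (m ^ 180 + 6)
    search-bound σ σ′ = time-search (letEnv parameters (startEnv n k) σ) σ′ refl (parameters-bounded σ)

    unfolded-bound : ∀ σ G → exec setup (letEnv parameters (startEnv n k) σ) σ 15 0 ≡ G → 1 ≤ G →
      preludeTime n k + (time (withLets parameters (setup ⍮ search-all)) (startEnv n k) σ + (3 + ∑ n λ _ → 17)) ≤ G * m ^ 188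
    unfolded-bound σ G eq 1≤G = assemble parameters setup search-all (startEnv n k) σ G eq 1≤G (setup-bound σ) (search-bound σ)

    total-bound : ∀ σ G → exec enumerated (letEnv parameters (startEnv n k) σ) σ 15 0 ≡ G → 1 ≤ G →
      preludeTime n k + (time main (startEnv n k) σ + (3 + ∑ n λ _ → 17)) ≤ G * m ^ 188
    total-bound σ G eq 1≤G = subst (λ s → preludeTime n k + (time s (startEnv n k) σ + (3 + ∑ n λ _ → 17)) ≤ G * m ^ 188)
      {withLets parameters (setup ⍮ search-all)} {main} (sym main-text) (unfolded-bound σ G
        (subst (λ s → exec s (letEnv parameters (startEnv n k) σ) σ 15 0 ≡ G) {enumerated} {setup} enumerated-text eq) 1≤G)

  -- Matroids, rationals and probabilities of the statement

  ∑-front : ∀ n (g : ℕ → ℕ) → ∑ (suc n) g ≡ g 0 + ∑ n (g ∘ suc)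
  ∑-front zero    g = sym (+-identityʳ (g 0))
  ∑-front (suc n) g = trans (cong (_+ g (suc n)) (∑-front n g)) (+-assoc (g 0) (∑ n (g ∘ suc)) (g (suc n)))

  sum-∑ : ∀ n (g : ℕ → ℕ) → sumᶠ {n} (g ∘ toℕ) ≡ ∑ n g
  sum-∑ zero    g = refl
  sum-∑ (suc n) g = trans (cong (g 0 +_) (sum-∑ n (g ∘ suc))) (sym (∑-front n g))

  subsetOf : ∀ n → FSet → Subset n
  subsetOf n S = tabulate (λ e → S (toℕ e))

  ∣subsetOf∣ : ∀ n S → Sub.∣ subsetOf n S ∣ ≡ ∑ n (bit ∘ S)
  ∣subsetOf∣ zero    S = refl
  ∣subsetOf∣ (suc n) S = trans (step-size (S 0)) (sym (∑-front n (bit ∘ S)))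
    where
    step-size : ∀ b → Sub.∣ b Vec.∷ subsetOf n (S ∘ suc) ∣ ≡ bit b + ∑ n (bit ∘ S ∘ suc)
    step-size true  = cong suc (∣subsetOf∣ n (S ∘ suc))
    step-size false = ∣subsetOf∣ n (S ∘ suc)

  lookup-subsetOf : ∀ {n} S (e : Fin n) → Vec.lookup (subsetOf n S) e ≡ S (toℕ e)
  lookup-subsetOf S e = VecP.lookup∘tabulate (λ e → S (toℕ e)) e

  ∈-subsetOf : ∀ {n} S (e : Fin n) → S (toℕ e) ≡ true → e Sub.∈ subsetOf n S
  ∈-subsetOf S e Se = VecP.lookup⇒[]= e _ (trans (lookup-subsetOf S e) Se)

  subsetOf-∈ : ∀ {n} S (e : Fin n) → e Sub.∈ subsetOf n S → S (toℕ e) ≡ true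
  subsetOf-∈ S e e∈ = trans (sym (lookup-subsetOf S e)) (VecP.[]=⇒lookup e∈)

  members : ∀ {n} → Subset n → FSet
  members Vec.[]      e       = false
  members (b Vec.∷ p) zero    = b
  members (b Vec.∷ p) (suc e) = members p e

  subsetOf-members : ∀ {n} (p : Subset n) → subsetOf n (members p) ≡ p
  subsetOf-members Vec.[]      = refl
  subsetOf-members (b Vec.∷ p) = cong (b Vec.∷_) (subsetOf-members p)

  index : ∀ {n e} → e < n → Σ[ i ∈ Fin n ] toℕ i ≡ e
  index e<n = Fin.fromℕ< e<n , FinP.toℕ-fromℕ< e<n

  does-true : ∀ {P : Set} (p? : Dec P) → P → does p? ≡ true
  does-true p? p = dec-true p? p

  true-does : ∀ {P : Set} (p? : Dec P) → does p? ≡ true → P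
  true-does (yes p) _ = p

  module FromMatroid {n : ℕ} (M : Defs.Matroid n) where
    private module M = Defs.Matroid M

    indep : FSet → Bool
    indep S = does (M.independent? (subsetOf n S))

    indep-true : ∀ {S} → M.Independent (subsetOf n S) → indep S ≡ true
    indep-true {S} = does-true (M.independent? (subsetOf n S))

    true-indep : ∀ {S} → indep S ≡ true → M.Independent (subsetOf n S)
    true-indep {S} = true-does (M.independent? (subsetOf n S))

    subsetOf-mono : ∀ {S T} → (∀ e → e < n → S e ≡ true → T e ≡ true) → subsetOf n S Sub.⊆ subsetOf n T
    subsetOf-mono {S} {T} h {e} e∈ = ∈-subsetOf T e (h (toℕ e) (toℕ<n e) (subsetOf-∈ S e e∈))

    functional : FMatroid n
    functional = record
      { ind      = indep
      ; ind-mono = λ {S} {T} h iT → indep-true {S} (M.hereditary (subsetOf-mono {S} {T} h) (true-indep {T} iT))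
      ; ind-∅    = indep-true {λ _ → false} (M.hereditary (λ {e} e∈ → case subsetOf-∈ (λ _ → false) e e∈ of λ ()) M.∅-independent)
      ; ind-exch = exchange
      }
      where
      exchange : ∀ {S T} → indep S ≡ true → indep T ≡ true → ∑ n (bit ∘ S) < ∑ n (bit ∘ T) →
        ∃[ e ] e < n × T e ≡ true × S e ≡ false × indep (S ⊕ e) ≡ true
      exchange {S} {T} iS iT lt with e , e∈T , e∉S , i ← M.exchange (true-indep {S} iS) (true-indep {T} iT)
          (subst₂ _<_ (sym (∣subsetOf∣ n S)) (sym (∣subsetOf∣ n T)) lt) =
        toℕ e , toℕ<n e , subsetOf-∈ T e e∈T , ¬true⇒false (λ Se → e∉S (∈-subsetOf S e Se))
        , indep-true {S ⊕ toℕ e} (M.hereditary extended i)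
        where
        extended : subsetOf n (S ⊕ toℕ e) Sub.⊆ subsetOf n S Sub.∪ Sub.⁅ e ⁆
        extended {f} f∈ with ∨-true {toℕ f ≡ᵇ toℕ e} (subsetOf-∈ (S ⊕ toℕ e) f f∈)
        ... | inj₂ Sf  = SubP.x∈p∪q⁺ (inj₁ (∈-subsetOf S f Sf))
        ... | inj₁ f≡e = SubP.x∈p∪q⁺ {p = subsetOf n S} (inj₂ (subst (Sub._∈ Sub.⁅ e ⁆) (sym (FinP.toℕ-injective (≡ᵇ-true _ _ f≡e))) (SubP.x∈⁅x⁆ e)))

    open Matroids functional

    everything : FSet
    everything _ = true

    -- A set without a proper independent superset admits no extension by a single element, and by
    -- exchange it is then a largest independent set.
    basis-full-rank : ∀ I → M.IsBasis I → indep (members I) ≡ true × ∣ members I ∣ ≡ rank everything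
    basis-full-rank I (i , maximal) = iI , ≤-antisym (ind-≤-rank iI λ _ _ _ → refl) (rank-≤-maximal iI largest)
      where
      B : FSet
      B = members I
      iI : indep B ≡ true
      iI = indep-true {B} (subst M.Independent (sym (subsetOf-members I)) i)
      largest : MaximalIn everything B
      largest e e<n _ Be = ¬true⇒false λ iBe → extension (index e<n) iBe
        where
        extension : Σ[ f ∈ Fin n ] toℕ f ≡ e → indep (B ⊕ e) ≡ true → ⊥
        extension (f , refl) iBe = maximal (subsetOf n (B ⊕ e) , true-indep {B ⊕ e} iBe
          , (λ {g} g∈ → subsetOf-mono {B} {B ⊕ e} (⊆-⊕ {B} e) (subst (g Sub.∈_) (sym (subsetOf-members I)) g∈))
          , f , ∈-subsetOf (B ⊕ e) f (⊕-here B e) , λ f∈I → true≢false (subsetOf-∈ B f (subst (f Sub.∈_) (sym (subsetOf-members I)) f∈I)) Be)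

    full-rank-basis : ∀ S → indep S ≡ true → ∣ S ∣ ≡ rank everything → M.IsBasis (subsetOf n S)
    full-rank-basis S iS size = true-indep {S} iS , λ (J , iJ , S⊂J) → <⇒≱ (SubP.p⊂q⇒∣p∣<∣q∣ S⊂J) (begin
        Sub.∣ J ∣                          ≡⟨ cong Sub.∣_∣ (sym (subsetOf-members J)) ⟩
        Sub.∣ subsetOf n (members J) ∣     ≡⟨ ∣subsetOf∣ n (members J) ⟩
        ∣ members J ∣                      ≤⟨ ind-≤-rank (indep-true {members J} (subst M.Independent (sym (subsetOf-members J)) iJ)) (λ _ _ _ → refl) ⟩
        rank everything                    ≡⟨ sym size ⟩
        ∣ S ∣                              ≡⟨ sym (∣subsetOf∣ n S) ⟩
        Sub.∣ subsetOf n S ∣               ∎)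
      where open ≤-Reasoning

  nth : List ℕ → ℕ → ℕ
  nth xs a = fromMaybe 0 (head (drop a xs))

  nth-left : ∀ xs ys i → i < length xs → nth (xs ++ ys) i ≡ nth xs i
  nth-left (x ∷ xs) ys zero    _  = refl
  nth-left (x ∷ xs) ys (suc i) lt = nth-left xs ys i (≤-pred lt)

  nth-right : ∀ xs ys i → nth (xs ++ ys) (length xs + i) ≡ nth ys i
  nth-right []       ys i = refl
  nth-right (x ∷ xs) ys i = nth-right xs ys i

  nth-beyond : ∀ xs i → length xs ≤ i → nth xs i ≡ 0
  nth-beyond xs i le = cong (λ ys → fromMaybe 0 (head ys)) (drop-all i xs le)

  nth-tabulate : ∀ {l} (f : Fin l → ℕ) j → nth (List.tabulate f) (toℕ j) ≡ f j
  nth-tabulate f zero    = refl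
  nth-tabulate f (suc j) = nth-tabulate (f ∘ suc) j

  length-rows : ∀ {l n} (f : Fin l → Fin n → ℕ) → length (List.concat (List.tabulate λ j → List.tabulate (f j))) ≡ l * n
  length-rows {zero}  f = refl
  length-rows {suc l} {n} f = trans (length-++ (List.tabulate (f zero))) (cong₂ _+_ (length-tabulate (f zero)) (length-rows (f ∘ suc)))

  nth-rows : ∀ {l n} (f : Fin l → Fin n → ℕ) j e →
    nth (List.concat (List.tabulate λ j → List.tabulate (f j))) ((∑ (toℕ j) λ _ → n) + toℕ e) ≡ f j e
  nth-rows {suc l} {n} f zero e = trans (nth-left (List.tabulate (f zero)) _ (toℕ e) (subst (toℕ e <_) (sym (length-tabulate (f zero))) (toℕ<n e)))
    (nth-tabulate (f zero) e)
  nth-rows {suc l} {n} f (suc j) e = trans (cong (nth _) position) (trans (nth-right (List.tabulate (f zero)) _ _) (nth-rows (f ∘ suc) j e))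
    where
    position : (∑ (suc (toℕ j)) λ _ → n) + toℕ e ≡ length (List.tabulate (f zero)) + ((∑ (toℕ j) λ _ → n) + toℕ e)
    position = trans (cong (_+ toℕ e) (+-comm (∑ (toℕ j) λ _ → n) n))
      (trans (+-assoc n _ (toℕ e)) (cong (_+ ((∑ (toℕ j) λ _ → n) + toℕ e)) (sym (length-tabulate (f zero)))))

  Pr-certain : ∀ {ℓ} t {A : Vec Bool t → Set ℓ} (A? : ∀ ω → Dec (A ω)) → (∀ ω → A ω) → Defs.Pr t A? ≡ ℚ.1ℚ
  Pr-certain zero    A? all = cong (λ b → if b then ℚ.1ℚ else ℚ.0ℚ) (dec-true (A? []) (all []))
  Pr-certain (suc t) A? all = cong₂ (λ x y → ℚ.½ ℚ.* (x ℚ.+ y))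
    (Pr-certain t (λ ω → A? (true ∷ ω)) λ ω → all (true ∷ ω)) (Pr-certain t (λ ω → A? (false ∷ ω)) λ ω → all (false ∷ ω))

  integer-below : ∀ c (x : ℚᵘ.ℚᵘ) num → ℚᵘ.↥ x ≡ pos num → c * ℚᵘ.↧ₙ x ≤ num → ℚᵘ.mkℚᵘ (pos c) 0 ℚᵘ.≤ x
  integer-below c x num eq le = ℚᵘ.*≤* (ℤP.≤-trans (ℤP.≤-reflexive (sym (ℤP.pos-* c (ℚᵘ.↧ₙ x))))
    (ℤP.≤-trans (ℤ.+≤+ le) (ℤP.≤-reflexive (sym (trans (ℤP.*-identityʳ _) eq)))))

  integer-above : ∀ c (x : ℚᵘ.ℚᵘ) num → ℚᵘ.↥ x ≡ pos num → num ≤ c * ℚᵘ.↧ₙ x → x ℚᵘ.≤ ℚᵘ.mkℚᵘ (pos c) 0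
  integer-above c x num eq le = ℚᵘ.*≤* (ℤP.≤-trans (ℤP.≤-reflexive (trans (ℤP.*-identityʳ _) eq))
    (ℤP.≤-trans (ℤ.+≤+ le) (ℤP.≤-reflexive (ℤP.pos-* c (ℚᵘ.↧ₙ x)))))

  toℚᵘ-fromℕ : ∀ c → ℚ.toℚᵘ (Defs.fromℕ c) ℚᵘ.≃ ℚᵘ.mkℚᵘ (pos c) 0
  toℚᵘ-fromℕ c = ℚP.toℚᵘ-fromℚᵘ (ℚᵘ.mkℚᵘ (pos c) 0)

  -- Proved on unnormalised rationals, whose numerators and denominators compute without a gcd.
  -- Positivity of ε rules out a negative numerator, so its absolute value can stand for it.
  scaled-≤ : ∀ ε c b → ℚ.0ℚ ℚ.< ε → ℚ.↧ₙ ε * c ≤ (ℚ.↧ₙ ε + ℤ.∣ ℚ.↥ ε ∣) * b →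
    Defs.fromℕ c ℚ.≤ (ℚ.1ℚ ℚ.+ ε) ℚ.* Defs.fromℕ b
  scaled-≤ (ℚ.mkℚ ℤ.-[1+ p ] d _) c b (ℚ.*<* ()) le
  scaled-≤ ε@(ℚ.mkℚ (ℤ.+ p) d _) c b _ le = ℚP.toℚᵘ-cancel-≤ (begin
      ℚ.toℚᵘ (Defs.fromℕ c)                                   ≃⟨ toℚᵘ-fromℕ c ⟩
      ℚᵘ.mkℚᵘ (pos c) 0                                        ≤⟨ integer-below c x ((suc d + p) * b) numerator (≤-trans (≤-reflexive (trans (cong (c *_) denominator) (*-comm c (suc d)))) le) ⟩
      x                                                        ≃⟨ ℚᵘP.*-cong (ℚᵘP.≃-sym (ℚP.toℚᵘ-homo-+ ℚ.1ℚ ε)) (ℚᵘP.≃-sym (toℚᵘ-fromℕ b)) ⟩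
      ℚ.toℚᵘ (ℚ.1ℚ ℚ.+ ε) ℚᵘ.* ℚ.toℚᵘ (Defs.fromℕ b)           ≃⟨ ℚᵘP.≃-sym (ℚP.toℚᵘ-homo-* (ℚ.1ℚ ℚ.+ ε) (Defs.fromℕ b)) ⟩
      ℚ.toℚᵘ ((ℚ.1ℚ ℚ.+ ε) ℚ.* Defs.fromℕ b)                   ∎)
    where
    open ℚᵘP.≤-Reasoning
    x : ℚᵘ.ℚᵘ
    x = (ℚᵘ.1ℚᵘ ℚᵘ.+ ℚᵘ.mkℚᵘ (pos p) d) ℚᵘ.* ℚᵘ.mkℚᵘ (pos b) 0
    numerator : ℚᵘ.↥ x ≡ pos ((suc d + p) * b)
    numerator = trans (cong (ℤ._* pos b) (cong₂ ℤ._+_ (ℤP.*-identityˡ (pos (suc d))) (ℤP.*-identityʳ (pos p))))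
      (sym (ℤP.pos-* (suc d + p) b))
    denominator : ℚᵘ.↧ₙ x ≡ suc d
    denominator = trans (*-identityʳ (1 * suc d)) (*-identityˡ (suc d))

  squared-≤ : ∀ ε e b → ℚ.0ℚ ℚ.< ε → (e * ℤ.∣ ℚ.↥ ε ∣) * (e * ℤ.∣ ℚ.↥ ε ∣) ≤ b * (ℚ.↧ₙ ε * ℚ.↧ₙ ε) →
    (Defs.fromℕ e ℚ.* ε) ℚ.* (Defs.fromℕ e ℚ.* ε) ℚ.≤ Defs.fromℕ b
  squared-≤ (ℚ.mkℚ ℤ.-[1+ p ] d _) e b (ℚ.*<* ()) le
  squared-≤ ε@(ℚ.mkℚ (ℤ.+ p) d _) e b _ le = ℚP.toℚᵘ-cancel-≤ (begin
      ℚ.toℚᵘ ((Defs.fromℕ e ℚ.* ε) ℚ.* (Defs.fromℕ e ℚ.* ε))                    ≃⟨ ℚP.toℚᵘ-homo-* (Defs.fromℕ e ℚ.* ε) (Defs.fromℕ e ℚ.* ε) ⟩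
      ℚ.toℚᵘ (Defs.fromℕ e ℚ.* ε) ℚᵘ.* ℚ.toℚᵘ (Defs.fromℕ e ℚ.* ε)              ≃⟨ ℚᵘP.*-cong factor factor ⟩
      x                                                                         ≤⟨ integer-above b x ((e * p) * (e * p)) numerator (≤-trans le (≤-reflexive (cong (b *_) (sym denominator)))) ⟩
      ℚᵘ.mkℚᵘ (pos b) 0                                                         ≃⟨ ℚᵘP.≃-sym (toℚᵘ-fromℕ b) ⟩
      ℚ.toℚᵘ (Defs.fromℕ b)                                                     ∎)
    where
    open ℚᵘP.≤-Reasoning
    y x : ℚᵘ.ℚᵘ
    y = ℚᵘ.mkℚᵘ (pos e) 0 ℚᵘ.* ℚᵘ.mkℚᵘ (pos p) d
    x = y ℚᵘ.* y
    factor : ℚ.toℚᵘ (Defs.fromℕ e ℚ.* ε) ℚᵘ.≃ y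
    factor = ℚᵘP.≃-trans (ℚP.toℚᵘ-homo-* (Defs.fromℕ e) ε) (ℚᵘP.*-cong (toℚᵘ-fromℕ e) ℚᵘP.≃-refl)
    numerator : ℚᵘ.↥ x ≡ pos ((e * p) * (e * p))
    numerator = trans (cong₂ ℤ._*_ (sym (ℤP.pos-* e p)) (sym (ℤP.pos-* e p))) (sym (ℤP.pos-* (e * p) (e * p)))
    denominator : ℚᵘ.↧ₙ x ≡ suc d * suc d
    denominator = cong₂ _*_ (*-identityˡ (suc d)) (*-identityˡ (suc d))

  -- For n ≥ 2, n + 1 ≤ n². For n ≤ 1 powers of n are too small, but h ≤ n leaves at most two
  -- guesses, which the polynomial factor absorbs.
  guesses-bound : ∀ n k h → h ≤ n → (n + 1) ^ h ≤ (2 + n + k) * n ^ (2 * h)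
  guesses-bound zero          k zero    _   = s≤s z≤n
  guesses-bound (suc zero)    k h       h≤1 = ≤-trans (two h h≤1) (*-mono-≤ (s≤s (s≤s (z≤n {suc k}))) (≤-reflexive (sym (^-zeroˡ (2 * h)))))
    where
    two : ∀ h → h ≤ 1 → 2 ^ h ≤ 2 * 1
    two zero          _ = s≤s z≤n
    two (suc zero)    _ = ≤-refl
    two (suc (suc h)) (s≤s ())
  guesses-bound n@(suc (suc n′)) k h    h≤n = ≤-trans (^-monoˡ-≤ h n+1≤n²)
    (≤-trans (≤-reflexive (^-*-assoc n 2 h)) (m≤n*m (n ^ (2 * h)) (2 + n + k)))
    where
    n+1≤n² : n + 1 ≤ n ^ 2
    n+1≤n² = ≤-trans (m≤m+n (n + 1) (n′ * n′ + 3 * n′ + 1)) (≤-reflexive (square n′))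
      where
      square : ∀ x → 2 + x + 1 + (x * x + 3 * x + 1) ≡ (2 + x) * ((2 + x) * 1)
      square = ℕS.solve-∀

  -- Approximation ratio and exponent on a given instance

  module OnInstance {n k : ℕ} (ε : ℚ.ℚ) (0<ε : ℚ.0ℚ ℚ.< ε) (X : Defs.Instance n k) where
    open Defs.Instance X using (matroid; d; B; IsBasis; Feasible; IsApproxSolution)
    open FromMatroid matroid

    oracle : Subset n → Bool
    oracle I = does (Defs.Instance.independent? X I)

    input : ℕ → ℕ
    input = nth (Defs.encode ε X)

    open Matroids functional
    open Parameters n k input
    open Numerics n k input
    open SearchSpec oracle functional (λ _ → refl) k input

    private
      p q : ℕ
      p = ℤ.∣ ℚ.↥ ε ∣
      q = ℚ.↧ₙ ε
      budgets costs : List ℕ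
      budgets = List.tabulate B
      costs = List.concat (List.tabulate λ j → List.tabulate (d j))

    supply≡ : ∀ j → supply (toℕ j) ≡ B j
    supply≡ j = trans (nth-left budgets costs (toℕ j) (subst (toℕ j <_) (sym (length-tabulate B)) (toℕ<n j))) (nth-tabulate B j)

    demand≡ : ∀ j e → demand (toℕ j) (toℕ e) ≡ d j e
    demand≡ j e = trans (cong (nth (budgets ++ costs)) (trans (+-assoc k _ (toℕ e)) (cong (_+ ((∑ (toℕ j) λ _ → n) + toℕ e)) (sym (length-tabulate B)))))
      (trans (nth-right budgets costs _) (nth-rows d j e))

    input-zero : ∀ z → baseOf n k ≤ z → input z ≡ 0
    input-zero z le = nth-beyond (Defs.encode ε X) z (≤-trans (≤-reflexive len) (≤-trans shorter le))
      where
      len : length (Defs.encode ε X) ≡ 4 + (k + k * n)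
      len = cong (4 +_) (trans (length-++ budgets) (cong₂ _+_ (length-tabulate B) (length-rows d)))
      shorter : 4 + (k + k * n) ≤ baseOf n k
      shorter = ≤-trans (m≤m+n _ n) (≤-reflexive (shuffle n k (k * n)))
        where
        shuffle : ∀ n k x → 4 + (k + x) + n ≡ 4 + n + k + x
        shuffle = ℕS.solve-∀

    cost≡ : ∀ j S → Defs.cost (d j) (subsetOf n S) ≡ total-demand S (toℕ j)
    cost≡ j S = trans (sum-cong-≗ pointwise) (sum-∑ n (λ e → bit (S e) * demand (toℕ j) e))
      where
      pointwise : ∀ e → (if Vec.lookup (subsetOf n S) e then d j e else 0) ≡ bit (S (toℕ e)) * demand (toℕ j) (toℕ e)
      pointwise e rewrite lookup-subsetOf S e | demand≡ j e with S (toℕ e)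
      ... | true  = sym (+-identityʳ (d j e))
      ... | false = refl

    feasible⇒cheap : ∀ I → (∀ j → Defs.cost (d j) I ≤ B j) → ∀ j → j < k → total-demand (members I) j ≤ supply j
    feasible⇒cheap I cheap j j<k = at (index j<k)
      where
      at : Σ[ i ∈ Fin k ] toℕ i ≡ j → total-demand (members I) j ≤ supply j
      at (i , refl) = subst₂ _≤_ (trans (cong (Defs.cost (d i)) (sym (subsetOf-members I))) (cost≡ i (members I))) (sym (supply≡ i)) (cheap i)

    -- The surplus 3Θ of `U` is 6kW, and maximality of h gives 6kq < (h + 1) p, so 3Θq is at most
    -- Np. This is the origin of the 6 in `guessSizeE`. If h = n there is no surplus.
    U-ratio : U * q ≤ N * (q + p)
    U-ratio = decide (n ∸ h) refl
      where
      open ≤-Reasoning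
      decide : ∀ g → n ∸ h ≡ g → U * q ≤ N * (q + p)
      decide zero    eq = subst (λ u → u * q ≤ N * (q + p)) (sym (U-bounded eq)) (*-monoʳ-≤ N (m≤m+n q p))
      decide (suc g) eq = subst (λ u → u * q ≤ N * (q + p)) (sym (U-slack eq)) (begin
        (N + Θ + Θ + Θ) * q                             ≡⟨ cong (λ t → (N + t + t + t) * q) Θ≡ ⟩
        (N + k * (W + W) + k * (W + W) + k * (W + W)) * q ≡⟨ rearrange N k W q ⟩
        N * q + 6 * (k * q) * W                         ≤⟨ +-monoʳ-≤ (N * q) (*-monoˡ-≤ W (<⇒≤ (h-maximal (m∸n≢0⇒n<m λ z → case trans (sym eq) z of λ ())))) ⟩
        N * q + suc h * p * W                           ≡⟨ cong (N * q +_) (trans (rearrange′ (suc h) p W) (cong (_* p) (sym N≡))) ⟩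
        N * q + N * p                                   ≡⟨ sym (*-distribˡ-+ N q p) ⟩
        N * (q + p)                                     ∎)
        where
        rearrange : ∀ N k W q → (N + k * (W + W) + k * (W + W) + k * (W + W)) * q ≡ N * q + 6 * (k * q) * W
        rearrange = ℕS.solve-∀
        rearrange′ : ∀ a p W → a * p * W ≡ a * W * p
        rearrange′ = ℕS.solve-∀

    valid⇒approx : ∀ S → Valid S → IsApproxSolution ε (subsetOf n S)
    valid⇒approx S (iS , size , rows) = full-rank-basis S iS size , λ j → scaled-≤ ε _ (B j) 0<ε (within j)
      where
      open ≤-Reasoning
      within : ∀ j → q * Defs.cost (d j) (subsetOf n S) ≤ (q + p) * B j
      within j = subst₂ (λ c b → q * c ≤ (q + p) * b) (sym (cost≡ j S)) (supply≡ j) (*-cancelˡ-≤ N ⦃ N≢0 ⦄ (begin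
        N * (q * total-demand S (toℕ j))      ≡⟨ swap N q _ ⟩
        q * (N * total-demand S (toℕ j))      ≤⟨ *-monoʳ-≤ q (rows (toℕ j) (toℕ<n j)) ⟩
        q * (U * supply (toℕ j))              ≡⟨ swap′ q U _ ⟩
        U * q * supply (toℕ j)                ≤⟨ *-monoˡ-≤ (supply (toℕ j)) U-ratio ⟩
        N * (q + p) * supply (toℕ j)          ≡⟨ *-assoc N (q + p) _ ⟩
        N * ((q + p) * supply (toℕ j))        ∎))
        where
        N≢0 : ℕB.NonZero N
        N≢0 = ℕB.>-nonZero (≤-trans (≤-trans (s≤s z≤n) (≤-reflexive (+-comm 1 n))) (m≤m+n W (∑ h λ _ → W)))
        swap : ∀ a b c → a * (b * c) ≡ b * (a * c)
        swap = ℕS.solve-∀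
        swap′ : ∀ a b c → a * (b * c) ≡ b * a * c
        swap′ = ℕS.solve-∀

    -- From h ε ≤ 6k the exponent 2h is at most 12k/ε; after squaring, k² ≤ k³ relaxes this to the
    -- required form.
    exponent-bound : ∀ C → 12 ≤ C → (Defs.fromℕ (2 * h) ℚ.* ε) ℚ.* (Defs.fromℕ (2 * h) ℚ.* ε) ℚ.≤ Defs.fromℕ (C ^ 2 * k ^ 3)
    exponent-bound C 12≤C = squared-≤ ε (2 * h) (C ^ 2 * k ^ 3) 0<ε (begin
        2 * h * p * (2 * h * p)                ≤⟨ *-mono-≤ once once ⟩
        12 * (k * q) * (12 * (k * q))          ≡⟨ rearrange k q ⟩
        144 * (k * k) * (q * q)                ≤⟨ *-monoˡ-≤ (q * q) (*-mono-≤ (*-mono-≤ 12≤C (*-mono-≤ 12≤C (≤-refl {1}))) (cube k)) ⟩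
        C ^ 2 * k ^ 3 * (q * q)                ∎)
      where
      open ≤-Reasoning
      once : 2 * h * p ≤ 12 * (k * q)
      once = ≤-trans (≤-reflexive (*-assoc 2 h p)) (≤-trans (*-monoʳ-≤ 2 h-fits) (≤-reflexive (sym (*-assoc 2 6 (k * q)))))
      rearrange : ∀ k q → 12 * (k * q) * (12 * (k * q)) ≡ 144 * (k * k) * (q * q)
      rearrange = ℕS.solve-∀
      cube : ∀ k → k * k ≤ k ^ 3
      cube zero    = z≤n
      cube (suc k) = *-monoʳ-≤ (suc k) (≤-trans (m≤m*n (suc k) (suc k)) (≤-reflexive (cong (suc k *_) (sym (*-identityʳ (suc k))))))

    -- Programs are variables here, so that the concrete one is never evaluated.
    deterministic : ∀ P C E t c → (Defs.fromℕ E ℚ.* ε) ℚ.* (Defs.fromℕ E ℚ.* ε) ℚ.≤ Defs.fromℕ (C ^ 2 * k ^ 3) →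
      t ≤ (2 + n + k) ^ C * n ^ E → Halted P c → (∀ (ω : Vec Bool t) → Defs.runOn P ε X ω ≡ c) → IsApproxSolution ε (Defs.output n c) →
      Σ[ t ∈ ℕ ] Defs.TimeBound C n k ε t × (∀ (ω : Vec Bool t) → Halted P (Defs.runOn P ε X ω))
        × ℤ.+ 2 ℚ./ 3 ℚ.≤ Defs.Pr t (λ ω → Defs.Instance.isApproxSolution? X ε (Defs.output n (Defs.runOn P ε X ω)))
    deterministic P C E t c exponent fast halted runs-to approx = t , (E , exponent , fast)
      , (λ ω → subst (Halted P) (sym (runs-to ω)) halted)
      , subst (ℤ.+ 2 ℚ./ 3 ℚ.≤_)
          (sym (Pr-certain t (λ ω → Defs.Instance.isApproxSolution? X ε (Defs.output n (Defs.runOn P ε X ω)))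
            λ ω → subst (λ c → IsApproxSolution ε (Defs.output n c)) (sym (runs-to ω)) approx))
          (ℚ.*≤* (ℤ.+≤+ (s≤s (s≤s z≤n))))

    sourceTime : Stm → ℕ
    sourceTime s = preludeTime n k + (Compilation.time oracle s (startEnv n k) (inputArrays input) + (3 + ∑ n λ _ → 17))

    conclude : ∀ s C E → wf visible₃ 3 s ≡ true →
      IsApproxSolution ε (subsetOf n (setOf (Compilation.exec oracle s (startEnv n k) (inputArrays input)) 14)) →
      (Defs.fromℕ E ℚ.* ε) ℚ.* (Defs.fromℕ E ℚ.* ε) ℚ.≤ Defs.fromℕ (C ^ 2 * k ^ 3) →
      sourceTime s ≤ (2 + n + k) ^ C * n ^ E →
      Σ[ t ∈ ℕ ] Defs.TimeBound C n k ε t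
        × (∀ (ω : Vec Bool t) → Halted (program 14 s) (Defs.runOn (program 14 s) ε X ω))
        × ℤ.+ 2 ℚ./ 3 ℚ.≤ Defs.Pr t (λ ω → Defs.Instance.isApproxSolution? X ε (Defs.output n (Defs.runOn (program 14 s) ε X ω)))
    conclude s C E w approx exponent fast = finish (Start.program-correct oracle k input refl refl input-zero 14 s (≤ᵇ⇒≤ 15 16 _) w)
      where
      finish : Σ[ c ∈ Config ] Halted (program 14 s) c
        × (∀ (ω : Vec Bool (sourceTime s)) → Defs.run oracle (program 14 s) (config 0 (λ _ → 0) input) ω ≡ c)
        × Defs.output n c ≡ tabulate (λ e → 0 <ᵇ Compilation.exec oracle s (startEnv n k) (inputArrays input) 14 (toℕ e)) → _
      finish (c , halted , runs-to , out) = deterministic (program 14 s) C E (sourceTime s) c exponent fast halted runs-to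
        (subst (IsApproxSolution ε) (sym out) approx)

  raise : ∀ C m G x t → t ≤ G * m ^ C → G ≤ m * x → t ≤ m ^ suc C * x
  raise C m G x t t≤ G≤ = ≤-trans t≤ (≤-trans (*-monoˡ-≤ (m ^ C) G≤) (≤-reflexive (rearrange m x (m ^ C))))
    where
    rearrange : ∀ a b c → a * b * c ≡ a * c * b
    rearrange = ℕS.solve-∀

  1≤count : ∀ a h → 1 ≤ (a + 1) ^ h
  1≤count a h = ≤-trans (≤-reflexive (sym (^-zeroˡ h))) (^-monoˡ-≤ h (m≤n+m 1 a))

  -- Opaque, so that powers of concrete degree are never unfolded.
  abstract
    degree : ℕ
    degree = 189

    degree-value : degree ≡ 189
    degree-value = refl

  module OnFeasible {n k : ℕ} (ε : ℚ.ℚ) (0<ε : ℚ.0ℚ ℚ.< ε) (X : Defs.Instance n k)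
    (I : Subset n) (basis : Defs.Instance.IsBasis X I)
    (cheap : ∀ j → Defs.cost (Defs.Instance.d X j) I ≤ Defs.Instance.B X j) where
    open Defs.Instance X using (matroid; IsApproxSolution)
    open FromMatroid matroid
    open OnInstance ε 0<ε X
    open Parameters n k input using (h)
    open Numerics n k input using (h≤n)
    open MainSpec oracle functional (λ _ → refl) k input using (main-spec; guess-count)

    solved : IsApproxSolution ε (subsetOf n (setOf (Compilation.exec oracle main (startEnv n k) (inputArrays input)) 14))
    solved = valid⇒approx (setOf (Compilation.exec oracle main (startEnv n k) (inputArrays input)) 14)
      (main-spec (members I) (proj₁ (basis-full-rank I basis)) (proj₂ (basis-full-rank I basis)) (feasible⇒cheap I cheap))

    -- Variables keep the powers and the count from being unfolded.
    fast-at : ∀ G m x → 1 ≤ G → Compilation.exec oracle enumerated (letEnv parameters (startEnv n k) (inputArrays input)) (inputArrays input) 15 0 ≡ G →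
      2 ≤ m → baseOf n k ≤ m ^ 2 → G ≤ m * x →
      preludeTime n k + (Compilation.time oracle main (startEnv n k) (inputArrays input) + (3 + ∑ n λ _ → 17)) ≤ m ^ degree * x
    fast-at G m x 1≤G eq 2≤m base≤ G≤ = subst (λ c → preludeTime n k + (Compilation.time oracle main (startEnv n k) (inputArrays input) + (3 + ∑ n λ _ → 17)) ≤ m ^ c * x)
      {189} {degree} (sym degree-value) (raise 188 m G x (preludeTime n k + (Compilation.time oracle main (startEnv n k) (inputArrays input) + (3 + ∑ n λ _ → 17)))
      (TimeBound.total-bound oracle k m 2≤m base≤ (inputArrays input) G eq 1≤G) G≤)

    fast : preludeTime n k + (Compilation.time oracle main (startEnv n k) (inputArrays input) + (3 + ∑ n λ _ → 17)) ≤ (2 + n + k) ^ degree * n ^ (2 * h)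
    fast = fast-at ((n + 1) ^ h) (2 + n + k) (n ^ (2 * h)) (1≤count n h) guess-count (s≤s (s≤s z≤n)) (size-bound n k) (guesses-bound n k h h≤n)

    conclusion : Σ[ t ∈ ℕ ] Defs.TimeBound degree n k ε t
      × (∀ (ω : Vec Bool t) → Halted (program 14 main) (Defs.runOn (program 14 main) ε X ω))
      × ℤ.+ 2 ℚ./ 3 ℚ.≤ Defs.Pr t (λ ω → Defs.Instance.isApproxSolution? X ε (Defs.output n (Defs.runOn (program 14 main) ε X ω)))
    conclusion = conclude main degree (2 * h) main-wf solved
      (exponent-bound degree (subst (12 ≤_) {189} {degree} (sym degree-value) (≤ᵇ⇒≤ 12 189 _))) fast

open import Defs
open import Data.Bool.Base using (Bool)
open import Data.Integer.Base using (+_)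
open import Data.Nat.Base using (ℕ)
open import Data.Product.Base using (_×_; ∃-syntax; Σ-syntax)
open import Data.Product.Base using (_,_)
open import Data.Rational using (ℚ; 0ℚ; _/_; _≤_; _<_)
open import Data.Vec.Base using (Vec)
open Development using (program; main; degree; module OnFeasible)

theorem9 : Σ[ P ∈ Program ] Σ[ C ∈ ℕ ]
    (∀ (ε : ℚ) → 0ℚ < ε → ∀ (n k : ℕ) (X : Instance n k) → Instance.Feasible X →
      Σ[ t ∈ ℕ ] TimeBound C n k ε t
        × (∀ (ω : Vec Bool t) → Halted P (runOn P ε X ω))
        × + 2 / 3 ≤ Pr t (λ ω → Instance.isApproxSolution? X ε (output n (runOn P ε X ω))))
theorem9 = program 14 main , degree , λ ε 0<ε n k X (I , basis , cheap) → OnFeasible.conclusion ε 0<ε X I basis cheap
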